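{- For all integers $k\ge 2$ and $r\ge 3$, $$\limsup_{n\to \infty} n^{ -2}f^{(r)}(n;(r-2)k+2,k)=\limsup_{n\to \infty} n^{ -2}g^{(r)}(n;(r-2)k+2,k).$$
   Context: All hypergraphs are finite with edges forming a set. In an $r$-uniform hypergraph, an $(s,k)$-configuration is a collection of $k$ edges whose union has at most $s$ vertices; a hypergraph is $(s,k)$-free if it contains no $(s,k)$-configuration. $f^{(r)}(n;s,k)$ is the maximum number of edges in an $(s,k)$-free $r$-uniform hypergraph on $n$ vertices. $g^{(r)}(n;(r-2)k+2,k)$ is the maximum number of edges in an $r$-uniform hypergraph on $n$ vertices that is $((r-2)k+2,k)$-free and also $((r-2)\ell+1,\ell)$-free for every integer $\ell\in[2,k-1]$. -}

module Defs where

open import Data.Nat using (ℕ; zero; suc; _+_; _*_; _∸_; _≤_)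
open import Data.Integer using (+_)
open import Data.Rational using (ℚ; _/_; 0ℚ) renaming (_≤_ to _≤ℚ_; _<_ to _<ℚ_)
open import Data.Fin.Subset using (Subset; ∣_∣; ⋃)
open import Data.List using (List; length)
open import Data.List.Relation.Unary.All using (All)
open import Data.List.Relation.Unary.Unique.Propositional using (Unique)
open import Data.List.Membership.Propositional using (_∈_)
open import Data.Product using (Σ; ∃; _×_)
open import Relation.Binary.PropositionalEquality using (_≡_)
open import Relation.Nullary using (¬_)
open import Function.Bundles using (_⇔_)

record Hypergraph (r n : ℕ) : Set where
  field
    edges   : List (Subset n)
    distinct : Unique edges
    uniform : All (λ e → ∣ e ∣ ≡ r) edges
open Hypergraph public

e : ∀ {r n} → Hypergraph r n → ℕ
e H = length (edges H)

Configuration : ∀ {r n} → ℕ → ℕ → Hypergraph r n → Set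
Configuration {n = n} s k H =
  Σ (List (Subset n)) λ C →
    (length C ≡ k) × Unique C × All (_∈ edges H) C × (∣ ⋃ C ∣ ≤ s)

Free : ∀ {r n} → ℕ → ℕ → Hypergraph r n → Set
Free s k H = ¬ Configuration s k H

IsMaxEdges : (r n : ℕ) → (Hypergraph r n → Set) → ℕ → Set
IsMaxEdges r n P m =
  (Σ (Hypergraph r n) λ H → P H × (e H ≡ m)) × (∀ H → P H → e H ≤ m)

IsF : (r s k : ℕ) → (ℕ → ℕ) → Set
IsF r s k F = ∀ n → IsMaxEdges r n (Free s k) (F n)

GFree : ∀ {r n} → ℕ → Hypergraph r n → Set
GFree {r} k H =
  Free ((r ∸ 2) * k + 2) k H ×
  (∀ ℓ → 2 ≤ ℓ → ℓ ≤ k ∸ 1 → Free ((r ∸ 2) * ℓ + 1) ℓ H)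

IsG : (r k : ℕ) → (ℕ → ℕ) → Set
IsG r k G = ∀ n → IsMaxEdges r n (GFree k) (G n)

-- n^{-2} m as a rational (value at n = 0 is irrelevant for limsup; set to 0)
normSq : ℕ → ℕ → ℚ
normSq m zero = 0ℚ
normSq m (suc n) = (+ m) / (suc n * suc n)

-- "limsup a < q" (in the extended reals), characterised via rationals:
-- there is a rational q' < q with a n ≤ q' for all sufficiently large n.
LimsupLt : (ℕ → ℚ) → ℚ → Set
LimsupLt a q = Σ ℚ λ q' → (q' <ℚ q) × ∃ λ N → ∀ n → N ≤ n → a n ≤ℚ q'

-- limsup a = limsup b (in the extended reals): they have the same rational
-- strict upper bounds (rationals are dense in the extended reals).
LimsupEq : (ℕ → ℚ) → (ℕ → ℚ) → Set
LimsupEq a b = ∀ q → LimsupLt a q ⇔ LimsupLt b q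

{-# OPTIONS --safe #-}
-- Let H have no k edges on (r−2)k+2 vertices, and suppose that some ℓ < k edges of H span at most (r−2)ℓ+1 vertices. For a largest such set S, the edges touching S spread out: any j of them have at least (r−2)j vertices outside S. As S has at least r+1 vertices, (r−2)((r+1)Δ − rk) ≤ n for the minimum degree Δ. Hence, after vertices of small degree are deleted one at a time, either few vertices remain or H is counted by g.
-- This works as long as the density of g exceeds 1/(2(r+1)(r−2)). To see that it does, a partial Steiner system without dense configurations, with 4/5 of the possible number of edges, is found by a nibble of boundedly many phases. In every phase an edge is chosen with probability proportional to the product of the inverse survival probabilities of its vertex pairs and of itself, an edge dying when it would complete a minimal dense configuration. These weights are martingales, asymptotically uncorrelated with each other and with the choices made, so first and second moments replace all trajectory and concentration arguments.
module Submission where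

open import Data.Bool as 𝔹 using (Bool; true; false; _∧_; _∨_; not; if_then_else_)
import Data.Bool.Properties as 𝔹ₚ
open import Data.Empty using (⊥-elim) renaming (⊥ to Empty)
open import Data.Fin as Fin using (Fin)
import Data.Fin.Properties as Finₚ
open import Data.Fin.Subset using (Subset; _∪_; _∩_; _─_; ∣_∣; ⋃; inside; ⁅_⁆) renaming (_∈_ to _∈ₛ_; _∉_ to _∉ₛ_; _⊆_ to _⊆ₛ_)
open import Data.Fin.Subset.Properties using (p⊆q⇒∣p∣≤∣q∣; p⊂q⇒∣p∣<∣q∣; p⊆p∪q; q⊆p∪q; x∈p∪q⁻; x∈p∪q⁺; x∈p∩q⁺; x∈p∩q⁻; ∉⊥; _∈?_; x∈p∧x∉q⇒x∈p─q; ∪-identityʳ; x∈⁅x⁆; x∈⁅y⁆⇒x≡y; ∣⁅x⁆∣≡1; ∪-assoc; ∣⊥∣≡0; ∩-idem; ∣p∣≤n; ⊆-antisym)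
import Data.Integer as ℤ
import Data.Integer.Tactic.RingSolver as ℤR
open import Data.List using (List; _++_; map; length; concatMap; filterᵇ; concat; cartesianProduct; allFin)
open import Data.List.Membership.Propositional using (_∈_; _∉_)
open import Data.List.Membership.Propositional.Properties using (∈-map⁺; ∈-++⁺ˡ; ∈-++⁺ʳ; ∈-++⁻; ∈-cartesianProduct⁺; ∈-∃++; ∈-map⁻; ∈-allFin)
open import Data.List.Properties using (length-map; ++-assoc; ++-identityʳ; length-++)
open import Data.List.Relation.Binary.Permutation.Propositional as P using (_↭_; ↭-refl; ↭-trans; prep; swap; ↭-sym)
open import Data.List.Relation.Binary.Permutation.Propositional.Properties using (All-resp-↭; ↭-length; ∈-resp-↭; shift)
open import Data.List.Relation.Binary.Sublist.Propositional using (_∷ʳ_; ⊆-refl)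
open import Data.List.Relation.Binary.Sublist.Propositional.Properties using (++⁺; ++⁺ˡ)
open import Data.List.Relation.Unary.All as All using (All; all?)
import Data.List.Relation.Unary.All.Properties as Allₚ
open import Data.List.Relation.Unary.AllPairs using (AllPairs)
import Data.List.Relation.Unary.AllPairs.Properties as APₚ
open import Data.List.Relation.Unary.Any as Any using (here; there; Any; any?)
import Data.List.Relation.Unary.Unique.DecPropositional as UD
open import Data.List.Relation.Unary.Unique.Propositional using (Unique)
import Data.List.Relation.Unary.Unique.Propositional.Properties as Uₚ
open import Data.Maybe using (Maybe; just; nothing)
open import Data.Nat as ℕ using (ℕ; s≤s; z≤n; _∸_)
open import Data.Nat.ListAction using (sum)
import Data.Nat.Properties as ℕₚ
import Data.Nat.Tactic.RingSolver as ℕR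
open import Data.Product using (∃; _×_; _,_; proj₁; proj₂)
open import Data.Product.Properties using () renaming (≡-dec to ×-≡-dec)
import Data.Rational as ℚ
import Data.Rational.Properties as ℚₚ
import Data.Rational.Unnormalised.Properties as ℚᵘₚ
open import Data.Sum using (inj₁; inj₂; _⊎_)
open import Data.Unit using (⊤; tt)
open import Data.Vec as Vec using (lookup; insertAt; removeAt)
open import Data.Vec.Properties using (∷-injectiveʳ; ≡-dec; lookup⇒[]=; []=⇒lookup; removeAt-insertAt; insertAt-removeAt)
open import Function.Bundles using (mk⇔)
open import Relation.Binary.Definitions using (DecidableEquality; tri<; tri≈; tri>)
open import Relation.Binary.PropositionalEquality
open import Relation.Nullary using (yes; no; does; ¬_; Dec)
open import Relation.Nullary.Decidable using (_×-dec_; _→-dec_; map′)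
open import Tactic.RingSolver.Core.AlmostCommutativeRing using (AlmostCommutativeRing; fromCommutativeRing)

-- Relative to the Steiner bound n(n-1)/(r(r-1)), the density that the degree argument has to beat
-- is r(r-1)/(2(r+1)(r-2)) = 1/2 + 1/((r+1)(r-2)). This is largest at r = 3, where it equals 3/4; so
-- a packing of a fixed fraction between 3/4 and 1 suffices, and 4/5 leaves room for rounding. Since
-- the fraction is below 1, the process may stop at total rate 9/10. Up to then inverse survival
-- weights stay below constants that do not depend on n, and a constant number of phases is enough,
-- so every correlation error is a constant times 1/n. The combinatorial core is that one pick
-- rarely destroys two objects at once. Minimality of the configurations gives it: every such
-- pattern has at least one new vertex fewer than its new edges pay for, which leaves a factor 1/n.
-- Picks of the same phase are independent and may collide. The expected loss is quadratic in the
-- phase rate, so over all phases it is inversely proportional to their number, and the culprits are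
-- simply deleted at the end. Everything is a finite sum of rationals; the exponential decay of
-- survival is imitated by powers with a fixed large exponent.

-- Rational arithmetic: inequalities, inverses, powers, indicators, finite sums and products.

module Rationals where
  open import Data.Rational using (ℚ; 0ℚ; 1ℚ; _+_; _*_; -_; _-_; _≤_; _<_; 1/_; Positive; positive; nonNegative)
  open import Data.Rational.Properties using (≤-refl; ≤-trans; ≤-reflexive; +-mono-≤; <⇒≤; +-*-commutativeRing)
  open import Data.Nat using (zero; suc)
  open import Data.List using ([]; _∷_)
  open import Tactic.RingSolver using (solve-∀)

  ℚring : AlmostCommutativeRing _ _
  ℚring = fromCommutativeRing +-*-commutativeRing isZero
    where
    isZero : ∀ x → Maybe (0ℚ ≡ x)
    isZero x with 0ℚ ℚ.≟ x
    ... | yes p = just p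
    ... | no _  = nothing

  infixr 2 _▸_
  _▸_ : ∀ {a b c : ℚ} → a ≤ b → b ≤ c → a ≤ c
  _▸_ = ≤-trans

  ≡≤ : ∀ {a b} → a ≡ b → a ≤ b
  ≡≤ = ≤-reflexive

  0≤1 : 0ℚ ≤ 1ℚ
  0≤1 = ℚₚ.nonNegative⁻¹ 1ℚ

  0<1 : 0ℚ < 1ℚ
  0<1 = ℚₚ.positive⁻¹ 1ℚ

  0≤* : ∀ {a b} → 0ℚ ≤ a → 0ℚ ≤ b → 0ℚ ≤ a * b
  0≤* {a} {b} p q = ℚₚ.nonNegative⁻¹ (a * b) {{ℚₚ.nonNeg*nonNeg⇒nonNeg a {{nonNegative p}} b {{nonNegative q}}}}

  0<* : ∀ {a b} → 0ℚ < a → 0ℚ < b → 0ℚ < a * b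
  0<* {a} {b} p q = ℚₚ.positive⁻¹ (a * b) {{ℚₚ.pos*pos⇒pos a {{positive p}} b {{positive q}}}}

  0≤+ : ∀ {a b} → 0ℚ ≤ a → 0ℚ ≤ b → 0ℚ ≤ a + b
  0≤+ = +-mono-≤

  *-monoˡ : ∀ {a b c} → 0ℚ ≤ c → a ≤ b → c * a ≤ c * b
  *-monoˡ {c = c} p q = ℚₚ.*-monoˡ-≤-nonNeg c {{nonNegative p}} q

  *-monoʳ : ∀ {a b c} → 0ℚ ≤ c → a ≤ b → a * c ≤ b * c
  *-monoʳ {c = c} p q = ℚₚ.*-monoʳ-≤-nonNeg c {{nonNegative p}} q

  *-mono : ∀ {a b c d} → 0ℚ ≤ a → a ≤ b → 0ℚ ≤ c → c ≤ d → a * c ≤ b * d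
  *-mono 0≤a a≤b 0≤c c≤d = *-monoʳ 0≤c a≤b ▸ *-monoˡ (0≤a ▸ a≤b) c≤d

  ≤+ : ∀ {a b c} → 0ℚ ≤ c → b ≡ a + c → a ≤ b
  ≤+ {a} {b} {c} p q = ≡≤ (sym (ℚₚ.+-identityʳ a)) ▸ +-mono-≤ (≤-refl {a}) p ▸ ≡≤ (sym q)

  0≤- : ∀ {a b} → a ≤ b → 0ℚ ≤ b - a
  0≤- {a} p = ≡≤ (sym (ℚₚ.+-inverseʳ a)) ▸ +-mono-≤ p (≤-refl {(- a)})

  -0≤ : ∀ {a b} → 0ℚ ≤ b - a → a ≤ b
  -0≤ {a} {b} p = ≤+ p (lem a b)
    where
    lem : ∀ a b → b ≡ a + (b - a)
    lem = solve-∀ ℚring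

  0≤sq : ∀ a → 0ℚ ≤ a * a
  0≤sq a with ℚₚ.≤-total 0ℚ a
  ... | inj₁ p = 0≤* p p
  ... | inj₂ p = 0≤* (0≤- p) (0≤- p) ▸ ≡≤ (lem a)
    where
    lem : ∀ a → (0ℚ - a) * (0ℚ - a) ≡ a * a
    lem = solve-∀ ℚring

  *-cancelʳ : ∀ {a b c} → 0ℚ < c → a * c ≤ b * c → a ≤ b
  *-cancelʳ {c = c} p q = ℚₚ.*-cancelʳ-≤-pos c {{positive p}} q

  -- With the convention inv 0 = 0.
  inv : ℚ → ℚ
  inv p with p ℚ.≟ 0ℚ
  ... | yes _ = 0ℚ
  ... | no p≢0 = 1/_ p {{ℚ.≢-nonZero p≢0}}

  inv-r : ∀ {p} → 0ℚ < p → p * inv p ≡ 1ℚ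
  inv-r {p} 0<p with p ℚ.≟ 0ℚ
  ... | yes refl = ⊥-elim (ℚₚ.<-irrefl refl 0<p)
  ... | no p≢0 = ℚₚ.*-inverseʳ p {{ℚ.≢-nonZero p≢0}}

  0≤inv : ∀ {p} → 0ℚ ≤ p → 0ℚ ≤ inv p
  0≤inv {p} 0≤p with p ℚ.≟ 0ℚ
  ... | yes _ = ≤-refl
  ... | no p≢0 = <⇒≤ (ℚₚ.positive⁻¹ _ {{ℚₚ.1/pos⇒pos p {{pos}}}})
    where
    pos : Positive p
    pos = ℚₚ.nonNeg∧nonZero⇒pos p {{nonNegative 0≤p}} {{ℚ.≢-nonZero p≢0}}

  <-≤ : ∀ {a b c} → a < b → b ≤ c → a < c
  <-≤ = ℚₚ.<-≤-trans

  *inv≤ : ∀ {a b p} → 0ℚ < p → a ≤ b * p → a * inv p ≤ b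
  *inv≤ {a} {b} {p} 0<p q = *-monoʳ (0≤inv (<⇒≤ 0<p)) q ▸ ≡≤ (trans (lem b p (inv p)) (trans (cong (b *_) (inv-r 0<p)) (ℚₚ.*-identityʳ b)))
    where
    lem : ∀ b p i → b * p * i ≡ b * (p * i)
    lem = solve-∀ ℚring

  nat : ℕ → ℚ
  nat zero = 0ℚ
  nat (suc n) = 1ℚ + nat n

  0≤nat : ∀ n → 0ℚ ≤ nat n
  0≤nat zero = ≤-refl
  0≤nat (suc n) = 0≤+ 0≤1 (0≤nat n)

  0<nat : ∀ n → 0ℚ < nat (suc n)
  0<nat n = <-≤ 0<1 (≤+ (0≤nat n) refl)

  1≤nat : ∀ n → 1ℚ ≤ nat (suc n)
  1≤nat n = ≤+ (0≤nat n) refl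

  nat-+ : ∀ m n → nat (m ℕ.+ n) ≡ nat m + nat n
  nat-+ zero n = sym (ℚₚ.+-identityˡ (nat n))
  nat-+ (suc m) n = trans (cong (1ℚ +_) (nat-+ m n)) (sym (ℚₚ.+-assoc 1ℚ (nat m) (nat n)))

  nat-* : ∀ m n → nat (m ℕ.* n) ≡ nat m * nat n
  nat-* zero n = sym (ℚₚ.*-zeroˡ (nat n))
  nat-* (suc m) n = trans (nat-+ n (m ℕ.* n)) (trans (cong (nat n +_) (nat-* m n)) (lem (nat m) (nat n)))
    where
    lem : ∀ a b → b + a * b ≡ (1ℚ + a) * b
    lem = solve-∀ ℚring

  nat-mono : ∀ {m n} → m ℕ.≤ n → nat m ≤ nat n
  nat-mono {n = n} ℕ.z≤n = 0≤nat n
  nat-mono (ℕ.s≤s p) = +-mono-≤ (≤-refl {1ℚ}) (nat-mono p)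

  infixr 8 _^_
  _^_ : ℚ → ℕ → ℚ
  x ^ zero = 1ℚ
  x ^ suc n = x * x ^ n

  0≤^ : ∀ {x} n → 0ℚ ≤ x → 0ℚ ≤ x ^ n
  0≤^ zero p = 0≤1
  0≤^ (suc n) p = 0≤* p (0≤^ n p)

  0<^ : ∀ {x} n → 0ℚ < x → 0ℚ < x ^ n
  0<^ zero p = 0<1
  0<^ (suc n) p = 0<* p (0<^ n p)

  ^-+ : ∀ x m n → x ^ (m ℕ.+ n) ≡ x ^ m * x ^ n
  ^-+ x zero n = sym (ℚₚ.*-identityˡ _)
  ^-+ x (suc m) n = trans (cong (x *_) (^-+ x m n)) (sym (ℚₚ.*-assoc x (x ^ m) (x ^ n)))

  *-^ : ∀ x y n → (x * y) ^ n ≡ x ^ n * y ^ n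
  *-^ x y zero = refl
  *-^ x y (suc n) = trans (cong (x * y *_) (*-^ x y n)) (lem x y (x ^ n) (y ^ n))
    where
    lem : ∀ a b c d → a * b * (c * d) ≡ a * c * (b * d)
    lem = solve-∀ ℚring

  ^-mono : ∀ {x y} n → 0ℚ ≤ x → x ≤ y → x ^ n ≤ y ^ n
  ^-mono zero p q = ≤-refl
  ^-mono (suc n) p q = *-mono p q (0≤^ n p) (^-mono n p q)

  1≤^ : ∀ {x} n → 1ℚ ≤ x → 1ℚ ≤ x ^ n
  1≤^ zero p = ≤-refl
  1≤^ {x} (suc n) p = ≡≤ (sym (ℚₚ.*-identityˡ 1ℚ)) ▸ *-mono 0≤1 p 0≤1 (1≤^ n p)

  ^-monoʳ : ∀ {x m n} → 1ℚ ≤ x → m ℕ.≤ n → x ^ m ≤ x ^ n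
  ^-monoʳ {n = n} p ℕ.z≤n = 1≤^ n p
  ^-monoʳ p (ℕ.s≤s q) = *-monoˡ (0≤1 ▸ p) (^-monoʳ p q)

  ^-antiʳ : ∀ {x m n} → 0ℚ ≤ x → x ≤ 1ℚ → m ℕ.≤ n → x ^ n ≤ x ^ m
  ^-antiʳ {x} {n = zero} p q ℕ.z≤n = ≤-refl
  ^-antiʳ {x} {n = suc n} p q ℕ.z≤n = *-mono p q (0≤^ n p) (^-antiʳ {n = n} p q ℕ.z≤n) ▸ ≡≤ (ℚₚ.*-identityˡ 1ℚ)
  ^-antiʳ p q (ℕ.s≤s r) = *-monoˡ p (^-antiʳ p q r)

  nat-^ : ∀ m n → nat (m ℕ.^ n) ≡ nat m ^ n
  nat-^ m zero = refl
  nat-^ m (suc n) = trans (nat-* m (m ℕ.^ n)) (cong (nat m *_) (nat-^ m n))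

  𝟙 : Bool → ℚ
  𝟙 true = 1ℚ
  𝟙 false = 0ℚ

  0≤𝟙 : ∀ b → 0ℚ ≤ 𝟙 b
  0≤𝟙 true = 0≤1
  0≤𝟙 false = ≤-refl

  𝟙≤1 : ∀ b → 𝟙 b ≤ 1ℚ
  𝟙≤1 true = ≤-refl
  𝟙≤1 false = 0≤1

  𝟙-∧ : ∀ a b → 𝟙 (a ∧ b) ≡ 𝟙 a * 𝟙 b
  𝟙-∧ true b = sym (ℚₚ.*-identityˡ (𝟙 b))
  𝟙-∧ false b = sym (ℚₚ.*-zeroˡ (𝟙 b))

  𝟙* : ∀ b {x} → 0ℚ ≤ x → 𝟙 b * x ≤ x
  𝟙* b {x} p = *-monoʳ p (𝟙≤1 b) ▸ ≡≤ (ℚₚ.*-identityˡ x)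

  module _ {A : Set} where
    Σ : List A → (A → ℚ) → ℚ
    Σ [] f = 0ℚ
    Σ (x ∷ xs) f = f x + Σ xs f

    Π : List A → (A → ℚ) → ℚ
    Π [] f = 1ℚ
    Π (x ∷ xs) f = f x * Π xs f

    Σ-cong∈ : ∀ xs {f g : A → ℚ} → (∀ {x} → x ∈ xs → f x ≡ g x) → Σ xs f ≡ Σ xs g
    Σ-cong∈ [] p = refl
    Σ-cong∈ (x ∷ xs) p = cong₂ _+_ (p (here refl)) (Σ-cong∈ xs (λ m → p (there m)))

    Σ-cong : ∀ xs {f g : A → ℚ} → (∀ x → f x ≡ g x) → Σ xs f ≡ Σ xs g
    Σ-cong xs p = Σ-cong∈ xs (λ {x} _ → p x)

    Σ-mono∈ : ∀ xs {f g : A → ℚ} → (∀ {x} → x ∈ xs → f x ≤ g x) → Σ xs f ≤ Σ xs g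
    Σ-mono∈ [] p = ≤-refl
    Σ-mono∈ (x ∷ xs) p = +-mono-≤ (p (here refl)) (Σ-mono∈ xs (λ m → p (there m)))

    Σ-mono : ∀ xs {f g : A → ℚ} → (∀ x → f x ≤ g x) → Σ xs f ≤ Σ xs g
    Σ-mono xs p = Σ-mono∈ xs (λ {x} _ → p x)

    Σ-0 : ∀ xs → Σ xs (λ _ → 0ℚ) ≡ 0ℚ
    Σ-0 [] = refl
    Σ-0 (x ∷ xs) = trans (ℚₚ.+-identityˡ _) (Σ-0 xs)

    0≤Σ : ∀ xs {f : A → ℚ} → (∀ x → 0ℚ ≤ f x) → 0ℚ ≤ Σ xs f
    0≤Σ xs p = ≡≤ (sym (Σ-0 xs)) ▸ Σ-mono xs p

    Σ-+ : ∀ xs (f g : A → ℚ) → Σ xs (λ x → f x + g x) ≡ Σ xs f + Σ xs g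
    Σ-+ [] f g = refl
    Σ-+ (x ∷ xs) f g = trans (cong (f x + g x +_) (Σ-+ xs f g)) (lem (f x) (g x) (Σ xs f) (Σ xs g))
      where
      lem : ∀ a b c d → a + b + (c + d) ≡ a + c + (b + d)
      lem = solve-∀ ℚring

    Σ-* : ∀ c xs (f : A → ℚ) → Σ xs (λ x → c * f x) ≡ c * Σ xs f
    Σ-* c [] f = sym (ℚₚ.*-zeroʳ c)
    Σ-* c (x ∷ xs) f = trans (cong (c * f x +_) (Σ-* c xs f)) (sym (ℚₚ.*-distribˡ-+ c (f x) (Σ xs f)))

    Σ-*ʳ : ∀ c xs (f : A → ℚ) → Σ xs (λ x → f x * c) ≡ Σ xs f * c
    Σ-*ʳ c xs f = trans (Σ-cong xs (λ x → ℚₚ.*-comm (f x) c)) (trans (Σ-* c xs f) (ℚₚ.*-comm c _))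

    Σ-++ : ∀ xs ys (f : A → ℚ) → Σ (xs ++ ys) f ≡ Σ xs f + Σ ys f
    Σ-++ [] ys f = sym (ℚₚ.+-identityˡ _)
    Σ-++ (x ∷ xs) ys f = trans (cong (f x +_) (Σ-++ xs ys f)) (sym (ℚₚ.+-assoc (f x) _ _))

    Σ-const : ∀ xs c → Σ xs (λ _ → c) ≡ nat (length xs) * c
    Σ-const [] c = sym (ℚₚ.*-zeroˡ c)
    Σ-const (x ∷ xs) c = trans (cong (c +_) (Σ-const xs c)) (lem c (nat (length xs)))
      where
      lem : ∀ c n → c + n * c ≡ (1ℚ + n) * c
      lem = solve-∀ ℚring

    Σ-filter : ∀ (b : A → Bool) xs (f : A → ℚ) → Σ (filterᵇ b xs) f ≡ Σ xs (λ x → 𝟙 (b x) * f x)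
    Σ-filter b [] f = refl
    Σ-filter b (x ∷ xs) f with b x
    ... | true = cong₂ _+_ (sym (ℚₚ.*-identityˡ (f x))) (Σ-filter b xs f)
    ... | false = trans (Σ-filter b xs f) (sym (trans (cong (_+ _) (ℚₚ.*-zeroˡ (f x))) (ℚₚ.+-identityˡ _)))

    Π-cong∈ : ∀ xs {f g : A → ℚ} → (∀ {x} → x ∈ xs → f x ≡ g x) → Π xs f ≡ Π xs g
    Π-cong∈ [] p = refl
    Π-cong∈ (x ∷ xs) p = cong₂ _*_ (p (here refl)) (Π-cong∈ xs (λ m → p (there m)))

    Π-cong : ∀ xs {f g : A → ℚ} → (∀ x → f x ≡ g x) → Π xs f ≡ Π xs g
    Π-cong xs p = Π-cong∈ xs (λ {x} _ → p x)

    0≤Π : ∀ xs {f : A → ℚ} → (∀ x → 0ℚ ≤ f x) → 0ℚ ≤ Π xs f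
    0≤Π [] p = 0≤1
    0≤Π (x ∷ xs) p = 0≤* (p x) (0≤Π xs p)

    0<Π : ∀ xs {f : A → ℚ} → (∀ x → 0ℚ < f x) → 0ℚ < Π xs f
    0<Π [] p = 0<1
    0<Π (x ∷ xs) p = 0<* (p x) (0<Π xs p)

    Π-mono : ∀ xs {f g : A → ℚ} → (∀ x → 0ℚ ≤ f x) → (∀ x → f x ≤ g x) → Π xs f ≤ Π xs g
    Π-mono [] p q = ≤-refl
    Π-mono (x ∷ xs) p q = *-mono (p x) (q x) (0≤Π xs p) (Π-mono xs p q)

    Π-* : ∀ xs (f g : A → ℚ) → Π xs (λ x → f x * g x) ≡ Π xs f * Π xs g
    Π-* [] f g = refl
    Π-* (x ∷ xs) f g = trans (cong (f x * g x *_) (Π-* xs f g)) (lem (f x) (g x) (Π xs f) (Π xs g))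
      where
      lem : ∀ a b c d → a * b * (c * d) ≡ a * c * (b * d)
      lem = solve-∀ ℚring

    Π-++ : ∀ xs ys (f : A → ℚ) → Π (xs ++ ys) f ≡ Π xs f * Π ys f
    Π-++ [] ys f = sym (ℚₚ.*-identityˡ _)
    Π-++ (x ∷ xs) ys f = trans (cong (f x *_) (Π-++ xs ys f)) (sym (ℚₚ.*-assoc (f x) _ _))

    Π-const : ∀ xs c → Π xs (λ _ → c) ≡ c ^ length xs
    Π-const [] c = refl
    Π-const (x ∷ xs) c = cong (c *_) (Π-const xs c)

    Π-elem0 : ∀ {xs x} {f : A → ℚ} → x ∈ xs → f x ≡ 0ℚ → Π xs f ≡ 0ℚ
    Π-elem0 {y ∷ xs} {f = f} (here refl) q = trans (cong (_* Π xs f) q) (ℚₚ.*-zeroˡ (Π xs f))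
    Π-elem0 {y ∷ xs} {f = f} (there m) q = trans (cong (f y *_) (Π-elem0 m q)) (ℚₚ.*-zeroʳ (f y))

  module _ {A B : Set} where
    Σ-swap : ∀ (xs : List A) (ys : List B) (f : A → B → ℚ) → Σ xs (λ x → Σ ys (f x)) ≡ Σ ys (λ y → Σ xs (λ x → f x y))
    Σ-swap [] ys f = sym (Σ-0 ys)
    Σ-swap (x ∷ xs) ys f = trans (cong (Σ ys (f x) +_) (Σ-swap xs ys f)) (sym (Σ-+ ys (f x) (λ y → Σ xs (λ x → f x y))))

    Σ-map : ∀ (g : A → B) xs (f : B → ℚ) → Σ (map g xs) f ≡ Σ xs (λ x → f (g x))
    Σ-map g [] f = refl
    Σ-map g (x ∷ xs) f = cong (f (g x) +_) (Σ-map g xs f)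

    Π-map : ∀ (g : A → B) xs (f : B → ℚ) → Π (map g xs) f ≡ Π xs (λ x → f (g x))
    Π-map g [] f = refl
    Π-map g (x ∷ xs) f = cong (f (g x) *_) (Π-map g xs f)

    Σ-concatMap : ∀ (g : A → List B) xs (f : B → ℚ) → Σ (concatMap g xs) f ≡ Σ xs (λ x → Σ (g x) f)
    Σ-concatMap g [] f = refl
    Σ-concatMap g (x ∷ xs) f = trans (Σ-++ (g x) (concatMap g xs) f) (cong (Σ (g x) f +_) (Σ-concatMap g xs f))

  -- The union bound in product form. Each step discards only the term `f x * Σ xs f`, which is
  -- nonnegative.
  Π-bernoulli : ∀ {A : Set} (xs : List A) {f : A → ℚ} → (∀ x → 0ℚ ≤ f x) → (∀ x → f x ≤ 1ℚ) →
    1ℚ - Σ xs f ≤ Π xs (λ x → 1ℚ - f x)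
  Π-bernoulli [] p q = ≤-refl
  Π-bernoulli (x ∷ xs) {f} p q =
    ≤+ (0≤* (p x) (0≤Σ xs p)) (lem (f x) (Σ xs f)) ▸ *-monoˡ (0≤- (q x)) (Π-bernoulli xs p q)
    where
    lem : ∀ a s → (1ℚ - a) * (1ℚ - s) ≡ 1ℚ - (a + s) + a * s
    lem = solve-∀ ℚring

  ≤+ˡ : ∀ {a c} → 0ℚ ≤ c → a ≤ c + a
  ≤+ˡ {a} {c} p = ≤+ p (ℚₚ.+-comm c a)

  ≤+ʳ : ∀ {a c} → 0ℚ ≤ c → a ≤ a + c
  ≤+ʳ p = ≤+ p refl

  *≤1 : ∀ {x y} → 0ℚ ≤ x → y ≤ 1ℚ → x * y ≤ x
  *≤1 {x} p q = *-monoˡ p q ▸ ≡≤ (ℚₚ.*-identityʳ x)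

  1*≤ : ∀ {x y} → 0ℚ ≤ x → y ≤ 1ℚ → y * x ≤ x
  1*≤ {x} p q = *-monoʳ p q ▸ ≡≤ (ℚₚ.*-identityˡ x)

  1^ : ∀ n → 1ℚ ^ n ≡ 1ℚ
  1^ zero = refl
  1^ (suc n) = trans (ℚₚ.*-identityˡ (1ℚ ^ n)) (1^ n)

  ≤1* : ∀ {x y} → 0ℚ ≤ x → 1ℚ ≤ y → x ≤ y * x
  ≤1* {x} {y} p q = ≡≤ (sym (ℚₚ.*-identityˡ x)) ▸ *-monoʳ p q

-- Expectations over independent random choices from a list.

module IndependentChoice where
  open Rationals
  open import Data.Rational using (ℚ; 0ℚ; 1ℚ; _+_; _*_; -_; _-_; _≤_; _<_)
  open import Data.Rational.Properties using (≤-refl; +-mono-≤; <⇒≤)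
  open import Data.List using ([]; _∷_)
  open import Data.List.Relation.Unary.All using ([]; _∷_)
  open import Data.List.Relation.Unary.AllPairs using ([]; _∷_)
  open import Tactic.RingSolver using (solve-∀)

  module Bernoulli {A : Set} (_≟_ : DecidableEquality A) where

    mem : A → List A → Bool
    mem x [] = false
    mem x (y ∷ ys) = does (x ≟ y) ∨ mem x ys

    mem-∈ : ∀ {x ys} → mem x ys ≡ true → x ∈ ys
    mem-∈ {x} {y ∷ ys} p with x ≟ y
    ... | yes q = here q
    ... | no _ = there (mem-∈ p)

    ∈-mem : ∀ {x ys} → x ∈ ys → mem x ys ≡ true
    ∈-mem {x} {y ∷ ys} p with x ≟ y
    ... | yes q = refl
    ∈-mem {x} {y ∷ ys} (here p) | no ¬q = ⊥-elim (¬q p)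
    ∈-mem {x} {y ∷ ys} (there p) | no ¬q = ∈-mem p

    ∉-mem : ∀ {x ys} → x ∉ ys → mem x ys ≡ false
    ∉-mem {x} {ys} p with mem x ys in eq
    ... | true = ⊥-elim (p (mem-∈ eq))
    ... | false = refl

    noHit : (A → Bool) → List A → Bool
    noHit K [] = true
    noHit K (x ∷ xs) = not (K x) ∧ noHit K xs

    noHit-∈ : ∀ {K x xs} → noHit K xs ≡ true → x ∈ xs → K x ≡ false
    noHit-∈ {K} {x} p (here refl) with K x
    ... | false = refl
    noHit-∈ {K} {x} {y ∷ ys} p (there m) with K y
    ... | false = noHit-∈ p m

    noHit-hit : ∀ {K x xs} → x ∈ xs → K x ≡ true → noHit K xs ≡ false
    noHit-hit {K} {x} {xs} m k with noHit K xs in eq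
    ... | false = refl
    ... | true with trans (sym k) (noHit-∈ {xs = xs} eq m)
    ...   | ()

    -- The expectation of `f` at the random sublist of `es` that contains each `e` independently
    -- with probability `q e`.
    ber : (A → ℚ) → List A → (List A → ℚ) → ℚ
    ber q [] f = f []
    ber q (e ∷ es) f = q e * ber q es (λ A → f (e ∷ A)) + (1ℚ - q e) * ber q es f

    Prob : (A → ℚ) → Set
    Prob q = ∀ e → (0ℚ ≤ q e) × (q e ≤ 1ℚ)

    private
      mix-same : ∀ q a → q * a + (1ℚ - q) * a ≡ a
      mix-same = solve-∀ ℚring
      mix-+ : ∀ q a b c d → q * (a + b) + (1ℚ - q) * (c + d) ≡ q * a + (1ℚ - q) * c + (q * b + (1ℚ - q) * d)
      mix-+ = solve-∀ ℚring
      mix-* : ∀ q k a c → q * (k * a) + (1ℚ - q) * (k * c) ≡ k * (q * a + (1ℚ - q) * c)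
      mix-* = solve-∀ ℚring

    ber-cong : ∀ q es {f g} → (∀ A → f A ≡ g A) → ber q es f ≡ ber q es g
    ber-cong q [] p = p []
    ber-cong q (e ∷ es) p = cong₂ (λ x y → q e * x + (1ℚ - q e) * y) (ber-cong q es (λ A → p (e ∷ A))) (ber-cong q es p)

    ber-congq : ∀ {q q′} es f → (∀ {e} → e ∈ es → q e ≡ q′ e) → ber q es f ≡ ber q′ es f
    ber-congq [] f p = refl
    ber-congq {q} {q′} (e ∷ es) f p =
      trans (cong₂ (λ x y → q e * x + (1ℚ - q e) * y) (ber-congq es (λ A → f (e ∷ A)) (λ m → p (there m))) (ber-congq es f (λ m → p (there m))))
            (cong (λ z → z * ber q′ es (λ A → f (e ∷ A)) + (1ℚ - z) * ber q′ es f) (p (here refl)))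

    ber-mono : ∀ {q} → Prob q → ∀ es {f g} → (∀ A → f A ≤ g A) → ber q es f ≤ ber q es g
    ber-mono pr [] p = p []
    ber-mono pr (e ∷ es) p = +-mono-≤ (*-monoˡ (proj₁ (pr e)) (ber-mono pr es (λ A → p (e ∷ A)))) (*-monoˡ (0≤- (proj₂ (pr e))) (ber-mono pr es p))

    ber-const : ∀ q es c → ber q es (λ _ → c) ≡ c
    ber-const q [] c = refl
    ber-const q (e ∷ es) c = trans (cong₂ (λ x y → q e * x + (1ℚ - q e) * y) (ber-const q es c) (ber-const q es c)) (mix-same (q e) c)

    ber-+ : ∀ q es f g → ber q es (λ A → f A + g A) ≡ ber q es f + ber q es g
    ber-+ q [] f g = refl
    ber-+ q (e ∷ es) f g = trans (cong₂ (λ x y → q e * x + (1ℚ - q e) * y) (ber-+ q es (λ A → f (e ∷ A)) (λ A → g (e ∷ A))) (ber-+ q es f g))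
      (mix-+ (q e) (ber q es (λ A → f (e ∷ A))) (ber q es (λ A → g (e ∷ A))) (ber q es f) (ber q es g))

    ber-* : ∀ q es c f → ber q es (λ A → c * f A) ≡ c * ber q es f
    ber-* q [] c f = refl
    ber-* q (e ∷ es) c f = trans (cong₂ (λ x y → q e * x + (1ℚ - q e) * y) (ber-* q es c (λ A → f (e ∷ A))) (ber-* q es c f))
      (mix-* (q e) c (ber q es (λ A → f (e ∷ A))) (ber q es f))

    ber-Σ : ∀ q es {B : Set} (xs : List B) (f : B → List A → ℚ) → ber q es (λ A → Σ xs (λ x → f x A)) ≡ Σ xs (λ x → ber q es (f x))
    ber-Σ q es [] f = ber-const q es 0ℚ
    ber-Σ q es (x ∷ xs) f = trans (ber-+ q es (f x) (λ A → Σ xs (λ x → f x A))) (cong (ber q es (f x) +_) (ber-Σ q es xs f))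

    0≤ber : ∀ {q} → Prob q → ∀ es {f} → (∀ A → 0ℚ ≤ f A) → 0ℚ ≤ ber q es f
    0≤ber {q} pr es p = ≡≤ (sym (ber-const q es 0ℚ)) ▸ ber-mono pr es p

    ber-noHit : ∀ q es K → ber q es (λ A → 𝟙 (noHit K A)) ≡ Π es (λ e → 1ℚ - q e * 𝟙 (K e))
    ber-noHit q [] K = refl
    ber-noHit q (e ∷ es) K with K e
    ... | true = trans (cong₂ (λ x y → q e * x + (1ℚ - q e) * y) (ber-const q es 0ℚ) (ber-noHit q es K)) (lem (q e) (Π es (λ e → 1ℚ - q e * 𝟙 (K e))))
      where
      lem : ∀ q s → q * 0ℚ + (1ℚ - q) * s ≡ (1ℚ - q * 1ℚ) * s
      lem = solve-∀ ℚring
    ... | false = trans (mix-same (q e) (ber q es (λ A → 𝟙 (noHit K A)))) (trans (ber-noHit q es K) (lem (q e) (Π es (λ e → 1ℚ - q e * 𝟙 (K e)))))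
      where
      lem : ∀ q s → s ≡ (1ℚ - q * 0ℚ) * s
      lem = solve-∀ ℚring

    -- Conditioning on the pick of `j`: by independence this only raises the rate of `j` to 1.
    _[_↦1] : (A → ℚ) → A → A → ℚ
    (q [ j ↦1]) e = if does (e ≟ j) then 1ℚ else q e

    ↦1-same : ∀ q j → (q [ j ↦1]) j ≡ 1ℚ
    ↦1-same q j with j ≟ j
    ... | yes _ = refl
    ... | no ¬p = ⊥-elim (¬p refl)

    ↦1-diff : ∀ q {j e} → e ≢ j → (q [ j ↦1]) e ≡ q e
    ↦1-diff q {j} {e} p with e ≟ j
    ... | yes r = ⊥-elim (p r)
    ... | no _ = refl

    ↦1-prob : ∀ q j → Prob q → Prob (q [ j ↦1])
    ↦1-prob q j pr e with e ≟ j
    ... | yes _ = 0≤1 , ≤-refl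
    ... | no _ = pr e

    ↦1-≥ : ∀ q j → Prob q → ∀ e → q e ≤ (q [ j ↦1]) e
    ↦1-≥ q j pr e with e ≟ j
    ... | yes _ = proj₂ (pr e)
    ... | no _ = ≤-refl

    ber-mem0 : ∀ q es j F → j ∉ es → ber q es (λ A → 𝟙 (mem j A) * F A) ≡ 0ℚ
    ber-mem0 q es j F j∉ = aux es F (λ A → F A) (λ A → refl) (λ A → mem j A) (λ A _ → refl) j∉
      where
      lem0 : ∀ q → q * 0ℚ + (1ℚ - q) * 0ℚ ≡ 0ℚ
      lem0 = solve-∀ ℚring
      aux : ∀ es F (G : List A → ℚ) → (∀ A → G A ≡ F A) → (m : List A → Bool) → (∀ A → j ∉ es → m A ≡ mem j A) → j ∉ es → ber q es (λ A → 𝟙 (m A) * F A) ≡ 0ℚ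
      aux [] F G _ m mq j∉ = trans (cong (λ b → 𝟙 b * F []) (mq [] j∉)) (ℚₚ.*-zeroˡ (F []))
      aux (e ∷ es) F G _ m mq j∉ = trans (cong₂ (λ x y → q e * x + (1ℚ - q e) * y)
          (aux es (λ A → F (e ∷ A)) (λ A → F (e ∷ A)) (λ A → refl) (λ A → m (e ∷ A)) (λ A _ → trans (mq (e ∷ A) j∉) (memskip A)) (λ x → j∉ (there x)))
          (aux es F F (λ A → refl) m (λ A _ → mq A j∉) (λ x → j∉ (there x)))) (lem0 (q e))
        where
        memskip : ∀ A → mem j (e ∷ A) ≡ mem j A
        memskip A with j ≟ e
        ... | yes p = ⊥-elim (j∉ (here p))
        ... | no _ = refl

    ber-mem : ∀ q {es j} F → Unique es → j ∈ es → ber q es (λ A → 𝟙 (mem j A) * F A) ≡ q j * ber (q [ j ↦1]) es F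
    ber-mem q {e ∷ es} {.e} F (al ∷ u) (here refl) =
      trans (cong₂ (λ x y → q e * x + (1ℚ - q e) * y)
              (trans (ber-cong q es hit) (ber-congq es (λ A → F (e ∷ A)) (λ m → sym (↦1-diff q (λ p → e∉ (subst (_∈ es) p m))))))
              (ber-mem0 q es e F e∉))
            (trans (lem (q e) b c) (cong (λ z → q e * (z * b + (1ℚ - z) * c)) (sym (↦1-same q e))))
      where
      e∉ : e ∉ es
      e∉ m = All.lookup al m refl
      b = ber (q [ e ↦1]) es (λ A → F (e ∷ A))
      c = ber (q [ e ↦1]) es F
      hit : ∀ A → 𝟙 (mem e (e ∷ A)) * F (e ∷ A) ≡ F (e ∷ A)
      hit A rewrite ∈-mem {e} {e ∷ A} (here refl) = ℚₚ.*-identityˡ _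
      lem : ∀ q b c → q * b + (1ℚ - q) * 0ℚ ≡ q * (1ℚ * b + (1ℚ - 1ℚ) * c)
      lem = solve-∀ ℚring
    ber-mem q {e ∷ es} {j} F (al ∷ u) (there m) =
      trans (cong₂ (λ x y → q e * x + (1ℚ - q e) * y)
              (trans (ber-cong q es (λ A → cong (λ z → 𝟙 z * F (e ∷ A)) (skip A))) (ber-mem q (λ A → F (e ∷ A)) u m))
              (ber-mem q F u m))
            (trans (mix-* (q e) (q j) b c) (cong (λ z → q j * (z * b + (1ℚ - z) * c)) (sym (↦1-diff q e≢j))))
      where
      e≢j : e ≢ j
      e≢j p = All.lookup al m p
      b = ber (q [ j ↦1]) es (λ A → F (e ∷ A))
      c = ber (q [ j ↦1]) es F
      skip : ∀ A → mem j (e ∷ A) ≡ mem j A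
      skip A with j ≟ e
      ... | yes p = ⊥-elim (e≢j (sym p))
      ... | no _ = refl

    private
      agree : ∀ {q q′ : A → ℚ} {j J} → (∀ {e} → e ∈ (j ∷ J) → q′ e ≡ q e) → All (j ≢_) J → ∀ {e} → e ∈ J → (q′ [ j ↦1]) e ≡ q e
      agree {q} {q′} ag al {e} m = trans (↦1-diff q′ (λ p → All.lookup al m (sym p))) (ag (there m))

    -- Conditioning on the picks of `J` raises their rates to 1, and higher rates can only lower the
    -- probability of avoiding `K`. The induction therefore runs over all rates above `q` that agree
    -- with `q` on the part of `J` still to be treated.
    ber-UB : ∀ {q} → Prob q → ∀ {es} K → Unique es → ∀ J → Unique J → All (_∈ es) J →
      ber q es (λ A → Π J (λ e → 𝟙 (mem e A)) * 𝟙 (noHit K A)) ≤ Π J q * Π es (λ e → 1ℚ - q e * 𝟙 (K e))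
    ber-UB {q} pr {es} K u J uJ J⊆ = go q pr (λ e → ≤-refl {q e}) J uJ J⊆ (λ _ → refl)
      where
      go : ∀ q′ → Prob q′ → (∀ e → q e ≤ q′ e) → ∀ J → Unique J → All (_∈ es) J → (∀ {e} → e ∈ J → q′ e ≡ q e) →
        ber q′ es (λ A → Π J (λ e → 𝟙 (mem e A)) * 𝟙 (noHit K A)) ≤ Π J q * Π es (λ e → 1ℚ - q e * 𝟙 (K e))
      go q′ pr′ q≤ [] _ _ _ =
        ≡≤ (trans (ber-cong q′ es (λ A → ℚₚ.*-identityˡ _)) (ber-noHit q′ es K))
        ▸ Π-mono es (λ e → 0≤- (*-mono (proj₁ (pr′ e)) (proj₂ (pr′ e)) (0≤𝟙 (K e)) (𝟙≤1 (K e)) ▸ ≡≤ (ℚₚ.*-identityˡ 1ℚ)))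
                    (λ e → +-mono-≤ (≤-refl {1ℚ}) (ℚₚ.neg-antimono-≤ (*-monoʳ (0≤𝟙 (K e)) (q≤ e))))
        ▸ ≡≤ (sym (ℚₚ.*-identityˡ _))
      go q′ pr′ q≤ (j ∷ J) (al ∷ uJ) (j∈ ∷ J⊆) ag =
        ≡≤ (trans (ber-cong q′ es (λ A → ℚₚ.*-assoc (𝟙 (mem j A)) _ _)) (ber-mem q′ (λ A → Π J (λ e → 𝟙 (mem e A)) * 𝟙 (noHit K A)) u j∈))
        ▸ *-mono (proj₁ (pr′ j)) (≡≤ (ag (here refl))) (0≤ber (↦1-prob q′ j pr′) es (λ A → 0≤* (0≤Π J (λ e → 0≤𝟙 (mem e A))) (0≤𝟙 (noHit K A))))
            (go (q′ [ j ↦1]) (↦1-prob q′ j pr′) (λ e → q≤ e ▸ ↦1-≥ q′ j pr′ e) J uJ J⊆ (agree {q} {q′} ag al))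
        ▸ ≡≤ (sym (ℚₚ.*-assoc (q j) (Π J q) _))

    -- Independence at distinct elements. The summand `a e` carries what the past has already
    -- contributed at `e`, such as an earlier pick.
    ber-crude : ∀ {q} → Prob q → ∀ {es} → Unique es → ∀ S → Unique S → All (_∈ es) S → (a : A → ℚ) → (∀ e → 0ℚ ≤ a e) →
      ber q es (λ A → Π S (λ e → a e + 𝟙 (mem e A))) ≤ Π S (λ e → a e + q e)
    ber-crude {q} pr {es} u S uS S⊆ a 0≤a = go q pr S uS S⊆ (λ _ → refl)
      where
      go : ∀ q′ → Prob q′ → ∀ S → Unique S → All (_∈ es) S → (∀ {e} → e ∈ S → q′ e ≡ q e) →
        ber q′ es (λ A → Π S (λ e → a e + 𝟙 (mem e A))) ≤ Π S (λ e → a e + q e)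
      go q′ pr′ [] _ _ _ = ≡≤ (ber-const q′ es 1ℚ)
      go q′ pr′ (j ∷ S) (al ∷ uS) (j∈ ∷ S⊆) ag =
        ≡≤ (trans (ber-cong q′ es (λ A → ℚₚ.*-distribʳ-+ (R A) (a j) (𝟙 (mem j A))))
           (trans (ber-+ q′ es (λ A → a j * R A) (λ A → 𝟙 (mem j A) * R A))
             (cong₂ _+_ (ber-* q′ es (a j) R) (ber-mem q′ R u j∈))))
        ▸ +-mono-≤ (*-monoˡ (0≤a j) (go q′ pr′ S uS S⊆ (λ m → ag (there m))))
                   (*-mono (proj₁ (pr′ j)) (≡≤ (ag (here refl))) (0≤ber (↦1-prob q′ j pr′) es (λ A → 0≤Π S (λ e → 0≤+ (0≤a e) (0≤𝟙 (mem e A)))))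
                     (go (q′ [ j ↦1]) (↦1-prob q′ j pr′) S uS S⊆ (agree {q} {q′} ag al)))
        ▸ ≡≤ (sym (ℚₚ.*-distribʳ-+ (Π S (λ e → a e + q e)) (a j) (q j)))
        where
        R : List A → ℚ
        R A = Π S (λ e → a e + 𝟙 (mem e A))

    -- The strict `0ℚ < q` in the first alternative is essential: it is how one later knows that
    -- every edge of the selected history had positive weight when it was picked.
    mix-exists : ∀ {c q x y} → 0ℚ ≤ q → q ≤ 1ℚ → c ≤ q * x + (1ℚ - q) * y → (0ℚ < q × c ≤ x) ⊎ (c ≤ y)
    mix-exists {c} {q} {x} {y} 0≤q q≤1 p with c ℚ.≤? y
    ... | yes r = inj₂ r
    ... | no r with ℚₚ.<-cmp 0ℚ q
    ...   | tri> _ _ l = ⊥-elim (ℚₚ.<-irrefl refl (ℚₚ.<-≤-trans l 0≤q))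
    ...   | tri≈ _ refl _ = ⊥-elim (r (p ▸ ≡≤ (lem x y)))
      where
      lem : ∀ x y → 0ℚ * x + (1ℚ - 0ℚ) * y ≡ y
      lem = solve-∀ ℚring
    ...   | tri< 0<q _ _ with c ℚ.≤? x
    ...     | yes s = inj₁ (0<q , s)
    ...     | no s = ⊥-elim (ℚₚ.<-irrefl refl (ℚₚ.≤-<-trans p lt))
      where
      x<c = ℚₚ.≰⇒> s
      y≤c = <⇒≤ (ℚₚ.≰⇒> r)
      lem : ∀ q c → q * c + (1ℚ - q) * c ≡ c
      lem = solve-∀ ℚring
      lt : q * x + (1ℚ - q) * y < c
      lt = ℚₚ.<-≤-trans (ℚₚ.+-mono-<-≤ (ℚₚ.*-monoʳ-<-pos q {{ℚ.positive 0<q}} x<c) (*-monoˡ (0≤- q≤1) y≤c)) (≡≤ (lem q c))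

    ber-exists : ∀ {q} → Prob q → ∀ es → Unique es → ∀ {f c} → c ≤ ber q es f →
      ∃ λ A → c ≤ f A × All (λ e → e ∈ es × 0ℚ < q e) A × Unique A
    ber-exists pr [] u p = [] , p , [] , []
    ber-exists {q} pr (e ∷ es) (al ∷ u) {f} p with mix-exists (proj₁ (pr e)) (proj₂ (pr e)) p
    ... | inj₁ (0<q , r) with ber-exists pr es u {λ A → f (e ∷ A)} r
    ...   | A , s , inA , uA = e ∷ A , s , (here refl , 0<q) ∷ All.map (λ (m , z) → there m , z) inA , All.map (λ (m , _) → All.lookup al m) inA ∷ uA
    ber-exists {q} pr (e ∷ es) (al ∷ u) {f} p | inj₂ r with ber-exists pr es u {f} r
    ...   | A , s , inA , uA = A , s , All.map (λ (m , z) → there m , z) inA , uA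

-- The random process: histories, survival weights, danger, eligibility and rates.

module NibbleProcess where
  open Rationals
  open IndependentChoice
  open import Data.Rational using (ℚ; 0ℚ; 1ℚ; ½; _+_; _*_; -_; _-_; _≤_; _<_; _⊓_; _≤?_)
  open import Data.Rational.Properties using (≤-refl; +-mono-≤)
  open import Data.Nat using (zero; suc)
  open import Data.List using ([]; _∷_)
  open import Data.Bool.ListAction using (all; any)
  open import Data.List.Relation.Unary.All using ([]; _∷_)
  open import Data.List.Relation.Unary.AllPairs using ([]; _∷_)
  open import Tactic.RingSolver using (solve-∀)

  2q : ℚ
  2q = 1ℚ + 1ℚ

  does-yes : ∀ {X : Set} (d : Dec X) → does d ≡ true → X
  does-yes (yes x) _ = x

  does-no : ∀ {X : Set} (d : Dec X) → does d ≡ false → ¬ X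
  does-no (no x) _ = x

  yes-does : ∀ {X : Set} (d : Dec X) → X → does d ≡ true
  yes-does (yes _) _ = refl
  yes-does (no ¬x) x = ⊥-elim (¬x x)

  abstract
    leᵇ : ℚ → ℚ → Bool
    leᵇ a b = does (a ≤? b)

    leᵇ-true : ∀ {a b} → leᵇ a b ≡ true → a ≤ b
    leᵇ-true {a} {b} = does-yes (a ≤? b)

    leᵇ-intro : ∀ {a b} → a ≤ b → leᵇ a b ≡ true
    leᵇ-intro {a} {b} = yes-does (a ≤? b)

    leᵇ-false : ∀ {a b} → leᵇ a b ≡ false → b < a
    leᵇ-false {a} {b} p = ℚₚ.≰⇒> (does-no (a ≤? b) p)

  bool? : ∀ x → (x ≡ true) ⊎ (x ≡ false)
  bool? true = inj₁ refl
  bool? false = inj₂ refl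

  bernoulli : ∀ M {x} → 0ℚ ≤ x → 1ℚ + nat M * x ≤ (1ℚ + x) ^ M
  bernoulli zero {x} p = ≡≤ (lem x)
    where
    lem : ∀ x → 1ℚ + 0ℚ * x ≡ 1ℚ
    lem = solve-∀ ℚring
  bernoulli (suc M) {x} p = ≤+ (0≤* (0≤nat M) (0≤sq x)) (lem (nat M) x) ▸ *-monoˡ (0≤+ 0≤1 p) (bernoulli M p)
    where
    lem : ∀ m x → (1ℚ + x) * (1ℚ + m * x) ≡ 1ℚ + (1ℚ + m) * x + m * (x * x)
    lem = solve-∀ ℚring

  module PowerDecay (M : ℕ) (h : ℚ) (0≤h : 0ℚ ≤ h) (Mh : nat M * h ≡ 1ℚ) where
    -- With `h` = 1/M, the power `(1ℚ - 2q * g * h) ^ M` stands in for exp(-2g), and this is the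
    -- analogue of exp(-2q) ≤ 1 - q. As `u` is at most 1, `u - x` is at most `u * (1ℚ - x)`. Then
    -- (1-x)^M (1+x)^M ≤ 1, while (1+x)^M ≥ 1 + 2q by Bernoulli's inequality and (1+2q)(1-q) ≥ 1 for
    -- q ≤ 1/2.
    decay1 : ∀ {u q} → 0ℚ ≤ q → q ≤ ½ → u ≤ 1ℚ → 0ℚ ≤ u - 2q * q * h → (u - 2q * q * h) ^ M ≤ u ^ M * (1ℚ - q)
    decay1 {u} {q} 0≤q q≤½ u≤1 p =
      ^-mono M p (≤+ (0≤* 0≤x (0≤- u≤1)) (lem1 u x)) ▸ ≡≤ (*-^ u (1ℚ - x) M) ▸ *-monoˡ (0≤^ M 0≤u) vM
      where
      x = 2q * q * h
      0≤x : 0ℚ ≤ x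
      0≤x = 0≤* (0≤* (0≤+ 0≤1 0≤1) 0≤q) 0≤h
      lem1 : ∀ u x → u * (1ℚ - x) ≡ u - x + x * (1ℚ - u)
      lem1 = solve-∀ ℚring
      0≤u : 0ℚ ≤ u
      0≤u = 0≤+ p 0≤x ▸ ≡≤ (lem u x)
        where
        lem : ∀ u x → u - x + x ≡ u
        lem = solve-∀ ℚring
      0≤v : 0ℚ ≤ 1ℚ - x
      0≤v = p ▸ +-mono-≤ u≤1 (≤-refl { - x})
      vv : (1ℚ - x) ^ M * (1ℚ + x) ^ M ≤ 1ℚ
      vv = ≡≤ (sym (*-^ (1ℚ - x) (1ℚ + x) M)) ▸ ^-mono M (0≤* 0≤v (0≤+ 0≤1 0≤x)) (≤+ (0≤sq x) (lem x)) ▸ ≡≤ (1^ M)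
        where
        lem : ∀ x → 1ℚ ≡ (1ℚ - x) * (1ℚ + x) + x * x
        lem = solve-∀ ℚring
      v2 : (1ℚ - x) ^ M * (1ℚ + 2q * q) ≤ 1ℚ
      v2 = *-monoˡ (0≤^ M 0≤v) (≡≤ (cong (1ℚ +_) (trans (sym (ℚₚ.*-identityʳ (2q * q))) (trans (cong (2q * q *_) (sym Mh)) (lem q (nat M) h)))) ▸ bernoulli M 0≤x) ▸ vv
        where
        lem : ∀ q m h → (1ℚ + 1ℚ) * q * (m * h) ≡ m * ((1ℚ + 1ℚ) * q * h)
        lem = solve-∀ ℚring
      vM : (1ℚ - x) ^ M ≤ 1ℚ - q
      vM = ≤+ (0≤* (0≤^ M 0≤v) (0≤* 0≤q (0≤- q≤½ ▸ ≤+ (0≤- q≤½) (lem q)))) (lem2 ((1ℚ - x) ^ M) q) ▸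
           *-monoʳ (0≤- (q≤½ ▸ ½≤1)) v2 ▸ ≡≤ (ℚₚ.*-identityˡ (1ℚ - q))
        where
        ½≤1 : ½ ≤ 1ℚ
        ½≤1 = ≤+ {½} {1ℚ} {½} (ℚₚ.nonNegative⁻¹ ½) refl
        lem : ∀ q → 1ℚ - 2q * q ≡ ½ - q + (½ - q)
        lem q = trans (l1 q) (trans (cong (_- (q + q)) (refl {x = 1ℚ})) (l2 ½ q))
          where
          l1 : ∀ q → 1ℚ - (1ℚ + 1ℚ) * q ≡ 1ℚ - (q + q)
          l1 = solve-∀ ℚring
          l2 : ∀ a q → a + a - (q + q) ≡ a - q + (a - q)
          l2 = solve-∀ ℚring
        lem2 : ∀ V q → V * (1ℚ + (1ℚ + 1ℚ) * q) * (1ℚ - q) ≡ V + V * (q * (1ℚ - (1ℚ + 1ℚ) * q))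
        lem2 = solve-∀ ℚring

    decay : ∀ {A : Set} (xs : List A) {f : A → ℚ} {u} → (∀ x → 0ℚ ≤ f x) → (∀ x → f x ≤ ½) → u ≤ 1ℚ →
      0ℚ ≤ u - 2q * Σ xs f * h → (u - 2q * Σ xs f * h) ^ M ≤ u ^ M * Π xs (λ x → 1ℚ - f x)
    decay [] {f} {u} _ _ _ _ = ≡≤ (trans (cong (_^ M) (lem u h)) (sym (ℚₚ.*-identityʳ (u ^ M))))
      where
      lem : ∀ u h → u - (1ℚ + 1ℚ) * 0ℚ * h ≡ u
      lem = solve-∀ ℚring
    decay (x ∷ xs) {f} {u} p q u≤1 r =
      ≡≤ (cong (_^ M) (lem u (f x) (Σ xs f) h)) ▸ decay xs p q u′≤1 (r ▸ ≡≤ (lem u (f x) (Σ xs f) h)) ▸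
      *-monoʳ (0≤Π xs (λ y → 0≤- (q y ▸ ½≤1))) (decay1 (p x) (q x) u≤1 0≤u′) ▸ ≡≤ (ℚₚ.*-assoc (u ^ M) (1ℚ - f x) _)
      where
      ½≤1 : ½ ≤ 1ℚ
      ½≤1 = ≤+ {½} {1ℚ} {½} (ℚₚ.nonNegative⁻¹ ½) refl
      lem : ∀ u a s h → u - (1ℚ + 1ℚ) * (a + s) * h ≡ u - (1ℚ + 1ℚ) * a * h - (1ℚ + 1ℚ) * s * h
      lem = solve-∀ ℚring
      0≤2 : 0ℚ ≤ 2q
      0≤2 = 0≤+ 0≤1 0≤1
      u′≤1 : u - 2q * f x * h ≤ 1ℚ
      u′≤1 = ≤+ (0≤* (0≤* 0≤2 (p x)) 0≤h) (l u (2q * f x * h)) ▸ u≤1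
        where
        l : ∀ u x → u ≡ u - x + x
        l = solve-∀ ℚring
      0≤u′ : 0ℚ ≤ u - 2q * f x * h
      0≤u′ = r ▸ ≡≤ (lem u (f x) (Σ xs f) h) ▸ ≤+ (0≤* (0≤* 0≤2 (0≤Σ xs p)) 0≤h) (l (u - 2q * f x * h) (2q * Σ xs f * h))
        where
        l : ∀ u x → u ≡ u - x + x
        l = solve-∀ ℚring

  -- In the application `E` lists all r-sets, `Di` is the reciprocal of the number of edges through
  -- a pair, `θ` is the rate of one phase, and `conf e x J` says that `e`, `x` and `J` form a
  -- minimal dense configuration. `L` caps the accumulated danger of an edge and `Y1` the normalised
  -- degree of a pair.
  module Process {A P : Set} (_≟A_ : DecidableEquality A) (_≟P_ : DecidableEquality P)
    (E : List A) (pairs : A → List P) (tup : List (List A)) (conf : A → A → List A → Bool) (θ Di L Y1 : ℚ) where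

    open Bernoulli _≟A_ public
    module MP = Bernoulli _≟P_

    Obj : Set
    Obj = P ⊎ A

    Hist : Set
    Hist = List (List A)

    inP : P → A → Bool
    inP p e = MP.mem p (pairs e)

    -- The objects that must all survive for `e` to stay available.
    objs : A → List Obj
    objs e = inj₂ e ∷ map inj₁ (pairs e)

    rest : P → A → List Obj
    rest p e = inj₂ e ∷ map inj₁ (filterᵇ (λ p′ → not (does (p ≟P p′))) (pairs e))

    pk : Hist → A → Bool
    pk [] e = false
    pk (S ∷ H) e = mem e S ∨ pk H e

    dang : Hist → A → A → Bool
    dang H e e″ = any (λ J → conf e e″ J ∧ all (pk H) J) tup

    -- φ is the inverse-probability weight of survival: given the past, φ of an object is a martingale.
    mutual
      φ : Hist → Obj → ℚ
      φ [] o = 1ℚ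
      φ (S ∷ H) o = φ H o * 𝟙 (noHit (K H o) S) * inv (surv H o)

      w : Hist → A → ℚ
      w H e = Π (objs e) (φ H)

      -- The normalised weighted degree of `p`. The factor of `p` itself is left out, so the typical
      -- value stays near 1 for as long as `p` survives.
      Y : Hist → P → ℚ
      Y H p = Di * Σ E (λ e → 𝟙 (inP p e) * Π (rest p e) (φ H))

      -- An upper bound for the expected number of picks in the coming phase that would make `e`
      -- complete a conflict; eligibility of those picks is ignored.
      gh : Hist → A → ℚ
      gh H e = θ * Di * Σ E (λ e″ → 𝟙 (dang H e e″) * w H e″)

      -- The accumulated danger of an edge; beyond L the edge is retired, which keeps its weight bounded.
      G : Hist → A → ℚ
      G [] e = 0ℚ
      G (S ∷ H) e = G⁺ H e

      -- This is the danger after the coming phase, yet it is known before that phase begins, since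
      -- `G (S ∷ H) e` does not depend on `S`. The cap `2q * L` keeps the danger bounded, and a step
      -- that reaches the cap still carries the total beyond `L`.
      G⁺ : Hist → A → ℚ
      G⁺ H e = G H e + gh H e ⊓ (2q * L)

      okF : Hist → A → Bool
      okF H e = leᵇ (G⁺ H e) L

      okY : Hist → P → Bool
      okY H p = leᵇ (Y H p) Y1

      elig : Hist → A → Bool
      elig H e = okF H e ∧ all (okY H) (pairs e)

      q : Hist → A → ℚ
      q H e = θ * Di * w H e * 𝟙 (elig H e)

      -- K H o x: picking x at history H destroys the object o. A pair dies when it is covered, an edge when picking it would complete a conflict.
      K : Hist → Obj → A → Bool
      K H (inj₁ p) e″ = inP p e″
      K H (inj₂ e) e″ = okF H e ∧ dang H e e″

      surv : Hist → Obj → ℚ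
      surv H o = Π E (λ e → 1ℚ - q H e * 𝟙 (K H o e))

    -- The latest phase stands at the head of a history, so the inner `ber` is the conditional
    -- expectation given the past.
    Et : ℕ → (Hist → ℚ) → ℚ
    Et zero f = f []
    Et (suc t) f = Et t (λ H → ber (q H) E (λ S → f (S ∷ H)))

-- Deterministic bounds on the weights along every history.

module Invariants where
  open Rationals
  open IndependentChoice
  open NibbleProcess
  open import Data.Rational using (ℚ; 0ℚ; 1ℚ; ½; _+_; _*_; -_; _-_; _≤_; _<_; _⊓_)
  open import Data.Rational.Properties using (≤-refl; ≤-trans; ≤-reflexive; +-mono-≤; <⇒≤)
  open import Data.Nat using (zero; suc)
  open import Data.List using ([]; _∷_)
  open import Data.Bool.ListAction using (all)
  open import Data.List.Relation.Unary.All using ([]; _∷_)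
  open import Data.List.Relation.Unary.AllPairs using ([]; _∷_)
  open import Tactic.RingSolver using (solve-∀)

  all-false : ∀ {A : Set} {f : A → Bool} {x xs} → x ∈ xs → f x ≡ false → all f xs ≡ false
  all-false {f = f} {xs = y ∷ xs} (here refl) p rewrite p = refl
  all-false {f = f} {xs = y ∷ xs} (there m) p with f y
  ... | true = all-false m p
  ... | false = refl

  0≤2q : 0ℚ ≤ 2q
  0≤2q = 0≤+ 0≤1 0≤1
  0≤½ : 0ℚ ≤ ½
  0≤½ = ℚₚ.nonNegative⁻¹ ½
  ½≤1 : ½ ≤ 1ℚ
  ½≤1 = ≤+ {½} {1ℚ} {½} 0≤½ refl
  2½ : 2q * ½ ≡ 1ℚ
  2½ = refl

  -- The numerical conditions keep all weights bounded for `I` phases: `Ib` leaves a reserve `b` to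
  -- every pair, `Lh` keeps the base of the decay power at least 1/2 while the danger is at most
  -- `L`, and `cDi` and `stepB` bound by 1/2 the rate of a single edge and the total rate through a
  -- pair.
  record Setup : Set₁ where
    field
      A P : Set
      _≟A_ : DecidableEquality A
      _≟P_ : DecidableEquality P
      E : List A
      pairs : A → List P
      tup : List (List A)
      conf : A → A → List A → Bool
      θ Di L Y1 : ℚ
      s : ℕ
      |pairs| : ∀ e → length (pairs e) ℕ.≤ s
      uPairs : ∀ e → Unique (pairs e)
      uE : Unique E
      0≤θ : 0ℚ ≤ θ
      0≤Di : 0ℚ ≤ Di
      0<L : 0ℚ < L
      0≤Y1 : 0ℚ ≤ Y1
      I M : ℕ
      h : ℚ
      0≤h : 0ℚ ≤ h
      Mh : nat M * h ≡ 1ℚ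
      Lh : 2q * L * h ≤ ½
      b B : ℚ
      0<b : 0ℚ < b
      bB : b * B ≡ 1ℚ
      Ib : nat I * (θ * Y1) ≤ 1ℚ - b
      β : ℚ
      1≤β : 1ℚ ≤ β
      B≤β : B ≤ β
      2M≤β : 2q ^ M ≤ β
      c : ℚ
      c≡ : c ≡ θ * β ^ suc s
      cDi : c * Di ≤ ½
      stepB : θ * (B * Y1) ≤ ½

  module Bounds (S : Setup) where
    open Setup S public
    open Process _≟A_ _≟P_ E pairs tup conf θ Di L Y1 public
    open PowerDecay M h 0≤h Mh

    0≤β : 0ℚ ≤ β
    0≤β = 0≤1 ▸ 1≤β

    0≤θDi : 0ℚ ≤ θ * Di
    0≤θDi = 0≤* 0≤θ 0≤Di

    0≤L : 0ℚ ≤ L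
    0≤L = <⇒≤ 0<L

    0≤c : 0ℚ ≤ c
    0≤c = 0≤* 0≤θ (0≤^ (suc s) 0≤β) ▸ ≡≤ (sym c≡)

    0≤cDi : 0ℚ ≤ c * Di
    0≤cDi = 0≤* 0≤c 0≤Di

    -- `φp` says that the reciprocal weight of a pair falls by at most `θ * Y1` per phase. `φG`
    -- bounds the weight of an edge by its danger while that is at most `L`; `φf` is the consequence
    -- that remains true after retirement.
    record Inv (H : Hist) : Set where
      field
        0≤φ : ∀ o → 0ℚ ≤ φ H o
        φp : ∀ p → φ H (inj₁ p) * (1ℚ - nat (length H) * (θ * Y1)) ≤ 1ℚ
        φf : ∀ e → φ H (inj₂ e) ≤ 2q ^ M
        φG : ∀ e → G H e ≤ L → φ H (inj₂ e) * (1ℚ - 2q * G H e * h) ^ M ≤ 1ℚ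
        0≤G : ∀ e → 0ℚ ≤ G H e

    w-split : ∀ H {p e} → p ∈ pairs e → w H e ≡ φ H (inj₁ p) * Π (rest p e) (φ H)
    w-split H {p} {e} m = trans (cong (φ H (inj₂ e) *_) (trans (Π-map inj₁ (pairs e) (φ H))
        (trans (go (pairs e) (uPairs e) m) (cong (φ H (inj₁ p) *_) (sym (Π-map inj₁ (filterᵇ ne (pairs e)) (φ H)))))))
        (lem (φ H (inj₂ e)) (φ H (inj₁ p)) _)
      where
      lem : ∀ a b c → a * (b * c) ≡ b * (a * c)
      lem = solve-∀ ℚring
      f : P → ℚ
      f p = φ H (inj₁ p)
      ne : P → Bool
      ne p′ = not (does (p ≟P p′))
      skip : ∀ ps → p ∉ ps → filterᵇ ne ps ≡ ps
      skip [] _ = refl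
      skip (x ∷ ps) m with p ≟P x
      ... | yes q = ⊥-elim (m (here q))
      ... | no _ = cong (x ∷_) (skip ps (λ z → m (there z)))
      go : ∀ ps → Unique ps → p ∈ ps → Π ps f ≡ f p * Π (filterᵇ ne ps) f
      go (x ∷ ps) (al ∷ u) m with p ≟P x
      ... | yes refl = cong (f p *_) (cong (λ z → Π z f) (sym (skip ps (λ z → All.lookup al z refl))))
      go (x ∷ ps) (al ∷ u) (here q) | no ¬q = ⊥-elim (¬q q)
      go (x ∷ ps) (al ∷ u) (there m) | no ¬q = trans (cong (f x *_) (go ps u m)) (lem (f x) (f p) _)

    module FromInv (H : Hist) (iv : Inv H) (H≤ : length H ℕ.≤ I) where
      open Inv iv public

      den : b ≤ 1ℚ - nat (length H) * (θ * Y1)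
      den = -0≤ (0≤- (*-monoʳ (0≤* 0≤θ 0≤Y1) (nat-mono H≤) ▸ Ib) ▸ ≡≤ (lem b (nat (length H) * (θ * Y1))))
        where
        lem : ∀ b x → 1ℚ - b - x ≡ 1ℚ - x - b
        lem = solve-∀ ℚring

      φp≤B : ∀ p → φ H (inj₁ p) ≤ B
      φp≤B p = *-cancelʳ 0<b (*-monoˡ (0≤φ (inj₁ p)) den ▸ φp p ▸ ≡≤ (trans (sym bB) (ℚₚ.*-comm b B)))

      φ≤β : ∀ o → φ H o ≤ β
      φ≤β (inj₁ p) = φp≤B p ▸ B≤β
      φ≤β (inj₂ e) = φf e ▸ 2M≤β

      0≤w : ∀ e → 0ℚ ≤ w H e
      0≤w e = 0≤Π (objs e) 0≤φ

      Πφ≤ : ∀ O → Π O (φ H) ≤ β ^ length O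
      Πφ≤ O = Π-mono O 0≤φ φ≤β ▸ ≡≤ (Π-const O β)

      w≤ : ∀ e → w H e ≤ β ^ suc s
      w≤ e = Πφ≤ (objs e) ▸ ^-monoʳ 1≤β (s≤s (ℕₚ.≤-trans (ℕₚ.≤-reflexive (length-map inj₁ (pairs e))) (|pairs| e)))

      0≤gh : ∀ e → 0ℚ ≤ gh H e
      0≤gh e = 0≤* 0≤θDi (0≤Σ E (λ x → 0≤* (0≤𝟙 (dang H e x)) (0≤w x)))

      q≤w : ∀ e → q H e ≤ θ * Di * w H e
      q≤w e = *-monoˡ (0≤* 0≤θDi (0≤w e)) (𝟙≤1 (elig H e)) ▸ ≡≤ (ℚₚ.*-identityʳ _)

      0≤q : ∀ e → 0ℚ ≤ q H e
      0≤q e = 0≤* (0≤* 0≤θDi (0≤w e)) (0≤𝟙 (elig H e))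

      q≤c : ∀ e → q H e ≤ c * Di
      q≤c e = q≤w e ▸ *-monoˡ 0≤θDi (w≤ e) ▸ ≡≤ (trans (lem θ Di (β ^ suc s)) (cong (_* Di) (sym c≡)))
        where
        lem : ∀ a b c → a * b * c ≡ a * c * b
        lem = solve-∀ ℚring

      q≤½ : ∀ e → q H e ≤ ½
      q≤½ e = q≤c e ▸ cDi

      prob : Prob (q H)
      prob e = 0≤q e , (q≤½ e ▸ ½≤1)

      0≤qK : ∀ o e → 0ℚ ≤ q H e * 𝟙 (K H o e)
      0≤qK o e = 0≤* (0≤q e) (0≤𝟙 (K H o e))
      qK≤½ : ∀ o e → q H e * 𝟙 (K H o e) ≤ ½
      qK≤½ o e = *-mono (0≤q e) (q≤½ e) (0≤𝟙 (K H o e)) (𝟙≤1 (K H o e)) ▸ ≡≤ (ℚₚ.*-identityʳ ½)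

      0<surv : ∀ o → 0ℚ < surv H o
      0<surv o = 0<Π E (λ e → ℚₚ.<-≤-trans (ℚₚ.positive⁻¹ ½) (+-mono-≤ (≤-refl {1ℚ}) (ℚₚ.neg-antimono-≤ (qK≤½ o e))))

      -- If the degree of `p` is too large, all edges through `p` are ineligible and the sum is
      -- zero. Otherwise `φ H (inj₁ p)` factors out of every weight and what is left is `Y H p`.
      load : ∀ p → Σ E (λ e → q H e * 𝟙 (inP p e)) ≤ θ * φ H (inj₁ p) * Y1
      load p with okY H p in eq
      ... | false = ≡≤ (trans (Σ-cong E zz) (Σ-0 E)) ▸ 0≤* (0≤* 0≤θ (0≤φ (inj₁ p))) 0≤Y1
        where
        zz : ∀ e → q H e * 𝟙 (inP p e) ≡ 0ℚ
        zz e with inP p e in eq′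
        ... | false = ℚₚ.*-zeroʳ (q H e)
        ... | true rewrite all-false {f = okY H} (MP.mem-∈ {p} {pairs e} eq′) eq with okF H e
        ...   | true = lem (θ * Di * w H e)
          where
          lem : ∀ x → x * 0ℚ * 1ℚ ≡ 0ℚ
          lem = solve-∀ ℚring
        ...   | false = lem (θ * Di * w H e)
          where
          lem : ∀ x → x * 0ℚ * 1ℚ ≡ 0ℚ
          lem = solve-∀ ℚring
      ... | true =
        Σ-mono E (λ e → *-monoʳ (0≤𝟙 (inP p e)) (q≤w e)) ▸
        ≡≤ (trans (Σ-cong E pt) (trans (Σ-* (θ * φ H (inj₁ p) * Di) E _) (lem θ (φ H (inj₁ p)) Di _))) ▸
        *-monoˡ (0≤* 0≤θ (0≤φ (inj₁ p))) Y≤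
        where
        lem : ∀ a b c d → a * b * c * d ≡ a * b * (c * d)
        lem = solve-∀ ℚring
        Y≤ : Y H p ≤ Y1
        Y≤ = leᵇ-true eq
        pt : ∀ e → θ * Di * w H e * 𝟙 (inP p e) ≡ θ * φ H (inj₁ p) * Di * (𝟙 (inP p e) * Π (rest p e) (φ H))
        pt e with bool? (inP p e)
        ... | inj₂ eq′ = trans (cong (λ z → θ * Di * w H e * 𝟙 z) eq′)
            (trans (l2 (θ * Di * w H e) (θ * φ H (inj₁ p) * Di) (Π (rest p e) (φ H))) (cong (λ z → θ * φ H (inj₁ p) * Di * (𝟙 z * Π (rest p e) (φ H))) (sym eq′)))
          where
          l2 : ∀ a b c → a * 0ℚ ≡ b * (0ℚ * c)
          l2 = solve-∀ ℚring
        ... | inj₁ eq′ = trans (cong₂ (λ z y → θ * Di * y * 𝟙 z) eq′ (w-split H {p} {e} (MP.mem-∈ {p} {pairs e} eq′)))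
            (trans (l2 θ Di (φ H (inj₁ p)) (Π (rest p e) (φ H))) (cong (λ z → θ * φ H (inj₁ p) * Di * (𝟙 z * Π (rest p e) (φ H))) (sym eq′)))
          where
          l2 : ∀ a b c d → a * b * (c * d) * 1ℚ ≡ a * c * b * (1ℚ * d)
          l2 = solve-∀ ℚring

      survP : ∀ p → 1ℚ - θ * φ H (inj₁ p) * Y1 ≤ surv H (inj₁ p)
      survP p = +-mono-≤ (≤-refl {1ℚ}) (ℚₚ.neg-antimono-≤ (load p)) ▸
        Π-bernoulli E (0≤qK (inj₁ p)) (λ e → qK≤½ (inj₁ p) e ▸ ½≤1)

      survP½ : ∀ p → ½ ≤ surv H (inj₁ p)
      survP½ p = +-mono-≤ (≤-refl {1ℚ}) (ℚₚ.neg-antimono-≤ (≡≤ (ℚₚ.*-assoc θ _ Y1) ▸ *-monoˡ 0≤θ (*-monoʳ 0≤Y1 (φp≤B p)) ▸ stepB)) ▸ survP p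

      okF-L : ∀ e → okF H e ≡ true → G⁺ H e ≤ L
      okF-L e p = leᵇ-true p

      0≤gmin : ∀ e → 0ℚ ≤ gh H e ⊓ (2q * L)
      0≤gmin e = ℚₚ.⊓-glb (0≤gh e) (0≤* 0≤2q 0≤L)

      0≤G⁺ : ∀ e → 0ℚ ≤ G⁺ H e
      0≤G⁺ e = 0≤+ (0≤G e) (0≤gmin e)

      G≤G⁺ : ∀ e → G H e ≤ G⁺ H e
      G≤G⁺ e = ≤+ (0≤gmin e) refl

      -- An increment of `2q * L` would by itself exceed `L`, so the cap is inactive as long as the
      -- total stays below `L`.
      gmin≡ : ∀ e → G⁺ H e ≤ L → gh H e ⊓ (2q * L) ≡ gh H e
      gmin≡ e p with ℚₚ.≤-total (gh H e) (2q * L)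
      ... | inj₁ r = ℚₚ.p≤q⇒p⊓q≡p r
      ... | inj₂ r = ⊥-elim (ℚₚ.<-irrefl refl (ℚₚ.<-≤-trans L<2L (≡≤ (sym (ℚₚ.p≥q⇒p⊓q≡q r)) ▸ ≤+ (0≤G e) (ℚₚ.+-comm (G H e) _) ▸ p)))
        where
        L<2L : L < 2q * L
        L<2L = ℚₚ.<-≤-trans (ℚₚ.≤-<-trans (≡≤ (sym (ℚₚ.+-identityʳ L))) (ℚₚ.+-monoʳ-< L 0<L)) (≡≤ (lem L))
          where
          lem : ∀ L → L + L ≡ (1ℚ + 1ℚ) * L
          lem = solve-∀ ℚring

      Σdang≤ : ∀ e → okF H e ≡ true → Σ E (λ x → q H x * 𝟙 (K H (inj₂ e) x)) ≤ gh H e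
      Σdang≤ e ok = Σ-mono E (λ x → pt x) ▸ ≡≤ (Σ-* (θ * Di) E _)
        where
        lem : ∀ a b c → a * b * c ≡ a * (c * b)
        lem = solve-∀ ℚring
        pt : ∀ x → q H x * 𝟙 (K H (inj₂ e) x) ≤ θ * Di * (𝟙 (dang H e x) * w H x)
        pt x rewrite ok = *-monoʳ (0≤𝟙 (dang H e x)) (q≤w x) ▸ ≡≤ (lem (θ * Di) (w H x) (𝟙 (dang H e x)))

      base≥½ : ∀ {g} → g ≤ L → ½ ≤ 1ℚ - 2q * g * h
      base≥½ {g} g≤L = +-mono-≤ (≤-refl {1ℚ}) (ℚₚ.neg-antimono-≤ (*-monoʳ 0≤h (*-monoˡ 0≤2q g≤L) ▸ Lh))

      -- With the cap inactive, `G` grows by at least the total rate of the picks that kill `e`;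
      -- `decay` turns this rate into a survival probability.
      survF : ∀ e → okF H e ≡ true → (1ℚ - 2q * G⁺ H e * h) ^ M ≤ (1ℚ - 2q * G H e * h) ^ M * surv H (inj₂ e)
      survF e ok =
        ^-mono M (0≤½ ▸ base≥½ (okF-L e ok)) mid ▸
        decay E (0≤qK (inj₂ e)) (qK≤½ (inj₂ e)) u≤1 ((0≤½ ▸ base≥½ (okF-L e ok)) ▸ mid)
        where
        lem : ∀ a b h → 1ℚ - (1ℚ + 1ℚ) * (a + b) * h ≡ 1ℚ - (1ℚ + 1ℚ) * a * h - (1ℚ + 1ℚ) * b * h
        lem = solve-∀ ℚring
        mid : 1ℚ - 2q * G⁺ H e * h ≤ 1ℚ - 2q * G H e * h - 2q * Σ E (λ x → q H x * 𝟙 (K H (inj₂ e) x)) * h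
        mid = ≡≤ (trans (cong (λ z → 1ℚ - 2q * (G H e + z) * h) (gmin≡ e (okF-L e ok))) (lem (G H e) (gh H e) h)) ▸
              +-mono-≤ (≤-refl {1ℚ - 2q * G H e * h}) (ℚₚ.neg-antimono-≤ (*-monoʳ 0≤h (*-monoˡ 0≤2q (Σdang≤ e ok))))
        u≤1 : 1ℚ - 2q * G H e * h ≤ 1ℚ
        u≤1 = ≤+ (0≤* (0≤* 0≤2q (0≤G e)) 0≤h) (l (2q * G H e * h))
          where
          l : ∀ x → 1ℚ ≡ 1ℚ - x + x
          l = solve-∀ ℚring

      survBad : ∀ e → okF H e ≡ false → surv H (inj₂ e) ≡ 1ℚ
      survBad e nok = trans (Π-cong E pt) (trans (Π-const E 1ℚ) (1^ (length E)))
        where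
        pt : ∀ x → 1ℚ - q H x * 𝟙 (K H (inj₂ e) x) ≡ 1ℚ
        pt x rewrite nok = lem (q H x)
          where
          lem : ∀ x → 1ℚ - x * 0ℚ ≡ 1ℚ
          lem = solve-∀ ℚring

      -- One bound for both kinds of object: within a phase a pair survives with probability at
      -- least 1/2, an active edge with probability at least 2^-M, and a retired edge surely.
      surv≥ : ∀ o → 1ℚ ≤ 2q * 2q ^ M * surv H o
      surv≥ (inj₁ p) = ≡≤ (sym 2½) ▸ *-mono 0≤2q (≡≤ (sym (ℚₚ.*-identityʳ 2q)) ▸ *-monoˡ 0≤2q (1≤^ M (≤+ 0≤1 refl))) 0≤½ (survP½ p)
      surv≥ (inj₂ e) with bool? (okF H e)
      ... | inj₂ eq = *-mono 0≤1 (≤+ 0≤1 refl) 0≤1 (1≤^ M (≤+ 0≤1 refl)) ▸ ≡≤ (trans (sym (ℚₚ.*-identityʳ _)) (cong (2q * 2q ^ M *_) (sym (survBad e eq))))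
      ... | inj₁ eq = ≡≤ (sym (trans (sym (*-^ 2q ½ M)) (1^ M))) ▸
        *-monoˡ (0≤^ M 0≤2q) (^-mono M 0≤½ (base≥½ (okF-L e eq)) ▸ survF e eq ▸ *-monoʳ (<⇒≤ (0<surv (inj₂ e))) (^-mono M (0≤½ ▸ base≥½ GL) u≤1) ▸ ≡≤ (trans (cong (_* surv H (inj₂ e)) (1^ M)) (ℚₚ.*-identityˡ _))) ▸
        *-monoʳ (<⇒≤ (0<surv (inj₂ e))) (≡≤ (sym (ℚₚ.*-identityˡ (2q ^ M))) ▸ *-monoʳ (0≤^ M 0≤2q) (≤+ {1ℚ} {2q} 0≤1 refl))
        where
        GL = G≤G⁺ e ▸ okF-L e eq
        u≤1 : 1ℚ - 2q * G H e * h ≤ 1ℚ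
        u≤1 = ≤+ (0≤* (0≤* 0≤2q (0≤G e)) 0≤h) (l (2q * G H e * h))
          where
          l : ∀ x → 1ℚ ≡ 1ℚ - x + x
          l = solve-∀ ℚring

      inv≤ : ∀ o → inv (surv H o) ≤ 2q * 2q ^ M
      inv≤ o = ≡≤ (sym (ℚₚ.*-identityˡ _)) ▸ *inv≤ (0<surv o) (surv≥ o)

      φ-next : ∀ S o → φ (S ∷ H) o ≤ φ H o * inv (surv H o)
      φ-next S o = *-monoʳ (0≤inv (<⇒≤ (0<surv o))) (*-monoˡ (0≤φ o) (𝟙≤1 (noHit (K H o) S)) ▸ ≡≤ (ℚₚ.*-identityʳ (φ H o)))

      inv-next : ∀ S → Inv (S ∷ H)
      inv-next S = record
        { 0≤φ = 0≤φ′
        ; φp = λ p → *-monoʳ-maybe p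
        ; φf = φf′
        ; φG = φG′
        ; 0≤G = 0≤G⁺ }
        where
        0≤φ′ : ∀ o → 0ℚ ≤ φ (S ∷ H) o
        0≤φ′ o = 0≤* (0≤* (0≤φ o) (0≤𝟙 (noHit (K H o) S))) (0≤inv (<⇒≤ (0<surv o)))
        *-monoʳ-maybe : ∀ p → φ (S ∷ H) (inj₁ p) * (1ℚ - (1ℚ + nat (length H)) * (θ * Y1)) ≤ 1ℚ
        -- Only `length H` is known to be at most `I`, so after one more phase the bracket may be
        -- negative; the claim is then trivial.
        *-monoʳ-maybe p with ℚₚ.≤-total 0ℚ (1ℚ - (1ℚ + nat (length H)) * (θ * Y1))
        ... | inj₂ neg = ≤+ (0≤* (0≤φ′ (inj₁ p)) (0≤- neg)) (l (φ (S ∷ H) (inj₁ p)) (1ℚ - (1ℚ + nat (length H)) * (θ * Y1))) ▸ 0≤1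
          where
          l : ∀ a b → 0ℚ ≡ a * b + a * (0ℚ - b)
          l = solve-∀ ℚring
        -- The load of `p` is proportional to its own weight: φ(1 - (n+1)θY1) = φ(1 - nθY1) - θφY1 ≤
        -- 1 - θφY1, which is at most the survival probability by `survP`.
        ... | inj₁ pos = *-monoʳ pos (φ-next S (inj₁ p)) ▸
          ≡≤ (l (φ H (inj₁ p)) (inv (surv H (inj₁ p))) (1ℚ - (1ℚ + nat (length H)) * (θ * Y1))) ▸
          *inv≤ (0<surv (inj₁ p)) (≡≤ (l2 (φ H (inj₁ p)) (nat (length H)) θ Y1) ▸ +-mono-≤ (φp p) (≤-refl { - (θ * φ H (inj₁ p) * Y1)}) ▸ survP p ▸ ≡≤ (sym (ℚₚ.*-identityˡ _)))
          where
          l : ∀ a i x → a * i * x ≡ a * x * i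
          l = solve-∀ ℚring
          l2 : ∀ f n t y → f * (1ℚ - (1ℚ + n) * (t * y)) ≡ f * (1ℚ - n * (t * y)) - t * f * y
          l2 = solve-∀ ℚring
        φG′ : ∀ e → G⁺ H e ≤ L → φ (S ∷ H) (inj₂ e) * (1ℚ - 2q * G⁺ H e * h) ^ M ≤ 1ℚ
        φG′ e gl = *-monoʳ (0≤^ M (0≤½ ▸ base≥½ gl)) (φ-next S (inj₂ e)) ▸
          ≡≤ (l (φ H (inj₂ e)) (inv (surv H (inj₂ e))) ((1ℚ - 2q * G⁺ H e * h) ^ M)) ▸
          *inv≤ (0<surv (inj₂ e)) (*-monoˡ (0≤φ (inj₂ e)) (survF e ok) ▸ ≡≤ (sym (ℚₚ.*-assoc (φ H (inj₂ e)) _ _)) ▸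
            *-monoʳ (<⇒≤ (0<surv (inj₂ e))) (φG e (G≤G⁺ e ▸ gl)))
          where
          l : ∀ a i x → a * i * x ≡ a * x * i
          l = solve-∀ ℚring
          ok : okF H e ≡ true
          ok = leᵇ-intro gl
        φf′ : ∀ e → φ (S ∷ H) (inj₂ e) ≤ 2q ^ M
        φf′ e with bool? (okF H e)
        -- A retired edge has survival probability 1, so its weight is frozen.
        ... | inj₂ eq = *-mono (0≤* (0≤φ (inj₂ e)) (0≤𝟙 (noHit (K H (inj₂ e)) S))) (*-monoˡ (0≤φ (inj₂ e)) (𝟙≤1 (noHit (K H (inj₂ e)) S)) ▸ ≡≤ (ℚₚ.*-identityʳ (φ H (inj₂ e))) ▸ φf e)
                (0≤inv (<⇒≤ (0<surv (inj₂ e)))) (≡≤ (cong inv (survBad e eq))) ▸ ≡≤ (ℚₚ.*-identityʳ _)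
        ... | inj₁ eq =
          ≡≤ (trans (sym (ℚₚ.*-identityʳ x)) (cong (x *_) (sym (trans (sym (*-^ ½ 2q M)) (1^ M))))) ▸
          ≡≤ (sym (ℚₚ.*-assoc x _ _)) ▸
          *-monoʳ (0≤^ M 0≤2q) (*-monoˡ (0≤φ′ (inj₂ e)) (^-mono M 0≤½ (base≥½ (okF-L e eq))) ▸ φG′ e (okF-L e eq)) ▸ ≡≤ (ℚₚ.*-identityˡ _)
          where
          x = φ (S ∷ H) (inj₂ e)

    inv-all : ∀ H → length H ℕ.≤ I → Inv H
    inv-all [] _ = record
      { 0≤φ = λ _ → 0≤1 ; φp = λ _ → ≡≤ (l (θ * Y1)) ; φf = λ _ → 1≤^ M (≤+ {1ℚ} {2q} 0≤1 refl)
      ; φG = λ _ _ → ≡≤ (trans (ℚₚ.*-identityˡ _) (trans (cong (_^ M) (l2 h)) (1^ M))) ; 0≤G = λ _ → ≤-refl }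
      where
      l : ∀ x → 1ℚ * (1ℚ - 0ℚ * x) ≡ 1ℚ
      l = solve-∀ ℚring
      l2 : ∀ h → 1ℚ - (1ℚ + 1ℚ) * 0ℚ * h ≡ 1ℚ
      l2 = solve-∀ ℚring
    inv-all (S ∷ H) p = FromInv.inv-next H (inv-all H p′) p′ S
      where p′ = ℕₚ.≤-trans (ℕₚ.n≤1+n _) p

    module At (H : Hist) (H≤ : length H ℕ.≤ I) = FromInv H (inv-all H H≤) H≤

-- Approximate independence of weights and picks.

module Correlations where
  open Rationals
  open IndependentChoice
  open NibbleProcess
  open Invariants
  open import Data.Rational using (ℚ; 0ℚ; 1ℚ; _+_; _*_; -_; _-_; _≤_)
  open import Data.Rational.Properties using (≤-refl; ≤-trans; +-mono-≤; <⇒≤)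
  open import Data.Nat using (zero; suc)
  open import Data.List using ([]; _∷_)
  open import Data.Bool.ListAction using (any)
  open import Data.List.Relation.Unary.All using ([]; _∷_)
  open import Data.List.Relation.Unary.AllPairs using ([]; _∷_)
  open import Data.List.Relation.Binary.Sublist.Propositional using (_⊆_; []; _∷_)
  open import Tactic.RingSolver using (solve-∀)

  module _ {A : Set} (p : A → ℚ) where
    -- The expected number of picks that hit both objects; up to bounded factors nothing else
    -- correlates their survival.
    over : ∀ {O : Set} (K : O → A → Bool) (xs : List A) → O → O → ℚ
    over K xs o o′ = Σ xs (λ x → p x * 𝟙 (K o x) * 𝟙 (K o′ x))

    overs : ∀ {O : Set} (K : O → A → Bool) (xs : List A) → List O → ℚ
    overs K xs [] = 0ℚ
    overs K xs (o ∷ os) = Σ os (over K xs o) + overs K xs os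

  module _ {A : Set} (p : A → ℚ) (0≤p : ∀ x → 0ℚ ≤ p x) (p≤1 : ∀ x → p x ≤ 1ℚ) where
    private
      S : List A → (A → Bool) → ℚ
      S xs f = Π xs (λ x → 1ℚ - p x * 𝟙 (f x))

      fac : ∀ x z → 0ℚ ≤ 1ℚ - p x * 𝟙 z × 1ℚ - p x * 𝟙 z ≤ 1ℚ
      fac x z = 0≤- (*-mono (0≤p x) (p≤1 x) (0≤𝟙 z) (𝟙≤1 z) ▸ ≡≤ (ℚₚ.*-identityˡ 1ℚ)) ,
                ≤+ (0≤* (0≤p x) (0≤𝟙 z)) (lem (p x * 𝟙 z))
        where
        lem : ∀ x → 1ℚ ≡ 1ℚ - x + x
        lem = solve-∀ ℚring

      0≤S : ∀ xs f → 0ℚ ≤ S xs f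
      0≤S xs f = 0≤Π xs (λ x → proj₁ (fac x (f x)))

      S≤1 : ∀ xs f → S xs f ≤ 1ℚ
      S≤1 [] f = ≤-refl
      S≤1 (x ∷ xs) f = *-mono (proj₁ (fac x (f x))) (proj₂ (fac x (f x))) (0≤S xs f) (S≤1 xs f) ▸ ≡≤ (ℚₚ.*-identityˡ 1ℚ)

      ∨-low : ∀ q a b → 0ℚ ≤ q → q ≤ 1ℚ → (1ℚ - q * 𝟙 a) * (1ℚ - q * 𝟙 b) ≤ 1ℚ - q * 𝟙 (a ∨ b)
      ∨-low q true true 0≤q q≤1 = ≤+ (0≤* 0≤q (0≤- q≤1)) (lem q)
        where
        lem : ∀ q → 1ℚ - q * 1ℚ ≡ (1ℚ - q * 1ℚ) * (1ℚ - q * 1ℚ) + q * (1ℚ - q)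
        lem = solve-∀ ℚring
      ∨-low q true false _ _ = ≡≤ (lem q)
        where
        lem : ∀ q → (1ℚ - q * 1ℚ) * (1ℚ - q * 0ℚ) ≡ 1ℚ - q * 1ℚ
        lem = solve-∀ ℚring
      ∨-low q false b _ _ = ≡≤ (lem q (𝟙 b))
        where
        lem : ∀ q b → (1ℚ - q * 0ℚ) * (1ℚ - q * b) ≡ 1ℚ - q * b
        lem = solve-∀ ℚring

      ∨-up : ∀ q a b → 0ℚ ≤ q → q ≤ 1ℚ → 1ℚ - q * 𝟙 (a ∨ b) ≤ (1ℚ - q * 𝟙 a) * (1ℚ - q * 𝟙 b) + q * 𝟙 a * 𝟙 b
      ∨-up q true true 0≤q q≤1 = ≤+ (0≤sq q) (lem q)
        where
        lem : ∀ q → (1ℚ - q * 1ℚ) * (1ℚ - q * 1ℚ) + q * 1ℚ * 1ℚ ≡ 1ℚ - q * 1ℚ + q * q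
        lem = solve-∀ ℚring
      ∨-up q true false _ _ = ≡≤ (lem q)
        where
        lem : ∀ q → 1ℚ - q * 1ℚ ≡ (1ℚ - q * 1ℚ) * (1ℚ - q * 0ℚ) + q * 1ℚ * 0ℚ
        lem = solve-∀ ℚring
      ∨-up q false b _ _ = ≡≤ (lem q (𝟙 b))
        where
        lem : ∀ q b → 1ℚ - q * b ≡ (1ℚ - q * 0ℚ) * (1ℚ - q * b) + q * 0ℚ * b
        lem = solve-∀ ℚring

    -- Survival of two threats is positively correlated: a pick that hits both is charged twice on
    -- the left and once on the right.
    avoid-low : ∀ xs f g → S xs f * S xs g ≤ S xs (λ x → f x ∨ g x)
    avoid-low [] f g = ≡≤ (ℚₚ.*-identityˡ 1ℚ)
    avoid-low (x ∷ xs) f g = ≡≤ (lem (1ℚ - p x * 𝟙 (f x)) (S xs f) (1ℚ - p x * 𝟙 (g x)) (S xs g)) ▸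
      *-mono (0≤* (proj₁ (fac x (f x))) (proj₁ (fac x (g x)))) (∨-low (p x) (f x) (g x) (0≤p x) (p≤1 x)) (0≤* (0≤S xs f) (0≤S xs g)) (avoid-low xs f g)
      where
      lem : ∀ a b c d → a * b * (c * d) ≡ a * c * (b * d)
      lem = solve-∀ ℚring

    -- The gain from positive correlation is at most the expected number of picks in both sets; all
    -- remaining factors are at most 1.
    avoid-up : ∀ xs f g → S xs (λ x → f x ∨ g x) ≤ S xs f * S xs g + Σ xs (λ x → p x * 𝟙 (f x) * 𝟙 (g x))
    avoid-up [] f g = ≡≤ refl
    avoid-up (x ∷ xs) f g =
      *-monoˡ (proj₁ (fac x (f x ∨ g x))) (avoid-up xs f g) ▸
      ≡≤ (ℚₚ.*-distribˡ-+ w (S xs f * S xs g) R) ▸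
      +-mono-≤ (*-monoʳ (0≤* (0≤S xs f) (0≤S xs g)) (∨-up (p x) (f x) (g x) (0≤p x) (p≤1 x)) ▸
                ≡≤ (ℚₚ.*-distribʳ-+ (S xs f * S xs g) (a₁ * b₁) r) ▸
                +-mono-≤ (≡≤ (lem a₁ b₁ (S xs f) (S xs g)))
                  (*≤1 0≤r (*-mono (0≤S xs f) (S≤1 xs f) (0≤S xs g) (S≤1 xs g) ▸ ≡≤ (ℚₚ.*-identityˡ 1ℚ))))
               (1*≤ (0≤Σ xs (λ y → 0≤* (0≤* (0≤p y) (0≤𝟙 (f y))) (0≤𝟙 (g y)))) (proj₂ (fac x (f x ∨ g x)))) ▸
      ≡≤ (ℚₚ.+-assoc (a₁ * S xs f * (b₁ * S xs g)) r R)
      where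
      w = 1ℚ - p x * 𝟙 (f x ∨ g x)
      a₁ = 1ℚ - p x * 𝟙 (f x)
      b₁ = 1ℚ - p x * 𝟙 (g x)
      R = Σ xs (λ x → p x * 𝟙 (f x) * 𝟙 (g x))
      r = p x * 𝟙 (f x) * 𝟙 (g x)
      0≤r : 0ℚ ≤ r
      0≤r = 0≤* (0≤* (0≤p x) (0≤𝟙 (f x))) (0≤𝟙 (g x))
      lem : ∀ a b c d → a * b * (c * d) ≡ a * c * (b * d)
      lem = solve-∀ ℚring

    avoid-low* : ∀ {O : Set} (K : O → A → Bool) xs (os : List O) → Π os (λ o → S xs (K o)) ≤ S xs (λ x → any (λ o → K o x) os)
    avoid-low* K xs [] = ≡≤ (sym (trans (Π-cong xs (λ x → lem (p x))) (trans (Π-const xs 1ℚ) (1^ (length xs)))))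
      where
      lem : ∀ q → 1ℚ - q * 0ℚ ≡ 1ℚ
      lem = solve-∀ ℚring
    avoid-low* K xs (o ∷ os) = *-monoˡ (0≤S xs (K o)) (avoid-low* K xs os) ▸ avoid-low xs (K o) (λ x → any (λ o → K o x) os)

    0≤over : ∀ {O : Set} (K : O → A → Bool) xs o o′ → 0ℚ ≤ over p K xs o o′
    0≤over K xs o o′ = 0≤Σ xs (λ y → 0≤* (0≤* (0≤p y) (0≤𝟙 (K o y))) (0≤𝟙 (K o′ y)))

    0≤overs : ∀ {O : Set} (K : O → A → Bool) xs os → 0ℚ ≤ overs p K xs os
    0≤overs K xs [] = ≤-refl
    0≤overs K xs (o ∷ os) = 0≤+ (0≤Σ os (0≤over K xs o)) (0≤overs K xs os)

    overs-mono : ∀ {O : Set} (K : O → A → Bool) xs {os os′} → os ⊆ os′ → overs p K xs os ≤ overs p K xs os′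
    overs-mono K xs [] = ≤-refl
    overs-mono K xs {os} {.o ∷ ys} (o ∷ʳ r) = overs-mono K xs r ▸ ≤+ˡ (0≤Σ ys (0≤over K xs o))
    overs-mono {O} K xs {o ∷ os} {.o ∷ os′} (refl ∷ r) = +-mono-≤ (sub r) (overs-mono K xs r)
      where
      sub : ∀ {os os′ : List O} → os ⊆ os′ → Σ os (over p K xs o) ≤ Σ os′ (over p K xs o)
      sub [] = ≤-refl
      sub (o′ ∷ʳ r) = sub r ▸ ≤+ˡ (0≤over K xs o o′)
      sub {o′ ∷ _} (refl ∷ r) = +-mono-≤ (≤-refl {over p K xs o o′}) (sub r)

    avoid-up* : ∀ {O : Set} (K : O → A → Bool) xs (os : List O) → S xs (λ x → any (λ o → K o x) os) ≤ Π os (λ o → S xs (K o)) + overs p K xs os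
    avoid-up* K xs [] = S≤1 xs (λ _ → false) ▸ ≡≤ (sym (ℚₚ.+-identityʳ 1ℚ))
    avoid-up* {O} K xs (o ∷ os) =
      avoid-up xs (K o) U ▸
      +-mono-≤ (*-monoˡ (0≤S xs (K o)) (avoid-up* K xs os) ▸ ≡≤ (ℚₚ.*-distribˡ-+ (S xs (K o)) (Π os (λ o → S xs (K o))) (overs p K xs os)) ▸
                +-mono-≤ (≤-refl {S xs (K o) * Π os (λ o → S xs (K o))}) (1*≤ (0≤overs K xs os) (S≤1 xs (K o))))
               (Σ-mono xs (λ x → *-monoˡ (0≤* (0≤p x) (0≤𝟙 (K o x))) (any≤ os x) ▸ ≡≤ (sym (Σ-* (p x * 𝟙 (K o x)) os (λ o′ → 𝟙 (K o′ x))))) ▸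
                ≡≤ (Σ-swap xs os (λ x o′ → p x * 𝟙 (K o x) * 𝟙 (K o′ x)))) ▸
      ≡≤ (lem (S xs (K o) * Π os (λ o → S xs (K o))) (overs p K xs os) (Σ os (over p K xs o)))
      where
      U = λ x → any (λ o → K o x) os
      lem : ∀ a b c → a + b + c ≡ a + (c + b)
      lem = solve-∀ ℚring
      any≤ : ∀ (os : List O) x → 𝟙 (any (λ o → K o x) os) ≤ Σ os (λ o → 𝟙 (K o x))
      any≤ [] x = ≤-refl
      any≤ (o ∷ os) x with K o x
      ... | true = ≤+ (0≤Σ os (λ o → 0≤𝟙 (K o x))) refl
      ... | false = any≤ os x ▸ ≡≤ (sym (ℚₚ.+-identityˡ _))

  𝟙any≤ : ∀ {O : Set} (f : O → Bool) (os : List O) → 𝟙 (any f os) ≤ Σ os (λ o → 𝟙 (f o))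
  𝟙any≤ f [] = ≤-refl
  𝟙any≤ f (o ∷ os) with f o
  ... | true = ≤+ (0≤Σ os (λ o → 0≤𝟙 (f o))) refl
  ... | false = 𝟙any≤ f os ▸ ≡≤ (sym (ℚₚ.+-identityˡ _))

  module Steps (S : Setup) where
    open Bounds S public

    noHit-∨ : ∀ f g R → 𝟙 (noHit (λ e → f e ∨ g e) R) ≡ 𝟙 (noHit f R) * 𝟙 (noHit g R)
    noHit-∨ f g [] = sym (ℚₚ.*-identityˡ 1ℚ)
    noHit-∨ f g (x ∷ R) with f x | g x
    ... | true | b = sym (ℚₚ.*-zeroˡ (𝟙 (not b ∧ noHit g R)))
    ... | false | true = sym (ℚₚ.*-zeroʳ (𝟙 (noHit f R)))
    ... | false | false = noHit-∨ f g R

    noHit-any : ∀ (k : Obj → A → Bool) O R → Π O (λ o → 𝟙 (noHit (k o) R)) ≡ 𝟙 (noHit (λ e → any (λ o → k o e) O) R)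
    noHit-any k [] R = sym (cong 𝟙 (none R))
      where
      none : ∀ R → noHit (λ _ → false) R ≡ true
      none [] = refl
      none (x ∷ R) = none R
    noHit-any k (o ∷ O) R = trans (cong (𝟙 (noHit (k o) R) *_) (noHit-any k O R)) (sym (noHit-∨ (k o) (λ e → any (λ o → k o e) O) R))

    -- The largest value an object's weight can take after one more phase: `β` bounds the weight,
    -- the other factor the reciprocal survival probability.
    κ : ℚ
    κ = β * (2q * 2q ^ M)

    1≤κ : 1ℚ ≤ κ
    1≤κ = *-mono 0≤1 1≤β 0≤1 (*-mono 0≤1 (≤+ {1ℚ} {2q} 0≤1 refl) 0≤1 (1≤^ M (≤+ {1ℚ} {2q} 0≤1 refl)))

    0≤κ : 0ℚ ≤ κ
    0≤κ = 0≤1 ▸ 1≤κ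

    module Step (H : Hist) (H≤ : length H ℕ.≤ I) where
      open At H H≤ public

      q≤1 : ∀ e → q H e ≤ 1ℚ
      q≤1 e = proj₂ (prob e)

      anyK : List Obj → A → Bool
      anyK O e = any (λ o → K H o e) O

      ov : List Obj → ℚ
      ov O = overs (q H) (K H) E O

      0≤ov : ∀ O → 0ℚ ≤ ov O
      0≤ov O = 0≤overs (q H) 0≤q q≤1 (K H) E O

      invs : List Obj → ℚ
      invs O = Π O (λ o → inv (surv H o))

      0≤invs : ∀ O → 0ℚ ≤ invs O
      0≤invs O = 0≤Π O (λ o → 0≤inv (<⇒≤ (0<surv o)))

      survs-invs : ∀ O → invs O * Π O (surv H) ≡ 1ℚ
      survs-invs O = trans (sym (Π-* O _ _)) (trans (Π-cong O (λ o → trans (ℚₚ.*-comm _ (surv H o)) (inv-r (0<surv o)))) (trans (Π-const O 1ℚ) (1^ (length O))))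

      Πnext : ∀ O R → Π O (φ (R ∷ H)) ≡ Π O (φ H) * invs O * 𝟙 (noHit (anyK O) R)
      Πnext O R = trans (Π-* O (λ o → φ H o * 𝟙 (noHit (K H o) R)) (λ o → inv (surv H o)))
        (trans (cong (_* invs O) (trans (Π-* O (φ H) (λ o → 𝟙 (noHit (K H o) R))) (cong (Π O (φ H) *_) (noHit-any (K H) O R))))
          (lem (Π O (φ H)) (𝟙 (noHit (anyK O) R)) (invs O)))
        where
        lem : ∀ a b c → a * b * c ≡ a * c * b
        lem = solve-∀ ℚring

      0≤Πφ : ∀ O → 0ℚ ≤ Π O (φ H)
      0≤Πφ O = 0≤Π O 0≤φ

      -- Dividing by the separate survival probabilities overcompensates for joint survival, so
      -- products of weights are submartingales.
      step-LB : ∀ O → Π O (φ H) ≤ ber (q H) E (λ R → Π O (φ (R ∷ H)))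
      step-LB O =
        ≡≤ (sym (trans (ℚₚ.*-assoc (Π O (φ H)) (invs O) (Π O (surv H))) (trans (cong (Π O (φ H) *_) (survs-invs O)) (ℚₚ.*-identityʳ _)))) ▸
        *-monoˡ (0≤* (0≤Πφ O) (0≤invs O)) (avoid-low* (q H) 0≤q q≤1 (K H) E O) ▸
        ≡≤ (sym (trans (ber-cong (q H) E (Πnext O)) (trans (ber-* (q H) E (Π O (φ H) * invs O) _) (cong (Π O (φ H) * invs O *_) (ber-noHit (q H) E (anyK O))))))

      -- Picking `J` can only hurt survival by `ber-UB`, and joint survival exceeds the product of
      -- the separate probabilities by at most `ov O`.
      step-UB : ∀ O J → Unique J → All (_∈ E) J →
        ber (q H) E (λ R → Π O (φ (R ∷ H)) * Π J (λ e → 𝟙 (mem e R))) ≤ Π O (φ H) * Π J (q H) + κ ^ length O * ov O * Π J (q H)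
      step-UB O J uJ J⊆ =
        ≡≤ (trans (ber-cong (q H) E pt) (ber-* (q H) E (Π O (φ H) * invs O) _)) ▸
        *-monoˡ (0≤* (0≤Πφ O) (0≤invs O)) (ber-UB prob (anyK O) uE J uJ J⊆ ▸ *-monoˡ (0≤Π J 0≤q) (avoid-up* (q H) 0≤q q≤1 (K H) E O)) ▸
        ≡≤ (lem (Π O (φ H)) (invs O) (Π J (q H)) (Π O (surv H)) (ov O)) ▸
        +-mono-≤ (≡≤ (trans (cong (_* (Π O (φ H) * Π J (q H))) (survs-invs O)) (ℚₚ.*-identityˡ (Π O (φ H) * Π J (q H)))))
          (*-monoʳ (0≤Π J 0≤q) (*-monoʳ (0≤ov O) (≡≤ (sym (Π-* O (φ H) _)) ▸
              Π-mono O (λ o → 0≤* (0≤φ o) (0≤inv (<⇒≤ (0<surv o)))) (λ o → *-mono (0≤φ o) (φ≤β o) (0≤inv (<⇒≤ (0<surv o))) (inv≤ o)) ▸ ≡≤ (Π-const O κ))))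
        where
        lem : ∀ p i j s v → p * i * (j * (s + v)) ≡ i * s * (p * j) + p * i * v * j
        lem = solve-∀ ℚring
        lem′ : ∀ a i h j → a * i * h * j ≡ a * i * (j * h)
        lem′ = solve-∀ ℚring
        pt : ∀ R → Π O (φ (R ∷ H)) * Π J (λ e → 𝟙 (mem e R)) ≡ Π O (φ H) * invs O * (Π J (λ e → 𝟙 (mem e R)) * 𝟙 (noHit (anyK O) R))
        pt R = trans (cong (_* Π J (λ e → 𝟙 (mem e R))) (Πnext O R)) (lem′ (Π O (φ H)) (invs O) (𝟙 (noHit (anyK O) R)) (Π J (λ e → 𝟙 (mem e R))))

    Et-mono : ∀ t → t ℕ.≤ I → ∀ {f g} → (∀ H → length H ≡ t → f H ≤ g H) → Et t f ≤ Et t g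
    Et-mono zero _ p = p [] refl
    Et-mono (suc t) t≤ p = Et-mono t t≤′ (λ H l → ber-mono (At.prob H (subst (ℕ._≤ I) (sym l) t≤′)) E (λ R → p (R ∷ H) (cong suc l)))
      where t≤′ = ℕₚ.≤-trans (ℕₚ.n≤1+n t) t≤

    Et-cong : ∀ t {f g} → (∀ H → f H ≡ g H) → Et t f ≡ Et t g
    Et-cong zero p = p []
    Et-cong (suc t) {f} {g} p = Et-cong t (λ H → ber-cong (q H) E (λ R → p (R ∷ H)))

    Et-const : ∀ t k → Et t (λ _ → k) ≡ k
    Et-const zero k = refl
    Et-const (suc t) k = trans (Et-cong t (λ H → ber-const (q H) E k)) (Et-const t k)

    Et-+ : ∀ t f g → Et t (λ H → f H + g H) ≡ Et t f + Et t g
    Et-+ zero f g = refl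
    Et-+ (suc t) f g = trans (Et-cong t (λ H → ber-+ (q H) E _ _)) (Et-+ t _ _)

    Et-* : ∀ t k f → Et t (λ H → k * f H) ≡ k * Et t f
    Et-* zero k f = refl
    Et-* (suc t) k f = trans (Et-cong t (λ H → ber-* (q H) E k _)) (Et-* t k _)

    Et-Σ : ∀ t {X : Set} (xs : List X) (f : X → Hist → ℚ) → Et t (λ H → Σ xs (λ x → f x H)) ≡ Σ xs (λ x → Et t (f x))
    Et-Σ t [] f = Et-const t 0ℚ
    Et-Σ t (x ∷ xs) f = trans (Et-+ t (f x) _) (cong (Et t (f x) +_) (Et-Σ t xs f))

    -- It holds for lists with repetitions too. This is used in `EwY`, where an edge is also
    -- combined with itself.
    Et-LB : ∀ t → t ℕ.≤ I → ∀ O → 1ℚ ≤ Et t (λ H → Π O (φ H))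
    Et-LB zero _ O = ≡≤ (sym (trans (Π-const O 1ℚ) (1^ (length O))))
    Et-LB (suc t) t≤ O = Et-LB t t≤′ O ▸ Et-mono t t≤′ (λ H l → Step.step-LB H (subst (ℕ._≤ I) (sym l) t≤′) O)
      where t≤′ = ℕₚ.≤-trans (ℕₚ.n≤1+n t) t≤

    𝟙∨ : ∀ a b → 𝟙 (a ∨ b) ≤ 𝟙 b + 𝟙 a
    𝟙∨ true b = ≤+ˡ (0≤𝟙 b)
    𝟙∨ false b = ≡≤ (sym (ℚₚ.+-identityʳ (𝟙 b)))

    -- The slack `y` carries the induction: peeling off the last phase replaces its picks by the
    -- rate bound `c * Di`, which is added to `y`.
    crude : ∀ t → t ℕ.≤ I → ∀ S → Unique S → All (_∈ E) S → ∀ y → 0ℚ ≤ y →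
      Et t (λ H → Π S (λ e → 𝟙 (pk H e) + y)) ≤ (nat t * (c * Di) + y) ^ length S
    crude zero _ S _ _ y _ = ≡≤ (trans (Π-const S (0ℚ + y)) (cong (_^ length S) (lem (c * Di) y)))
      where
      lem : ∀ c y → 0ℚ + y ≡ 0ℚ * c + y
      lem = solve-∀ ℚring
    crude (suc t) t≤ S uS S⊆ y 0≤y =
      Et-mono t t≤′ (λ H l → let module X = At H (subst (ℕ._≤ I) (sym l) t≤′) in
        ber-mono X.prob E (λ R → Π-mono S (λ e → 0≤+ (0≤𝟙 (mem e R ∨ pk H e)) 0≤y) (λ e → +-mono-≤ (𝟙∨ (mem e R) (pk H e)) (≤-refl {y}) ▸ ≡≤ (l1 (𝟙 (pk H e)) (𝟙 (mem e R)) y))) ▸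
        ber-crude X.prob uE S uS S⊆ (λ e → 𝟙 (pk H e) + y) (λ e → 0≤+ (0≤𝟙 (pk H e)) 0≤y) ▸
        Π-mono S (λ e → 0≤+ (0≤+ (0≤𝟙 (pk H e)) 0≤y) (X.0≤q e)) (λ e → +-mono-≤ (≤-refl {𝟙 (pk H e) + y}) (X.q≤c e) ▸ ≡≤ (ℚₚ.+-assoc (𝟙 (pk H e)) y (c * Di)))) ▸
      crude t t≤′ S uS S⊆ (y + c * Di) (0≤+ 0≤y 0≤cDi) ▸
      ≡≤ (cong (_^ length S) (l2 (nat t) (c * Di) y))
      where
      t≤′ = ℕₚ.≤-trans (ℕₚ.n≤1+n t) t≤
      l1 : ∀ a b y → a + b + y ≡ a + y + b
      l1 = solve-∀ ℚring
      l2 : ∀ n c y → n * c + (y + c) ≡ (1ℚ + n) * c + y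
      l2 = solve-∀ ℚring

    objs* : List A → List Obj
    objs* [] = []
    objs* (e ∷ J) = objs e ++ objs* J

    T : ℚ
    T = nat I * θ

    0≤T : 0ℚ ≤ T
    0≤T = 0≤* (0≤nat I) 0≤θ

    c₂ : ℚ
    c₂ = c + T

    0≤c₂ : 0ℚ ≤ c₂
    0≤c₂ = 0≤+ 0≤c 0≤T

    -- Either `e` has been picked, or a further total rate `z` is still to be spent on its weight.
    -- In expectation one phase turns `fac z` into at most `fac (z + θ)`, up to overlaps; at `z` = 0
    -- it is the plain indicator of a pick.
    fac : ℚ → Hist → A → ℚ
    fac z H e = 𝟙 (pk H e) + z * Di * w H e

    -- The majorant used inside error terms, where weights are not tracked: `c * Di` bounds the rate
    -- of the present phase and `T * Di` the remaining allowance.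
    efac : Hist → A → ℚ
    efac H e = 𝟙 (pk H e) + c₂ * Di

    module Expand (H : Hist) (H≤ : suc (length H) ℕ.≤ I) (z : ℚ) (0≤z : 0ℚ ≤ z) (z≤T : z ≤ T) where
      H≤′ = ℕₚ.≤-trans (ℕₚ.n≤1+n _) H≤
      open Step H H≤′

      0≤zDi : 0ℚ ≤ z * Di
      0≤zDi = 0≤* 0≤z 0≤Di

      err : List Obj → List A → List A → ℚ
      err O J₁ J = κ ^ length (O ++ objs* J) * ov (O ++ objs* J) * Π J₁ (q H) * Π J (efac H)

      0≤efac : ∀ e → 0ℚ ≤ efac H e
      0≤efac e = 0≤+ (0≤𝟙 (pk H e)) (0≤* 0≤c₂ 0≤Di)

      κov-mono : ∀ {O O′} → O ⊆ O′ → κ ^ length O * ov O ≤ κ ^ length O′ * ov O′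
      κov-mono {O} {O′} p = *-mono (0≤^ (length O) 0≤κ) (^-monoʳ 1≤κ (sub-len p)) (0≤ov O) (overs-mono (q H) 0≤q q≤1 (K H) E p)
        where
        sub-len : ∀ {O O′ : List Obj} → O ⊆ O′ → length O ℕ.≤ length O′
        sub-len [] = z≤n
        sub-len (_ ∷ʳ p) = ℕₚ.m≤n⇒m≤1+n (sub-len p)
        sub-len (_ ∷ p) = s≤s (sub-len p)

      next : List Obj → List A → List A → List A → ℚ
      next O J₁ J R = Π O (φ (R ∷ H)) * Π J₁ (λ e → 𝟙 (mem e R)) * Π J (fac z (R ∷ H))

      main : List Obj → List A → List A → ℚ
      main O J₁ J = Π O (φ H) * Π J₁ (q H) * Π J (fac (z + θ) H)

      -- Each edge of `J` is in one of three states after the phase: picked earlier, picked now,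
      -- whence it moves to `J₁`, or represented by its weight, whence its objects move to `O`. The
      -- three main terms add up to `fac (z + θ)` and the three error terms to `efac`.
      expand : ∀ J O J₁ → Unique J → Unique J₁ → All (_∈ E) J → All (_∈ E) J₁ → (∀ {e} → e ∈ J → e ∉ J₁) →
        ber (q H) E (next O J₁ J) ≤ main O J₁ J + err O J₁ J
      expand [] O J₁ _ u₁ _ J₁⊆ _ =
        ≡≤ (ber-cong (q H) E (λ R → ℚₚ.*-identityʳ _)) ▸ step-UB O J₁ u₁ J₁⊆ ▸
        ≡≤ (trans (lem (Π O (φ H) * Π J₁ (q H)) (κ ^ length O * ov O) (Π J₁ (q H))) (cong (λ X → Π O (φ H) * Π J₁ (q H) * 1ℚ + κ ^ length X * ov X * Π J₁ (q H) * 1ℚ) (sym (++-identityʳ O))))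
        where
        lem : ∀ a b j → a + b * j ≡ a * 1ℚ + b * j * 1ℚ
        lem = solve-∀ ℚring
      expand (e ∷ J) O J₁ (al ∷ u) u₁ (e∈ ∷ J⊆) J₁⊆ dj =
        ber-mono prob E split ▸
        ≡≤ (trans (ber-+ (q H) E _ _) (cong₂ _+_ (trans (ber-+ (q H) E _ _) (cong (_+ ber (q H) E (next O (e ∷ J₁) J)) (ber-* (q H) E a (next O J₁ J)))) (ber-* (q H) E (z * Di) (next (O ++ objs e) J₁ J)))) ▸
        +-mono-≤ (+-mono-≤ (*-monoˡ (0≤𝟙 (pk H e)) (expand J O J₁ u u₁ J⊆ J₁⊆ (λ m → dj (there m)) ▸ +-mono-≤ (≤-refl {main O J₁ J}) E1))
                           (expand J O (e ∷ J₁) u (All.tabulate (λ m r → dj (here refl) (subst (_∈ J₁) (sym r) m)) ∷ u₁) J⊆ (e∈ ∷ J₁⊆) dj′ ▸ +-mono-≤ (≤-refl {main O (e ∷ J₁) J}) E2))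
                 (*-monoˡ 0≤zDi (expand J (O ++ objs e) J₁ u u₁ J⊆ J₁⊆ (λ m → dj (there m)) ▸ +-mono-≤ (≡≤ mainO) E3)) ▸
        ≡≤ (lem a (q H e) (z * Di) (w H e) (Π O (φ H)) (Π J₁ (q H)) F X (Π J (efac H))) ▸
        +-mono-≤ (*-monoˡ (0≤* (0≤Πφ O) (0≤Π J₁ 0≤q)) (*-monoʳ 0≤F (+-mono-≤ (+-mono-≤ (≤-refl {a}) (q≤w e)) (≤-refl {z * Di * w H e}) ▸ ≡≤ (lem2 a θ Di (w H e) z))))
                 (*-monoˡ (0≤* 0≤κov (0≤Π J₁ 0≤q)) (*-monoʳ (0≤Π J 0≤efac) (+-mono-≤ (+-mono-≤ (≤-refl {a}) (q≤c e)) (*-monoʳ 0≤Di z≤T) ▸ ≡≤ (lem3 a c Di T))))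
        where
        a = 𝟙 (pk H e)
        F = Π J (fac (z + θ) H)
        OF = O ++ (objs e ++ objs* J)
        X = κ ^ length OF * ov OF
        0≤F : 0ℚ ≤ F
        0≤F = 0≤Π J (λ e → 0≤+ (0≤𝟙 (pk H e)) (0≤* (0≤* (0≤+ 0≤z 0≤θ) 0≤Di) (0≤w e)))
        0≤κov : 0ℚ ≤ X
        0≤κov = 0≤* (0≤^ (length OF) 0≤κ) (0≤ov OF)
        lem : ∀ a q y w o j F X f → a * (o * j * F + X * j * f) + (o * (q * j) * F + X * (q * j) * f) + y * (o * w * j * F + X * j * f)
                ≡ o * j * ((a + q + y * w) * F) + X * j * ((a + q + y) * f)
        lem = solve-∀ ℚring
        lem2 : ∀ a t d w z → a + t * d * w + z * d * w ≡ a + (z + t) * d * w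
        lem2 = solve-∀ ℚring
        lem3 : ∀ a c d t → a + c * d + t * d ≡ a + (c + t) * d
        lem3 = solve-∀ ℚring
        mainO : main (O ++ objs e) J₁ J ≡ Π O (φ H) * w H e * Π J₁ (q H) * F
        mainO = cong (λ x → x * Π J₁ (q H) * F) (Π-++ O (objs e) (φ H))
        sub : O ++ objs* J ⊆ OF
        sub = ++⁺ (⊆-refl {x = O}) (++⁺ˡ (objs e) ⊆-refl)
        E1 : err O J₁ J ≤ X * Π J₁ (q H) * Π J (efac H)
        E1 = *-monoʳ (0≤Π J 0≤efac) (*-monoʳ (0≤Π J₁ 0≤q) (κov-mono sub))
        E2 : err O (e ∷ J₁) J ≤ X * (q H e * Π J₁ (q H)) * Π J (efac H)
        E2 = *-monoʳ (0≤Π J 0≤efac) (*-monoʳ (0≤Π (e ∷ J₁) 0≤q) (κov-mono sub))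
        E3 : err (O ++ objs e) J₁ J ≤ X * Π J₁ (q H) * Π J (efac H)
        E3 = ≡≤ (cong (λ Z → κ ^ length Z * ov Z * Π J₁ (q H) * Π J (efac H)) (++-assoc O (objs e) (objs* J)))
        dj′ : ∀ {e′} → e′ ∈ J → e′ ∉ (e ∷ J₁)
        dj′ m (here r) = All.lookup al m (sym r)
        dj′ m (there m′) = dj (there m) m′
        split : ∀ R → next O J₁ (e ∷ J) R ≤ a * next O J₁ J R + next O (e ∷ J₁) J R + z * Di * next (O ++ objs e) J₁ J R
        split R = *-monoˡ (0≤* (0≤Π O 0≤φ′) (0≤Π J₁ (λ e → 0≤𝟙 (mem e R)))) (*-monoʳ 0≤P (+-mono-≤ (𝟙∨ (mem e R) (pk H e)) (≤-refl {z * Di * w (R ∷ H) e}))) ▸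
          ≡≤ (trans (l a (𝟙 (mem e R)) (z * Di) (w (R ∷ H) e) (Π O (φ (R ∷ H))) (Π J₁ (λ e → 𝟙 (mem e R))) (Π J (fac z (R ∷ H))))
               (cong (λ y → a * next O J₁ J R + next O (e ∷ J₁) J R + z * Di * (y * Π J₁ (λ e → 𝟙 (mem e R)) * Π J (fac z (R ∷ H)))) (sym (Π-++ O (objs e) (φ (R ∷ H))))))
          where
          open At (R ∷ H) H≤ using () renaming (0≤φ to 0≤φ′; 0≤w to 0≤w′)
          0≤P : 0ℚ ≤ Π J (fac z (R ∷ H))
          0≤P = 0≤Π J (λ e → 0≤+ (0≤𝟙 (pk (R ∷ H) e)) (0≤* 0≤zDi (0≤w′ e)))
          l : ∀ a m y w o j f → o * j * ((a + m + y * w) * f) ≡ a * (o * j * f) + o * (m * j) * f + y * (o * w * j * f)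
          l = solve-∀ ℚring

    -- Up to the overlap error, inverse-probability weights are uncorrelated with one another and with the picks.
    Et-UB : ∀ (ε : ℚ) O J → Unique J → All (_∈ E) J →
      (∀ t (t<I : suc t ℕ.≤ I) → Et t (λ H → overs (q H) (K H) E (O ++ objs* J) * Π J (efac H)) ≤ Di ^ length J * ε) →
      ∀ t → t ℕ.≤ I → ∀ z → 0ℚ ≤ z → z + nat t * θ ≤ T →
      Et t (λ H → Π O (φ H) * Π J (fac z H)) ≤ Di ^ length J * ((z + nat t * θ) ^ length J + nat t * (κ ^ length (O ++ objs* J) * ε))
    Et-UB ε O J uJ J⊆ hyp zero _ z _ _ =
      ≡≤ (cong₂ _*_ (trans (Π-const O 1ℚ) (1^ (length O))) (trans (Π-cong J (λ e → cong (λ x → 0ℚ + z * Di * x) (trans (Π-const (objs e) 1ℚ) (1^ (length (objs e)))))) (trans (Π-const J _) (trans (cong (_^ length J) (l z Di)) (*-^ Di z (length J)))))) ▸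
      ≡≤ (trans (l2 (Di ^ length J) (z ^ length J) (κ ^ length (O ++ objs* J) * ε)) (cong (λ x → Di ^ length J * (x ^ length J + 0ℚ * (κ ^ length (O ++ objs* J) * ε))) (sym (l3 z θ))))
      where
      l : ∀ z d → 0ℚ + z * d * 1ℚ ≡ d * z
      l = solve-∀ ℚring
      l2 : ∀ d z e → 1ℚ * (d * z) ≡ d * (z + 0ℚ * e)
      l2 = solve-∀ ℚring
      l3 : ∀ z t → z + 0ℚ * t ≡ z
      l3 = solve-∀ ℚring
    Et-UB ε O J uJ J⊆ hyp (suc t) t≤ z 0≤z z≤ =
      Et-mono t t≤′ (λ H l → let module X = Expand H (subst (λ k → suc k ℕ.≤ I) (sym l) t≤) z 0≤z z≤T in
        ≡≤ (ber-cong (q H) E (λ R → cong (_* Π J (fac z (R ∷ H))) (sym (ℚₚ.*-identityʳ (Π O (φ (R ∷ H))))))) ▸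
        X.expand J O [] uJ [] J⊆ [] (λ _ ()) ▸
        ≡≤ (l1 (Π O (φ H)) (Π J (fac (z + θ) H)) (κ ^ length OJ) (overs (q H) (K H) E OJ) (Π J (efac H)))) ▸
      ≡≤ (trans (Et-+ t _ _) (cong (Et t (λ H → Π O (φ H) * Π J (fac (z + θ) H)) +_) (Et-* t (κ ^ length OJ) _))) ▸
      +-mono-≤ (Et-UB ε O J uJ J⊆ hyp t t≤′ (z + θ) (0≤+ 0≤z 0≤θ) (≡≤ (l2 z (nat t) θ) ▸ z≤)) (*-monoˡ (0≤^ (length OJ) 0≤κ) (hyp t t≤)) ▸
      ≡≤ (trans (l3 (Di ^ length J) ((z + θ + nat t * θ) ^ length J) (nat t) (κ ^ length OJ) ε) (cong (λ x → Di ^ length J * (x ^ length J + nat (suc t) * (κ ^ length OJ * ε))) (l2 z (nat t) θ)))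
      where
      OJ = O ++ objs* J
      t≤′ = ℕₚ.≤-trans (ℕₚ.n≤1+n t) t≤
      z≤T : z ≤ T
      z≤T = ≤+ʳ (0≤* (0≤nat (suc t)) 0≤θ) ▸ z≤
      l1 : ∀ o f k v e → o * 1ℚ * f + k * v * 1ℚ * e ≡ o * f + k * (v * e)
      l1 = solve-∀ ℚring
      l2 : ∀ z n t → z + t + n * t ≡ z + (1ℚ + n) * t
      l2 = solve-∀ ℚring
      l3 : ∀ d x n k e → d * (x + n * (k * e)) + k * (d * e) ≡ d * (x + (1ℚ + n) * (k * e))
      l3 = solve-∀ ℚring

-- First and second moments: almost all the weight stays eligible.

module PhaseYield where
  open Rationals
  open IndependentChoice
  open NibbleProcess
  open Invariants
  open Correlations
  open import Data.Rational using (ℚ; 0ℚ; 1ℚ; _+_; _*_; -_; _-_; _≤_; _<_)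
  open import Data.Rational.Properties using (≤-refl; ≤-trans; ≤-reflexive; +-mono-≤; <⇒≤)
  open import Data.Nat using (zero; suc)
  open import Data.List using ([]; _∷_)
  open import Data.Bool.ListAction using (all)
  open import Data.List.Relation.Unary.All using ([]; _∷_)
  open import Data.List.Relation.Unary.AllPairs using ([]; _∷_)
  open import Tactic.RingSolver using (solve-∀)

  -- `hW` and `hY2` feed a Chebyshev bound for the degrees, with loss `loss-Y`; `hμ` and `hov` feed
  -- a Markov bound for the danger, with loss `loss-F`. The last field is the balance: the target
  -- `x` plus the collisions within phases fits into the eligible part of the total rate `T`.
  record NearRegular (S : Setup) : Set₁ where
    open Steps S
    field
      allP : List P
      pairs⊆allP : ∀ {e p} → p ∈ pairs e → p ∈ allP
      tup⊆E : ∀ {J} → J ∈ tup → All (_∈ E) J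
      confU : ∀ {e e″ J} → conf e e″ J ≡ true → Unique (e ∷ e″ ∷ J)
      Kc : ℚ
      conf-deg : ∀ {e} → e ∈ E → Σ E (λ e″ → Σ tup (λ J → 𝟙 (conf e e″ J) * (Di * Di ^ length J))) ≤ Kc
      regular : ∀ {e p} → e ∈ E → p ∈ pairs e → Di * Σ E (λ e₁ → 𝟙 (inP p e₁)) ≡ 1ℚ
      allP-size : nat (length allP) ≤ nat s * (nat (length E) * Di)
      δ ε₀ ε₁ ε₂ μ ρ Rk x : ℚ
      0<δ : 0ℚ < δ
      Y1≡ : Y1 ≡ 1ℚ + δ
      0≤ε₀ : 0ℚ ≤ ε₀
      0≤ρ : 0ℚ ≤ ρ
      hov : ∀ t → t ℕ.≤ I → ∀ {e} → e ∈ E → Et t (λ H → overs (q H) (K H) E (objs e)) ≤ ε₀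
      hW : ∀ t → t ℕ.≤ I → ∀ {e} → e ∈ E → Et t (λ H → w H e) ≤ 1ℚ + ε₁
      hY2 : ∀ t → t ℕ.≤ I → ∀ {e p} → e ∈ E → p ∈ pairs e → Et t (λ H → w H e * (Y H p * Y H p)) ≤ 1ℚ + ε₁
      hμ : ∀ t → t ℕ.≤ I → ∀ {e} → e ∈ E → Et t (λ H → w H e * gh H e) ≤ θ * μ
      0≤μ : 0ℚ ≤ μ
      ε₂≥ : nat I * (κ ^ suc s * ε₀ * (nat I * (2q * L))) ≤ ε₂
      loss-Y : ε₁ + ε₁ ≤ ρ * (δ * δ)
      loss-F : (T + θ) * μ + ε₂ ≤ ρ * L
      0≤Rk : 0ℚ ≤ Rk
      Rk≥ : ∀ {J} → J ∈ tup → (nat I * c) ^ length J ≤ Rk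
      x≤ : x + nat I * (nat s * (θ * (B * Y1) * (θ * (B * Y1)))) + nat I * (c * c * (Rk * Kc)) ≤ T * (1ℚ - (nat s * ρ + ρ))

  module Expect (S : Setup) (hyp : NearRegular S) where
    open Steps S public
    open NearRegular hyp public

    wY : ∀ H e p → w H e * Y H p ≡ Di * Σ E (λ e₁ → 𝟙 (inP p e₁) * Π (objs e ++ rest p e₁) (φ H))
    wY H e p = trans (l (w H e) Di (Σ E (λ e₁ → 𝟙 (inP p e₁) * Π (rest p e₁) (φ H)))) (cong (Di *_) (trans (sym (Σ-* (w H e) E _)) (Σ-cong E pt)))
      where
      l : ∀ a b c → a * (b * c) ≡ b * (a * c)
      l = solve-∀ ℚring
      pt : ∀ e₁ → w H e * (𝟙 (inP p e₁) * Π (rest p e₁) (φ H)) ≡ 𝟙 (inP p e₁) * Π (objs e ++ rest p e₁) (φ H)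
      pt e₁ = trans (l (w H e) (𝟙 (inP p e₁)) (Π (rest p e₁) (φ H))) (cong (𝟙 (inP p e₁) *_) (sym (Π-++ (objs e) (rest p e₁) (φ H))))

    EwY : ∀ t → t ℕ.≤ I → ∀ {e p} → e ∈ E → p ∈ pairs e → 1ℚ ≤ Et t (λ H → w H e * Y H p)
    EwY t t≤ {e} {p} e∈ p∈ =
      ≡≤ (sym (trans (cong (Di *_) (Σ-cong E (λ e₁ → ℚₚ.*-identityʳ (𝟙 (inP p e₁))))) (regular e∈ p∈))) ▸
      *-monoˡ 0≤Di (Σ-mono E (λ e₁ → *-monoˡ (0≤𝟙 (inP p e₁)) (Et-LB t t≤ (objs e ++ rest p e₁)))) ▸
      ≡≤ (sym (trans (Et-cong t (λ H → wY H e p)) (trans (Et-* t Di _) (cong (Di *_) (trans (Et-Σ t E (λ e₁ H → 𝟙 (inP p e₁) * Π (objs e ++ rest p e₁) (φ H))) (Σ-cong E (λ e₁ → Et-* t (𝟙 (inP p e₁)) _)))))))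

    -- The variance of `Y H p` about 1 under the measure tilted by `w`. Upper bounds enter for the
    -- two squares and the lower bound `EwY` for the cross term, so the errors add up to twice `ε₁`.
    EwY² : ∀ t → t ℕ.≤ I → ∀ {e p} → e ∈ E → p ∈ pairs e → Et t (λ H → w H e * ((Y H p - 1ℚ) * (Y H p - 1ℚ))) ≤ ε₁ + ε₁
    EwY² t t≤ {e} {p} e∈ p∈ =
      ≡≤ (trans (Et-cong t (λ H → l (w H e) (Y H p))) (trans (Et-+ t _ _) (cong₂ _+_ (Et-+ t _ _) (trans (Et-* t (- 2q) _) refl)))) ▸
      +-mono-≤ (+-mono-≤ (hY2 t t≤ e∈ p∈) (hW t t≤ e∈)) (≡≤ (l3 2q (Et t (λ H → w H e * Y H p))) ▸ ℚₚ.neg-antimono-≤ (*-monoˡ 0≤2q (EwY t t≤ e∈ p∈)) ▸ ≤-refl) ▸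
      ≡≤ (l2 ε₁)
      where
      l : ∀ w y → w * ((y - 1ℚ) * (y - 1ℚ)) ≡ w * (y * y) + w + - (1ℚ + 1ℚ) * (w * y)
      l = solve-∀ ℚring
      l2 : ∀ e → 1ℚ + e + (1ℚ + e) + - ((1ℚ + 1ℚ) * 1ℚ) ≡ e + e
      l2 = solve-∀ ℚring
      l3 : ∀ a b → - a * b ≡ - (a * b)
      l3 = solve-∀ ℚring

    private
      I≤ : ∀ {t} → suc t ℕ.≤ I → t ℕ.≤ I
      I≤ = ℕₚ.≤-trans (ℕₚ.n≤1+n _)

    -- Chebyshev's inequality under the tilted measure: a pair is rejected only when its degree
    -- exceeds 1 by more than `δ`.
    bad-Y : ∀ t → t ℕ.≤ I → ∀ {e p} → e ∈ E → p ∈ pairs e → Et t (λ H → w H e * 𝟙 (not (okY H p))) ≤ ρ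
    bad-Y t t≤ {e} {p} e∈ p∈ = *-cancelʳ (0<* 0<δ 0<δ)
      (≡≤ (trans (ℚₚ.*-comm _ (δ * δ)) (sym (Et-* t (δ * δ) _))) ▸
       Et-mono t t≤ (λ H l → pt H (subst (ℕ._≤ I) (sym l) t≤)) ▸ EwY² t t≤ e∈ p∈ ▸ loss-Y)
      where
      pt : ∀ H → length H ℕ.≤ I → δ * δ * (w H e * 𝟙 (not (okY H p))) ≤ w H e * ((Y H p - 1ℚ) * (Y H p - 1ℚ))
      pt H H≤ with bool? (okY H p)
      ... | inj₁ eq = ≡≤ (trans (cong (λ z → δ * δ * (w H e * 𝟙 (not z))) eq) (l δ (w H e))) ▸ 0≤* (At.0≤w H H≤ e) (0≤sq (Y H p - 1ℚ))
        where
        l : ∀ d w → d * d * (w * 0ℚ) ≡ 0ℚ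
        l = solve-∀ ℚring
      ... | inj₂ eq = ≡≤ (trans (cong (λ z → δ * δ * (w H e * 𝟙 (not z))) eq) (l δ (w H e))) ▸
          *-monoˡ (At.0≤w H H≤ e) (*-mono (<⇒≤ 0<δ) δ≤ (<⇒≤ 0<δ) δ≤)
        where
        l : ∀ d w → d * d * (w * 1ℚ) ≡ w * (d * d)
        l = solve-∀ ℚring
        l2 : ∀ d → d ≡ 1ℚ + d - 1ℚ
        l2 = solve-∀ ℚring
        δ≤ : δ ≤ Y H p - 1ℚ
        δ≤ = ≡≤ (l2 δ) ▸ +-mono-≤ (≡≤ (sym Y1≡) ▸ <⇒≤ (leᵇ-false eq)) (≤-refl { - 1ℚ})

    G≤ : ∀ H e → length H ℕ.≤ I → G H e ≤ nat (length H) * (2q * L)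
    G≤ [] e _ = ≡≤ (sym (ℚₚ.*-zeroˡ (2q * L)))
    G≤ (R ∷ H) e p = +-mono-≤ (G≤ H e (I≤ p)) (ℚₚ.p⊓q≤q (gh H e) (2q * L)) ▸ ≡≤ (l (nat (length H)) (2q * L))
      where
      l : ∀ n x → n * x + x ≡ (1ℚ + n) * x
      l = solve-∀ ℚring

    |objs|≤ : ∀ e → length (objs e) ℕ.≤ suc s
    |objs|≤ e = s≤s (ℕₚ.≤-trans (ℕₚ.≤-reflexive (length-map inj₁ (pairs e))) (|pairs| e))

    err₂ : ℚ
    err₂ = κ ^ suc s * ε₀ * (nat I * (2q * L))

    0≤2L : 0ℚ ≤ 2q * L
    0≤2L = 0≤* 0≤2q 0≤L

    0≤err₂ : 0ℚ ≤ err₂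
    0≤err₂ = 0≤* (0≤* (0≤^ (suc s) 0≤κ) 0≤ε₀) (0≤* (0≤nat I) 0≤2L)

    EwG⁺ : ∀ t → t ℕ.≤ I → ∀ {e} → e ∈ E → Et t (λ H → w H e * G⁺ H e) ≤ Et t (λ H → w H e * G H e) + θ * μ
    EwG⁺ t t≤ {e} e∈ = Et-mono t t≤ (λ H l → *-monoˡ (At.0≤w H (subst (ℕ._≤ I) (sym l) t≤) e) (+-mono-≤ (≤-refl {G H e}) (ℚₚ.p⊓q≤p (gh H e) (2q * L))) ▸ ≡≤ (ℚₚ.*-distribˡ-+ (w H e) (G H e) (gh H e))) ▸
      ≡≤ (Et-+ t _ _) ▸ +-mono-≤ (≤-refl {Et t (λ H → w H e * G H e)}) (hμ t t≤ e∈)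

    -- The danger of the next step is fixed before the phase, so only `w` moves, and its upward
    -- drift is bounded by the overlaps among the objects of `e`. The new danger costs `θ * μ` per
    -- phase.
    EwG : ∀ t → t ℕ.≤ I → ∀ {e} → e ∈ E → Et t (λ H → w H e * G H e) ≤ nat t * (θ * μ + err₂)
    EwG zero _ {e} _ = ≡≤ (l (w [] e) (θ * μ + err₂))
      where
      l : ∀ a b → a * 0ℚ ≡ 0ℚ * b
      l = solve-∀ ℚring
    EwG (suc t) t≤ {e} e∈ =
      Et-mono t (I≤ t≤) (λ H l → step H (subst (ℕ._≤ I) (sym l) (I≤ t≤)) (subst (λ k → suc k ℕ.≤ I) (sym l) t≤)) ▸
      ≡≤ (trans (Et-+ t _ _) (cong (Et t (λ H → w H e * G⁺ H e) +_) (Et-* t (κ ^ suc s * (nat I * (2q * L))) _))) ▸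
      +-mono-≤ (EwG⁺ t (I≤ t≤) e∈ ▸ +-mono-≤ (EwG t (I≤ t≤) e∈) (≤-refl {θ * μ})) (*-monoˡ (0≤* (0≤^ (suc s) 0≤κ) (0≤* (0≤nat I) 0≤2L)) (hov t (I≤ t≤) e∈)) ▸
      ≡≤ (l2 (nat t) (θ * μ) (κ ^ suc s) ε₀ (nat I * (2q * L)))
      where
      l2 : ∀ n a k e i → n * (a + k * e * i) + a + k * i * e ≡ (1ℚ + n) * (a + k * e * i)
      l2 = solve-∀ ℚring
      l3 : ∀ g w k o → g * (w * 1ℚ + k * o * 1ℚ) ≡ w * g + k * g * o
      l3 = solve-∀ ℚring
      step : ∀ H → length H ℕ.≤ I → suc (length H) ℕ.≤ I → ber (q H) E (λ R → w (R ∷ H) e * G⁺ H e) ≤ w H e * G⁺ H e + κ ^ suc s * (nat I * (2q * L)) * overs (q H) (K H) E (objs e)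
      step H H≤ H< =
        ≡≤ (trans (ber-cong (q H) E (λ R → trans (ℚₚ.*-comm (w (R ∷ H) e) (G⁺ H e)) (cong (G⁺ H e *_) (sym (ℚₚ.*-identityʳ (w (R ∷ H) e)))))) (ber-* (q H) E (G⁺ H e) _)) ▸
        *-monoˡ (0≤G⁺ e) (step-UB (objs e) [] [] []) ▸
        ≡≤ (l3 (G⁺ H e) (w H e) (κ ^ length (objs e)) (ov (objs e))) ▸
        +-mono-≤ (≤-refl {w H e * G⁺ H e}) (*-monoʳ (0≤ov (objs e)) (*-mono (0≤^ (length (objs e)) 0≤κ) (^-monoʳ 1≤κ (|objs|≤ e)) (0≤G⁺ e) G⁺≤))
        where
        open Step H H≤
        G⁺≤ : G⁺ H e ≤ nat I * (2q * L)
        G⁺≤ = G≤ ([] ∷ H) e H< ▸ *-monoʳ 0≤2L (nat-mono H<)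

    -- Markov's inequality for the accumulated danger, weighted by `w`.
    bad-F : ∀ t → suc t ℕ.≤ I → ∀ {e} → e ∈ E → Et t (λ H → w H e * 𝟙 (not (okF H e))) ≤ ρ
    bad-F t t< {e} e∈ = *-cancelʳ 0<L
      (≡≤ (trans (ℚₚ.*-comm _ L) (sym (Et-* t L _))) ▸
       Et-mono t t≤ (λ H l → pt H (subst (ℕ._≤ I) (sym l) t≤)) ▸ EwG⁺ t t≤ e∈ ▸
       +-mono-≤ (EwG t t≤ e∈ ▸ *-monoʳ (0≤+ 0≤θμ 0≤err₂) (nat-mono t≤)) (≤-refl {θ * μ}) ▸
       ≡≤ (l (nat I) θ μ err₂) ▸ +-mono-≤ (≤-refl {(T + θ) * μ}) ε₂≥ ▸ loss-F)
      where
      t≤ = I≤ t<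
      0≤θμ = 0≤* 0≤θ 0≤μ
      l : ∀ n t m e → n * (t * m + e) + t * m ≡ (n * t + t) * m + n * e
      l = solve-∀ ℚring
      pt : ∀ H → length H ℕ.≤ I → L * (w H e * 𝟙 (not (okF H e))) ≤ w H e * G⁺ H e
      pt H H≤ with bool? (okF H e)
      ... | inj₁ eq = ≡≤ (trans (cong (λ z → L * (w H e * 𝟙 (not z))) eq) (l′ L (w H e))) ▸ 0≤* (At.0≤w H H≤ e) (At.0≤G⁺ H H≤ e)
        where
        l′ : ∀ d w → d * (w * 0ℚ) ≡ 0ℚ
        l′ = solve-∀ ℚring
      ... | inj₂ eq = ≡≤ (trans (cong (λ z → L * (w H e * 𝟙 (not z))) eq) (l′ L (w H e))) ▸ *-monoˡ (At.0≤w H H≤ e) (<⇒≤ (leᵇ-false eq))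
        where
        l′ : ∀ d w → d * (w * 1ℚ) ≡ w * d
        l′ = solve-∀ ℚring

    𝟙∧not : ∀ a b → 𝟙 b - 𝟙 (not a) ≤ 𝟙 (a ∧ b)
    𝟙∧not true b = ≡≤ (ℚₚ.+-identityʳ (𝟙 b))
    𝟙∧not false b = 1-≤′ b
      where
      1-≤′ : ∀ b → 𝟙 b - 1ℚ ≤ 0ℚ
      1-≤′ true = ≤-refl
      1-≤′ false = ≤+ 0≤1 refl

    𝟙all : ∀ {X : Set} (f : X → Bool) xs → 1ℚ - Σ xs (λ x → 𝟙 (not (f x))) ≤ 𝟙 (all f xs)
    𝟙all f [] = ≤-refl
    𝟙all f (x ∷ xs) = ≡≤ (l (𝟙 (not (f x))) (Σ xs (λ x → 𝟙 (not (f x))))) ▸ +-mono-≤ (𝟙all f xs) (≤-refl { - 𝟙 (not (f x))}) ▸ 𝟙∧not (f x) (all f xs)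
      where
      l : ∀ a s → 1ℚ - (a + s) ≡ 1ℚ - s - a
      l = solve-∀ ℚring

    η : ℚ
    η = nat s * ρ + ρ

    -- A union bound over the edge and its at most `s` pairs, starting from mean weight at least 1.
    E-elig : ∀ t → suc t ℕ.≤ I → ∀ {e} → e ∈ E → 1ℚ - η ≤ Et t (λ H → w H e * 𝟙 (elig H e))
    E-elig t t< {e} e∈ =
      main ▸
      Et-mono t t≤ (λ H l → pt H (subst (ℕ._≤ I) (sym l) t≤))
      where
      t≤ = I≤ t<
      bY bF : Hist → ℚ
      bY H = Σ (pairs e) (λ p → w H e * 𝟙 (not (okY H p)))
      bF H = w H e * 𝟙 (not (okF H e))
      EbY : Et t bY ≤ nat s * ρ
      EbY = ≡≤ (Et-Σ t (pairs e) (λ p H → w H e * 𝟙 (not (okY H p)))) ▸ Σ-mono∈ (pairs e) (λ {p} p∈ → bad-Y t t≤ e∈ p∈) ▸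
        ≡≤ (Σ-const (pairs e) ρ) ▸ *-monoʳ 0≤ρ (nat-mono (|pairs| e))
      main : 1ℚ - η ≤ Et t (λ H → w H e + - 1ℚ * bY H + - 1ℚ * bF H)
      main = ≡≤ (l (nat s * ρ) ρ) ▸ +-mono-≤ (+-mono-≤ (Et-LB t t≤ (objs e)) (ℚₚ.neg-antimono-≤ EbY)) (ℚₚ.neg-antimono-≤ (bad-F t t< e∈)) ▸
        ≡≤ (trans (l2 (Et t (λ H → w H e)) (Et t bY) (Et t bF)) (sym (trans (Et-+ t _ _) (cong₂ _+_ (trans (Et-+ t _ _) (cong (Et t (λ H → w H e) +_) (Et-* t (- 1ℚ) bY))) (Et-* t (- 1ℚ) bF)))))
        where
        l : ∀ a r → 1ℚ - (a + r) ≡ 1ℚ + - a + - r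
        l = solve-∀ ℚring
        l2 : ∀ a b c → a + - b + - c ≡ a + - 1ℚ * b + - 1ℚ * c
        l2 = solve-∀ ℚring
      pt : ∀ H → length H ℕ.≤ I → w H e + - 1ℚ * bY H + - 1ℚ * bF H ≤ w H e * 𝟙 (elig H e)
      pt H H≤ = ≡≤ (trans (cong (λ z → w H e + - 1ℚ * z + - 1ℚ * bF H) (Σ-* (w H e) (pairs e) (λ p → 𝟙 (not (okY H p))))) (l (w H e) (Σ (pairs e) (λ p → 𝟙 (not (okY H p)))) (𝟙 (not (okF H e))))) ▸
        *-monoˡ (At.0≤w H H≤ e) (+-mono-≤ (𝟙all (okY H) (pairs e)) (≤-refl { - 𝟙 (not (okF H e))}) ▸ 𝟙∧not (okF H e) (all (okY H) (pairs e)))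
        where
        l : ∀ w s f → w + - 1ℚ * (w * s) + - 1ℚ * (w * f) ≡ w * (1ℚ - s - f)
        l = solve-∀ ℚring

-- Collisions within phases, their deletion, and correctness of the surviving set.

module Survivors where
  open Rationals
  open IndependentChoice
  open NibbleProcess
  open Invariants
  open Correlations
  open PhaseYield
  open import Data.Rational using (ℚ; 0ℚ; 1ℚ; _+_; _*_; -_; _-_; _≤_; _<_)
  open import Data.Rational.Properties using (≤-refl; ≤-trans; ≤-reflexive; +-mono-≤)
  open import Data.Nat using (zero; suc)
  open import Data.List using ([]; _∷_)
  open import Data.Bool.ListAction using (all; any)
  open import Data.List.Relation.Unary.All using ([]; _∷_)
  open import Data.List.Relation.Unary.AllPairs using ([]; _∷_)
  open import Data.Empty using (⊥)
  open import Tactic.RingSolver using (solve-∀)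

  nat-len-filter : ∀ {X Z : Set} (g : X → Z) (t : X → Bool) xs → nat (length (map g (filterᵇ t xs))) ≡ Σ xs (λ x → 𝟙 (t x))
  nat-len-filter g t [] = refl
  nat-len-filter g t (x ∷ xs) with t x
  ... | true = cong (1ℚ +_) (nat-len-filter g t xs)
  ... | false = trans (nat-len-filter g t xs) (sym (ℚₚ.+-identityˡ _))

  Σ-cart : ∀ {X Z : Set} (xs : List X) (ys : List Z) (f : X × Z → ℚ) → Σ (cartesianProduct xs ys) f ≡ Σ xs (λ x → Σ ys (λ y → f (x , y)))
  Σ-cart [] ys f = refl
  Σ-cart (x ∷ xs) ys f = trans (Σ-++ (map (x ,_) ys) (cartesianProduct xs ys) f) (cong₂ _+_ (Σ-map (x ,_) ys f) (Σ-cart xs ys f))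

  ∈-filterᵇ : ∀ {X : Set} (t : X → Bool) {x xs} → x ∈ xs → t x ≡ true → x ∈ filterᵇ t xs
  ∈-filterᵇ t {x} {y ∷ xs} (here refl) p rewrite p = here refl
  ∈-filterᵇ t {x} {y ∷ xs} (there m) p with t y
  ... | true = there (∈-filterᵇ t m p)
  ... | false = ∈-filterᵇ t m p

  filterᵇ-∈ : ∀ {X : Set} (t : X → Bool) {x} xs → x ∈ filterᵇ t xs → x ∈ xs × t x ≡ true
  filterᵇ-∈ t (y ∷ xs) m with t y in eq
  filterᵇ-∈ t (y ∷ xs) (here refl) | true = here refl , eq
  filterᵇ-∈ t (y ∷ xs) (there m) | true = let (a , b) = filterᵇ-∈ t xs m in there a , b
  ... | false = let (a , b) = filterᵇ-∈ t xs m in there a , b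

  filterᵇ-unique : ∀ {X : Set} (t : X → Bool) {xs} → Unique xs → Unique (filterᵇ t xs)
  filterᵇ-unique t [] = []
  filterᵇ-unique t {x ∷ xs} (al ∷ u) with t x
  ... | true = All.tabulate (λ m → All.lookup al (proj₁ (filterᵇ-∈ t xs m))) ∷ filterᵇ-unique t u
  ... | false = filterᵇ-unique t u

  u-hd : ∀ {X : Set} {x : X} {xs} → Unique (x ∷ xs) → All (x ≢_) xs
  u-hd (al ∷ _) = al

  u-tl : ∀ {X : Set} {x : X} {xs} → Unique (x ∷ xs) → Unique xs
  u-tl (_ ∷ u) = u

  record ConflictStructure (S : Setup) : Set₁ where
    open Setup S
    field
      hyp : NearRegular S
      confL : List A → Bool
      conf≡ : ∀ e e″ J → conf e e″ J ≡ confL (e ∷ e″ ∷ J)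
      confL-↭ : ∀ {C C′} → C ↭ C′ → confL C ≡ true → confL C′ ≡ true
      confL-tup : ∀ {e e″ J} → confL (e ∷ e″ ∷ J) ≡ true → All (_∈ E) J → J ∈ tup
      pairs-ne : ∀ {e} → e ∈ E → ∃ λ p → p ∈ pairs e
      confL-0 : confL [] ≡ true → ⊥
      confL-1 : ∀ {e} → confL (e ∷ []) ≡ true → ⊥

  module Extraction (S : Setup) (hyp′ : ConflictStructure S) where
    open ConflictStructure hyp′
    open Expect S hyp public

    -- Picks of different phases cannot share a pair, because the earlier one sends the weight of
    -- the pair to zero. Only two picks of the same phase can, and these are recorded for deletion.
    -- `testC` does the same for conflicts: two of the edges must stem from one phase.
    tests : Hist → List A → P × (A × A) → Bool
    tests H R (p , e , e′) = inP p e ∧ (inP p e′ ∧ (not (does (e ≟A e′)) ∧ (mem e R ∧ mem e′ R)))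

    sameB : Hist → A → A → Bool
    sameB [] e e′ = false
    sameB (R ∷ H) e e′ = (mem e R ∧ mem e′ R) ∨ sameB H e e′

    testC : Hist → (A × A) × List A → Bool
    testC H ((e , e′) , J) = conf e e′ J ∧ (sameB H e e′ ∧ all (pk H) J)

    trP : List (P × (A × A))
    trP = cartesianProduct allP (cartesianProduct E E)

    trC : List ((A × A) × List A)
    trC = cartesianProduct (cartesianProduct E E) tup

    badP : Hist → List A → List A
    badP H R = map (λ x → proj₁ (proj₂ x)) (filterᵇ (tests H R) trP)

    badPs badC bad : Hist → List A
    badPs [] = []
    badPs (R ∷ H) = badP H R ++ badPs H
    badC H = map (λ x → proj₁ (proj₁ x)) (filterᵇ (testC H) trC)
    bad H = badPs H ++ badC H

    ber-length : ∀ q es → ber q es (λ R → nat (length R)) ≡ Σ es q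
    ber-length q [] = refl
    ber-length q (e ∷ es) = trans (cong (λ x → q e * x + (1ℚ - q e) * ber q es (λ R → nat (length R))) (ber-+ q es (λ _ → 1ℚ) _))
      (trans (cong (λ x → q e * (x + ber q es (λ R → nat (length R))) + (1ℚ - q e) * ber q es (λ R → nat (length R))) (ber-const q es 1ℚ))
        (trans (l (q e) (ber q es (λ R → nat (length R)))) (cong (q e +_) (ber-length q es))))
      where
      l : ∀ q x → q * (1ℚ + x) + (1ℚ - q) * x ≡ q + x
      l = solve-∀ ℚring

    module Layer (H : Hist) (H≤ : length H ℕ.≤ I) where
      open Step H H≤

      two : ∀ e e′ → e ∈ E → e′ ∈ E → e ≢ e′ → ber (q H) E (λ R → 𝟙 (mem e R) * 𝟙 (mem e′ R)) ≤ q H e * q H e′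
      two e e′ e∈ e′∈ ne = ≡≤ (ber-cong (q H) E (λ R → l (𝟙 (mem e R)) (𝟙 (mem e′ R)))) ▸
        ber-crude prob uE (e ∷ e′ ∷ []) ((ne ∷ []) ∷ [] ∷ []) (e∈ ∷ e′∈ ∷ []) (λ _ → 0ℚ) (λ _ → ≤-refl) ▸ ≡≤ (sym (l (q H e) (q H e′)))
        where
        l : ∀ a b → a * b ≡ (0ℚ + a) * ((0ℚ + b) * 1ℚ)
        l = solve-∀ ℚring

      λP : ℚ
      λP = θ * (B * Y1) * (θ * (B * Y1))

      load≤ : ∀ p → Σ E (λ e → q H e * 𝟙 (inP p e)) ≤ θ * (B * Y1)
      load≤ p = load p ▸ *-monoʳ 0≤Y1 (*-monoˡ 0≤θ (φp≤B p)) ▸ ≡≤ (ℚₚ.*-assoc θ B Y1)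

      -- Distinct picks are independent, so the expected number of ordered collisions at a pair is
      -- at most the square of its load.
      badP-exp : ber (q H) E (λ R → nat (length (badP H R))) ≤ nat (length allP) * λP
      badP-exp =
        ≡≤ (trans (ber-cong (q H) E (λ R → trans (nat-len-filter (λ x → proj₁ (proj₂ x)) (tests H R) trP) (trans (Σ-cart allP (cartesianProduct E E) _) (Σ-cong allP (λ p → Σ-cart E E _)))))
           (trans (ber-Σ (q H) E allP _) (Σ-cong allP (λ p → trans (ber-Σ (q H) E E _) (Σ-cong E (λ e → ber-Σ (q H) E E _)))))) ▸
        Σ-mono allP (λ p → Σ-mono∈ E (λ {e} e∈ → Σ-mono∈ E (λ {e′} e′∈ → pt p e e′ e∈ e′∈)) ▸
          ≡≤ (trans (Σ-cong E (λ e → Σ-* (q H e * 𝟙 (inP p e)) E _)) (Σ-*ʳ _ E _)) ▸ *-mono (0≤l p) (load≤ p) (0≤l p) (load≤ p)) ▸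
        ≡≤ (Σ-const allP λP)
        where
        0≤l : ∀ p → 0ℚ ≤ Σ E (λ e → q H e * 𝟙 (inP p e))
        0≤l p = 0≤Σ E (λ e → 0≤* (0≤q e) (0≤𝟙 (inP p e)))
        pt : ∀ p e e′ → e ∈ E → e′ ∈ E → ber (q H) E (λ R → 𝟙 (tests H R (p , e , e′))) ≤ q H e * 𝟙 (inP p e) * (q H e′ * 𝟙 (inP p e′))
        pt p e e′ e∈ e′∈ with inP p e | inP p e′
        ... | false | y = ≡≤ (ber-const (q H) E 0ℚ) ▸ 0≤* (0≤* (0≤q e) ≤-refl) (0≤* (0≤q e′) (0≤𝟙 y))
        ... | true | false = ≡≤ (ber-const (q H) E 0ℚ) ▸ 0≤* (0≤* (0≤q e) 0≤1) (0≤* (0≤q e′) ≤-refl)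
        ... | true | true with e ≟A e′
        ...   | yes _ = ≡≤ (ber-const (q H) E 0ℚ) ▸ 0≤* (0≤* (0≤q e) 0≤1) (0≤* (0≤q e′) 0≤1)
        ...   | no ne = ≡≤ (ber-cong (q H) E (λ R → 𝟙-∧ (mem e R) (mem e′ R))) ▸ two e e′ e∈ e′∈ ne ▸
                  ≡≤ (sym (cong₂ _*_ (ℚₚ.*-identityʳ (q H e)) (ℚₚ.*-identityʳ (q H e′))))

      pair-exp : ∀ e e′ J → Unique (e ∷ e′ ∷ J) → e ∈ E → e′ ∈ E → All (_∈ E) J → ∀ y → 0ℚ ≤ y →
        ber (q H) E (λ R → 𝟙 (mem e R) * 𝟙 (mem e′ R) * Π J (λ j → 𝟙 (pk (R ∷ H) j) + y)) ≤ c * Di * (c * Di) * Π J (λ j → 𝟙 (pk H j) + (y + c * Di))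
      pair-exp e e′ J uC e∈ e′∈ J⊆ y 0≤y =
          ber-mono prob E pt ▸
          ber-crude prob uE (e ∷ e′ ∷ J) uC (e∈ ∷ e′∈ ∷ J⊆) a 0≤a ▸
          *-mono (0≤aq e) (a0 e (here refl)) (0≤* (0≤aq e′) (0≤Π J 0≤aq)) (*-mono (0≤aq e′) (a0 e′ (there (here refl))) (0≤Π J 0≤aq)
            (Π-mono J 0≤aq (λ j → +-mono-≤ (aj j) (q≤c j) ▸ ≡≤ (ℚₚ.+-assoc (𝟙 (pk H j)) y (c * Di))))) ▸
          ≡≤ (sym (ℚₚ.*-assoc (c * Di) (c * Di) _))
        where
        out : A → Bool
        out x = not (mem x (e ∷ e′ ∷ []))
        -- At `e` and `e′` only a pick of the present phase counts, so the past and the slack are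
        -- switched off there; on `J` they are kept.
        a : A → ℚ
        a x = 𝟙 (out x) * (𝟙 (pk H x) + y)
        0≤a : ∀ x → 0ℚ ≤ a x
        0≤a x = 0≤* (0≤𝟙 (out x)) (0≤+ (0≤𝟙 (pk H x)) 0≤y)
        0≤aq : ∀ x → 0ℚ ≤ a x + q H x
        0≤aq x = 0≤+ (0≤a x) (0≤q x)
        a0 : ∀ x → x ∈ (e ∷ e′ ∷ []) → a x + q H x ≤ c * Di
        a0 x m = ≡≤ (trans (cong (λ z → 𝟙 (not z) * (𝟙 (pk H x) + y) + q H x) (∈-mem m)) (l0 (𝟙 (pk H x) + y) (q H x))) ▸ q≤c x
          where
          l0 : ∀ a b → 0ℚ * a + b ≡ b
          l0 = solve-∀ ℚring
        aj : ∀ j → a j ≤ 𝟙 (pk H j) + y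
        aj j = 1*≤ (0≤+ (0≤𝟙 (pk H j)) 0≤y) (𝟙≤1 (out j))
        pt : ∀ R → 𝟙 (mem e R) * 𝟙 (mem e′ R) * Π J (λ j → 𝟙 (pk (R ∷ H) j) + y) ≤ Π (e ∷ e′ ∷ J) (λ x → a x + 𝟙 (mem x R))
        pt R = ≡≤ (ℚₚ.*-assoc (𝟙 (mem e R)) (𝟙 (mem e′ R)) _) ▸
          *-mono (0≤𝟙 (mem e R)) (≤+ˡ (0≤a e)) (0≤* (0≤𝟙 (mem e′ R)) (0≤Π J 0≤f))
            (*-mono (0≤𝟙 (mem e′ R)) (≤+ˡ (0≤a e′)) (0≤Π J 0≤f) (Jpart J (λ m → outside m)))
          where
          0≤f : ∀ j → 0ℚ ≤ 𝟙 (pk (R ∷ H) j) + y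
          0≤f j = 0≤+ (0≤𝟙 (pk (R ∷ H) j)) 0≤y
          outside : ∀ {j} → j ∈ J → j ∉ (e ∷ e′ ∷ [])
          outside m (here refl) = All.lookup (u-hd uC) (there m) refl
          outside m (there (here refl)) = All.lookup (u-hd (u-tl uC)) m refl
          Jpart : ∀ J′ → (∀ {j} → j ∈ J′ → j ∉ (e ∷ e′ ∷ [])) → Π J′ (λ j → 𝟙 (pk (R ∷ H) j) + y) ≤ Π J′ (λ x → a x + 𝟙 (mem x R))
          Jpart [] _ = ≤-refl
          Jpart (j ∷ J′) o = *-mono (0≤f j) (+-mono-≤ (𝟙∨ (mem j R) (pk H j)) (≤-refl {y}) ▸ ≡≤ (trans (l1 (𝟙 (pk H j)) (𝟙 (mem j R)) y) (cong (λ z → 𝟙 (not z) * (𝟙 (pk H j) + y) + 𝟙 (mem j R)) (sym (∉-mem (o (here refl)))))))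
            (0≤Π J′ 0≤f) (Jpart J′ (λ m → o (there m)))
            where
            l1 : ∀ k m y → k + m + y ≡ 1ℚ * (k + y) + m
            l1 = solve-∀ ℚring

      keep-exp : ∀ J → Unique J → All (_∈ E) J → ∀ y → 0ℚ ≤ y →
        ber (q H) E (λ R → Π J (λ j → 𝟙 (pk (R ∷ H) j) + y)) ≤ Π J (λ j → 𝟙 (pk H j) + (y + c * Di))
      keep-exp J uJ J⊆ y 0≤y =
        ber-mono prob E (λ R → Π-mono J (λ j → 0≤+ (0≤𝟙 (pk (R ∷ H) j)) 0≤y) (λ j → +-mono-≤ (𝟙∨ (mem j R) (pk H j)) (≤-refl {y}) ▸ ≡≤ (l1 (𝟙 (pk H j)) (𝟙 (mem j R)) y))) ▸
        ber-crude prob uE J uJ J⊆ (λ j → 𝟙 (pk H j) + y) (λ j → 0≤+ (0≤𝟙 (pk H j)) 0≤y) ▸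
        Π-mono J (λ j → 0≤+ (0≤+ (0≤𝟙 (pk H j)) 0≤y) (0≤q j)) (λ j → +-mono-≤ (≤-refl {𝟙 (pk H j) + y}) (q≤c j) ▸ ≡≤ (ℚₚ.+-assoc (𝟙 (pk H j)) y (c * Di)))
        where
        l1 : ∀ k m y → k + m + y ≡ k + y + m
        l1 = solve-∀ ℚring

    same : Hist → A → A → ℚ
    same [] e e′ = 0ℚ
    same (R ∷ H) e e′ = 𝟙 (mem e R) * 𝟙 (mem e′ R) + same H e e′

    0≤same : ∀ H e e′ → 0ℚ ≤ same H e e′
    0≤same [] e e′ = ≤-refl
    0≤same (R ∷ H) e e′ = 0≤+ (0≤* (0≤𝟙 (mem e R)) (0≤𝟙 (mem e′ R))) (0≤same H e e′)

    sameB≤ : ∀ H e e′ → 𝟙 (sameB H e e′) ≤ same H e e′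
    sameB≤ [] e e′ = ≤-refl
    sameB≤ (R ∷ H) e e′ = 𝟙∨ (mem e R ∧ mem e′ R) (sameB H e e′) ▸ ≡≤ (ℚₚ.+-comm _ (𝟙 (mem e R ∧ mem e′ R))) ▸
      +-mono-≤ (≡≤ (𝟙-∧ (mem e R) (mem e′ R))) (sameB≤ H e e′)

    -- A sum over the phase in which `e` and `e′` are picked together, while each edge of `J` may be
    -- picked at any time.
    E-same : ∀ t → t ℕ.≤ I → ∀ e e′ J → Unique (e ∷ e′ ∷ J) → e ∈ E → e′ ∈ E → All (_∈ E) J → ∀ y → 0ℚ ≤ y →
      Et t (λ H → same H e e′ * Π J (λ j → 𝟙 (pk H j) + y)) ≤ nat t * (c * Di * (c * Di) * (nat t * (c * Di) + y) ^ length J)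
    E-same zero _ e e′ J _ _ _ _ y _ = ≡≤ (l (Π J (λ j → 0ℚ + y)) (c * Di * (c * Di) * (0ℚ * (c * Di) + y) ^ length J))
      where
      l : ∀ a b → 0ℚ * a ≡ 0ℚ * b
      l = solve-∀ ℚring
    E-same (suc t) t< e e′ J uC e∈ e′∈ J⊆ y 0≤y =
      Et-mono t t≤ (λ H l → pt H (subst (ℕ._≤ I) (sym l) t≤)) ▸
      ≡≤ (trans (Et-+ t _ _) (cong (_+ Et t (λ H → same H e e′ * Π J (λ j → 𝟙 (pk H j) + y′))) (Et-* t (c * Di * (c * Di)) _))) ▸
      +-mono-≤ (*-monoˡ (0≤* 0≤cDi 0≤cDi) (crude t t≤ J uJ J⊆ y′ 0≤y′)) (E-same t t≤ e e′ J uC e∈ e′∈ J⊆ y′ 0≤y′) ▸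
      ≡≤ (trans (l2 (c * Di * (c * Di)) ((nat t * (c * Di) + y′) ^ length J) (nat t)) (cong (λ z → nat (suc t) * (c * Di * (c * Di) * z ^ length J)) (l3 (nat t) (c * Di) y)))
      where
      t≤ = ℕₚ.≤-trans (ℕₚ.n≤1+n t) t<
      y′ = y + c * Di
      0≤y′ = 0≤+ 0≤y 0≤cDi
      uJ : Unique J
      uJ = u-tl (u-tl uC)
      l2 : ∀ c x n → c * x + n * (c * x) ≡ (1ℚ + n) * (c * x)
      l2 = solve-∀ ℚring
      l3 : ∀ n c y → n * c + (y + c) ≡ (1ℚ + n) * c + y
      l3 = solve-∀ ℚring
      pt : ∀ H → length H ℕ.≤ I → ber (q H) E (λ R → same (R ∷ H) e e′ * Π J (λ j → 𝟙 (pk (R ∷ H) j) + y)) ≤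
        c * Di * (c * Di) * Π J (λ j → 𝟙 (pk H j) + y′) + same H e e′ * Π J (λ j → 𝟙 (pk H j) + y′)
      pt H H≤ = ≡≤ (trans (ber-cong (q H) E (λ R → ℚₚ.*-distribʳ-+ (Π J (λ j → 𝟙 (pk (R ∷ H) j) + y)) (𝟙 (mem e R) * 𝟙 (mem e′ R)) (same H e e′)))
          (trans (ber-+ (q H) E _ _) (cong (ber (q H) E (λ R → 𝟙 (mem e R) * 𝟙 (mem e′ R) * Π J (λ j → 𝟙 (pk (R ∷ H) j) + y)) +_) (ber-* (q H) E (same H e e′) _)))) ▸
        +-mono-≤ (Layer.pair-exp H H≤ e e′ J uC e∈ e′∈ J⊆ y 0≤y) (*-monoˡ (0≤same H e e′) (Layer.keep-exp H H≤ J uJ J⊆ y 0≤y))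

    𝟙all-Π : ∀ (f : A → Bool) J → 𝟙 (all f J) ≡ Π J (λ j → 𝟙 (f j))
    𝟙all-Π f [] = refl
    𝟙all-Π f (j ∷ J) = trans (𝟙-∧ (f j) (all f J)) (cong (𝟙 (f j) *_) (𝟙all-Π f J))

    EDi : ℚ
    EDi = nat (length E) * Di

    0≤EDi : 0ℚ ≤ EDi
    0≤EDi = 0≤* (0≤nat (length E)) 0≤Di

    -- Two picks of one phase cost `c * c`, once for each of the `I` phases. When `c` is of order
    -- 1/I, the whole sum is of order 1/I as well.
    badC-Exp : Et I (λ H → nat (length (badC H))) ≤ nat I * (EDi * (c * c * (Rk * Kc)))
    badC-Exp =
      ≡≤ (trans (Et-cong I (λ H → trans (nat-len-filter (λ x → proj₁ (proj₁ x)) (testC H) trC) (trans (Σ-cart (cartesianProduct E E) tup _) (Σ-cart E E _))))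
        (trans (Et-Σ I E _) (Σ-cong E (λ e → trans (Et-Σ I E _) (Σ-cong E (λ e′ → Et-Σ I tup _)))))) ▸
      Σ-mono∈ E (λ {e} e∈ → Σ-mono∈ E (λ {e′} e′∈ → Σ-mono∈ tup (λ {J} J∈ → pt e e′ J e∈ e′∈ J∈) ▸ ≡≤ (Σ-* (nat I * (c * c * Rk * Di)) tup _)) ▸
         ≡≤ (Σ-* (nat I * (c * c * Rk * Di)) E _) ▸ *-monoˡ (0≤* (0≤nat I) (0≤* (0≤* (0≤* 0≤c 0≤c) 0≤Rk) 0≤Di)) (conf-deg e∈)) ▸
      ≡≤ (trans (Σ-const E _) (l (nat (length E)) c Rk Di Kc (nat I)))
      where
      l : ∀ n c r d k i → n * (i * (c * c * r * d) * k) ≡ i * (n * d * (c * c * (r * k)))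
      l = solve-∀ ℚring
      pt : ∀ e e′ J → e ∈ E → e′ ∈ E → J ∈ tup → Et I (λ H → 𝟙 (testC H ((e , e′) , J))) ≤ nat I * (c * c * Rk * Di) * (𝟙 (conf e e′ J) * (Di * Di ^ length J))
      pt e e′ J e∈ e′∈ J∈ with conf e e′ J in cf
      ... | false = ≡≤ (trans (Et-const I 0ℚ) (sym (l0 (nat I * (c * c * Rk * Di)) (Di * Di ^ length J))))
        where
        l0 : ∀ b d → b * (0ℚ * d) ≡ 0ℚ
        l0 = solve-∀ ℚring
      ... | true = Et-mono I ℕₚ.≤-refl (λ H _ → ≡≤ (trans (𝟙-∧ (sameB H e e′) _) (cong (𝟙 (sameB H e e′) *_) (trans (𝟙all-Π (pk H) J) (Π-cong J (λ j → sym (ℚₚ.+-identityʳ (𝟙 (pk H j)))))))) ▸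
               *-monoʳ (0≤Π J (λ j → 0≤+ (0≤𝟙 (pk H j)) ≤-refl)) (sameB≤ H e e′)) ▸
             E-same I ℕₚ.≤-refl e e′ J (confU cf) e∈ e′∈ (tup⊆E J∈) 0ℚ ≤-refl ▸
             *-monoˡ (0≤nat I) (*-monoˡ (0≤* 0≤cDi 0≤cDi) (≡≤ (trans (cong (_^ length J) (l1 (nat I) c Di)) (*-^ (nat I * c) Di (length J))) ▸ *-monoʳ (0≤^ (length J) 0≤Di) (Rk≥ J∈))) ▸
             ≡≤ (l2 (nat I) c Di Rk (Di ^ length J))
        where
        l1 : ∀ n c d → n * (c * d) + 0ℚ ≡ n * c * d
        l1 = solve-∀ ℚring
        l2 : ∀ n c d r e → n * (c * d * (c * d) * (r * e)) ≡ n * (c * c * r * d) * (1ℚ * (d * e))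
        l2 = solve-∀ ℚring

    picks : Hist → List A
    picks = concat

    score₁ score : Hist → ℚ
    score₁ H = nat (length (picks H)) - nat (length (badPs H))
    score H = nat (length (picks H)) - nat (length (bad H))

    nat-len-++ : ∀ {X : Set} (xs ys : List X) → nat (length (xs ++ ys)) ≡ nat (length xs) + nat (length ys)
    nat-len-++ xs ys = trans (cong nat (length-++ xs)) (nat-+ (length xs) (length ys))

    lossP lossC : ℚ
    lossP = nat s * (θ * (B * Y1) * (θ * (B * Y1)))
    lossC = c * c * (Rk * Kc)

    -- Pair collisions are charged phase by phase. Conflicts are charged once, in `E-total`, because
    -- a conflict may become complete long after its two simultaneous edges were picked.
    E-score : ∀ t → t ℕ.≤ I → nat t * (EDi * (θ * (1ℚ - η) - lossP)) ≤ Et t score₁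
    E-score zero _ = ≡≤ (ℚₚ.*-zeroˡ (EDi * (θ * (1ℚ - η) - lossP)))
    E-score (suc t) t< =
      ≡≤ (l (nat t) EDi (θ * (1ℚ - η)) lossP) ▸
      +-mono-≤ (+-mono-≤ (E-score t t≤) Eq) (ℚₚ.neg-antimono-≤ EP ▸ ≡≤ (l5 _)) ▸
      ≡≤ (sym (trans (Et-cong t expand-score) (trans (Et-+ t _ _) (cong₂ _+_ (Et-+ t score₁ _) (Et-* t (- 1ℚ) _)))))
      where
      t≤ = ℕₚ.≤-trans (ℕₚ.n≤1+n t) t<
      l : ∀ n d a p → (1ℚ + n) * (d * (a - p)) ≡ n * (d * (a - p)) + d * a + - (d * p)
      l = solve-∀ ℚring
      l5 : ∀ x → - x ≡ - 1ℚ * x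
      l5 = solve-∀ ℚring
      Eq : EDi * (θ * (1ℚ - η)) ≤ Et t (λ H → Σ E (q H))
      Eq = ≡≤ (trans (l7 (nat (length E)) Di θ (1ℚ - η)) (sym (Σ-const E _))) ▸
        Σ-mono∈ E (λ {e} e∈ → *-monoˡ 0≤θDi (E-elig t t< e∈) ▸ ≡≤ (trans (sym (Et-* t (θ * Di) _)) (Et-cong t (λ H → sym (ℚₚ.*-assoc (θ * Di) (w H e) (𝟙 (elig H e))))))) ▸ ≡≤ (sym (Et-Σ t E (λ e H → q H e)))
        where
        l7 : ∀ n d t x → n * d * (t * x) ≡ n * (t * d * x)
        l7 = solve-∀ ℚring
      EP : Et t (λ H → ber (q H) E (λ R → nat (length (badP H R)))) ≤ EDi * lossP
      EP = Et-mono t t≤ (λ H l → Layer.badP-exp H (subst (ℕ._≤ I) (sym l) t≤)) ▸ ≡≤ (Et-const t (nat (length allP) * λP)) ▸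
        *-monoʳ 0≤λP allP-size ▸ ≡≤ (l8 (nat s) EDi λP)
        where
        λP = θ * (B * Y1) * (θ * (B * Y1))
        0≤λP : 0ℚ ≤ λP
        0≤λP = 0≤sq (θ * (B * Y1))
        l8 : ∀ s d l → s * d * l ≡ d * (s * l)
        l8 = solve-∀ ℚring
      expand-score : ∀ H → ber (q H) E (λ R → score₁ (R ∷ H)) ≡ score₁ H + Σ E (q H) + - 1ℚ * ber (q H) E (λ R → nat (length (badP H R)))
      expand-score H = trans (ber-cong (q H) E pt) (trans (ber-+ (q H) E _ _) (cong₂ _+_ (trans (ber-+ (q H) E _ _) (cong₂ _+_ (ber-const (q H) E (score₁ H)) (ber-length (q H) E))) (ber-* (q H) E (- 1ℚ) _)))
        where
        l9 : ∀ r h p b → r + h - (p + b) ≡ h - b + r + - 1ℚ * p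
        l9 = solve-∀ ℚring
        pt : ∀ R → score₁ (R ∷ H) ≡ score₁ H + nat (length R) + - 1ℚ * nat (length (badP H R))
        pt R = trans (cong₂ (λ x y → x - y) (nat-len-++ R (concat H)) (nat-len-++ (badP H R) (badPs H)))
          (l9 (nat (length R)) (nat (length (concat H))) (nat (length (badP H R))) (nat (length (badPs H))))

    E-total : EDi * x ≤ Et I score
    E-total = *-monoˡ 0≤EDi (≡≤ (l x (nat I * lossP) (nat I * lossC)) ▸ +-mono-≤ (+-mono-≤ x≤ (≤-refl { - (nat I * lossP)})) (≤-refl { - (nat I * lossC)})) ▸
      ≡≤ (l2 (nat I) EDi θ (1ℚ - η) lossP lossC) ▸ +-mono-≤ (E-score I ℕₚ.≤-refl) (ℚₚ.neg-antimono-≤ badC-Exp) ▸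
      ≡≤ (sym (trans (Et-cong I (λ H → trans (cong (λ z → nat (length (picks H)) - z) (nat-len-++ (badPs H) (badC H))) (l3 (nat (length (picks H))) (nat (length (badPs H))) (nat (length (badC H))))))
         (trans (Et-+ I score₁ _) (cong (Et I score₁ +_) (trans (Et-* I (- 1ℚ) _) (l4 (Et I (λ H → nat (length (badC H))))))))))
      where
      l : ∀ x p c → x ≡ x + p + c + - p + - c
      l = solve-∀ ℚring
      l2 : ∀ n d t e p c → d * (n * t * e + - (n * p) + - (n * c)) ≡ n * (d * (t * e - p)) + - (n * (d * c))
      l2 = solve-∀ ℚring
      l3 : ∀ a b c → a - (b + c) ≡ a - b + - 1ℚ * c
      l3 = solve-∀ ℚring
      l4 : ∀ a → - 1ℚ * a ≡ - a
      l4 = solve-∀ ℚring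

    -- Every pick had positive rate. This is all that is used of a history having positive
    -- probability, and it turns zero weights into contradictions.
    Reach : Hist → Set
    Reach [] = ⊤
    Reach (R ∷ H) = Reach H × All (λ e → e ∈ E × 0ℚ < q H e) R × Unique R

    Et-exists : ∀ t → t ℕ.≤ I → ∀ {f k} → k ≤ Et t f → ∃ λ H → length H ≡ t × Reach H × k ≤ f H
    Et-exists zero _ p = [] , refl , tt , p
    Et-exists (suc t) t≤ {f} {k} p = next (Et-exists t t≤′ p)
      where
      t≤′ = ℕₚ.≤-trans (ℕₚ.n≤1+n t) t≤
      last : ∀ H → length H ≡ t → Reach H → (∃ λ R → k ≤ f (R ∷ H) × All (λ e → e ∈ E × 0ℚ < q H e) R × Unique R) → ∃ λ H → length H ≡ suc t × Reach H × k ≤ f H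
      last H l r (R , p″ , al , u) = R ∷ H , cong suc l , (r , al , u) , p″
      next : (∃ λ H → length H ≡ t × Reach H × k ≤ ber (q H) E (λ R → f (R ∷ H))) → ∃ λ H → length H ≡ suc t × Reach H × k ≤ f H
      next (H , l , r , p′) = last H l r (ber-exists (At.prob H (subst (ℕ._≤ I) (sym l) t≤′)) E uE p′)

    pk-∈ : ∀ H {e} → pk H e ≡ true → e ∈ picks H
    pk-∈ (R ∷ H) {e} p with mem e R in eq
    ... | true = ∈-++⁺ˡ {xs = R} (mem-∈ eq)
    ... | false = ∈-++⁺ʳ R (pk-∈ H p)

    ∈-pk : ∀ H {e} → e ∈ picks H → pk H e ≡ true
    ∈-pk (R ∷ H) {e} m with ∈-++⁻ R m
    ... | inj₁ m′ rewrite ∈-mem m′ = refl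
    ... | inj₂ m′ rewrite ∈-pk H m′ = 𝔹ₚ.∨-zeroʳ (mem e R)

    w0 : ∀ H {e o} → o ∈ objs e → φ H o ≡ 0ℚ → w H e ≡ 0ℚ
    w0 H m z = Π-elem0 {f = φ H} m z

    q0-w : ∀ H {e} → w H e ≡ 0ℚ → q H e ≡ 0ℚ
    q0-w H {e} z = trans (cong (λ x → θ * Di * x * 𝟙 (elig H e)) z) (l (θ * Di) (𝟙 (elig H e)))
      where
      l : ∀ a b → a * 0ℚ * b ≡ 0ℚ
      l = solve-∀ ℚring

    q0-F : ∀ H {e} → okF H e ≡ false → q H e ≡ 0ℚ
    q0-F H {e} z = trans (cong (λ b → θ * Di * w H e * 𝟙 (b ∧ all (okY H) (pairs e))) z) (ℚₚ.*-zeroʳ (θ * Di * w H e))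

    q>0 : ∀ {H e} → 0ℚ < q H e → q H e ≡ 0ℚ → ⊥
    q>0 p z = ℚₚ.<-irrefl (sym z) p

    φ-dead : ∀ R H {o} → φ H o ≡ 0ℚ → φ (R ∷ H) o ≡ 0ℚ
    φ-dead R H {o} z = trans (cong (λ x → x * 𝟙 (noHit (K H o) R) * inv (surv H o)) z) (l (𝟙 (noHit (K H o) R)) (inv (surv H o)))
      where
      l : ∀ a b → 0ℚ * a * b ≡ 0ℚ
      l = solve-∀ ℚring

    φ-kill : ∀ R H {o e} → e ∈ R → K H o e ≡ true → φ (R ∷ H) o ≡ 0ℚ
    φ-kill R H {o} {e} m k = trans (cong (λ b → φ H o * 𝟙 b * inv (surv H o)) (noHit-hit {K H o} m k)) (l (φ H o) (inv (surv H o)))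
      where
      l : ∀ a b → a * 0ℚ * b ≡ 0ℚ
      l = solve-∀ ℚring

    φ-pair-dead : ∀ H {e p} → pk H e ≡ true → p ∈ pairs e → φ H (inj₁ p) ≡ 0ℚ
    φ-pair-dead (R ∷ H) {e} {p} k m with mem e R in eq
    ... | true = φ-kill R H (mem-∈ eq) (MP.∈-mem m)
    ... | false = φ-dead R H (φ-pair-dead H k m)

    pair-obj : ∀ {e p} → p ∈ pairs e → inj₁ p ∈ objs e
    pair-obj m = there (∈-map⁺ inj₁ m)

    -- A retired edge stays retired because G only grows.
    okF-mono : ∀ R H e → length (R ∷ H) ℕ.≤ I → okF H e ≡ false → okF (R ∷ H) e ≡ false
    okF-mono R H e len z with bool? (okF (R ∷ H) e)
    ... | inj₂ r = r
    ... | inj₁ r = ⊥-elim (ℚₚ.<-irrefl refl (ℚₚ.<-≤-trans (leᵇ-false {G⁺ H e} {L} z) (At.G≤G⁺ (R ∷ H) len e ▸ leᵇ-true r)))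

    u-swap : ∀ {x y : A} {xs} → x ∷ y ∷ xs ↭ y ∷ x ∷ xs
    u-swap = swap _ _ ↭-refl

    -- An edge picked before has killed its own pairs; it has at least one, so its weight and its
    -- rate are zero.
    fresh : ∀ {H e} → e ∈ E → 0ℚ < q H e → pk H e ≡ false
    fresh {H} {e} e∈ pos with bool? (pk H e)
    ... | inj₂ r = r
    ... | inj₁ r = ⊥-elim (q>0 {H} {e} pos (q0-w H {e} (w0 H {e} (pair-obj (proj₂ (pairs-ne e∈))) (φ-pair-dead H r (proj₂ (pairs-ne e∈))))))

    picks-⊆E : ∀ H → Reach H → ∀ {e} → e ∈ picks H → e ∈ E
    picks-⊆E (R ∷ H) (r , al , _) m with ∈-++⁻ R m
    ... | inj₁ m′ = proj₁ (All.lookup al m′)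
    ... | inj₂ m′ = picks-⊆E H r m′

    picks-unique : ∀ H → Reach H → Unique (picks H)
    picks-unique [] _ = []
    picks-unique (R ∷ H) (r , al , u) = Uₚ.++⁺ u (picks-unique H r) (λ (m , m′) → false≢true (trans (sym (fresh {H} (proj₁ (All.lookup al m)) (proj₂ (All.lookup al m)))) (∈-pk H m′)))
      where
      false≢true : false ≡ true → ⊥
      false≢true ()

    all-pk : ∀ {f : A → Bool} {J} → All (λ j → f j ≡ true) J → all f J ≡ true
    all-pk [] = refl
    all-pk (p ∷ ps) rewrite p = all-pk ps

    clash : ∀ H → Reach H → ∀ {e e′ p} → e ∈ picks H → e′ ∈ picks H → e ≢ e′ → p ∈ pairs e → p ∈ pairs e′ → e ∈ badPs H ⊎ e′ ∈ badPs H
    clash (R ∷ H) (r , al , u) {e} {e′} {p} m m′ ne pe pe′ with ∈-++⁻ R m | ∈-++⁻ R m′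
    ... | inj₁ a | inj₁ b = inj₁ (∈-++⁺ˡ (∈-map⁺ (λ x → proj₁ (proj₂ x)) (∈-filterᵇ (tests H R) {p , e , e′}
            (∈-cartesianProduct⁺ (pairs⊆allP pe) (∈-cartesianProduct⁺ (proj₁ (All.lookup al a)) (proj₁ (All.lookup al b)))) test)))
      where
      test : tests H R (p , e , e′) ≡ true
      test rewrite MP.∈-mem pe | MP.∈-mem pe′ | ∈-mem a | ∈-mem b with e ≟A e′
      ... | yes q = ⊥-elim (ne q)
      ... | no _ = refl
    ... | inj₁ a | inj₂ b = ⊥-elim (q>0 {H} {e} (proj₂ (All.lookup al a)) (q0-w H {e} (w0 H {e} (pair-obj pe) (φ-pair-dead H (∈-pk H b) pe′))))
    ... | inj₂ a | inj₁ b = ⊥-elim (q>0 {H} {e′} (proj₂ (All.lookup al b)) (q0-w H {e′} (w0 H {e′} (pair-obj pe′) (φ-pair-dead H (∈-pk H a) pe))))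
    ... | inj₂ a | inj₂ b with clash H r a b ne pe pe′
    ...   | inj₁ z = inj₁ (∈-++⁺ʳ (badP H R) z)
    ...   | inj₂ z = inj₂ (∈-++⁺ʳ (badP H R) z)

    splitR : ∀ (R : List A) H C → All (λ j → pk (R ∷ H) j ≡ true) C →
      All (λ j → pk H j ≡ true) C ⊎ (∃ λ e → ∃ λ D → C ↭ e ∷ D × e ∈ R)
    splitR R H [] [] = inj₁ []
    splitR R H (x ∷ C) (p ∷ ps) with bool? (mem x R)
    ... | inj₁ m = inj₂ (x , C , ↭-refl , mem-∈ m)
    ... | inj₂ m with splitR R H C ps
    ...   | inj₂ (e , D , pr , e∈) = inj₂ (e , x ∷ D , ↭-trans (prep x pr) u-swap , e∈)
    ...   | inj₁ al = inj₁ (trans (cong (_∨ pk H x) (sym m)) p ∷ al)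

    Same : Hist → List A → Set
    Same H C = ∃ λ e → ∃ λ e′ → ∃ λ J → C ↭ e ∷ e′ ∷ J × sameB H e e′ ≡ true

    Same-mono : ∀ R H {C} → Same H C → Same (R ∷ H) C
    Same-mono R H (e , e′ , J , pr , s) = e , e′ , J , pr , trans (cong ((mem e R ∧ mem e′ R) ∨_) s) (𝔹ₚ.∨-zeroʳ (mem e R ∧ mem e′ R))

    Same-here : ∀ R H {e e′} → e ∈ R → e′ ∈ R → sameB (R ∷ H) e e′ ≡ true
    Same-here R H m m′ rewrite ∈-mem m | ∈-mem m′ = refl

    Same-↭ : ∀ {H C C′} → C ↭ C′ → Same H C′ → Same H C
    Same-↭ p (e , e′ , J , pr , s) = e , e′ , J , ↭-trans p pr , s

    Same-cons : ∀ {H C} x → Same H C → Same H (x ∷ C)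
    Same-cons x (e , e′ , J , pr , s) = e , e′ , x ∷ J , ↭-trans (prep x pr) (↭-trans u-swap (prep e u-swap)) , s

    picks-All : ∀ H → Reach H → ∀ {J} → All (λ j → pk H j ≡ true) J → All (_∈ E) J
    picks-All H r = All.map (λ p → picks-⊆E H r (pk-∈ H p))

    -- Consider the latest phase that picked an edge of `D`. If it picked only one, the rest of `D`
    -- was there already, so that pick was dangerous for `e`: it killed `e`, unless `e` was retired,
    -- and retirement is permanent.
    kill : ∀ H → Reach H → length H ℕ.≤ I → ∀ e D → D ≢ [] → confL (e ∷ D) ≡ true → All (λ j → pk H j ≡ true) D →
      (φ H (inj₂ e) ≡ 0ℚ ⊎ okF H e ≡ false) ⊎ Same H D
    kill [] _ _ e [] ne _ _ = ⊥-elim (ne refl)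
    kill [] _ _ e (_ ∷ _) _ _ (() ∷ _)
    kill (R ∷ H) (r , al , u) len e D ne cf ps with splitR R H D ps
    ... | inj₁ ps′ with kill H r (ℕₚ.≤-trans (ℕₚ.n≤1+n _) len) e D ne cf ps′
    ...   | inj₁ (inj₁ z) = inj₁ (inj₁ (φ-dead R H z))
    ...   | inj₁ (inj₂ z) = inj₁ (inj₂ (okF-mono R H e len z))
    ...   | inj₂ s = inj₂ (Same-mono R H s)
    kill (R ∷ H) (r , al , u) len e D ne cf ps | inj₂ (e₁ , D₁ , pr , e₁∈) with splitR R H D₁ (All.tail (All-resp-↭ pr ps))
    ... | inj₂ (e₂ , D₂ , pr₂ , e₂∈) = inj₂ (e₁ , e₂ , D₂ , ↭-trans pr (prep e₁ pr₂) , Same-here R H e₁∈ e₂∈)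
    ... | inj₁ ps₁ = inj₁ (fin (bool? (okF H e)))
      where
      cf₁ : confL (e ∷ e₁ ∷ D₁) ≡ true
      cf₁ = confL-↭ (prep e pr) cf
      D₁∈ : D₁ ∈ tup
      D₁∈ = confL-tup cf₁ (picks-All H r ps₁)
      any-∈ : ∀ {f : List A → Bool} {J Js} → J ∈ Js → f J ≡ true → any f Js ≡ true
      any-∈ {f} {J} (here refl) p rewrite p = refl
      any-∈ {f} {J} {K ∷ Js} (there m) p rewrite any-∈ {f} m p = 𝔹ₚ.∨-zeroʳ (f K)
      dg : dang H e e₁ ≡ true
      dg = any-∈ {λ J → conf e e₁ J ∧ all (pk H) J} D₁∈ (cong₂ _∧_ (trans (conf≡ e e₁ D₁) cf₁) (all-pk ps₁))
      fin : okF H e ≡ true ⊎ okF H e ≡ false → φ (R ∷ H) (inj₂ e) ≡ 0ℚ ⊎ okF (R ∷ H) e ≡ false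
      fin (inj₁ ok) = inj₁ (φ-kill R H {inj₂ e} e₁∈ (cong₂ _∧_ ok dg))
      fin (inj₂ nok) = inj₂ (okF-mono R H e len nok)

    -- Consider the latest phase that contributes to `C`. If it contributes a single edge `e`, the
    -- others were all picked before, so `kill` gives `e` rate zero at the moment of its pick,
    -- unless two of the others already came together.
    clashC : ∀ H → Reach H → length H ℕ.≤ I → ∀ C → confL C ≡ true → All (λ j → pk H j ≡ true) C → Same H C
    clashC [] _ _ [] cf [] = ⊥-elim (confL-0 cf)
    clashC (R ∷ H) (r , al , u) len C cf ps with splitR R H C ps
    ... | inj₁ ps′ = Same-mono R H (clashC H r (ℕₚ.≤-trans (ℕₚ.n≤1+n _) len) C cf ps′)
    ... | inj₂ (e , D , pr , e∈) with splitR R H D (All.tail (All-resp-↭ pr ps))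
    ...   | inj₂ (e₂ , D₂ , pr₂ , e₂∈) = e , e₂ , D₂ , ↭-trans pr (prep e pr₂) , Same-here R H e∈ e₂∈
    ...   | inj₁ ps₁ with kill H r (ℕₚ.≤-trans (ℕₚ.n≤1+n _) len) e D ne (confL-↭ pr cf) ps₁
      where
      ne : D ≢ []
      ne refl = confL-1 (confL-↭ pr cf)
    ...     | inj₂ s = Same-↭ {R ∷ H} pr (Same-cons {R ∷ H} e (Same-mono R H s))
    ...     | inj₁ (inj₁ z) = ⊥-elim (q>0 {H} {e} (proj₂ (All.lookup al e∈)) (q0-w H {e} (w0 H {e} (here refl) z)))
    ...     | inj₁ (inj₂ z) = ⊥-elim (q>0 {H} {e} (proj₂ (All.lookup al e∈)) (q0-F H {e} z))

    remove-len : ∀ bs xs → Unique xs → length xs ℕ.≤ length (filterᵇ (λ x → not (mem x bs)) xs) ℕ.+ length bs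
    remove-len [] xs _ = ℕₚ.≤-trans (ℕₚ.≤-reflexive (sym (same-len xs))) (ℕₚ.m≤m+n _ 0)
      where
      same-len : ∀ xs → length (filterᵇ (λ x → not (mem x [])) xs) ≡ length xs
      same-len [] = refl
      same-len (x ∷ xs) = cong suc (same-len xs)
    remove-len (b ∷ bs) xs u = ℕₚ.≤-trans (remove-len bs xs u) (ℕₚ.≤-trans (ℕₚ.+-monoˡ-≤ (length bs) (one xs u)) (ℕₚ.≤-reflexive (sym (ℕₚ.+-suc _ (length bs)))))
      where
      f g : A → Bool
      f x = not (mem x bs)
      g x = not (mem x (b ∷ bs))
      none : ∀ xs → b ∉ xs → length (filterᵇ f xs) ≡ length (filterᵇ g xs)
      none [] _ = refl
      none (x ∷ xs) b∉ with x ≟A b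
      ... | yes refl = ⊥-elim (b∉ (here refl))
      ... | no _ with mem x bs
      ...   | true = none xs (λ m → b∉ (there m))
      ...   | false = cong suc (none xs (λ m → b∉ (there m)))
      one : ∀ xs → Unique xs → length (filterᵇ f xs) ℕ.≤ suc (length (filterᵇ g xs))
      one [] _ = z≤n
      one (x ∷ xs) (al ∷ u) with x ≟A b
      ... | no _ with mem x bs
      ...   | true = one xs u
      ...   | false = s≤s (one xs u)
      one (x ∷ xs) (al ∷ u) | yes refl with mem x bs
      ... | true = ℕₚ.≤-trans (ℕₚ.≤-reflexive (none xs (λ m → All.lookup al m refl))) (ℕₚ.n≤1+n _)
      ... | false = s≤s (ℕₚ.≤-reflexive (none xs (λ m → All.lookup al m refl)))

    Result : Set
    Result = ∃ λ M′ → Unique M′ × All (_∈ E) M′ × EDi * x ≤ nat (length M′) ×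
      (∀ {e e′ p} → e ∈ M′ → e′ ∈ M′ → e ≢ e′ → p ∈ pairs e → p ∈ pairs e′ → ⊥) ×
      (∀ C → All (_∈ M′) C → confL C ≡ true → ⊥)
    -- Some history attains the mean score; deleting the recorded edges leaves at least that many
    -- and removes every collision.
    result : Result
    result = fin (Et-exists I ℕₚ.≤-refl E-total)
      where
      fin : (∃ λ H → length H ≡ I × Reach H × EDi * x ≤ score H) → Result
      fin (H , len , r , sc) = M′ , filterᵇ-unique ok uH , All.tabulate (λ m → picks-⊆E H r (proj₁ (out m))) ,
          (sc ▸ (+-mono-≤ (nat-mono (remove-len (bad H) (picks H) uH) ▸ ≡≤ (nat-+ (length M′) (length (bad H)))) (≤-refl { - nat (length (bad H))}) ▸ ≡≤ (l (nat (length M′)) (nat (length (bad H)))))) ,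
          noPair , noConf
        where
        ok : A → Bool
        ok x = not (mem x (bad H))
        M′ = filterᵇ ok (picks H)
        uH = picks-unique H r
        out : ∀ {e} → e ∈ M′ → e ∈ picks H × ok e ≡ true
        out = filterᵇ-∈ ok (picks H)
        l : ∀ a b → a + b - b ≡ a
        l = solve-∀ ℚring
        notbad : ∀ {e} → e ∈ M′ → e ∉ bad H
        notbad m b with trans (sym (proj₂ (out m))) (cong not (∈-mem b))
        ... | ()
        noPair : ∀ {e e′ p} → e ∈ M′ → e′ ∈ M′ → e ≢ e′ → p ∈ pairs e → p ∈ pairs e′ → ⊥
        noPair m m′ ne pe pe′ with clash H r (proj₁ (out m)) (proj₁ (out m′)) ne pe pe′
        ... | inj₁ b = notbad m (∈-++⁺ˡ b)
        ... | inj₂ b = notbad m′ (∈-++⁺ˡ b)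
        noConf : ∀ C → All (_∈ M′) C → confL C ≡ true → ⊥
        noConf C ms cf = go (clashC H r (ℕₚ.≤-reflexive len) C cf (All.map (λ m → ∈-pk H (proj₁ (out m))) ms))
          where
          go : Same H C → ⊥
          go (e , e′ , J , pr , s) = notbad (All.head ms′) (∈-++⁺ʳ (badPs H) (∈-map⁺ (λ x → proj₁ (proj₁ x)) (∈-filterᵇ (testC H) {(e , e′) , J}
              (∈-cartesianProduct⁺ (∈-cartesianProduct⁺ (inE (All.head ms′)) (inE (All.head (All.tail ms′)))) (confL-tup cf′ (All.map inE (All.tail (All.tail ms′))))) test)))
            where
            ms′ = All-resp-↭ pr ms
            cf′ = confL-↭ pr cf
            inE : ∀ {e} → e ∈ M′ → e ∈ E
            inE m = picks-⊆E H r (proj₁ (out m))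
            test : testC H ((e , e′) , J) ≡ true
            test = cong₂ _∧_ (trans (conf≡ e e′ J) cf′) (cong₂ _∧_ s (all-pk (All.map (λ m → ∈-pk H (proj₁ (out m))) (All.tail (All.tail ms′)))))

-- Vertex counts for minimal configurations and pairs of them.

module Conflicts where
  open import Data.Nat using (zero; suc; _+_; _*_; _≤_; _<_; _≤?_)
  open import Data.Nat.Properties
  open import Data.Nat.Tactic.RingSolver using (solve-∀)
  open import Data.Fin using (zero; suc)
  open import Data.Fin.Subset using (_⊆_)
  open import Data.Vec using ([]; _∷_)
  open import Data.List using ([]; _∷_)
  open import Data.List.Relation.Unary.All using ([]; _∷_)
  open import Data.List.Relation.Unary.AllPairs using ([]; _∷_)

  ∣∪∣+∣∩∣ : ∀ {n} (p q : Subset n) → ∣ p ∪ q ∣ + ∣ p ∩ q ∣ ≡ ∣ p ∣ + ∣ q ∣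
  ∣∪∣+∣∩∣ [] [] = refl
  ∣∪∣+∣∩∣ (true ∷ p) (true ∷ q) = trans (cong suc (trans (+-suc _ _) (cong suc (∣∪∣+∣∩∣ p q)))) (cong suc (sym (+-suc ∣ p ∣ ∣ q ∣)))
  ∣∪∣+∣∩∣ (true ∷ p) (false ∷ q) = cong suc (∣∪∣+∣∩∣ p q)
  ∣∪∣+∣∩∣ (false ∷ p) (true ∷ q) = trans (cong suc (∣∪∣+∣∩∣ p q)) (sym (+-suc ∣ p ∣ ∣ q ∣))
  ∣∪∣+∣∩∣ (false ∷ p) (false ∷ q) = ∣∪∣+∣∩∣ p q

  ∣─∣+∣∩∣ : ∀ {n} (p q : Subset n) → ∣ p ─ q ∣ + ∣ p ∩ q ∣ ≡ ∣ p ∣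
  ∣─∣+∣∩∣ [] [] = refl
  ∣─∣+∣∩∣ (true ∷ p) (true ∷ q) = trans (+-suc _ _) (cong suc (∣─∣+∣∩∣ p q))
  ∣─∣+∣∩∣ (true ∷ p) (false ∷ q) = cong suc (∣─∣+∣∩∣ p q)
  ∣─∣+∣∩∣ (false ∷ p) (true ∷ q) = ∣─∣+∣∩∣ p q
  ∣─∣+∣∩∣ (false ∷ p) (false ∷ q) = ∣─∣+∣∩∣ p q

  ∣∪─∣ : ∀ {n} (p q s : Subset n) → ∣ (p ∪ q) ─ s ∣ ≡ ∣ p ─ s ∣ + ∣ q ─ (s ∪ p) ∣
  ∣∪─∣ [] [] [] = refl
  ∣∪─∣ (true ∷ p) (true ∷ q) (true ∷ s) = ∣∪─∣ p q s
  ∣∪─∣ (true ∷ p) (true ∷ q) (false ∷ s) = cong suc (∣∪─∣ p q s)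
  ∣∪─∣ (true ∷ p) (false ∷ q) (true ∷ s) = ∣∪─∣ p q s
  ∣∪─∣ (true ∷ p) (false ∷ q) (false ∷ s) = cong suc (∣∪─∣ p q s)
  ∣∪─∣ (false ∷ p) (true ∷ q) (true ∷ s) = ∣∪─∣ p q s
  ∣∪─∣ (false ∷ p) (true ∷ q) (false ∷ s) = trans (cong suc (∣∪─∣ p q s)) (sym (+-suc ∣ p ─ s ∣ _))
  ∣∪─∣ (false ∷ p) (false ∷ q) (true ∷ s) = ∣∪─∣ p q s
  ∣∪─∣ (false ∷ p) (false ∷ q) (false ∷ s) = ∣∪─∣ p q s

  ∈─ : ∀ {n} {x : Fin n} (p q : Subset n) → x ∈ₛ p ─ q → x ∈ₛ p × x ∉ₛ q
  ∈─ {x = zero} (true ∷ p) (false ∷ q) _ = Vec.here , λ ()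
  ∈─ {x = suc x} (true ∷ p) (true ∷ q) (Vec.there m) = let (a , b) = ∈─ p q m in Vec.there a , λ { (Vec.there z) → b z }
  ∈─ {x = suc x} (true ∷ p) (false ∷ q) (Vec.there m) = let (a , b) = ∈─ p q m in Vec.there a , λ { (Vec.there z) → b z }
  ∈─ {x = suc x} (false ∷ p) (true ∷ q) (Vec.there m) = let (a , b) = ∈─ p q m in Vec.there a , λ { (Vec.there z) → b z }
  ∈─ {x = suc x} (false ∷ p) (false ∷ q) (Vec.there m) = let (a , b) = ∈─ p q m in Vec.there a , λ { (Vec.there z) → b z }

  ─-mono : ∀ {n} (p p′ q q′ : Subset n) → p ⊆ p′ → q′ ⊆ q → ∣ p ─ q ∣ ≤ ∣ p′ ─ q′ ∣
  ─-mono p p′ q q′ a b = p⊆q⇒∣p∣≤∣q∣ (λ m → let (x , y) = ∈─ p q m in x∈p∧x∉q⇒x∈p─q (a x) (λ z → y (b z)))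

  ∣─∣ : ∀ {n} (p q : Subset n) → q ⊆ p → ∣ p ─ q ∣ + ∣ q ∣ ≤ ∣ p ∣
  ∣─∣ p q s = ≤-trans (+-monoʳ-≤ ∣ p ─ q ∣ (p⊆q⇒∣p∣≤∣q∣ (λ m → x∈p∩q⁺ (s m , m)))) (≤-reflexive (∣─∣+∣∩∣ p q))

  ∈⋃ : ∀ {n} {x : Fin n} {e C} → e ∈ C → x ∈ₛ e → x ∈ₛ ⋃ C
  ∈⋃ (here refl) m = x∈p∪q⁺ (inj₁ m)
  ∈⋃ (there i) m = x∈p∪q⁺ (inj₂ (∈⋃ i m))

  ⋃∈ : ∀ {n} {x : Fin n} C → x ∈ₛ ⋃ C → ∃ λ e → e ∈ C × x ∈ₛ e
  ⋃∈ [] m = ⊥-elim (∉⊥ m)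
  ⋃∈ (e ∷ C) m with x∈p∪q⁻ e (⋃ C) m
  ... | inj₁ a = e , here refl , a
  ... | inj₂ b = let (e′ , i , a) = ⋃∈ C b in e′ , there i , a

  ⋃-mono : ∀ {n} {C C′ : List (Subset n)} → (∀ {e} → e ∈ C → e ∈ C′) → ⋃ C ⊆ ⋃ C′
  ⋃-mono {C = C} f m = let (e , i , a) = ⋃∈ C m in ∈⋃ (f i) a

  unique-⊂ : ∀ {X : Set} {xs ys : List X} → Unique xs → (∀ {x} → x ∈ xs → x ∈ ys) → length xs ≤ length ys
  unique-⊂ [] _ = z≤n
  unique-⊂ {xs = x ∷ xs} {ys} (al ∷ u) f with ∈-∃++ (f (here refl))
  ... | as , bs , refl = ≤-trans (s≤s (unique-⊂ u g)) (≤-reflexive (trans (cong suc (length-++ as)) (trans (sym (+-suc (length as) (length bs))) (sym (length-++ as)))))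
    where
    g : ∀ {z} → z ∈ xs → z ∈ as ++ bs
    g m with ∈-++⁻ as (f (there m))
    ... | inj₁ p = ∈-++⁺ˡ p
    ... | inj₂ (here refl) = ⊥-elim (All.lookup al m refl)
    ... | inj₂ (there p) = ∈-++⁺ʳ as p

  module _ {X : Set} (f : X → Bool) where
    filter-in : ∀ {x} xs → x ∈ filterᵇ f xs → x ∈ xs × f x ≡ true
    filter-in (y ∷ xs) m with f y in eq
    filter-in (y ∷ xs) (here refl) | true = here refl , eq
    filter-in (y ∷ xs) (there m) | true = let (a , b) = filter-in xs m in there a , b
    ... | false = let (a , b) = filter-in xs m in there a , b

    in-filter : ∀ {x xs} → x ∈ xs → f x ≡ true → x ∈ filterᵇ f xs
    in-filter {x} {y ∷ xs} (here refl) p rewrite p = here refl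
    in-filter {x} {y ∷ xs} (there m) p with f y
    ... | true = there (in-filter m p)
    ... | false = in-filter m p

    filter-u : ∀ {xs} → Unique xs → Unique (filterᵇ f xs)
    filter-u [] = []
    filter-u {x ∷ xs} (al ∷ u) with f x
    ... | true = All.tabulate (λ m → All.lookup al (proj₁ (filter-in xs m))) ∷ filter-u u
    ... | false = filter-u u

    filter-len : ∀ xs → length (filterᵇ f xs) + length (filterᵇ (λ x → not (f x)) xs) ≡ length xs
    filter-len [] = refl
    filter-len (x ∷ xs) with f x
    ... | true = cong suc (filter-len xs)
    ... | false = trans (+-suc _ _) (cong suc (filter-len xs))

  empty : ∀ {X : Set} {x : X} {xs} → x ∈ xs → 1 ≤ length xs
  empty (here _) = s≤s z≤n
  empty (there _) = s≤s z≤n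

  inhabited : ∀ {X : Set} {xs : List X} {m} → length xs ≡ suc m → ∃ λ x → x ∈ xs
  inhabited {xs = x ∷ _} _ = x , here refl

  nil : ∀ {X : Set} {xs : List X} → length xs ≤ 0 → ∀ {x} → x ∈ xs → Empty
  nil {xs = xs} p m with ≤-trans (empty m) p
  ... | ()

  module Config {n : ℕ} (t k : ℕ) (1≤t : 1 ≤ t) (mem : Subset n → List (Subset n) → Bool)
    (mem-∈ : ∀ {x ys} → mem x ys ≡ true → x ∈ ys) (∈-mem : ∀ {x ys} → x ∈ ys → mem x ys ≡ true) where

    Edge : Set
    Edge = Subset n

    -- A minimal configuration of excess at most two.
    record IsConf (C : List Edge) : Set where
      field
        3≤ : 3 ≤ length C
        ≤k : length C ≤ k
        uniq : Unique C
        card : ∀ {e} → e ∈ C → ∣ e ∣ ≡ 2 + t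
        small : ∣ ⋃ C ∣ ≤ t * length C + 2
        proper : ∀ D → Unique D → (∀ {e} → e ∈ D → e ∈ C) → 2 ≤ length D → length D < length C → t * length D + 3 ≤ ∣ ⋃ D ∣

    open IsConf

    notmem : ∀ {x ys} → mem x ys ≡ false → x ∉ ys
    notmem p m with trans (sym p) (∈-mem m)
    ... | ()

    mem? : ∀ x ys → x ∈ ys ⊎ x ∉ ys
    mem? x ys with mem x ys in eq
    ... | true = inj₁ (mem-∈ eq)
    ... | false = inj₂ (notmem eq)

    not-true : ∀ {b} → not b ≡ true → b ≡ false
    not-true {false} _ = refl

    _∖_ : List Edge → List Edge → List Edge
    C ∖ F = filterᵇ (λ x → not (mem x F)) C

    _⋒_ : List Edge → List Edge → List Edge
    C ⋒ F = filterᵇ (λ x → mem x F) C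

    ∈∖ : ∀ {x} C F → x ∈ C ∖ F → x ∈ C × x ∉ F
    ∈∖ C F m = let (a , b) = filter-in (λ x → not (mem x F)) C m in a , notmem (not-true b)

    ∖∈ : ∀ {x C F} → x ∈ C → x ∉ F → x ∈ C ∖ F
    ∖∈ {x} {C} {F} m nm = in-filter (λ x → not (mem x F)) m (lem (mem x F) refl)
      where
      lem : ∀ b → mem x F ≡ b → not (mem x F) ≡ true
      lem true p = ⊥-elim (nm (mem-∈ p))
      lem false p = cong not p

    ∈⋒ : ∀ {x} C F → x ∈ C ⋒ F → x ∈ C × x ∈ F
    ∈⋒ C F m = let (a , b) = filter-in (λ x → mem x F) C m in a , mem-∈ b

    ⋒∈ : ∀ {x C F} → x ∈ C → x ∈ F → x ∈ C ⋒ F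
    ⋒∈ {F = F} m m′ = in-filter (λ x → mem x F) m (∈-mem m′)

    u∖ : ∀ C F → Unique C → Unique (C ∖ F)
    u∖ C F = filter-u (λ x → not (mem x F))

    u⋒ : ∀ C F → Unique C → Unique (C ⋒ F)
    u⋒ C F = filter-u (λ x → mem x F)

    len-split : ∀ C F → length (C ⋒ F) + length (C ∖ F) ≡ length C
    len-split C F = filter-len (λ x → mem x F) C

    -- The part of `C` inside `F` spans many vertices: at least `t` per edge plus 3 if it has two or
    -- more edges and is proper, and `t` plus 2 if it is one edge. As `C` spans at most `t` per edge
    -- plus 2, its other edges bring at most `t` new vertices each, and one fewer in total in the
    -- former case.
    part : ∀ {C} → IsConf C → ∀ F {S : Subset n} → ⋃ (C ⋒ F) ⊆ S →
      (length (C ∖ F) ≡ 0 → ∣ ⋃ C ─ S ∣ ≡ 0) ×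
      (2 ≤ length (C ⋒ F) → 1 ≤ length (C ∖ F) → ∣ ⋃ C ─ S ∣ + 1 ≤ t * length (C ∖ F)) ×
      (1 ≤ length (C ⋒ F) → ∣ ⋃ C ─ S ∣ ≤ t * length (C ∖ F))
    part {C} cf F {S} sub = zer , big , any
      where
      X = C ⋒ F
      fl = length (C ∖ F)
      X⊆ : ∀ {e} → e ∈ X → e ∈ C
      X⊆ m = proj₁ (∈⋒ C F m)
      bound : ∣ ⋃ C ─ S ∣ + ∣ ⋃ X ∣ ≤ ∣ ⋃ C ∣
      bound = ≤-trans (+-monoˡ-≤ _ (─-mono (⋃ C) (⋃ C) S (⋃ X) (λ z → z) sub)) (∣─∣ (⋃ C) (⋃ X) (⋃-mono X⊆))
      zer : fl ≡ 0 → ∣ ⋃ C ─ S ∣ ≡ 0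
      zer z = n≤0⇒n≡0 (+-cancelʳ-≤ ∣ ⋃ C ∣ _ 0 (≤-trans (+-monoʳ-≤ _ (p⊆q⇒∣p∣≤∣q∣ (⋃-mono all))) bound))
        where
        all : ∀ {e} → e ∈ C → e ∈ X
        all {e} m with mem? e F
        ... | inj₁ a = ⋒∈ m a
        ... | inj₂ b = ⊥-elim (nil (≤-reflexive z) (∖∈ m b))
      big : 2 ≤ length X → 1 ≤ fl → ∣ ⋃ C ─ S ∣ + 1 ≤ t * fl
      big 2≤ 1≤ = +-cancelʳ-≤ (t * length X + 2) _ _ (≤-trans (≤-reflexive (l1 ∣ ⋃ C ─ S ∣ (t * length X)))
        (≤-trans (+-monoʳ-≤ ∣ ⋃ C ─ S ∣ (proper cf X (u⋒ C F (uniq cf)) X⊆ 2≤ (≤-trans (m<m+n (length X) 1≤) (≤-reflexive (len-split C F)))))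
          (≤-trans bound (≤-trans (small cf) (≤-reflexive (trans (cong (λ z → t * z + 2) (sym (len-split C F))) (l2 t (length X) fl)))))))
        where
        l1 : ∀ a b → a + 1 + (b + 2) ≡ a + (b + 3)
        l1 = solve-∀
        l2 : ∀ t x f → t * (x + f) + 2 ≡ t * f + (t * x + 2)
        l2 = solve-∀
      any : 1 ≤ length X → ∣ ⋃ C ─ S ∣ ≤ t * fl
      any 1≤ with fl in eqf | length X in eqX
      ... | zero | _ = ≤-trans (≤-reflexive (zer eqf)) z≤n
      ... | suc f | suc (suc x) = ≤-trans (m≤m+n _ 1) (≤-trans (big (subst (2 ≤_) (sym eqX) (s≤s (s≤s z≤n))) (subst (1 ≤_) (sym eqf) (s≤s z≤n))) (≤-reflexive (cong (t *_) eqf)))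
      ... | suc f | suc zero = +-cancelʳ-≤ (2 + t) _ _ (≤-trans (+-monoʳ-≤ _ r≤) (≤-trans bound (≤-trans (small cf)
            (≤-reflexive (trans (cong (λ z → t * z + 2) (trans (sym (len-split C F)) (cong₂ _+_ eqX eqf))) (l t (suc f)))))))
        where
        l : ∀ t f → t * (1 + f) + 2 ≡ t * f + (2 + t)
        l = solve-∀
        elt : ∃ λ e → e ∈ X
        elt = inhabited eqX
        r≤ : 2 + t ≤ ∣ ⋃ X ∣
        r≤ = ≤-trans (≤-reflexive (sym (card cf (X⊆ (proj₂ elt))))) (p⊆q⇒∣p∣≤∣q∣ (λ m → ∈⋃ (proj₂ elt) m))

    -- A configuration has at least three edges, so two of them form a proper part and span at least
    -- 2t + 3 vertices.
    share≤1 : ∀ {C e x} → IsConf C → e ∈ C → x ∈ C → e ≢ x → ∣ e ∩ x ∣ ≤ 1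
    share≤1 {C} {e} {x} cf e∈ x∈ ne = +-cancelˡ-≤ (t * 2 + 3) _ _ (≤-trans (+-monoˡ-≤ ∣ e ∩ x ∣ two) (≤-reflexive (trans (cong (λ z → ∣ e ∪ z ∣ + ∣ e ∩ x ∣) (∪-identityʳ x)) (trans (∣∪∣+∣∩∣ e x) (trans (cong₂ _+_ (card cf e∈) (card cf x∈)) (l t))))))
      where
      l : ∀ t → 2 + t + (2 + t) ≡ t * 2 + 3 + 1
      l = solve-∀
      sub : ∀ {z} → z ∈ e ∷ x ∷ [] → z ∈ C
      sub (here refl) = e∈
      sub (there (here refl)) = x∈
      two : t * 2 + 3 ≤ ∣ ⋃ (e ∷ x ∷ []) ∣
      two = proper cf (e ∷ x ∷ []) ((ne ∷ []) ∷ [] ∷ []) sub (s≤s (s≤s z≤n)) (3≤ cf)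

    front≢ : ∀ {e x : Edge} {J} → Unique (e ∷ x ∷ J) → e ≢ x
    front≢ ((ne ∷ _) ∷ _) = ne

    f-tail : ∀ {C₀ F J y} x J₁ → C₀ ≡ y ∷ x ∷ J₁ → y ∈ F → (∀ {z} → z ∈ J → z ∈ F) → Unique J₁ → length (C₀ ∖ F) ≤ 1 + length (J₁ ∖ J)
    f-tail {C₀} {F} {J} {y} x J₁ refl y∈ J⊆ u with mem y F | ∈-mem y∈
    ... | true | _ with mem x F
    ...   | true = ≤-trans (unique-⊂ (u∖ J₁ F u) sub) (n≤1+n _)
      where
      sub : ∀ {z} → z ∈ J₁ ∖ F → z ∈ J₁ ∖ J
      sub m = let (a , b) = ∈∖ J₁ F m in ∖∈ a (λ z → b (J⊆ z))
    ...   | false = s≤s (unique-⊂ (u∖ J₁ F u) sub)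
      where
      sub : ∀ {z} → z ∈ J₁ ∖ F → z ∈ J₁ ∖ J
      sub m = let (a , b) = ∈∖ J₁ F m in ∖∈ a (λ z → b (J⊆ z))

    u-tl : ∀ {X : Set} {x : X} {xs} → Unique (x ∷ xs) → Unique xs
    u-tl (_ ∷ u) = u

    -- A pair and an edge killed by the same `x`. The only case not settled by `part` is that `C`
    -- meets the fixed edges in `e` alone. Then `p`, which lies in `x`, meets `e` in at most one
    -- vertex, so it fixes a further vertex of `C` and saves it from the count.
    RF : ∀ {e x J₁ J} (p : Subset n) → IsConf (e ∷ x ∷ J₁) → p ⊆ x → 2 ≤ ∣ p ∣ →
      ∣ ⋃ (x ∷ J₁) ─ (⋃ (e ∷ J) ∪ p) ∣ + 1 ≤ t * (1 + length (J₁ ∖ J))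
    RF {e} {x} {J₁} {J} p cf p⊆x 2≤p = ≤-trans (+-monoˡ-≤ 1 (─-mono (⋃ (x ∷ J₁)) (⋃ C) S S (q⊆p∪q e (⋃ (x ∷ J₁))) (λ z → z))) main
      where
      C = e ∷ x ∷ J₁
      F = e ∷ J
      S = ⋃ F ∪ p
      e∈X : e ∈ C ⋒ F
      e∈X = ⋒∈ {C = C} (here refl) (here refl)
      fl≤ : length (C ∖ F) ≤ 1 + length (J₁ ∖ J)
      fl≤ = f-tail x J₁ refl (here refl) there (u-tl (u-tl (uniq cf)))
      sub : ⋃ (C ⋒ F) ⊆ S
      sub m = p⊆p∪q p (⋃-mono (λ z → proj₂ (∈⋒ C F z)) m)
      pt = part cf F sub
      main : ∣ ⋃ C ─ S ∣ + 1 ≤ t * (1 + length (J₁ ∖ J))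
      main with length (C ∖ F) in eqf | length (C ⋒ F) in eqX
      ... | suc f | suc (suc y) = ≤-trans (proj₁ (proj₂ pt) (subst (2 ≤_) (sym eqX) (s≤s (s≤s z≤n))) (subst (1 ≤_) (sym eqf) (s≤s z≤n))) (*-monoʳ-≤ t fl≤)
      ... | _ | zero = ⊥-elim (nil (≤-reflexive eqX) e∈X)
      ... | zero | suc y = ≤-trans (≤-reflexive (cong (_+ 1) (proj₁ pt eqf))) (≤-trans 1≤t (m≤m*n t (1 + length (J₁ ∖ J))))
      ... | suc f | suc zero = ≤-trans (+-cancelʳ-≤ (2 + t) _ _ (≤-trans (≤-reflexive (+-assoc ∣ ⋃ C ─ S ∣ 1 (2 + t)))
          (≤-trans (+-monoʳ-≤ ∣ ⋃ C ─ S ∣ ep) (≤-trans (≤-trans (+-monoˡ-≤ ∣ e ∪ p ∣ (─-mono (⋃ C) (⋃ C) S (e ∪ p) (λ z → z) epS)) (∣─∣ (⋃ C) (e ∪ p) epC)) (≤-trans (small cf) (≤-reflexive (trans (cong (λ z → t * z + 2) (trans (sym (len-split C F)) (cong₂ _+_ eqX eqf))) (l t (suc f)))))))))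
          (≤-trans (≤-reflexive (cong (t *_) (sym eqf))) (*-monoʳ-≤ t fl≤))
        where
        l : ∀ t f → t * (1 + f) + 2 ≡ t * f + (2 + t)
        l = solve-∀
        ep : 1 + (2 + t) ≤ ∣ e ∪ p ∣
        ep = +-cancelʳ-≤ 1 _ _ (≤-trans (≤-reflexive (l2 t)) (≤-trans (+-mono-≤ (≤-reflexive (sym (card cf (here refl)))) 2≤p)
             (≤-trans (≤-reflexive (sym (∣∪∣+∣∩∣ e p))) (+-monoʳ-≤ ∣ e ∪ p ∣ (≤-trans (p⊆q⇒∣p∣≤∣q∣ (λ m → let (a , b) = x∈p∩q⁻ e p m in x∈p∩q⁺ (a , p⊆x b))) (share≤1 cf (here refl) (there (here refl)) (front≢ (uniq cf))))))))
          where
          l2 : ∀ t → 1 + (2 + t) + 1 ≡ 2 + t + 2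
          l2 = solve-∀
        epC : e ∪ p ⊆ ⋃ C
        epC m with x∈p∪q⁻ e p m
        ... | inj₁ a = ∈⋃ {C = C} (here refl) a
        ... | inj₂ b = ∈⋃ {C = C} (there (here refl)) (p⊆x b)
        epS : e ∪ p ⊆ S
        epS m with x∈p∪q⁻ e p m
        ... | inj₁ a = p⊆p∪q p (∈⋃ {C = F} (here refl) a)
        ... | inj₂ b = q⊆p∪q (⋃ F) p b

    -- Two edges threatened by the same `x`. Add `C₁` first and `C₂` on top of it. If `C₂` has a new
    -- edge, it saves a vertex, because it already shares `e′` and `x` with what is present. If it
    -- has none, `C₁` must save the vertex, which it does when it meets the fixed edges twice or has
    -- no new edge; the remaining case is `stuck`.
    FF : ∀ {e e′ x J₁ J₂ J} → IsConf (e ∷ x ∷ J₁) → IsConf (e′ ∷ x ∷ J₂) → e ≢ e′ → ∣ e ∩ e′ ∣ ≤ 2 →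
      ∣ ⋃ (x ∷ J₁ ++ J₂) ─ ⋃ (e ∷ e′ ∷ J) ∣ + 1 ≤ t * (1 + length (J₁ ∖ J) + length (J₂ ∖ (J ++ J₁)))
    FF {e} {e′} {x} {J₁} {J₂} {J} cf₁ cf₂ e≢e′ ee′ = ≤-trans (+-monoˡ-≤ 1 ν≤) main
      where
      C₁ = e ∷ x ∷ J₁
      C₂ = e′ ∷ x ∷ J₂
      F = e ∷ e′ ∷ J
      S = ⋃ F
      F₂ = F ++ C₁
      f₁ = length (C₁ ∖ F)
      f₂ = length (C₂ ∖ F₂)
      a = length (J₁ ∖ J)
      b = length (J₂ ∖ (J ++ J₁))
      V₁ = ⋃ C₁
      V₂ = ⋃ C₂
      ν≤ : ∣ ⋃ (x ∷ J₁ ++ J₂) ─ S ∣ ≤ ∣ V₁ ─ S ∣ + ∣ V₂ ─ (S ∪ V₁) ∣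
      ν≤ = ≤-trans (─-mono (⋃ (x ∷ J₁ ++ J₂)) (V₁ ∪ V₂) S S sub (λ z → z)) (≤-reflexive (∣∪─∣ V₁ V₂ S))
        where
        sub : ⋃ (x ∷ J₁ ++ J₂) ⊆ V₁ ∪ V₂
        sub m with ⋃∈ (x ∷ J₁ ++ J₂) m
        ... | _ , here refl , z = x∈p∪q⁺ (inj₁ (∈⋃ {C = C₁} (there (here refl)) z))
        ... | y , there i , z with ∈-++⁻ J₁ i
        ...   | inj₁ i₁ = x∈p∪q⁺ (inj₁ (∈⋃ {C = C₁} (there (there i₁)) z))
        ...   | inj₂ i₂ = x∈p∪q⁺ (inj₂ (∈⋃ {C = C₂} (there (there i₂)) z))
      f₁≤ : f₁ ≤ 1 + a
      f₁≤ = f-tail x J₁ refl (here refl) (λ z → there (there z)) (u-tl (u-tl (uniq cf₁)))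
      x∈₁ : x ∈ C₁
      x∈₁ = there (here refl)
      x∈₂ : x ∈ C₂
      x∈₂ = there (here refl)
      f₂≤ : f₂ ≤ b
      f₂≤ = unique-⊂ (u∖ C₂ F₂ (uniq cf₂)) sub
        where
        sub : ∀ {z} → z ∈ C₂ ∖ F₂ → z ∈ J₂ ∖ (J ++ J₁)
        sub m with ∈∖ C₂ F₂ m
        ... | here refl , nm = ⊥-elim (nm (there (here refl)))
        ... | there (here refl) , nm = ⊥-elim (nm (∈-++⁺ʳ F x∈₁))
        ... | there (there i) , nm = ∖∈ i (λ w → nm (case (∈-++⁻ J w)))
          where
          case : ∀ {z} → z ∈ J ⊎ z ∈ J₁ → z ∈ F₂
          case (inj₁ p) = there (there (∈-++⁺ˡ p))
          case (inj₂ p) = ∈-++⁺ʳ F (there (there p))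
      e∈X : e ∈ C₁ ⋒ F
      e∈X = ⋒∈ {C = C₁} (here refl) (here refl)
      pt₁ = part cf₁ F {S} (⋃-mono (λ z → proj₂ (∈⋒ C₁ F z)))
      pt₂ = part cf₂ F₂ {S ∪ V₁} sub
        where
        sub : ⋃ (C₂ ⋒ F₂) ⊆ S ∪ V₁
        sub m with ⋃∈ (C₂ ⋒ F₂) m
        ... | y , i , z with ∈-++⁻ F (proj₂ (∈⋒ C₂ F₂ i))
        ...   | inj₁ p = x∈p∪q⁺ (inj₁ (∈⋃ p z))
        ...   | inj₂ p = x∈p∪q⁺ (inj₂ (∈⋃ p z))
      two₂ : 2 ≤ length (C₂ ⋒ F₂)
      two₂ = ≤-trans (≤-reflexive refl) (unique-⊂ {xs = e′ ∷ x ∷ []} (u2 (uniq cf₂)) sub)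
        where
        u2 : ∀ {e x} {J : List Edge} → Unique (e ∷ x ∷ J) → Unique (e ∷ x ∷ [])
        u2 ((p ∷ _) ∷ _) = (p ∷ []) ∷ [] ∷ []
        sub : ∀ {z} → z ∈ e′ ∷ x ∷ [] → z ∈ C₂ ⋒ F₂
        sub (here refl) = ⋒∈ {C = C₂} (here refl) (there (here refl))
        sub (there (here refl)) = ⋒∈ {C = C₂} x∈₂ (∈-++⁺ʳ F x∈₁)
      ν₁≤ : ∣ V₁ ─ S ∣ ≤ t * f₁
      ν₁≤ = proj₂ (proj₂ pt₁) (empty e∈X)
      ν₂≤ : ∣ V₂ ─ (S ∪ V₁) ∣ ≤ t * f₂
      ν₂≤ = proj₂ (proj₂ pt₂) (≤-trans (s≤s z≤n) two₂)
      tot : t * f₁ + t * f₂ ≤ t * (1 + a + b)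
      tot = ≤-trans (≤-reflexive (sym (*-distribˡ-+ t f₁ f₂))) (*-monoʳ-≤ t (+-mono-≤ f₁≤ f₂≤))
      gain₁ : ∣ V₁ ─ S ∣ + 1 ≤ t * f₁ → ∣ V₁ ─ S ∣ + ∣ V₂ ─ (S ∪ V₁) ∣ + 1 ≤ t * (1 + a + b)
      gain₁ g = ≤-trans (≤-reflexive (l (∣ V₁ ─ S ∣) (∣ V₂ ─ (S ∪ V₁) ∣))) (≤-trans (+-mono-≤ g ν₂≤) tot)
        where
        l : ∀ x y → x + y + 1 ≡ x + 1 + y
        l = solve-∀
      -- If C₂ brings nothing new and C₁ meets the fixed part only in e, the fixed part still meets C₁ outside e.
      stuck : f₂ ≡ 0 → length (C₁ ⋒ F) ≡ 1 → t * f₁ ≤ ∣ V₁ ─ S ∣ → Empty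
      stuck z₂ z₁ ge = go (mem? e C₂)
        where
        len₁ : length C₁ ≡ 1 + f₁
        len₁ = trans (sym (len-split C₁ F)) (cong (_+ f₁) z₁)
        V₁∩S : ∣ V₁ ∩ S ∣ ≤ 2 + t
        V₁∩S = +-cancelˡ-≤ (t * f₁) _ _ (≤-trans (+-monoˡ-≤ _ ge) (≤-trans (≤-reflexive (∣─∣+∣∩∣ V₁ S)) (≤-trans (small cf₁) (≤-reflexive (trans (cong (λ z → t * z + 2) len₁) (l t f₁))))))
          where
          l : ∀ t f → t * (1 + f) + 2 ≡ t * f + (2 + t)
          l = solve-∀
        e⊆V₁S : e ⊆ V₁ ∩ S
        e⊆V₁S m = x∈p∩q⁺ (∈⋃ {C = C₁} (here refl) m , ∈⋃ {C = F} (here refl) m)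
        V₁S⊆e : V₁ ∩ S ⊆ e
        V₁S⊆e {y} m with y ∈? e
        ... | yes p = p
        ... | no np = ⊥-elim (<-irrefl refl (<-≤-trans (s≤s (≤-reflexive (sym (card cf₁ (here refl))))) (≤-trans (p⊂q⇒∣p∣<∣q∣ (e⊆V₁S , y , m , np)) V₁∩S)))
        V₁≥ : t * length C₁ + 2 ≤ ∣ V₁ ∣
        V₁≥ = ≤-trans (≤-reflexive (trans (cong (λ z → t * z + 2) len₁) (l t f₁))) (≤-trans (+-mono-≤ ge (≤-trans (≤-reflexive (sym (card cf₁ (here refl)))) (p⊆q⇒∣p∣≤∣q∣ e⊆V₁S))) (≤-reflexive (∣─∣+∣∩∣ V₁ S)))
          where
          l : ∀ t f → t * (1 + f) + 2 ≡ t * f + (2 + t)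
          l = solve-∀
        Z = C₂ ⋒ C₁
        F′ = C₂ ∖ C₁
        lenZF : length Z + length F′ ≡ length C₂
        lenZF = len-split C₂ C₁
        e′∉C₁ : e′ ∉ C₁
        e′∉C₁ m = 2≰1 (≤-trans (unique-⊂ {xs = e ∷ e′ ∷ []} ((e≢e′ ∷ []) ∷ [] ∷ []) sub) (≤-reflexive z₁))
          where
          2≰1 : ¬ (2 ≤ 1)
          2≰1 (s≤s ())
          sub : ∀ {z} → z ∈ e ∷ e′ ∷ [] → z ∈ C₁ ⋒ F
          sub (here refl) = e∈X
          sub (there (here refl)) = ⋒∈ {C = C₁} m (there (here refl))
        e′∈F′ : e′ ∈ F′
        e′∈F′ = ∖∈ {C = C₂} (here refl) e′∉C₁
        x∈Z : x ∈ Z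
        x∈Z = ⋒∈ {C = C₂} x∈₂ x∈₁
        Z⊆₂ : ∀ {z} → z ∈ Z → z ∈ C₂
        Z⊆₂ m = proj₁ (∈⋒ C₂ C₁ m)
        Z⊆₁ : ∀ {z} → z ∈ Z → z ∈ C₁
        Z⊆₁ m = proj₂ (∈⋒ C₂ C₁ m)
        F′⊆₂ : ∀ {z} → z ∈ F′ → z ∈ C₂
        F′⊆₂ m = proj₁ (∈∖ C₂ C₁ m)
        uZ = filter-u (λ z → mem z C₁) (uniq cf₂)
        uF′ = filter-u (λ z → not (mem z C₁)) (uniq cf₂)
        F′⊆F : ∀ {z} → z ∈ F′ → z ∈ F
        F′⊆F {z} m with mem? z F₂
        ... | inj₂ nm = ⊥-elim (nil (≤-reflexive z₂) (∖∈ (F′⊆₂ m) nm))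
        ... | inj₁ p with ∈-++⁻ F p
        ...   | inj₁ q = q
        ...   | inj₂ q = ⊥-elim (proj₂ (∈∖ C₂ C₁ m) q)
        ∩⊆e : ⋃ Z ∩ ⋃ F′ ⊆ e
        ∩⊆e m = let (a , b) = x∈p∩q⁻ (⋃ Z) (⋃ F′) m in V₁S⊆e (x∈p∩q⁺ (⋃-mono Z⊆₁ a , ⋃-mono F′⊆F b))
        V₂≥ : ∣ ⋃ Z ∣ + ∣ ⋃ F′ ∣ ≤ ∣ V₂ ∣ + ∣ ⋃ Z ∩ ⋃ F′ ∣
        V₂≥ = ≤-trans (≤-reflexive (sym (∣∪∣+∣∩∣ (⋃ Z) (⋃ F′)))) (+-monoˡ-≤ _ (p⊆q⇒∣p∣≤∣q∣ sub))
          where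
          sub : ⋃ Z ∪ ⋃ F′ ⊆ V₂
          sub m with x∈p∪q⁻ (⋃ Z) (⋃ F′) m
          ... | inj₁ a = ⋃-mono Z⊆₂ a
          ... | inj₂ b = ⋃-mono F′⊆₂ b
        V₂≤ : ∣ V₂ ∣ ≤ t * (length Z + length F′) + 2
        V₂≤ = ≤-trans (small cf₂) (≤-reflexive (cong (λ z → t * z + 2) (sym lenZF)))
        Z<C₂ : length Z < length C₂
        Z<C₂ = ≤-trans (m<m+n (length Z) (empty e′∈F′)) (≤-reflexive lenZF)
        ∣e∣ : ∣ e ∣ ≡ 2 + t
        ∣e∣ = card cf₁ (here refl)
        go : e ∈ C₂ ⊎ e ∉ C₂ → Empty
        -- `Z` and `e ∷ F′` are proper parts of `C₂`, each with excess at least three, and their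
        -- vertex sets overlap only inside `e`; glued along `e` they exceed the size of `C₂`.
        go (inj₁ e∈₂) = <-irrefl refl (≤-trans (≤-reflexive (l₁ t (length Z) (length F′))) (+-cancelʳ-≤ (2 + t + ∣ e ∩ ⋃ F′ ∣) _ _ chain))
          where
          e∈Z : e ∈ Z
          e∈Z = ⋒∈ {C = C₂} e∈₂ (here refl)
          Z2 : 2 ≤ length Z
          Z2 = unique-⊂ {xs = e ∷ x ∷ []} (u2 (uniq cf₁)) sub
            where
            u2 : ∀ {e x} {J : List Edge} → Unique (e ∷ x ∷ J) → Unique (e ∷ x ∷ [])
            u2 ((p ∷ _) ∷ _) = (p ∷ []) ∷ [] ∷ []
            sub : ∀ {z} → z ∈ e ∷ x ∷ [] → z ∈ Z
            sub (here refl) = e∈Z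
            sub (there (here refl)) = x∈Z
          Z≥ : t * length Z + 3 ≤ ∣ ⋃ Z ∣
          Z≥ = proper cf₂ Z uZ Z⊆₂ Z2 Z<C₂
          G≥ : t * (1 + length F′) + 3 ≤ ∣ e ∪ ⋃ F′ ∣
          G≥ = proper cf₂ (e ∷ F′) (All.tabulate (λ m r → proj₂ (∈∖ C₂ C₁ m) (subst (_∈ C₁) r (here refl))) ∷ uF′)
                (λ { (here refl) → e∈₂ ; (there m) → F′⊆₂ m }) (s≤s (empty e′∈F′)) (≤-trans (+-monoˡ-≤ (length F′) Z2) (≤-reflexive lenZF))
          chain : t * (length Z + length F′) + 2 + 1 + (2 + t + ∣ e ∩ ⋃ F′ ∣) ≤ t * (length Z + length F′) + 2 + (2 + t + ∣ e ∩ ⋃ F′ ∣)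
          chain = ≤-trans (≤-trans (n≤1+n _) (≤-reflexive (l₂ t (length Z) (length F′) ∣ e ∩ ⋃ F′ ∣)))
            (≤-trans (+-monoˡ-≤ ∣ e ∩ ⋃ F′ ∣ (+-mono-≤ Z≥ G≥))
            (≤-trans (≤-reflexive (trans (+-assoc ∣ ⋃ Z ∣ _ _) (trans (cong (∣ ⋃ Z ∣ +_) (trans (∣∪∣+∣∩∣ e (⋃ F′)) (cong (_+ ∣ ⋃ F′ ∣) ∣e∣))) (l₃ (∣ ⋃ Z ∣) t (∣ ⋃ F′ ∣)))))
            (≤-trans (+-monoʳ-≤ (2 + t) V₂≥)
            (≤-trans (+-monoʳ-≤ (2 + t) (+-mono-≤ V₂≤ (p⊆q⇒∣p∣≤∣q∣ {q = e ∩ ⋃ F′} (λ m → x∈p∩q⁺ (∩⊆e m , proj₂ (x∈p∩q⁻ (⋃ Z) (⋃ F′) m))))))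
            (≤-reflexive (l₄ t (t * (length Z + length F′)) ∣ e ∩ ⋃ F′ ∣))))))
            where
            l₂ : ∀ t z f i → suc (t * (z + f) + 2 + 1 + (2 + t + i)) ≡ t * z + 3 + (t * (1 + f) + 3) + i
            l₂ = solve-∀
            l₃ : ∀ z t f → z + (2 + t + f) ≡ 2 + t + (z + f)
            l₃ = solve-∀
            l₄ : ∀ t x i → 2 + t + (x + 2 + i) ≡ x + 2 + (2 + t + i)
            l₄ = solve-∀
          l₁ : ∀ t z f → suc (t * (z + f) + 2) ≡ t * (z + f) + 2 + 1
          l₁ = solve-∀
        -- Now `e ∷ Z` lies in `C₁` and spans many vertices, which limits how much of `e` the set
        -- `Z` can cover. The overlap of `Z` and `F′` lies inside `e` and is limited with it, so
        -- `F′` is too dense to be a proper part of two or more edges.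
        go (inj₂ e∉₂) = fin (length F′) refl
          where
          e∉Z : e ∉ Z
          e∉Z m = e∉₂ (Z⊆₂ m)
          ueZ : Unique (e ∷ Z)
          ueZ = All.tabulate (λ m r → e∉Z (subst (_∈ Z) (sym r) m)) ∷ uZ
          eZ⊆ : ∀ {z} → z ∈ e ∷ Z → z ∈ C₁
          eZ⊆ (here refl) = here refl
          eZ⊆ (there m) = Z⊆₁ m
          eZ≥ : t * (1 + length Z) + 2 ≤ ∣ e ∪ ⋃ Z ∣
          eZ≥ with suc (length Z) Data.Nat.<? length C₁
          ... | yes lt = ≤-trans (+-monoʳ-≤ (t * (1 + length Z)) (n≤1+n 2)) (proper cf₁ (e ∷ Z) ueZ eZ⊆ (s≤s (empty x∈Z)) lt)
          ... | no nlt = ≤-trans (+-monoˡ-≤ 2 (*-monoʳ-≤ t (unique-⊂ ueZ eZ⊆))) (≤-trans V₁≥ (p⊆q⇒∣p∣≤∣q∣ (⋃-mono all)))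
            where
            all : ∀ {z} → z ∈ C₁ → z ∈ e ∷ Z
            all {z} m with mem? z (e ∷ Z)
            ... | inj₁ p = p
            ... | inj₂ np = ⊥-elim (nlt (unique-⊂ {xs = z ∷ e ∷ Z} (All.tabulate (λ m′ r → np (subst (_∈ e ∷ Z) (sym r) m′)) ∷ ueZ) (λ { (here refl) → m ; (there m′) → eZ⊆ m′ })))
          o≤ : ∣ ⋃ Z ∩ ⋃ F′ ∣ + t * length Z ≤ ∣ ⋃ Z ∣
          o≤ = +-cancelʳ-≤ (2 + t) _ _ (≤-trans (≤-reflexive (l ∣ ⋃ Z ∩ ⋃ F′ ∣ t (length Z))) (≤-trans (+-mono-≤ eZ≥ (p⊆q⇒∣p∣≤∣q∣ {q = e ∩ ⋃ Z} (λ m → x∈p∩q⁺ (∩⊆e m , proj₁ (x∈p∩q⁻ (⋃ Z) (⋃ F′) m)))))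
               (≤-reflexive (trans (∣∪∣+∣∩∣ e (⋃ Z)) (trans (cong (_+ ∣ ⋃ Z ∣) ∣e∣) (+-comm (2 + t) ∣ ⋃ Z ∣))))))
            where
            l : ∀ o t z → o + t * z + (2 + t) ≡ t * (1 + z) + 2 + o
            l = solve-∀
          F′≤ : ∣ ⋃ F′ ∣ ≤ t * length F′ + 2
          F′≤ = +-cancelˡ-≤ (∣ ⋃ Z ∩ ⋃ F′ ∣ + t * length Z) _ _ (≤-trans (+-monoˡ-≤ ∣ ⋃ F′ ∣ o≤) (≤-trans V₂≥ (≤-trans (+-monoˡ-≤ ∣ ⋃ Z ∩ ⋃ F′ ∣ V₂≤) (≤-reflexive (l t (length Z) (length F′) ∣ ⋃ Z ∩ ⋃ F′ ∣)))))
            where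
            l : ∀ t z f o → t * (z + f) + 2 + o ≡ o + t * z + (t * f + 2)
            l = solve-∀
          fin : ∀ f → length F′ ≡ f → Empty
          fin zero eq = nil (≤-reflexive eq) e′∈F′
          fin (suc (suc f)) eq = <-irrefl refl (≤-trans (≤-reflexive (l (t * length F′))) (≤-trans (proper cf₂ F′ uF′ F′⊆₂ (subst (2 ≤_) (sym eq) (s≤s (s≤s z≤n))) (≤-trans (m<n+m (length F′) (empty x∈Z)) (≤-reflexive lenZF))) F′≤))
            where
            l : ∀ x → suc (x + 2) ≡ x + 3
            l = solve-∀
          -- With `F′` reduced to `e′`, the overlap lies in the intersection of `e` and `e′`; here
          -- the hypothesis that they share at most two vertices decides.
          fin (suc zero) eq = <-irrefl refl (≤-trans (≤-reflexive (l₁ t (length Z))) (+-cancelʳ-≤ ∣ ⋃ Z ∩ ⋃ F′ ∣ _ _ (≤-trans (+-monoʳ-≤ _ o2)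
              (≤-trans (≤-reflexive (l₂ t (length Z))) (≤-trans (+-mono-≤ Z≥ F≥) (≤-trans V₂≥ (+-monoˡ-≤ _ (≤-trans V₂≤ (≤-reflexive (cong (λ z → t * (length Z + z) + 2) eq))))))))))
            where
            l₁ : ∀ t z → suc (t * (z + 1) + 2) ≡ t * z + 3 + t
            l₁ = solve-∀
            l₂ : ∀ t z → t * z + 3 + t + 2 ≡ t * z + 3 + (2 + t)
            l₂ = solve-∀
            only : ∀ {z} → z ∈ F′ → z ≡ e′
            only {z} m = one F′ eq m e′∈F′
              where
              one : ∀ xs → length xs ≡ 1 → ∀ {a b : Edge} → a ∈ xs → b ∈ xs → a ≡ b
              one (y ∷ []) _ (here refl) (here refl) = refl
            o2 : ∣ ⋃ Z ∩ ⋃ F′ ∣ ≤ 2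
            o2 = ≤-trans (p⊆q⇒∣p∣≤∣q∣ {q = e ∩ e′} (λ m → x∈p∩q⁺ (∩⊆e m , inE′ (proj₂ (x∈p∩q⁻ (⋃ Z) (⋃ F′) m))))) ee′
              where
              inE′ : ∀ {y} → y ∈ₛ ⋃ F′ → y ∈ₛ e′
              inE′ {y} m = let (z , i , w) = ⋃∈ F′ m in subst (y ∈ₛ_) (only i) w
            F≥ : 2 + t ≤ ∣ ⋃ F′ ∣
            F≥ = ≤-trans (≤-reflexive (sym (card cf₂ (here refl)))) (p⊆q⇒∣p∣≤∣q∣ (λ m → ∈⋃ e′∈F′ m))
            Z≥ : t * length Z + 3 ≤ ∣ ⋃ Z ∣
            Z≥ = proper cf₂ Z uZ Z⊆₂ (≤-pred (≤-trans (3≤ cf₂) (≤-reflexive (trans (sym lenZF) (trans (cong (length Z +_) eq) (+-comm (length Z) 1)))))) Z<C₂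
      main : ∣ V₁ ─ S ∣ + ∣ V₂ ─ (S ∪ V₁) ∣ + 1 ≤ t * (1 + a + b)
      main with f₂ in eq₂
      ... | suc g = ≤-trans (≤-reflexive (+-assoc ∣ V₁ ─ S ∣ _ 1)) (≤-trans (+-mono-≤ ν₁≤ (proj₁ (proj₂ pt₂) two₂ (subst (1 ≤_) (sym eq₂) (s≤s z≤n)))) tot)
      ... | zero with f₁ in eq₁ | length (C₁ ⋒ F) in eqX
      ...   | _ | zero = ⊥-elim (nil (≤-reflexive eqX) e∈X)
      ...   | zero | suc _ = ≤-trans (≤-reflexive (cong₂ (λ p q → p + q + 1) (proj₁ pt₁ eq₁) (proj₁ pt₂ eq₂))) (≤-trans 1≤t (m≤m*n t (1 + a + b)))
      ...   | suc g | suc (suc y) = gain₁ (proj₁ (proj₂ pt₁) (subst (2 ≤_) (sym eqX) (s≤s (s≤s z≤n))) (subst (1 ≤_) (sym eq₁) (s≤s z≤n)))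
      ...   | suc g | suc zero with suc ∣ V₁ ─ S ∣ ≤? t * f₁
      ...     | yes p = gain₁ (≤-trans (≤-reflexive (+-comm _ 1)) p)
      ...     | no np = ⊥-elim (stuck eq₂ eqX (≤-pred (≰⇒> np)))

-- Subsets of fixed size, binomial coefficients, and weighted counts by new vertices.

module UniformSets where
  open Rationals
  open import Data.Rational using (ℚ; 0ℚ; 1ℚ; _+_; _*_; -_; _-_; _≤_; _<_)
  open import Data.Rational.Properties using (≤-refl; ≤-trans; ≤-reflexive; +-mono-≤)
  open import Data.Nat using (zero; suc)
  open import Data.Fin using (zero; suc)
  open import Data.Fin.Subset using (outside)
  open import Data.Vec using ([]; _∷_)
  open import Data.List using ([]; _∷_)
  open import Data.List.Relation.Unary.All using ([]; _∷_)
  open import Data.List.Relation.Unary.AllPairs using ([]; _∷_)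
  open import Tactic.RingSolver using (solve-∀)

  rsub : ∀ n (r : ℕ) → List (Subset n)
  rsub zero zero = [] ∷ []
  rsub zero (suc r) = []
  rsub (suc n) zero = map (outside ∷_) (rsub n zero)
  rsub (suc n) (suc r) = map (inside ∷_) (rsub n r) ++ map (outside ∷_) (rsub n (suc r))

  rsub-card : ∀ n r {e} → e ∈ rsub n r → ∣ e ∣ ≡ r
  rsub-card zero zero (here refl) = refl
  rsub-card (suc n) zero m with ∈-map⁻ (outside ∷_) m
  ... | e , i , refl = rsub-card n zero i
  rsub-card (suc n) (suc r) m with ∈-++⁻ (map (inside ∷_) (rsub n r)) m
  ... | inj₁ i with ∈-map⁻ (inside ∷_) i
  ...   | e , j , refl = cong suc (rsub-card n r j)
  rsub-card (suc n) (suc r) m | inj₂ i with ∈-map⁻ (outside ∷_) i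
  ...   | e , j , refl = rsub-card n (suc r) j

  rsub-complete : ∀ {n} r (e : Subset n) → ∣ e ∣ ≡ r → e ∈ rsub n r
  rsub-complete zero [] p = here refl
  rsub-complete (suc r) [] ()
  rsub-complete zero (true ∷ e) ()
  rsub-complete zero (false ∷ e) p = ∈-map⁺ (outside ∷_) (rsub-complete zero e p)
  rsub-complete (suc r) (true ∷ e) p = ∈-++⁺ˡ (∈-map⁺ (inside ∷_) (rsub-complete r e (ℕₚ.suc-injective p)))
  rsub-complete {suc n} (suc r) (false ∷ e) p = ∈-++⁺ʳ (map (inside ∷_) (rsub n r)) (∈-map⁺ (outside ∷_) (rsub-complete (suc r) e p))

  rsub-unique : ∀ n r → Unique (rsub n r)
  rsub-unique zero zero = [] ∷ []
  rsub-unique zero (suc r) = []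
  rsub-unique (suc n) zero = Uₚ.map⁺ ∷-injectiveʳ (rsub-unique n zero)
  rsub-unique (suc n) (suc r) = Uₚ.++⁺ (Uₚ.map⁺ ∷-injectiveʳ (rsub-unique n r)) (Uₚ.map⁺ ∷-injectiveʳ (rsub-unique n (suc r))) disj
    where
    disj : ∀ {e} → e ∈ map (inside ∷_) (rsub n r) × e ∈ map (outside ∷_) (rsub n (suc r)) → _
    disj (a , b) with ∈-map⁻ (inside ∷_) a | ∈-map⁻ (outside ∷_) b
    ... | _ , _ , refl | _ , _ , ()

  binom : ℕ → ℕ → ℕ
  binom n zero = 1
  binom zero (suc r) = 0
  binom (suc n) (suc r) = binom n r ℕ.+ binom n (suc r)

  rsub-length : ∀ n r → length (rsub n r) ≡ binom n r
  rsub-length zero zero = refl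
  rsub-length zero (suc r) = refl
  rsub-length (suc n) zero = trans (length-map _ (rsub n zero)) (rsub-length n zero)
  rsub-length (suc n) (suc r) = trans (length-++ (map (inside ∷_) (rsub n r))) (cong₂ ℕ._+_ (trans (length-map _ (rsub n r)) (rsub-length n r)) (trans (length-map _ (rsub n (suc r))) (rsub-length n (suc r))))

  absorb : ∀ n r → suc r ℕ.* binom (suc n) (suc r) ≡ suc n ℕ.* binom n r
  absorb zero zero = refl
  absorb zero (suc r) = trans (ℕₚ.*-zeroʳ (suc (suc r))) refl
  absorb (suc n) zero = trans (cong (λ z → 1 ℕ.* (1 ℕ.+ z)) (trans (sym (ℕₚ.*-identityˡ _)) (absorb n zero))) (l (suc n))
    where
    l : ∀ n → 1 ℕ.* (1 ℕ.+ n ℕ.* 1) ≡ suc n ℕ.* 1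
    l = ℕR.solve-∀
  absorb (suc n) (suc r) = trans (l₁ r (binom (suc n) (suc r)) (binom (suc n) (suc (suc r))))
    (trans (cong₂ (λ a b → a ℕ.+ binom (suc n) (suc r) ℕ.+ b) (absorb n r) (absorb n (suc r))) (l₂ n (binom n r) (binom n (suc r))))
    where
    l₁ : ∀ r a b → suc (suc r) ℕ.* (a ℕ.+ b) ≡ suc r ℕ.* a ℕ.+ a ℕ.+ suc (suc r) ℕ.* b
    l₁ = ℕR.solve-∀
    l₂ : ∀ n x y → suc n ℕ.* x ℕ.+ (x ℕ.+ y) ℕ.+ suc n ℕ.* y ≡ suc (suc n) ℕ.* (x ℕ.+ y)
    l₂ = ℕR.solve-∀

  binom-pos : ∀ {n r} → r ℕ.≤ n → 1 ℕ.≤ binom n r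
  binom-pos z≤n = s≤s z≤n
  binom-pos (s≤s p) = ℕₚ.≤-trans (binom-pos p) (ℕₚ.m≤m+n _ _)

  -- The factor `suc j` comes from absorption, and the power of two pays for replacing `suc m` by
  -- `m` in a `j`-th power.
  lowK : ℕ → ℕ
  lowK zero = 1
  lowK (suc j) = 2 ℕ.^ j ℕ.* suc j ℕ.* lowK j

  binom-low : ∀ j m → j ℕ.≤ m → m ℕ.^ j ℕ.≤ lowK j ℕ.* binom m j
  binom-low zero m _ = ℕₚ.≤-refl
  binom-low (suc j) (suc m) (s≤s p) = ℕₚ.≤-trans (ℕₚ.*-monoʳ-≤ (suc m) (ℕₚ.≤-trans (pw j m p) (ℕₚ.*-monoʳ-≤ (2 ℕ.^ j) (binom-low j m p))))
    (ℕₚ.≤-reflexive (trans (l₁ (suc m) (2 ℕ.^ j) (lowK j) (binom m j)) (trans (cong (2 ℕ.^ j ℕ.* lowK j ℕ.*_) (sym (absorb m j))) (l₂ (2 ℕ.^ j) (lowK j) (suc j) (binom (suc m) (suc j))))))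
    where
    l₁ : ∀ m p k b → m ℕ.* (p ℕ.* (k ℕ.* b)) ≡ p ℕ.* k ℕ.* (m ℕ.* b)
    l₁ = ℕR.solve-∀
    l₂ : ∀ p k j b → p ℕ.* k ℕ.* (j ℕ.* b) ≡ p ℕ.* j ℕ.* k ℕ.* b
    l₂ = ℕR.solve-∀
    pw : ∀ j m → j ℕ.≤ m → suc m ℕ.^ j ℕ.≤ 2 ℕ.^ j ℕ.* m ℕ.^ j
    pw zero m _ = ℕₚ.≤-refl
    pw (suc j) (suc m) (s≤s p) = ℕₚ.≤-trans (ℕₚ.*-mono-≤ (dbl m) (pw j (suc m) (ℕₚ.m≤n⇒m≤1+n p))) (ℕₚ.≤-reflexive (l (suc m) (2 ℕ.^ j) (suc m ℕ.^ j)))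
      where
      dbl : ∀ m → suc (suc m) ℕ.≤ 2 ℕ.* suc m
      dbl m = ℕₚ.≤-trans (s≤s (s≤s (ℕₚ.m≤m+n m (m ℕ.+ 0)))) (ℕₚ.≤-reflexive (cong suc (sym (ℕₚ.+-suc m (m ℕ.+ 0)))))
      l : ∀ m p q → 2 ℕ.* m ℕ.* (p ℕ.* q) ≡ 2 ℕ.* p ℕ.* (m ℕ.* q)
      l = ℕR.solve-∀

  Σ-rsub : ∀ n r (f : Subset (suc n) → ℚ) → Σ (rsub (suc n) (suc r)) f ≡ Σ (rsub n r) (λ e → f (inside ∷ e)) + Σ (rsub n (suc r)) (λ e → f (outside ∷ e))
  Σ-rsub n r f = trans (Σ-++ (map (inside ∷_) (rsub n r)) _ f) (cong₂ _+_ (Σ-map (inside ∷_) (rsub n r) f) (Σ-map (outside ∷_) (rsub n (suc r)) f))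

  -- Degrees in the complete uniform hypergraph: of a vertex among `suc n` vertices, and of a pair
  -- among `suc (suc n)`.
  D₁ D₂ : ℕ → ℕ → ℕ
  D₁ n zero = 0
  D₁ n (suc r) = binom n r
  D₂ n zero = 0
  D₂ n (suc r) = D₁ n r

  D₁-step : ∀ n r → D₁ n r ℕ.+ D₁ n (suc r) ≡ D₁ (suc n) (suc r)
  D₁-step n zero = refl
  D₁-step n (suc r) = refl

  D₂-step : ∀ n r → D₂ n r ℕ.+ D₂ n (suc r) ≡ D₂ (suc n) (suc r)
  D₂-step n zero = refl
  D₂-step n (suc r) = D₁-step n r

  count₀ : ∀ n (r : ℕ) → Σ (rsub n r) (λ _ → 1ℚ) ≡ nat (binom n r)
  count₀ n r = trans (Σ-const (rsub n r) 1ℚ) (trans (ℚₚ.*-identityʳ _) (cong nat (rsub-length n r)))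

  count₁ : ∀ n (r : ℕ) (a : Fin (suc n)) → Σ (rsub (suc n) r) (λ e → 𝟙 (lookup e a)) ≡ nat (D₁ n r)
  count₁ n zero zero = trans (Σ-map (outside ∷_) (rsub n zero) (λ e → 𝟙 (lookup e zero))) (Σ-0 (rsub n zero))
  count₁ (suc n) zero (suc a) = trans (Σ-map (outside ∷_) (rsub (suc n) zero) (λ e → 𝟙 (lookup e (suc a)))) (count₁ n zero a)
  count₁ n (suc r) zero = trans (Σ-rsub n r (λ e → 𝟙 (lookup e zero))) (trans (cong₂ _+_ (count₀ n r) (Σ-0 (rsub n (suc r)))) (ℚₚ.+-identityʳ _))
  count₁ (suc n) (suc r) (suc a) = trans (Σ-rsub (suc n) r (λ e → 𝟙 (lookup e (suc a)))) (trans (cong₂ _+_ (count₁ n r a) (count₁ n (suc r) a))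
    (trans (sym (nat-+ (D₁ n r) (D₁ n (suc r)))) (cong nat (D₁-step n r))))

  count₂ : ∀ n (r : ℕ) (a b : Fin (suc (suc n))) → a Fin.< b → Σ (rsub (suc (suc n)) r) (λ e → 𝟙 (lookup e a ∧ lookup e b)) ≡ nat (D₂ n r)
  count₂ n zero zero (suc b) _ = trans (Σ-map (outside ∷_) (rsub (suc n) zero) (λ e → 𝟙 (lookup e zero ∧ lookup e (suc b)))) (Σ-0 (rsub (suc n) zero))
  count₂ (suc n) zero (suc a) (suc b) (s≤s p) = trans (Σ-map (outside ∷_) (rsub (suc (suc n)) zero) (λ e → 𝟙 (lookup e (suc a) ∧ lookup e (suc b)))) (count₂ n zero a b p)
  count₂ zero zero (suc zero) (suc zero) (s≤s ())
  count₂ n (suc r) zero (suc b) _ = trans (Σ-rsub (suc n) r (λ e → 𝟙 (lookup e zero ∧ lookup e (suc b)))) (trans (cong₂ _+_ (count₁ n r b) (Σ-0 (rsub (suc n) (suc r)))) (ℚₚ.+-identityʳ _))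
  count₂ zero (suc r) (suc zero) (suc zero) (s≤s ())
  count₂ (suc n) (suc r) (suc a) (suc b) (s≤s p) = trans (Σ-rsub (suc (suc n)) r (λ e → 𝟙 (lookup e (suc a) ∧ lookup e (suc b)))) (trans (cong₂ _+_ (count₂ n r a b p) (count₂ n (suc r) a b p))
    (trans (sym (nat-+ (D₂ n r) (D₂ n (suc r)))) (cong nat (D₂-step n r))))

  -- For j = ⌈n/2⌉, the inequality (1+ι)^j (1 - jι) ≤ 1 with jι ≤ 2/3 gives (1+ι)^j ≤ 3; squaring
  -- reaches the exponent n.
  compound : ∀ n {ι} → 3 ℕ.≤ n → 0ℚ ≤ ι → nat n * ι ≡ 1ℚ → (1ℚ + ι) ^ n ≤ nat 9
  compound n {ι} 3≤n 0≤ι nι = ^-monoʳ (≤+ʳ 0≤ι) n≤2j ▸ ≡≤ (trans (cong ((1ℚ + ι) ^_) (cong (j ℕ.+_) (ℕₚ.+-identityʳ j))) (^-+ (1ℚ + ι) j j)) ▸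
    *-mono (0≤^ j 0≤1+ι) half (0≤^ j 0≤1+ι) half ▸ ≡≤ refl
    where
    j = ℕ.⌈ n /2⌉
    0≤1+ι : 0ℚ ≤ 1ℚ + ι
    0≤1+ι = 0≤+ 0≤1 0≤ι
    n≤2j : n ℕ.≤ 2 ℕ.* j
    n≤2j = ℕₚ.≤-trans (ℕₚ.≤-reflexive (sym (ℕₚ.⌊n/2⌋+⌈n/2⌉≡n n))) (ℕₚ.≤-trans (ℕₚ.+-monoˡ-≤ j (ℕₚ.⌊n/2⌋≤⌈n/2⌉ n)) (ℕₚ.≤-reflexive (cong (j ℕ.+_) (sym (ℕₚ.+-identityʳ j)))))
    2j≤ : 2 ℕ.* j ℕ.≤ suc n
    2j≤ = ℕₚ.≤-trans (ℕₚ.≤-reflexive (cong (j ℕ.+_) (ℕₚ.+-identityʳ j))) (ℕₚ.≤-trans (ℕₚ.+-monoʳ-≤ j (ceil n)) (ℕₚ.≤-reflexive (trans (ℕₚ.+-suc j _) (cong suc (trans (ℕₚ.+-comm j _) (ℕₚ.⌊n/2⌋+⌈n/2⌉≡n n))))))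
      where
      ceil : ∀ n → ℕ.⌈ n /2⌉ ℕ.≤ suc ℕ.⌊ n /2⌋
      ceil zero = z≤n
      ceil (suc zero) = s≤s z≤n
      ceil (suc (suc n)) = s≤s (ceil n)
    3j≤2n : 3 ℕ.* j ℕ.≤ 2 ℕ.* n
    3j≤2n = ℕₚ.*-cancelˡ-≤ 2 (ℕₚ.≤-trans (ℕₚ.≤-reflexive (l j)) (ℕₚ.≤-trans (ℕₚ.*-monoʳ-≤ 3 2j≤) (ℕₚ.≤-trans (ℕₚ.≤-reflexive (l₂ n)) (ℕₚ.≤-trans (ℕₚ.+-monoʳ-≤ (3 ℕ.* n) 3≤n) (ℕₚ.≤-reflexive (l₃ n))))))
      where
      l : ∀ j → 2 ℕ.* (3 ℕ.* j) ≡ 3 ℕ.* (2 ℕ.* j)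
      l = ℕR.solve-∀
      l₂ : ∀ n → 3 ℕ.* suc n ≡ 3 ℕ.* n ℕ.+ 3
      l₂ = ℕR.solve-∀
      l₃ : ∀ n → 3 ℕ.* n ℕ.+ n ≡ 2 ℕ.* (2 ℕ.* n)
      l₃ = ℕR.solve-∀
    3jι : nat 3 * (nat j * ι) ≤ nat 2
    3jι = ≡≤ (trans (sym (ℚₚ.*-assoc (nat 3) (nat j) ι)) (cong (_* ι) (sym (nat-* 3 j)))) ▸ *-monoʳ 0≤ι (nat-mono 3j≤2n) ▸
      ≡≤ (trans (cong (_* ι) (nat-* 2 n)) (trans (ℚₚ.*-assoc (nat 2) (nat n) ι) (trans (cong (nat 2 *_) nι) (ℚₚ.*-identityʳ (nat 2)))))
    dec : ∀ j → (1ℚ + ι) ^ j * (1ℚ - nat j * ι) ≤ 1ℚ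
    dec zero = ≡≤ (l ι)
      where
      l : ∀ i → 1ℚ * (1ℚ - 0ℚ * i) ≡ 1ℚ
      l = solve-∀ ℚring
    dec (suc j) = ≤+ (0≤* (0≤^ j 0≤1+ι) (0≤* (0≤+ 0≤1 (0≤nat j)) (0≤sq ι))) (l ((1ℚ + ι) ^ j) ι (nat j)) ▸ dec j
      where
      l : ∀ p i n → p * (1ℚ - n * i) ≡ (1ℚ + i) * p * (1ℚ - (1ℚ + n) * i) + p * ((1ℚ + n) * (i * i))
      l = solve-∀ ℚring
    half : (1ℚ + ι) ^ j ≤ nat 3
    half = *-cancelʳ {(1ℚ + ι) ^ j} {nat 3} {1ℚ} 0<1 (≡≤ (ℚₚ.*-identityʳ ((1ℚ + ι) ^ j)) ▸ -0≤ (0≤+ (0≤* (0≤^ j 0≤1+ι) (0≤- 3jι)) (0≤* (0≤nat 3) (0≤- (dec j))) ▸ ≡≤ (l ((1ℚ + ι) ^ j) (nat j * ι))) ▸ ≡≤ (sym (ℚₚ.*-identityʳ (nat 3))))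
      where
      l : ∀ p x → p * (1ℚ + (1ℚ + 0ℚ) - (1ℚ + (1ℚ + (1ℚ + 0ℚ))) * x) + (1ℚ + (1ℚ + (1ℚ + 0ℚ))) * (1ℚ - p * (1ℚ - x)) ≡ 1ℚ + (1ℚ + (1ℚ + 0ℚ)) - p
      l = solve-∀ ℚring

  -- A generating function: a vertex of `S` contributes a factor at most 2, any other vertex at most
  -- `1ℚ + ι`. With `ι` = 1/n the sum over all edges, each weighted by its new vertices, is bounded
  -- independently of n.
  weight₁ : ∀ n (r : ℕ) (S : Subset n) {ι} → 0ℚ ≤ ι → Σ (rsub n r) (λ e → ι ^ ∣ e ─ S ∣) ≤ nat 2 ^ ∣ S ∣ * (1ℚ + ι) ^ n
  weight₁ zero zero [] p = ≡≤ refl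
  weight₁ zero (suc r) [] p = 0≤1
  weight₁ (suc n) zero (true ∷ S) {ι} p = ≡≤ (Σ-map (outside ∷_) (rsub n zero) _) ▸ weight₁ n zero S p ▸
    *-mono (0≤^ ∣ S ∣ (0≤nat 2)) (≤1* (0≤^ ∣ S ∣ (0≤nat 2)) (1≤nat 1)) (0≤^ n (0≤+ 0≤1 p)) (≤1* (0≤^ n (0≤+ 0≤1 p)) (≤+ʳ {1ℚ} {ι} p))
  weight₁ (suc n) zero (false ∷ S) {ι} p = ≡≤ (Σ-map (outside ∷_) (rsub n zero) _) ▸ weight₁ n zero S p ▸
    *-monoˡ (0≤^ ∣ S ∣ (0≤nat 2)) (≤1* (0≤^ n (0≤+ 0≤1 p)) (≤+ʳ {1ℚ} {ι} p))
  weight₁ (suc n) (suc r) (true ∷ S) {ι} p = ≡≤ (Σ-rsub n r _) ▸ +-mono-≤ (weight₁ n r S p) (weight₁ n (suc r) S p) ▸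
    ≡≤ (l (nat 2 ^ ∣ S ∣) ((1ℚ + ι) ^ n)) ▸ *-monoˡ (0≤* (0≤nat 2) (0≤^ ∣ S ∣ (0≤nat 2))) (≤1* (0≤^ n (0≤+ 0≤1 p)) (≤+ʳ {1ℚ} {ι} p))
    where
    l : ∀ a b → a * b + a * b ≡ (1ℚ + (1ℚ + 0ℚ)) * a * b
    l = solve-∀ ℚring
  weight₁ (suc n) (suc r) (false ∷ S) {ι} p = ≡≤ (trans (Σ-rsub n r _) (cong (_+ Σ (rsub n (suc r)) (λ e → ι ^ ∣ e ─ S ∣)) (Σ-* ι (rsub n r) _))) ▸
    +-mono-≤ (*-monoˡ p (weight₁ n r S p)) (weight₁ n (suc r) S p) ▸ ≡≤ (l ι (nat 2 ^ ∣ S ∣) ((1ℚ + ι) ^ n))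
    where
    l : ∀ i a b → i * (a * b) + a * b ≡ a * ((1ℚ + i) * b)
    l = solve-∀ ℚring

  lists : {X : Set} → ℕ → List X → List (List X)
  lists zero xs = [] ∷ []
  lists (suc l) xs = concatMap (λ x → map (x ∷_) (lists l xs)) xs

  Σ-lists : ∀ {X : Set} l (xs : List X) f → Σ (lists (suc l) xs) f ≡ Σ xs (λ x → Σ (lists l xs) (λ J → f (x ∷ J)))
  Σ-lists l xs f = trans (Σ-concatMap _ xs f) (Σ-cong xs (λ x → Σ-map (x ∷_) (lists l xs) f))

  ∈-cat : ∀ {X Z : Set} (g : X → List Z) {x z xs} → x ∈ xs → z ∈ g x → z ∈ concatMap g xs
  ∈-cat g {xs = y ∷ xs} (here refl) m = ∈-++⁺ˡ m
  ∈-cat g {xs = y ∷ xs} (there i) m = ∈-++⁺ʳ (g y) (∈-cat g i m)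

  cat-∈ : ∀ {X Z : Set} (g : X → List Z) {z} xs → z ∈ concatMap g xs → ∃ λ x → x ∈ xs × z ∈ g x
  cat-∈ g (y ∷ xs) m with ∈-++⁻ (g y) m
  ... | inj₁ a = y , here refl , a
  ... | inj₂ b = let (x , i , j) = cat-∈ g xs b in x , there i , j

  ∈-lists : ∀ {X : Set} (xs : List X) J → All (_∈ xs) J → J ∈ lists (length J) xs
  ∈-lists xs [] [] = here refl
  ∈-lists xs (j ∷ J) (p ∷ ps) = ∈-cat (λ x → map (x ∷_) (lists (length J) xs)) p (∈-map⁺ (j ∷_) (∈-lists xs J ps))

  lists-∈ : ∀ {X : Set} l (xs : List X) {J} → J ∈ lists l xs → length J ≡ l × All (_∈ xs) J
  lists-∈ zero xs (here refl) = refl , []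
  lists-∈ (suc l) xs m with cat-∈ (λ x → map (x ∷_) (lists l xs)) xs m
  ... | x , i , m′ with ∈-map⁻ (x ∷_) m′
  ...   | J , j , refl = let (a , b) = lists-∈ l xs j in cong suc a , i ∷ b

-- The concrete system of edges, pairs and minimal configurations.

module ConflictSystem where
  open Conflicts
  open UniformSets using (rsub; lists; ∈-lists; lists-∈)
  open IndependentChoice
  open NibbleProcess using (does-yes; yes-does)
  open import Data.Nat using (zero; suc; _+_; _*_; _≤_; _<_; _≤?_; _<?_; _≟_)
  open import Data.Nat.Properties
  open import Data.Fin using (zero; suc)
  open import Data.Fin.Subset using (_⊆_)
  open import Data.Vec using ([]; _∷_)
  open import Data.List using ([]; _∷_)
  open import Data.List.Relation.Unary.All using ([]; _∷_)
  open import Data.List.Relation.Unary.AllPairs using ([]; _∷_)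

  _≟S_ : ∀ {n} → DecidableEquality (Subset n)
  _≟S_ = ≡-dec 𝔹._≟_

  _≟F_ : ∀ {n} → DecidableEquality (Fin n × Fin n)
  _≟F_ = ×-≡-dec Finₚ._≟_ Finₚ._≟_

  short : {X : Set} → ℕ → List X → List (List X)
  short zero xs = []
  short (suc j) xs = lists j xs ++ short j xs

  ∈-short : ∀ {X : Set} j (xs : List X) J → length J < j → All (_∈ xs) J → J ∈ short j xs
  ∈-short (suc j) xs J (s≤s p) al with length J ≟ j
  ... | yes refl = ∈-++⁺ˡ (∈-lists xs J al)
  ... | no ne = ∈-++⁺ʳ (lists j xs) (∈-short j xs J (≤∧≢⇒< p ne) al)

  short-∈ : ∀ {X : Set} j (xs : List X) {J} → J ∈ short j xs → length J < j × All (_∈ xs) J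
  short-∈ (suc j) xs m with ∈-++⁻ (lists j xs) m
  ... | inj₁ a = let (p , q) = lists-∈ j xs a in s≤s (≤-reflexive p) , q
  ... | inj₂ b = let (p , q) = short-∈ j xs b in m≤n⇒m≤1+n p , q

  elems : ∀ {n} → Subset n → List (Fin n)
  elems [] = []
  elems (true ∷ e) = zero ∷ map suc (elems e)
  elems (false ∷ e) = map suc (elems e)

  elems-length : ∀ {n} (e : Subset n) → length (elems e) ≡ ∣ e ∣
  elems-length [] = refl
  elems-length (true ∷ e) = cong suc (trans (length-map suc (elems e)) (elems-length e))
  elems-length (false ∷ e) = trans (length-map suc (elems e)) (elems-length e)

  ∈-elems : ∀ {n} (e : Subset n) a → lookup e a ≡ true → a ∈ elems e
  ∈-elems (true ∷ e) zero p = here refl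
  ∈-elems (true ∷ e) (suc a) p = there (∈-map⁺ suc (∈-elems e a p))
  ∈-elems (false ∷ e) (suc a) p = ∈-map⁺ suc (∈-elems e a p)

  length-cart : ∀ {X Z : Set} (xs : List X) (ys : List Z) → length (cartesianProduct xs ys) ≡ length xs * length ys
  length-cart [] ys = refl
  length-cart (x ∷ xs) ys = trans (length-++ (map (x ,_) ys)) (cong₂ _+_ (length-map (x ,_) ys) (length-cart xs ys))

  unique-↭ : ∀ {X : Set} {xs ys : List X} → xs ↭ ys → Unique xs → Unique ys
  unique-↭ P.refl u = u
  unique-↭ (P.prep x p) (al ∷ u) = All-resp-↭ p al ∷ unique-↭ p u
  unique-↭ (P.swap x y p) ((ne ∷ ax) ∷ (ay ∷ u)) = (≢-sym ne ∷ All-resp-↭ p ay) ∷ (All-resp-↭ p ax ∷ unique-↭ p u)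
  unique-↭ (P.trans p q) u = unique-↭ q (unique-↭ p u)

  module Concrete (n t k : ℕ) (1≤t : 1 ≤ t) where
    open Bernoulli (_≟S_ {n}) public using (mem; mem-∈; ∈-mem; ∉-mem)
    module MF = Bernoulli (_≟F_ {n})
    open Config {n} t k 1≤t mem mem-∈ ∈-mem public

    r : ℕ
    r = 2 + t

    E : List Edge
    E = rsub n r

    allP : List (Fin n × Fin n)
    allP = filterᵇ (λ (a , b) → does (a Finₚ.<? b)) (cartesianProduct (allFin n) (allFin n))

    -- The test of the size makes `pairs` empty on sets that are not edges, so that the bound by `s`
    -- holds for all subsets.
    test : Edge → Fin n × Fin n → Bool
    test e (a , b) = (lookup e a ∧ lookup e b) ∧ does (∣ e ∣ ≟ r)

    pairs : Edge → List (Fin n × Fin n)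
    pairs e = filterᵇ (test e) allP

    s : ℕ
    s = r * r

    ∈allP : ∀ {a b} → a Fin.< b → (a , b) ∈ allP
    ∈allP {a} {b} p = in-filter _ (∈-cartesianProduct⁺ (∈-allFin a) (∈-allFin b)) (yes-does (a Finₚ.<? b) p)

    allP< : ∀ {a b} → (a , b) ∈ allP → a Fin.< b
    allP< {a} {b} m = does-yes (a Finₚ.<? b) (proj₂ (filter-in _ (cartesianProduct (allFin n) (allFin n)) m))

    uAllP : Unique allP
    uAllP = filter-u _ (Uₚ.cartesianProduct⁺ (Uₚ.allFin⁺ n) (Uₚ.allFin⁺ n))

    uPairs : ∀ e → Unique (pairs e)
    uPairs e = filter-u (test e) uAllP

    ∧-split : ∀ {a b} → a ∧ b ≡ true → a ≡ true × b ≡ true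
    ∧-split {true} {true} _ = refl , refl

    pairs-out : ∀ {e a b} → (a , b) ∈ pairs e → a Fin.< b × lookup e a ≡ true × lookup e b ≡ true × ∣ e ∣ ≡ r
    pairs-out {e} {a} {b} m with filter-in (test e) allP m
    ... | i , z with ∧-split {lookup e a ∧ lookup e b} z
    ...   | z₁ , z₂ with ∧-split {lookup e a} z₁
    ...     | z₃ , z₄ = allP< i , z₃ , z₄ , does-yes (∣ e ∣ ≟ r) z₂

    pairs-in : ∀ {e a b} → a Fin.< b → a ∈ₛ e → b ∈ₛ e → ∣ e ∣ ≡ r → (a , b) ∈ pairs e
    pairs-in {e} {a} {b} p a∈ b∈ c = in-filter (test e) (∈allP p) (cong₂ _∧_ (cong₂ _∧_ ([]=⇒lookup a∈) ([]=⇒lookup b∈)) (yes-does (∣ e ∣ ≟ r) c))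

    |pairs| : ∀ e → length (pairs e) ≤ s
    |pairs| e = len (pairs e) (λ m → m) (uPairs e)
      where
      len : ∀ ps → (∀ {p} → p ∈ ps → p ∈ pairs e) → Unique ps → length ps ≤ s
      len [] _ _ = z≤n
      len ((a , b) ∷ ps) f u with pairs-out {e} (f (here refl))
      ... | _ , _ , _ , c = ≤-trans (unique-⊂ u sub) (≤-reflexive (trans (length-cart (elems e) (elems e)) (cong (λ z → z * z) (trans (elems-length e) c))))
        where
        sub : ∀ {p} → p ∈ (a , b) ∷ ps → p ∈ cartesianProduct (elems e) (elems e)
        sub {x , y} m with pairs-out {e} (f m)
        ... | _ , z₁ , z₂ , _ = ∈-cartesianProduct⁺ (∈-elems e x z₁) (∈-elems e y z₂)

    pset : Fin n × Fin n → Edge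
    pset (a , b) = ⁅ a ⁆ ∪ ⁅ b ⁆

    a∈pset : ∀ a b → a ∈ₛ pset (a , b)
    a∈pset a b = x∈p∪q⁺ (inj₁ (x∈⁅x⁆ a))
    b∈pset : ∀ a b → b ∈ₛ pset (a , b)
    b∈pset a b = x∈p∪q⁺ (inj₂ (x∈⁅x⁆ b))

    pset⊆ : ∀ {e p} → p ∈ pairs e → pset p ⊆ e
    pset⊆ {e} {a , b} m {x} z with pairs-out {e} m
    ... | _ , z₁ , z₂ , _ with x∈p∪q⁻ ⁅ a ⁆ ⁅ b ⁆ z
    ...   | inj₁ q = subst (_∈ₛ e) (sym (x∈⁅y⁆⇒x≡y a q)) (lookup⇒[]= a e z₁)
    ...   | inj₂ q = subst (_∈ₛ e) (sym (x∈⁅y⁆⇒x≡y b q)) (lookup⇒[]= b e z₂)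

    ∣pset∣ : ∀ {a b} → a Fin.< b → ∣ pset (a , b) ∣ ≡ 2
    ∣pset∣ {a} {b} p = +-cancelʳ-≡ 0 _ 2 (trans (cong (∣ pset (a , b) ∣ +_) (sym disj)) (trans (∣∪∣+∣∩∣ ⁅ a ⁆ ⁅ b ⁆) (cong₂ _+_ (∣⁅x⁆∣≡1 a) (∣⁅x⁆∣≡1 b))))
      where
      disj : ∣ ⁅ a ⁆ ∩ ⁅ b ⁆ ∣ ≡ 0
      disj = card0 (⁅ a ⁆ ∩ ⁅ b ⁆) (λ {x} m → let (u , v) = x∈p∩q⁻ ⁅ a ⁆ ⁅ b ⁆ m in Finₚ.<⇒≢ p (trans (sym (x∈⁅y⁆⇒x≡y a u)) (x∈⁅y⁆⇒x≡y b v)))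
        where
        card0 : ∀ {n} (q : Subset n) → (∀ {x} → x ∈ₛ q → Empty) → ∣ q ∣ ≡ 0
        card0 [] f = refl
        card0 (true ∷ q) f = ⊥-elim (f Vec.here)
        card0 (false ∷ q) f = card0 q (λ m → f (Vec.there m))

    ∣pset∪∣ : ∀ {p p′} → p ∈ allP → p′ ∈ allP → p ≢ p′ → 3 ≤ ∣ pset p ∪ pset p′ ∣
    ∣pset∪∣ {a , b} {c , d} m m′ ne = ≤-trans (s≤s (≤-reflexive (sym (∣pset∣ (allP< m))))) (p⊂ (new (c Finₚ.≟ a) (c Finₚ.≟ b) (d Finₚ.≟ a) (d Finₚ.≟ b)))
      where
      open import Data.Fin.Subset.Properties using (p⊂q⇒∣p∣<∣q∣; p⊆p∪q; q⊆p∪q)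
      p⊂ : (∃ λ x → x ∈ₛ pset (c , d) × x ∉ₛ pset (a , b)) → ∣ pset (a , b) ∣ < ∣ pset (a , b) ∪ pset (c , d) ∣
      p⊂ (x , i , j) = p⊂q⇒∣p∣<∣q∣ (p⊆p∪q (pset (c , d)) , x , q⊆p∪q (pset (a , b)) (pset (c , d)) i , j)
      out : ∀ {x} → x ≢ a → x ≢ b → x ∉ₛ pset (a , b)
      out f g z with x∈p∪q⁻ ⁅ a ⁆ ⁅ b ⁆ z
      ... | inj₁ q = f (x∈⁅y⁆⇒x≡y a q)
      ... | inj₂ q = g (x∈⁅y⁆⇒x≡y b q)
      new : Dec (c ≡ a) → Dec (c ≡ b) → Dec (d ≡ a) → Dec (d ≡ b) → ∃ λ x → x ∈ₛ pset (c , d) × x ∉ₛ pset (a , b)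
      new (no f) (no g) _ _ = c , a∈pset c d , out f g
      new _ _ (no f) (no g) = d , b∈pset c d , out f g
      new (yes refl) _ _ (yes refl) = ⊥-elim (ne refl)
      new (yes refl) _ (yes refl) _ = ⊥-elim (Finₚ.<-irrefl refl (allP< m′))
      new _ (yes refl) _ (yes refl) = ⊥-elim (Finₚ.<-irrefl refl (allP< m′))
      new _ (yes refl) (yes refl) _ = ⊥-elim (Finₚ.<-asym (allP< m) (allP< m′))

    two⇒pair : ∀ {q : Edge} → 2 ≤ ∣ q ∣ → ∃ λ a → ∃ λ b → a Fin.< b × a ∈ₛ q × b ∈ₛ q
    two⇒pair {q} p = go q p
      where
      one : ∀ {n} (q : Subset n) → 1 ≤ ∣ q ∣ → ∃ λ a → a ∈ₛ q
      one (true ∷ q) _ = zero , Vec.here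
      one (false ∷ q) p = let (a , i) = one q p in suc a , Vec.there i
      go : ∀ {n} (q : Subset n) → 2 ≤ ∣ q ∣ → ∃ λ a → ∃ λ b → a Fin.< b × a ∈ₛ q × b ∈ₛ q
      go (true ∷ q) (s≤s p) = let (b , i) = one q p in zero , suc b , s≤s z≤n , Vec.here , Vec.there i
      go (false ∷ q) p = let (a , b , l , i , j) = go q p in suc a , suc b , s≤s l , Vec.there i , Vec.there j

    open UD (_≟S_ {n}) using (unique?)

    IsConf? : ∀ C → Dec (IsConf C)
    IsConf? C = map′ to from ((3 ≤? length C) ×-dec (length C ≤? k) ×-dec unique? C ×-dec all? (λ e → ∣ e ∣ ≟ 2 + t) C ×-dec (∣ ⋃ C ∣ ≤? t * length C + 2) ×-dec
        all? (λ D → unique? D →-dec ((2 ≤? length D) →-dec (t * length D + 3 ≤? ∣ ⋃ D ∣))) (short (length C) C))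
      where
      Checks : Set
      Checks = 3 ≤ length C × length C ≤ k × Unique C × All (λ e → ∣ e ∣ ≡ 2 + t) C × ∣ ⋃ C ∣ ≤ t * length C + 2 ×
        All (λ D → Unique D → 2 ≤ length D → t * length D + 3 ≤ ∣ ⋃ D ∣) (short (length C) C)
      to : Checks → IsConf C
      to (a , b , u , c , d , f) = record { 3≤ = a ; ≤k = b ; uniq = u ; card = All.lookup c ; small = d
        ; proper = λ D uD D⊆ 2≤ lt → All.lookup f (∈-short (length C) C D lt (All.tabulate D⊆)) uD 2≤ }
      from : IsConf C → Checks
      from cf = let open IsConf cf in 3≤ , ≤k , uniq , All.tabulate card , small ,
        All.tabulate (λ {D} m uD 2≤ → proper D uD (All.lookup (proj₂ (short-∈ (length C) C m))) 2≤ (proj₁ (short-∈ (length C) C m)))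

    abstract
      confL : List Edge → Bool
      confL C = does (IsConf? C)

      confL-out : ∀ {C} → confL C ≡ true → IsConf C
      confL-out {C} = does-yes (IsConf? C)

      confL-in : ∀ {C} → IsConf C → confL C ≡ true
      confL-in {C} = yes-does (IsConf? C)

    IsConf-↭ : ∀ {C C′} → C ↭ C′ → IsConf C → IsConf C′
    IsConf-↭ {C} {C′} p cf = record
      { 3≤ = subst (3 ≤_) len 3≤ ; ≤k = subst (_≤ k) len ≤k ; uniq = unique-↭ p uniq ; card = λ m → card (back m)
      ; small = ≤-trans (p⊆q⇒∣p∣≤∣q∣ (⋃-mono back)) (subst (λ l → ∣ ⋃ C ∣ ≤ t * l + 2) len small)
      ; proper = λ D uD D⊆ 2≤ lt → proper D uD (λ m → back (D⊆ m)) 2≤ (subst (length D <_) (sym len) lt) }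
      where
      open IsConf cf
      len = ↭-length p
      back : ∀ {e} → e ∈ C′ → e ∈ C
      back = ∈-resp-↭ (↭-sym p)

    tup : List (List Edge)
    tup = short k E

    conf : Edge → Edge → List Edge → Bool
    conf e x J = confL (e ∷ x ∷ J)

    conf-tup : ∀ {e x J} → confL (e ∷ x ∷ J) ≡ true → All (_∈ E) J → J ∈ tup
    conf-tup {e} {x} {J} c al = ∈-short k E J (≤-trans (n≤1+n _) (IsConf.≤k (confL-out c))) al

    confL-≤2 : ∀ {C} → length C ≤ 2 → confL C ≡ true → Empty
    confL-≤2 p c with ≤-trans (IsConf.3≤ (confL-out c)) p
    ... | s≤s (s≤s ())

    -- Excess at least three at every size from 2 to `k`; this yields both halves of `GFree`.
    HGood : List Edge → Set
    HGood M = ∀ C → Unique C → (∀ {e} → e ∈ C → e ∈ M) → 2 ≤ length C → length C ≤ k → t * length C + 3 ≤ ∣ ⋃ C ∣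

    -- By induction on the size, all smaller subsets have excess three. So a violating set of three
    -- or more edges is a minimal configuration, which `noConf` excludes, and two violating edges
    -- share a pair, which `noPair` excludes.
    hgood : ∀ M → (∀ {e} → e ∈ M → ∣ e ∣ ≡ r) → (∀ {e e′ p} → e ∈ M → e′ ∈ M → e ≢ e′ → p ∈ pairs e → p ∈ pairs e′ → Empty) →
      (∀ C → All (_∈ M) C → confL C ≡ true → Empty) → HGood M
    hgood M cardM noPair noConf C uC C⊆ 2≤ ≤k = go (length C) C ≤-refl uC C⊆ 2≤ ≤k
      where
      go : ∀ f C → length C ≤ f → Unique C → (∀ {e} → e ∈ C → e ∈ M) → 2 ≤ length C → length C ≤ k → t * length C + 3 ≤ ∣ ⋃ C ∣
      go f (_ ∷ []) _ _ _ (s≤s ()) _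
      go f (e ∷ e′ ∷ []) _ ((ne ∷ []) ∷ _) C⊆ _ _ with 2 ≤? ∣ e ∩ e′ ∣
      ... | yes p with two⇒pair p
      ...   | a , b , l , i , j = ⊥-elim (noPair (C⊆ (here refl)) (C⊆ (there (here refl))) ne
                (pairs-in l (proj₁ (x∈p∩q⁻ e e′ i)) (proj₁ (x∈p∩q⁻ e e′ j)) (cardM (C⊆ (here refl))))
                (pairs-in l (proj₂ (x∈p∩q⁻ e e′ i)) (proj₂ (x∈p∩q⁻ e e′ j)) (cardM (C⊆ (there (here refl))))))
      go f (e ∷ e′ ∷ []) _ ((ne ∷ []) ∷ _) C⊆ _ _ | no np = ≤-trans (+-cancelʳ-≤ 1 _ _ (≤-trans (≤-reflexive (l t)) (≤-trans (≤-reflexive (sym (cong₂ _+_ (cardM (C⊆ (here refl))) (cardM (C⊆ (there (here refl)))))))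
          (≤-trans (≤-reflexive (sym (∣∪∣+∣∩∣ e e′))) (+-monoʳ-≤ ∣ e ∪ e′ ∣ (≤-pred (≰⇒> np))))))) (≤-reflexive (cong (λ z → ∣ e ∪ z ∣) (sym (∪-identityʳ e′))))
        where
        open import Data.Fin.Subset.Properties using (∪-identityʳ)
        open import Data.Nat.Tactic.RingSolver using (solve-∀)
        l : ∀ t → t * 2 + 3 + 1 ≡ 2 + t + (2 + t)
        l = solve-∀
      go zero (e ∷ e′ ∷ e″ ∷ C) ()
      go (suc f) C₀@(e ∷ e′ ∷ e″ ∷ C) (s≤s lf) u C⊆ 2≤ ≤k with t * length C₀ + 3 ≤? ∣ ⋃ C₀ ∣
      ... | yes p = p
      ... | no np = ⊥-elim (noConf C₀ (All.tabulate C⊆) (confL-in record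
            { 3≤ = s≤s (s≤s (s≤s z≤n)) ; ≤k = ≤k ; uniq = u ; card = λ m → cardM (C⊆ m)
            ; small = ≤-pred (≤-trans (≰⇒> np) (≤-reflexive (+-suc (t * length C₀) 2)))
            ; proper = λ D uD D⊆ 2≤D lt → go f D (≤-trans (≤-pred lt) lf) uD (λ m → C⊆ (D⊆ m)) 2≤D (≤-trans (<⇒≤ lt) ≤k) }))

-- Sums over edge patterns, weighted by 1/n for each new vertex.

module PatternCounts where
  open Rationals
  open Correlations
  open Conflicts using (∣∪∣+∣∩∣; ∣∪─∣)
  open UniformSets
  open ConflictSystem
  open import Data.Rational using (ℚ; 0ℚ; 1ℚ; _+_; _*_; _≤_)
  open import Data.Rational.Properties using (≤-refl; ≤-trans; ≤-reflexive; +-mono-≤; <⇒≤)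
  open import Data.Integer using (+_)
  open import Data.Nat using (zero; suc)
  open import Data.List using ([]; _∷_)
  open import Data.List.Relation.Unary.All using ([]; _∷_)
  open import Data.List.Relation.Unary.AllPairs using ([]; _∷_)

  module Weights (r : ℕ) where
    W : ℕ → ℕ
    W σ = 9 ℕ.* 2 ℕ.^ σ

    -- Bounds, with `σ` vertices fixed, for the weighted sums over lists of exactly `l` edges and of
    -- fewer than `j` edges.
    Wb WT : ℕ → ℕ → ℕ
    Wb zero σ = 1
    Wb (suc l) σ = W σ ℕ.* Wb l (σ ℕ.+ r)
    WT zero σ = 0
    WT (suc j) σ = Wb j σ ℕ.+ WT j σ

    W-mono : ∀ {σ τ} → σ ℕ.≤ τ → W σ ℕ.≤ W τ
    W-mono p = ℕₚ.*-monoʳ-≤ 9 (ℕₚ.^-monoʳ-≤ 2 p)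

  ∣∪∣≤ : ∀ {n} (p q : Subset n) → ∣ p ∪ q ∣ ℕ.≤ ∣ p ∣ ℕ.+ ∣ q ∣
  ∣∪∣≤ p q = ℕₚ.≤-trans (ℕₚ.m≤m+n _ _) (ℕₚ.≤-reflexive (∣∪∣+∣∩∣ p q))

  ⋃-++ : ∀ {n} (xs ys : List (Subset n)) → ⋃ (xs ++ ys) ≡ ⋃ xs ∪ ⋃ ys
  ⋃-++ [] ys = sym (∪-identityˡ (⋃ ys))
    where open import Data.Fin.Subset.Properties using (∪-identityˡ)
  ⋃-++ (x ∷ xs) ys = trans (cong (x ∪_) (⋃-++ xs ys)) (sym (∪-assoc x (⋃ xs) (⋃ ys)))

  module PatternSums (n r : ℕ) (3≤n : 3 ℕ.≤ n) (ι : ℚ) (0≤ι : 0ℚ ≤ ι) (nι : nat n * ι ≡ 1ℚ) where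
    open Weights r public

    E₀ : List (Subset n)
    E₀ = rsub n r

    sum₁ : ∀ {σ} S → ∣ S ∣ ℕ.≤ σ → Σ E₀ (λ e → ι ^ ∣ e ─ S ∣) ≤ nat (W σ)
    sum₁ {σ} S p = weight₁ n r S 0≤ι ▸ *-mono (0≤^ ∣ S ∣ (0≤nat 2)) (^-monoʳ (1≤nat 1) p) (0≤^ n (0≤+ 0≤1 0≤ι)) (compound n 3≤n 0≤ι nι) ▸
      ≡≤ (trans (ℚₚ.*-comm (nat 2 ^ σ) (nat 9)) (sym (trans (nat-* 9 (2 ℕ.^ σ)) (cong (nat 9 *_) (nat-^ 2 σ)))))

    ι-split : ∀ x y (S : Subset n) → ι ^ ∣ (x ∪ y) ─ S ∣ ≡ ι ^ ∣ x ─ S ∣ * ι ^ ∣ y ─ (S ∪ x) ∣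
    ι-split x y S = trans (cong (ι ^_) (∣∪─∣ x y S)) (^-+ ι (∣ x ─ S ∣) (∣ y ─ (S ∪ x) ∣))

    -- Patterns are summed one edge at a time: once `x` is chosen, its vertices count as fixed for
    -- all later edges.
    sum-cons : ∀ {σ K} S → ∣ S ∣ ℕ.≤ σ → (f : Subset n → ℚ) → (∀ {x} → x ∈ E₀ → ∣ S ∪ x ∣ ℕ.≤ σ ℕ.+ r → f x ≤ nat K) →
      Σ E₀ (λ x → ι ^ ∣ x ─ S ∣ * f x) ≤ nat (W σ ℕ.* K)
    sum-cons {σ} {K} S p f h =
      Σ-mono∈ E₀ (λ {x} x∈ → *-monoˡ (0≤^ ∣ x ─ S ∣ 0≤ι) (h x∈ (ℕₚ.≤-trans (∣∪∣≤ S x) (ℕₚ.+-mono-≤ p (ℕₚ.≤-reflexive (rsub-card n r x∈)))))) ▸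
      ≡≤ (Σ-*ʳ (nat K) E₀ (λ x → ι ^ ∣ x ─ S ∣)) ▸ *-monoʳ (0≤nat K) (sum₁ S p) ▸ ≡≤ (sym (nat-* (W σ) K))

    sumₗ : ∀ l {σ} S → ∣ S ∣ ℕ.≤ σ → Σ (lists l E₀) (λ J → ι ^ ∣ ⋃ J ─ S ∣) ≤ nat (Wb l σ)
    sumₗ zero S p = +-mono-≤ (^-antiʳ {n = ∣ ⋃ [] ─ S ∣} 0≤ι ι≤1 z≤n) (≤-refl {0ℚ})
      where
      ι≤1 : ι ≤ 1ℚ
      ι≤1 = ≤1* 0≤ι (nat-mono {1} (ℕₚ.≤-trans (s≤s z≤n) 3≤n)) ▸ ≡≤ nι
    sumₗ (suc l) S p = ≡≤ (trans (Σ-lists l E₀ _) (Σ-cong E₀ (λ x → trans (Σ-cong (lists l E₀) (λ J → ι-split x (⋃ J) S)) (Σ-* (ι ^ ∣ x ─ S ∣) (lists l E₀) _)))) ▸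
      sum-cons S p (λ x → Σ (lists l E₀) (λ J → ι ^ ∣ ⋃ J ─ (S ∪ x) ∣)) (λ {x} _ q → sumₗ l (S ∪ x) q)

    sumₛ : ∀ j {σ} S → ∣ S ∣ ℕ.≤ σ → Σ (short j E₀) (λ J → ι ^ ∣ ⋃ J ─ S ∣) ≤ nat (WT j σ)
    sumₛ zero S p = ≤-refl
    sumₛ (suc j) {σ} S p = ≡≤ (Σ-++ (lists j E₀) (short j E₀) _) ▸ +-mono-≤ (sumₗ j S p) (sumₛ j S p) ▸ ≡≤ (sym (nat-+ (Wb j σ) (WT j σ)))

    ∣⋃∣≤ : ∀ J → All (_∈ E₀) J → ∣ ⋃ J ∣ ℕ.≤ r ℕ.* length J
    ∣⋃∣≤ [] _ = ℕₚ.≤-trans (ℕₚ.≤-reflexive (∣⊥∣≡0 n)) z≤n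
    ∣⋃∣≤ (j ∷ J) (p ∷ ps) = ℕₚ.≤-trans (∣∪∣≤ j (⋃ J)) (ℕₚ.≤-trans (ℕₚ.+-mono-≤ (ℕₚ.≤-reflexive (rsub-card n r p)) (∣⋃∣≤ J ps)) (ℕₚ.≤-reflexive (sym (ℕₚ.*-suc r (length J)))))

    sum₂ : ∀ k {σ} S → ∣ S ∣ ℕ.≤ σ → Σ E₀ (λ x → Σ (short k E₀) (λ J → ι ^ ∣ ⋃ (x ∷ J) ─ S ∣)) ≤ nat (W σ ℕ.* WT k (σ ℕ.+ r))
    sum₂ k S p = ≡≤ (Σ-cong E₀ (λ x → trans (Σ-cong (short k E₀) (λ J → ι-split x (⋃ J) S)) (Σ-* (ι ^ ∣ x ─ S ∣) (short k E₀) _))) ▸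
      sum-cons S p (λ x → Σ (short k E₀) (λ J → ι ^ ∣ ⋃ J ─ (S ∪ x) ∣)) (λ {x} _ q → sumₛ k (S ∪ x) q)

    sum₃ : ∀ k {σ} S → ∣ S ∣ ℕ.≤ σ → Σ E₀ (λ x → Σ (short k E₀) (λ J₁ → Σ (short k E₀) (λ J₂ → ι ^ ∣ ⋃ (x ∷ J₁ ++ J₂) ─ S ∣))) ≤
      nat (W σ ℕ.* (WT k (σ ℕ.+ r) ℕ.* WT k (σ ℕ.+ r ℕ.+ r ℕ.* k)))
    sum₃ k {σ} S p = ≡≤ (Σ-cong E₀ (λ x → trans (Σ-cong sk (λ J₁ → trans (Σ-cong sk (λ J₂ → pt x J₁ J₂)) (Σ-* (ι ^ ∣ x ─ S ∣) sk _))) (Σ-* (ι ^ ∣ x ─ S ∣) sk _))) ▸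
      sum-cons S p (λ x → Σ sk (λ J₁ → Σ sk (λ J₂ → ι ^ ∣ ⋃ J₁ ─ (S ∪ x) ∣ * ι ^ ∣ ⋃ J₂ ─ (S ∪ x ∪ ⋃ J₁) ∣)))
        (λ {x} _ q → Σ-mono∈ sk (λ {J₁} m → ≡≤ (Σ-* (ι ^ ∣ ⋃ J₁ ─ (S ∪ x) ∣) sk _) ▸ *-monoˡ (0≤^ ∣ ⋃ J₁ ─ (S ∪ x) ∣ 0≤ι) (sumₛ k (S ∪ x ∪ ⋃ J₁) (size x J₁ q m))) ▸
          ≡≤ (Σ-*ʳ (nat N₂) sk _) ▸ *-monoʳ (0≤nat N₂) (sumₛ k (S ∪ x) q) ▸ ≡≤ (sym (nat-* (WT k (σ ℕ.+ r)) N₂)))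
      where
      sk = short k E₀
      N₂ = WT k (σ ℕ.+ r ℕ.+ r ℕ.* k)
      pt : ∀ x J₁ J₂ → ι ^ ∣ ⋃ (x ∷ J₁ ++ J₂) ─ S ∣ ≡ ι ^ ∣ x ─ S ∣ * (ι ^ ∣ ⋃ J₁ ─ (S ∪ x) ∣ * ι ^ ∣ ⋃ J₂ ─ (S ∪ x ∪ ⋃ J₁) ∣)
      pt x J₁ J₂ = trans (cong (λ z → ι ^ ∣ (x ∪ z) ─ S ∣) (⋃-++ J₁ J₂)) (trans (ι-split x (⋃ J₁ ∪ ⋃ J₂) S) (cong (ι ^ ∣ x ─ S ∣ *_)
        (trans (ι-split (⋃ J₁) (⋃ J₂) (S ∪ x)) (cong (λ z → ι ^ ∣ ⋃ J₁ ─ (S ∪ x) ∣ * ι ^ ∣ ⋃ J₂ ─ z ∣) (∪-assoc S x (⋃ J₁))))))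
      size : ∀ x J₁ → ∣ S ∪ x ∣ ℕ.≤ σ ℕ.+ r → J₁ ∈ sk → ∣ S ∪ x ∪ ⋃ J₁ ∣ ℕ.≤ σ ℕ.+ r ℕ.+ r ℕ.* k
      size x J₁ q m = ℕₚ.≤-trans (ℕₚ.≤-reflexive (cong ∣_∣ (sym (∪-assoc S x (⋃ J₁))))) (ℕₚ.≤-trans (∣∪∣≤ (S ∪ x) (⋃ J₁))
        (ℕₚ.+-mono-≤ q (ℕₚ.≤-trans (∣⋃∣≤ J₁ (proj₂ (short-∈ k E₀ m))) (ℕₚ.*-monoʳ-≤ r (ℕₚ.<⇒≤ (proj₁ (short-∈ k E₀ m)))))))

-- The constants, the threshold for n, and the concrete setup.

module Parameters where
  open Rationals
  open NibbleProcess
  open Invariants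
  open Correlations
  open UniformSets
  open ConflictSystem
  open PatternCounts
  open import Data.Rational using (ℚ; 0ℚ; 1ℚ; ½; _+_; _*_; -_; _-_; _≤_; _<_; _/_)
  open import Data.Rational.Properties using (≤-trans; ≤-reflexive; +-mono-≤; <⇒≤)
  open import Data.Integer using (+_)
  open import Data.Nat using (zero; suc)
  open import Tactic.RingSolver using (solve-∀)

  -- Constants, chosen in the order in which they depend on one another; nothing here depends on n.
  module Const (t k : ℕ) where
    r s : ℕ
    r = 2 ℕ.+ t
    s = r ℕ.* r
    open Weights r public

    abstract
      cD : ℕ
      cD = 3 ℕ.^ t ℕ.* lowK t

      Kn : ℕ
      Kn = suc (suc cD ℕ.^ k ℕ.* (W r ℕ.* WT k (r ℕ.+ r)))

      -- At least `6 * Kn` divided by the admissible failure 1/(30(s+1)), as the Markov bound on the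
      -- danger requires.
      Ln : ℕ
      Ln = suc (3 ℕ.* (2 ℕ.* Kn) ℕ.* (30 ℕ.* suc s))

      -- The factor 4 makes 2L/M equal to 1/2.
      Mn : ℕ
      Mn = 4 ℕ.* Ln

      βn : ℕ
      βn = 20 ℕ.+ 2 ℕ.^ Mn

      Rn : ℕ
      Rn = βn ℕ.^ suc s

      -- The factor 30 makes the losses from collisions at most 1/30. The number 500 exceeds 361 =
      -- 19², where 19 = 9/10 * 20 * 19/18 is the bound for the load of a pair summed over all
      -- phases. The final 2 guarantees at least 60 phases.
      In : ℕ
      In = 30 ℕ.* (s ℕ.* 500 ℕ.+ Rn ℕ.^ (2 ℕ.+ k) ℕ.* Kn ℕ.+ 2)

      cD≡ : cD ≡ 3 ℕ.^ t ℕ.* lowK t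
      cD≡ = refl
      Kn≥ : suc cD ℕ.^ k ℕ.* (W r ℕ.* WT k (r ℕ.+ r)) ℕ.≤ Kn
      Kn≥ = ℕₚ.n≤1+n _
      1≤Kn : 1 ℕ.≤ Kn
      1≤Kn = s≤s z≤n
      1≤Ln : 1 ℕ.≤ Ln
      1≤Ln = s≤s z≤n
      Ln≥ : 3 ℕ.* (2 ℕ.* Kn) ℕ.* (30 ℕ.* suc s) ℕ.≤ Ln
      Ln≥ = ℕₚ.n≤1+n _
      Mn≡ : Mn ≡ 4 ℕ.* Ln
      Mn≡ = refl
      βn≡ : βn ≡ 20 ℕ.+ 2 ℕ.^ Mn
      βn≡ = refl
      Rn≡ : Rn ≡ βn ℕ.^ suc s
      Rn≡ = refl
      In≡ : In ≡ 30 ℕ.* (s ℕ.* 500 ℕ.+ Rn ℕ.^ (2 ℕ.+ k) ℕ.* Kn ℕ.+ 2)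
      In≡ = refl
      In≥ : 60 ℕ.≤ In
      In≥ = ℕₚ.*-monoʳ-≤ 30 {2} (ℕₚ.m≤n+m 2 (s ℕ.* 500 ℕ.+ Rn ℕ.^ (2 ℕ.+ k) ℕ.* Kn))

    -- `ω` bounds the number of objects belonging to at most `3 + k` edges, `σ₀` the number of
    -- vertices fixed in an overlap pattern, and `Cε` times 1/n the overlap of two objects.
    κn R₃ ω σ₀ Wall Cε : ℕ
    κn = βn ℕ.* (2 ℕ.* 2 ℕ.^ Mn)
    R₃ = 2 ℕ.* Rn ℕ.+ 1
    ω = suc s ℕ.* (3 ℕ.+ k)
    σ₀ = r ℕ.* (2 ℕ.+ k) ℕ.+ 4
    Wall = W σ₀ ℕ.* (suc (WT k (σ₀ ℕ.+ r)) ℕ.* suc (WT k (σ₀ ℕ.+ r ℕ.+ r ℕ.* k)))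
    Cε = Rn ℕ.* (R₃ ℕ.^ (3 ℕ.* k) ℕ.* (suc cD ℕ.^ (1 ℕ.+ 2 ℕ.* k) ℕ.* Wall))

    -- `Q` and `Q₂` are the numerators over n of the moment error and of the drift error. In `N₀`
    -- they are scaled to their allowances, with 324 = 18² from `δ′` = 1/18; the term
    -- `2 * Rn * suc cD` keeps single rates at most 1/2.
    Q Q₂ N₀ : ℕ
    Q = In ℕ.* (κn ℕ.^ ω ℕ.* (ω ℕ.* ω ℕ.* Cε)) ℕ.+ 3 ℕ.* suc cD ℕ.* W (r ℕ.+ r) ℕ.* βn ℕ.^ (3 ℕ.* suc s)
    Q₂ = In ℕ.* (κn ℕ.^ suc s ℕ.* (ω ℕ.* ω ℕ.* Cε) ℕ.* (In ℕ.* (2 ℕ.* Ln)))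
    N₀ = 2 ℕ.* Q ℕ.* (30 ℕ.* suc s ℕ.* 324) ℕ.+ Q₂ ℕ.+ 2 ℕ.* Rn ℕ.* suc cD ℕ.+ t ℕ.+ 3

  ninth twentieth : ℚ
  ninth = + 9 / 10
  twentieth = + 1 / 20

  module Instance (t k m : ℕ) (1≤t : 1 ℕ.≤ t) (n≥ : Const.N₀ t k ℕ.≤ 2 ℕ.+ m) where
    open Const t k
    n : ℕ
    n = 2 ℕ.+ m
    module C = Concrete n t k 1≤t

    ι : ℚ
    ι = inv (nat n)
    0<n : 0ℚ < nat n
    0<n = 0<nat (suc m)
    nι : nat n * ι ≡ 1ℚ
    nι = inv-r 0<n
    0≤ι : 0ℚ ≤ ι
    0≤ι = 0≤inv (<⇒≤ 0<n)

    n≥+ : ∀ {a} → a ℕ.≤ N₀ → a ℕ.≤ n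
    n≥+ p = ℕₚ.≤-trans p n≥
    3≤n : 3 ℕ.≤ n
    3≤n = n≥+ (ℕₚ.m≤n+m 3 _)
    t+3≤n : t ℕ.+ 3 ℕ.≤ n
    t+3≤n = n≥+ (ℕₚ.≤-trans (ℕₚ.m≤n+m (t ℕ.+ 3) (2 ℕ.* Q ℕ.* (30 ℕ.* suc s ℕ.* 324) ℕ.+ Q₂ ℕ.+ 2 ℕ.* Rn ℕ.* suc cD)) (ℕₚ.≤-reflexive (sym (ℕₚ.+-assoc _ t 3))))
    1+t≤m : suc t ℕ.≤ m
    1+t≤m = ℕₚ.+-cancelˡ-≤ 2 _ _ (ℕₚ.≤-trans (ℕₚ.≤-reflexive (ℕₚ.+-comm 3 t)) t+3≤n)
    t≤m : t ℕ.≤ m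
    t≤m = ℕₚ.≤-trans (ℕₚ.n≤1+n t) 1+t≤m

    ι-small : ∀ {a} → a ℕ.≤ n → nat a * ι ≤ 1ℚ
    ι-small p = *-monoʳ 0≤ι (nat-mono p) ▸ ≡≤ nι

    ι≤1 : ι ≤ 1ℚ
    ι≤1 = ≡≤ (trans (sym (ℚₚ.*-identityˡ ι)) (cong (_* ι) (sym (ℚₚ.+-identityʳ 1ℚ)))) ▸ ι-small (ℕₚ.≤-trans (s≤s z≤n) 3≤n)

    open PatternSums n r 3≤n ι 0≤ι nι using (sum₁; sum₂; sum₃; ∣⋃∣≤) public

    D : ℕ
    D = binom m t
    0<D : 0ℚ < nat D
    0<D = <-≤ 0<1 (≡≤ (sym (ℚₚ.+-identityʳ 1ℚ)) ▸ nat-mono (binom-pos t≤m))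
    Di : ℚ
    Di = inv (nat D)
    0≤Di : 0ℚ ≤ Di
    0≤Di = 0≤inv (<⇒≤ 0<D)
    DDi : nat D * Di ≡ 1ℚ
    DDi = inv-r 0<D

    cd : ℚ
    cd = nat (suc cD)
    1≤cd : 1ℚ ≤ cd
    1≤cd = 1≤nat cD
    0≤cd : 0ℚ ≤ cd
    0≤cd = 0≤nat (suc cD)

    pow-n : n ℕ.^ t ℕ.≤ cD ℕ.* D
    pow-n = ℕₚ.≤-trans (ℕₚ.^-monoˡ-≤ t n≤3m) (ℕₚ.≤-trans (ℕₚ.≤-reflexive (mul 3 m t)) (ℕₚ.≤-trans (ℕₚ.*-monoʳ-≤ (3 ℕ.^ t) (binom-low t m t≤m))
       (ℕₚ.≤-reflexive (trans (sym (ℕₚ.*-assoc (3 ℕ.^ t) (lowK t) D)) (cong (ℕ._* D) (sym cD≡))))))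
      where
      n≤3m : n ℕ.≤ 3 ℕ.* m
      n≤3m = ℕₚ.≤-trans (ℕₚ.≤-reflexive (ℕₚ.+-comm 2 m)) (ℕₚ.+-monoʳ-≤ m (ℕₚ.+-mono-≤ 1≤m (ℕₚ.+-mono-≤ 1≤m z≤n)))
        where 1≤m = ℕₚ.≤-trans (s≤s z≤n) 1+t≤m
      mul : ∀ a b t → (a ℕ.* b) ℕ.^ t ≡ a ℕ.^ t ℕ.* b ℕ.^ t
      mul a b zero = refl
      mul a b (suc t) = trans (cong (a ℕ.* b ℕ.*_) (mul a b t)) (l a b (a ℕ.^ t) (b ℕ.^ t))
        where
        l : ∀ a b c d → a ℕ.* b ℕ.* (c ℕ.* d) ≡ a ℕ.* c ℕ.* (b ℕ.* d)
        l = ℕR.solve-∀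

    Di≤ : Di ≤ cd * ι ^ t
    Di≤ = *-cancelʳ (0<^ t 0<n) (*-cancelʳ 0<D (≡≤ (trans (l Di (nat n ^ t) (nat D)) (trans (cong (nat n ^ t *_) DDi) (ℚₚ.*-identityʳ _))) ▸
        ≡≤ (sym (nat-^ n t)) ▸ nat-mono (ℕₚ.≤-trans pow-n (ℕₚ.*-monoˡ-≤ D (ℕₚ.n≤1+n cD))) ▸ ≡≤ (trans (nat-* (suc cD) D) (sym (cong (_* nat D) (trans (ℚₚ.*-assoc cd (ι ^ t) (nat n ^ t)) (trans (cong (cd *_) ιn) (ℚₚ.*-identityʳ cd))))))))
      where
      l : ∀ a b c → a * b * c ≡ b * (c * a)
      l = solve-∀ ℚring
      ιn : ι ^ t * nat n ^ t ≡ 1ℚ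
      ιn = trans (sym (*-^ ι (nat n) t)) (trans (cong (_^ t) (trans (ℚₚ.*-comm ι (nat n)) nι)) (1^ t))

    -- f edges pay for t·f new vertices.
    Di^≤ : ∀ f {ν c} → ν ℕ.≤ t ℕ.* f → f ℕ.≤ c → Di ^ f ≤ cd ^ c * ι ^ ν
    Di^≤ f {ν} {c} p q = ^-mono f 0≤Di Di≤ ▸ ≡≤ (trans (*-^ cd (ι ^ t) f) (cong (cd ^ f *_) (pw t f))) ▸
      *-mono (0≤^ f 0≤cd) (^-monoʳ 1≤cd q) (0≤^ (t ℕ.* f) 0≤ι) (^-antiʳ 0≤ι ι≤1 p)
      where
      pw : ∀ t f → (ι ^ t) ^ f ≡ ι ^ (t ℕ.* f)
      pw t zero = cong (ι ^_) (sym (ℕₚ.*-zeroʳ t))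
      pw t (suc f) = trans (cong (ι ^ t *_) (pw t f)) (trans (sym (^-+ ι t (t ℕ.* f))) (cong (ι ^_) (sym (ℕₚ.*-suc t f))))

    iI : ℚ
    iI = inv (nat In)
    0<In : 0ℚ < nat In
    0<In = <-≤ 0<1 (≡≤ (sym (ℚₚ.+-identityʳ 1ℚ)) ▸ nat-mono (ℕₚ.≤-trans (s≤s z≤n) In≥))
    IiI : nat In * iI ≡ 1ℚ
    IiI = inv-r 0<In
    0≤iI : 0ℚ ≤ iI
    0≤iI = 0≤inv (<⇒≤ 0<In)

    I-small : ∀ {a} → a ℕ.≤ In → nat a * iI ≤ 1ℚ
    I-small p = *-monoʳ 0≤iI (nat-mono p) ▸ ≡≤ IiI

    -- All phases together have rate 9/10. As 9/10 * 19/18 = 19/20, the reserve `b` is 1/20 and pair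
    -- weights stay below `B` = 20.
    θ Y1 β c h : ℚ
    θ = ninth * iI
    Y1 = + 19 / 18
    β = nat βn
    c = θ * β ^ suc s
    h = inv (nat Mn)

    1≤Mn : 1 ℕ.≤ Mn
    1≤Mn = ℕₚ.≤-trans (ℕₚ.≤-trans (s≤s z≤n) (ℕₚ.*-monoʳ-≤ 4 1≤Ln)) (ℕₚ.≤-reflexive (sym Mn≡))
    0<Mn : 0ℚ < nat Mn
    0<Mn = <-≤ 0<1 (≡≤ (sym (ℚₚ.+-identityʳ 1ℚ)) ▸ nat-mono 1≤Mn)
    0≤h : 0ℚ ≤ h
    0≤h = 0≤inv (<⇒≤ 0<Mn)

    0≤θ : 0ℚ ≤ θ
    0≤θ = 0≤* (ℚₚ.nonNegative⁻¹ ninth) 0≤iI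

    Iθ : nat In * θ ≡ ninth
    Iθ = trans (l (nat In) ninth iI) (trans (cong (ninth *_) IiI) (ℚₚ.*-identityʳ ninth))
      where
      l : ∀ n a i → n * (a * i) ≡ a * (n * i)
      l = solve-∀ ℚring

    1≤β : 1ℚ ≤ β
    1≤β = ≡≤ (sym (ℚₚ.+-identityʳ 1ℚ)) ▸ nat-mono (ℕₚ.≤-trans (s≤s z≤n) (ℕₚ.≤-reflexive (sym βn≡)))

    nat-Rn : nat Rn ≡ β ^ suc s
    nat-Rn = trans (cong nat Rn≡) (nat-^ βn (suc s))

    Ic≤ : nat In * c ≤ nat Rn
    Ic≤ = ≡≤ (trans (sym (ℚₚ.*-assoc (nat In) θ _)) (cong (_* β ^ suc s) Iθ)) ▸ 1*≤ (0≤^ (suc s) (0≤nat βn)) (ℚₚ.nonNegative⁻¹ (1ℚ - ninth) ▸0) ▸ ≡≤ (sym nat-Rn)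
      where
      _▸0 : 0ℚ ≤ 1ℚ - ninth → ninth ≤ 1ℚ
      p ▸0 = -0≤ p

    0≤c : 0ℚ ≤ c
    0≤c = 0≤* 0≤θ (0≤^ (suc s) (0≤nat βn))

    c≤R : c ≤ nat Rn
    c≤R = ≤1* 0≤c (≡≤ (sym (ℚₚ.+-identityʳ 1ℚ)) ▸ nat-mono 1≤In) ▸ Ic≤
      where
      1≤In : 1 ℕ.≤ In
      1≤In = ℕₚ.≤-trans (s≤s z≤n) In≥

    S : Setup
    S = record
      { A = Subset n ; P = Fin n × Fin n ; _≟A_ = _≟S_ ; _≟P_ = _≟F_ ; E = C.E ; pairs = C.pairs ; tup = C.tup ; conf = C.conf
      ; θ = θ ; Di = Di ; L = nat Ln ; Y1 = Y1 ; s = s ; |pairs| = C.|pairs| ; uPairs = C.uPairs ; uE = rsub-unique n r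
      ; 0≤θ = 0≤θ ; 0≤Di = 0≤Di ; 0<L = <-≤ 0<1 (≡≤ (sym (ℚₚ.+-identityʳ 1ℚ)) ▸ nat-mono 1≤Ln) ; 0≤Y1 = ℚₚ.nonNegative⁻¹ Y1
      ; I = In ; M = Mn ; h = h ; 0≤h = 0≤h ; Mh = inv-r 0<Mn ; Lh = Lh
      ; b = twentieth ; B = nat 20 ; 0<b = ℚₚ.positive⁻¹ twentieth ; bB = refl
      ; Ib = ≡≤ (trans (sym (ℚₚ.*-assoc (nat In) θ Y1)) (cong (_* Y1) Iθ))
      ; β = β ; 1≤β = 1≤β ; B≤β = nat-mono (ℕₚ.≤-trans (ℕₚ.m≤m+n 20 _) (ℕₚ.≤-reflexive (sym βn≡)))
      ; 2M≤β = ≡≤ (sym (nat-^ 2 Mn)) ▸ nat-mono (ℕₚ.≤-trans (ℕₚ.m≤n+m _ 20) (ℕₚ.≤-reflexive (sym βn≡)))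
      ; c = c ; c≡ = refl ; cDi = cDi≤ ; stepB = stepB }
      where
      Lh : 2q * nat Ln * h ≤ ½
      Lh = *-cancelʳ 0<Mn (≡≤ (trans (ℚₚ.*-assoc (2q * nat Ln) h (nat Mn)) (trans (cong (2q * nat Ln *_) (trans (ℚₚ.*-comm h (nat Mn)) (inv-r 0<Mn))) (trans (ℚₚ.*-identityʳ (2q * nat Ln)) (sym (trans (cong (λ z → ½ * nat z) Mn≡) (trans (cong (½ *_) (nat-* 4 Ln)) (sym (ℚₚ.*-assoc ½ (nat 4) (nat Ln))))))))))
      stepB : θ * (nat 20 * Y1) ≤ ½
      stepB = *-cancelʳ (0<nat 59) (≡≤ (l ninth iI (nat 20 * Y1) (nat 60)) ▸ *-monoˡ (0≤* (ℚₚ.nonNegative⁻¹ ninth) (0≤* (0≤nat 20) (ℚₚ.nonNegative⁻¹ Y1))) 60I ▸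
        ≤+ {ninth * (nat 20 * Y1) * 1ℚ} {½ * nat 60} {nat 11} (0≤nat 11) refl)
        where
        l : ∀ a i b c → a * i * b * c ≡ a * b * (c * i)
        l = solve-∀ ℚring
        60I : nat 60 * iI ≤ 1ℚ
        60I = I-small In≥
      cDi≤ : c * Di ≤ ½
      cDi≤ = *-cancelʳ (0<nat 1) (*-monoʳ (0≤nat 2) (*-mono 0≤c c≤R 0≤Di (Di≤ ▸ *-monoˡ 0≤cd (^-antiʳ {n = t} 0≤ι ι≤1 1≤t))) ▸
        ≡≤ (trans (l (nat Rn) cd ι) (cong (_* ι) (sym (trans (nat-* (2 ℕ.* Rn) (suc cD)) (cong (_* cd) (nat-* 2 Rn)))))) ▸ ι-small (n≥+ big) ▸ ≡≤ refl)
        where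
        l : ∀ R d i → R * (d * (i * 1ℚ)) * (1ℚ + (1ℚ + 0ℚ)) ≡ (1ℚ + (1ℚ + 0ℚ)) * R * d * i
        l = solve-∀ ℚring
        big : 2 ℕ.* Rn ℕ.* suc cD ℕ.≤ N₀
        big = ℕₚ.≤-trans (ℕₚ.m≤n+m _ (2 ℕ.* Q ℕ.* (30 ℕ.* suc s ℕ.* 324) ℕ.+ Q₂)) (ℕₚ.≤-trans (ℕₚ.m≤m+n _ t) (ℕₚ.m≤m+n _ 3))

-- A single pick rarely kills two objects.

module OverlapErrors where
  open Rationals
  open IndependentChoice
  open NibbleProcess
  open Invariants
  open Correlations
  open Conflicts using (∣─∣)
  open UniformSets
  open ConflictSystem
  open PatternCounts
  open Parameters
  open import Data.Rational using (ℚ; 0ℚ; 1ℚ; _+_; _*_; _≤_; _/_)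
  open import Data.Rational.Properties using (≤-refl; ≤-trans; ≤-reflexive; +-mono-≤; <⇒≤)
  open import Data.Integer using (+_)
  open import Data.Nat using (suc)
  open import Data.Bool.ListAction using (all)
  open import Data.List using ([]; _∷_)
  open import Data.List.Relation.Unary.All using ([]; _∷_)
  open import Data.List.Relation.Unary.AllPairs using ([]; _∷_)
  open import Tactic.RingSolver using (solve-∀)

  module Errors (t k m : ℕ) (1≤t : 1 ℕ.≤ t) (n≥ : Const.N₀ t k ℕ.≤ 2 ℕ.+ m) where
    open Const t k hiding (s) public
    open Instance t k m 1≤t n≥ hiding (θ; Di; Y1; β; c; h; 0≤θ; 0≤Di; 1≤β; 0≤h; 0≤c) public
    open Steps S public
    open C using (_∖_; ∈∖; u∖; pset; pset⊆; ∣pset∣; ∣pset∪∣; allP<; RF; FF; confL-out; IsConf; len-split) public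

    -- The earlier picks that help `x` to kill an object: none for a pair, the remaining edges of a
    -- conflict for an edge.
    opts : Obj → List (List A)
    opts (inj₁ p) = [] ∷ []
    opts (inj₂ e) = tup

    test : Obj → A → List A → Bool
    test (inj₁ p) x J = inP p x
    test (inj₂ e) x J = conf e x J

    pks : Hist → List A → ℚ
    pks H J = Π J (λ e → 𝟙 (pk H e))

    0≤pks : ∀ H J → 0ℚ ≤ pks H J
    0≤pks H J = 0≤Π J (λ e → 0≤𝟙 (pk H e))

    all-pk : ∀ H J → 𝟙 (all (pk H) J) ≡ pks H J
    all-pk H [] = refl
    all-pk H (e ∷ J) = trans (𝟙-∧ (pk H e) (all (pk H) J)) (cong (𝟙 (pk H e) *_) (all-pk H J))

    dang≤ : ∀ H e x → 𝟙 (dang H e x) ≤ Σ tup (λ J → 𝟙 (conf e x J) * pks H J)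
    dang≤ H e x = 𝟙any≤ (λ J → conf e x J ∧ all (pk H) J) tup ▸ ≡≤ (Σ-cong tup (λ J → trans (𝟙-∧ (conf e x J) (all (pk H) J)) (cong (𝟙 (conf e x J) *_) (all-pk H J))))

    K≤ : ∀ H o x → 𝟙 (K H o x) ≤ Σ (opts o) (λ J → 𝟙 (test o x J) * pks H J)
    K≤ H (inj₁ p) x = ≡≤ (l (𝟙 (inP p x)))
      where
      l : ∀ a → a ≡ a * 1ℚ + 0ℚ
      l = solve-∀ ℚring
    K≤ H (inj₂ e) x = ≡≤ (𝟙-∧ (okF H e) (dang H e x)) ▸ 𝟙* (okF H e) (0≤𝟙 (dang H e x)) ▸ dang≤ H e x

    Π-filter : ∀ (f : A → Bool) J {g : A → ℚ} → (∀ e → 0ℚ ≤ g e) → (∀ e → g e ≤ 1ℚ) → Π J g ≤ Π (filterᵇ f J) g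
    Π-filter f [] _ _ = ≤-refl
    Π-filter f (e ∷ J) {g} p q with f e
    ... | true = *-monoˡ (p e) (Π-filter f J p q)
    ... | false = 1*≤ (0≤Π J p) (q e) ▸ Π-filter f J p q

    picks≤ : ∀ H J (f : A → Bool) {y} → 0ℚ ≤ y → pks H J ≤ Π (filterᵇ f J) (λ e → 𝟙 (pk H e) + y)
    picks≤ H J f {y} p = Π-filter f J (λ e → 0≤𝟙 (pk H e)) (λ e → 𝟙≤1 (pk H e)) ▸ Π-mono (filterᵇ f J) (λ e → 0≤𝟙 (pk H e)) (λ e → ≤+ p refl)

    R₃Di : ℚ
    R₃Di = nat R₃ * Di

    T≤1 : T ≤ 1ℚ
    T≤1 = ≡≤ Iθ ▸ ≤+ {ninth} {1ℚ} {+ 1 / 10} (ℚₚ.nonNegative⁻¹ (+ 1 / 10)) refl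

    rate≤ : ∀ {τ} → τ ℕ.≤ I → nat τ * (c * Di) + c₂ * Di ≤ R₃Di
    rate≤ {τ} τ≤ = +-mono-≤ (*-monoʳ 0≤cDi (nat-mono τ≤)) (≤-refl {c₂ * Di}) ▸ ≡≤ (l (nat I) c Di T) ▸
      *-monoʳ 0≤Di (+-mono-≤ (+-mono-≤ Ic≤ c≤R) T≤1) ▸ ≡≤ (cong (_* Di) (trans (l2 (nat Rn)) (sym (trans (nat-+ (2 ℕ.* Rn) 1) (cong (_+ nat 1) (nat-* 2 Rn))))))
      where
      l : ∀ i c d t → i * (c * d) + (c + t) * d ≡ (i * c + c + t) * d
      l = solve-∀ ℚring
      l2 : ∀ r → r + r + 1ℚ ≡ (1ℚ + (1ℚ + 0ℚ)) * r + (1ℚ + 0ℚ)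
      l2 = solve-∀ ℚring

    -- `J₁` and `J₂` may meet each other and `J`, so each distinct edge is counted once; it costs at
    -- most (2Rn + 1) * `Di`, the sum of all its rates and the allowance in `efac`.
    Et-picks : ∀ τ → τ ℕ.≤ I → ∀ J J₁ J₂ → Unique J → Unique J₁ → Unique J₂ → All (_∈ E) J → All (_∈ E) J₁ → All (_∈ E) J₂ →
      Et τ (λ H → pks H J₁ * pks H J₂ * Π J (efac H)) ≤ R₃Di ^ (length J ℕ.+ (length (J₁ ∖ J) ℕ.+ length (J₂ ∖ (J ++ J₁))))
    Et-picks τ τ≤ J J₁ J₂ u u₁ u₂ J⊆ J₁⊆ J₂⊆ =
      Et-mono τ τ≤ (λ H l → *-monoʳ (0≤Π J (λ e → 0≤f H e)) (*-mono (0≤pks H J₁) (picks≤ H J₁ _ 0≤y) (0≤pks H J₂) (picks≤ H J₂ _ 0≤y)) ▸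
        ≡≤ (sym (trans (Π-++ J (X ++ X′) (λ e → 𝟙 (pk H e) + y)) (trans (cong (Π J (efac H) *_) (Π-++ X X′ (λ e → 𝟙 (pk H e) + y)))
          (ℚₚ.*-comm (Π J (efac H)) (Π X (λ e → 𝟙 (pk H e) + y) * Π X′ (λ e → 𝟙 (pk H e) + y))))))) ▸
      crude τ τ≤ (J ++ (X ++ X′)) uS (Allₚ.++⁺ J⊆ (Allₚ.++⁺ (sub J J₁⊆) (sub (J ++ J₁) J₂⊆))) y 0≤y ▸
      ^-mono (length (J ++ (X ++ X′))) (0≤+ (0≤* (0≤nat τ) 0≤cDi) 0≤y) (rate≤ τ≤) ▸
      ≡≤ (cong (R₃Di ^_) (trans (length-++ J) (cong (length J ℕ.+_) (length-++ X))))
      where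
      y = c₂ * Di
      0≤y = 0≤* 0≤c₂ 0≤Di
      X = J₁ ∖ J
      X′ = J₂ ∖ (J ++ J₁)
      0≤f : ∀ H e → 0ℚ ≤ efac H e
      0≤f H e = 0≤+ (0≤𝟙 (pk H e)) 0≤y
      sub : ∀ {C} F → All (_∈ E) C → All (_∈ E) (C ∖ F)
      sub {C} F al = All.tabulate (λ m → All.lookup al (proj₁ (∈∖ C F m)))
      uS : Unique (J ++ (X ++ X′))
      uS = Uₚ.++⁺ u (Uₚ.++⁺ (u∖ J₁ J u₁) (u∖ J₂ (J ++ J₁) u₂) (λ (a , b) → proj₂ (∈∖ J₂ (J ++ J₁) b) (∈-++⁺ʳ J (proj₁ (∈∖ J₁ J a))))) dj
        where
        dj : ∀ {v} → v ∈ J × v ∈ X ++ X′ → Empty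
        dj (a , b) with ∈-++⁻ X b
        ... | inj₁ c = proj₂ (∈∖ J₁ J c) a
        ... | inj₂ c = proj₂ (∈∖ J₂ (J ++ J₁) c) (∈-++⁺ˡ a)

    opt-len : ∀ o {J} → J ∈ opts o → length J ℕ.≤ k
    opt-len (inj₁ p) (here refl) = z≤n
    opt-len (inj₂ e) m = ℕₚ.<⇒≤ (proj₁ (short-∈ k E m))

    opt⊆ : ∀ o {J} → J ∈ opts o → All (_∈ E) J
    opt⊆ (inj₁ p) (here refl) = []
    opt⊆ (inj₂ e) m = proj₂ (short-∈ k E m)

    opt-u : ∀ o {x J} → J ∈ opts o → test o x J ≡ true → Unique J
    opt-u (inj₁ p) (here refl) _ = []
    opt-u (inj₂ e) _ c with IsConf.uniq (confL-out c)
    ... | _ ∷ (_ ∷ u) = u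

    -- V is the set of vertices already spoken for by the two objects and by J; every way in which x can kill both objects spans few vertices outside V.
    record Joint (J : List A) (o o′ : Obj) : Set where
      field
        V : A
        cov : ∀ {x J₁ J₂} → x ∈ E → J₁ ∈ opts o → J₂ ∈ opts o′ → test o x J₁ ≡ true → test o′ x J₂ ≡ true →
          ∣ ⋃ (x ∷ J₁ ++ J₂) ─ V ∣ ℕ.+ 1 ℕ.≤ t ℕ.* (1 ℕ.+ length (J₁ ∖ J) ℕ.+ length (J₂ ∖ (J ++ J₁)))
        total : Σ E (λ x → Σ (opts o) (λ J₁ → Σ (opts o′) (λ J₂ → ι ^ ∣ ⋃ (x ∷ J₁ ++ J₂) ─ V ∣))) ≤ nat Wall

    Rε : ℚ
    Rε = nat Rn * (nat R₃ ^ (3 ℕ.* k) * cd ^ (1 ℕ.+ 2 ℕ.* k))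
    0≤Rε : 0ℚ ≤ Rε
    0≤Rε = 0≤* (0≤nat Rn) (0≤* (0≤^ (3 ℕ.* k) (0≤nat R₃)) (0≤^ (1 ℕ.+ 2 ℕ.* k) 0≤cd))

    1≤R₃ : 1ℚ ≤ nat R₃
    1≤R₃ = ≡≤ (sym (ℚₚ.+-identityʳ 1ℚ)) ▸ nat-mono (ℕₚ.m≤n+m 1 (2 ℕ.* Rn))

    Cε≡ : Rε * ι * nat Wall ≡ nat Cε * ι
    Cε≡ = trans (l (nat Rn) (nat R₃ ^ (3 ℕ.* k)) (cd ^ (1 ℕ.+ 2 ℕ.* k)) ι (nat Wall)) (cong (_* ι) (sym (trans (nat-* Rn _) (cong (nat Rn *_) (trans (nat-* (R₃ ℕ.^ (3 ℕ.* k)) _)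
       (cong₂ _*_ (nat-^ R₃ (3 ℕ.* k)) (trans (nat-* (suc cD ℕ.^ (1 ℕ.+ 2 ℕ.* k)) Wall) (cong (_* nat Wall) (nat-^ (suc cD) (1 ℕ.+ 2 ℕ.* k))))))))))
      where
      l : ∀ a b c i w → a * (b * c) * i * w ≡ a * (b * (c * w)) * i
      l = solve-∀ ℚring

    module _ {J o o′} (jt : Joint J o o′) (lJ : length J ℕ.≤ k) (uJ : Unique J) (J⊆ : All (_∈ E) J) (τ : ℕ) (τ≤ : τ ℕ.≤ I) where
      open Joint jt

      private
        tt′ : A → List A → List A → ℚ
        tt′ x J₁ J₂ = 𝟙 (test o x J₁) * 𝟙 (test o′ x J₂)

        -- The new edges of the pattern, `x` included, each bring a factor `Di`, that is, `t` powers
        -- of 1/n up to constants. By `cov` the pattern has at least one new vertex fewer than these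
        -- powers pay for, so a spare factor `ι` remains.
        term≤ : ∀ {x J₁ J₂} → x ∈ E → J₁ ∈ opts o → J₂ ∈ opts o′ →
          nat Rn * Di * tt′ x J₁ J₂ * Et τ (λ H → pks H J₁ * pks H J₂ * Π J (efac H)) ≤ Di ^ length J * (Rε * ι) * ι ^ ∣ ⋃ (x ∷ J₁ ++ J₂) ─ V ∣
        term≤ {x} {J₁} {J₂} x∈ m₁ m₂ with bool? (test o x J₁) | bool? (test o′ x J₂)
        ... | inj₂ eq | _ = ≡≤ (trans (cong (λ z → nat Rn * Di * (𝟙 z * 𝟙 (test o′ x J₂)) * ex) eq) (l (nat Rn) Di (𝟙 (test o′ x J₂)) ex)) ▸ 0≤rhs
          where
          ex = Et τ (λ H → pks H J₁ * pks H J₂ * Π J (efac H))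
          l : ∀ r d b x → r * d * (0ℚ * b) * x ≡ 0ℚ
          l = solve-∀ ℚring
          0≤rhs = 0≤* (0≤* (0≤^ (length J) 0≤Di) (0≤* 0≤Rε 0≤ι)) (0≤^ ∣ ⋃ (x ∷ J₁ ++ J₂) ─ V ∣ 0≤ι)
        ... | inj₁ _ | inj₂ eq = ≡≤ (trans (cong (λ z → nat Rn * Di * (𝟙 (test o x J₁) * 𝟙 z) * ex) eq) (l (nat Rn) Di (𝟙 (test o x J₁)) ex)) ▸ 0≤rhs
          where
          ex = Et τ (λ H → pks H J₁ * pks H J₂ * Π J (efac H))
          l : ∀ r d b x → r * d * (b * 0ℚ) * x ≡ 0ℚ
          l = solve-∀ ℚring
          0≤rhs = 0≤* (0≤* (0≤^ (length J) 0≤Di) (0≤* 0≤Rε 0≤ι)) (0≤^ ∣ ⋃ (x ∷ J₁ ++ J₂) ─ V ∣ 0≤ι)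
        ... | inj₁ eq₁ | inj₁ eq₂ =
          ≡≤ (cong₂ (λ y z → nat Rn * Di * (𝟙 y * 𝟙 z) * ex) eq₁ eq₂) ▸
          *-monoˡ (0≤* (0≤* (0≤nat Rn) 0≤Di) (0≤* 0≤1 0≤1)) (Et-picks τ τ≤ J J₁ J₂ uJ (opt-u o m₁ eq₁) (opt-u o′ m₂ eq₂) J⊆ (opt⊆ o m₁) (opt⊆ o′ m₂)) ▸
          ≡≤ (trans (cong (nat Rn * Di * (1ℚ * 1ℚ) *_) (trans (*-^ (nat R₃) Di (length J ℕ.+ ab)) (cong (nat R₃ ^ (length J ℕ.+ ab) *_) (^-+ Di (length J) ab))))
                (l (nat Rn) Di (nat R₃ ^ (length J ℕ.+ ab)) (Di ^ length J) (Di ^ ab))) ▸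
          *-monoˡ (0≤* (0≤^ (length J) 0≤Di) (0≤nat Rn)) (*-mono (0≤^ (length J ℕ.+ ab) (0≤nat R₃)) (^-monoʳ 1≤R₃ len) (0≤^ (suc ab) 0≤Di) (Di^≤ (suc ab) (cov x∈ m₁ m₂ eq₁ eq₂) f≤)) ▸
          ≡≤ (trans (cong (λ z → Di ^ length J * nat Rn * (nat R₃ ^ (3 ℕ.* k) * (cd ^ (1 ℕ.+ 2 ℕ.* k) * z))) (^-+ ι ν 1))
                (l2 (Di ^ length J) (nat Rn) (nat R₃ ^ (3 ℕ.* k)) (cd ^ (1 ℕ.+ 2 ℕ.* k)) ι (ι ^ ν)))
          where
          ex = Et τ (λ H → pks H J₁ * pks H J₂ * Π J (efac H))
          a = length (J₁ ∖ J)
          a′ = length (J₂ ∖ (J ++ J₁))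
          ab = a ℕ.+ a′
          ν = ∣ ⋃ (x ∷ J₁ ++ J₂) ─ V ∣
          a≤ : a ℕ.≤ k
          a≤ = ℕₚ.≤-trans (ℕₚ.≤-trans (ℕₚ.m≤n+m a _) (ℕₚ.≤-reflexive (len-split J₁ J))) (opt-len o m₁)
          a′≤ : a′ ℕ.≤ k
          a′≤ = ℕₚ.≤-trans (ℕₚ.≤-trans (ℕₚ.m≤n+m a′ _) (ℕₚ.≤-reflexive (len-split J₂ (J ++ J₁)))) (opt-len o′ m₂)
          len : length J ℕ.+ ab ℕ.≤ 3 ℕ.* k
          len = ℕₚ.+-mono-≤ lJ (ℕₚ.+-mono-≤ a≤ (ℕₚ.≤-trans a′≤ (ℕₚ.m≤m+n k 0)))
          f≤ : suc ab ℕ.≤ 1 ℕ.+ 2 ℕ.* k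
          f≤ = s≤s (ℕₚ.+-mono-≤ a≤ (ℕₚ.≤-trans a′≤ (ℕₚ.m≤m+n k 0)))
          l : ∀ r d R J A → r * d * (1ℚ * 1ℚ) * (R * (J * A)) ≡ J * r * (R * (d * A))
          l = solve-∀ ℚring
          l2 : ∀ j r R c i v → j * r * (R * (c * (v * (i * 1ℚ)))) ≡ j * (r * (R * c) * i) * v
          l2 = solve-∀ ℚring

        ptw : ∀ H → length H ℕ.≤ I → over (q H) (K H) E o o′ * Π J (efac H) ≤
          Σ E (λ x → Σ (opts o) (λ J₁ → Σ (opts o′) (λ J₂ → nat Rn * Di * tt′ x J₁ J₂ * (pks H J₁ * pks H J₂ * Π J (efac H)))))
        ptw H H≤ = ≡≤ (sym (Σ-*ʳ (Π J (efac H)) E _)) ▸ Σ-mono E one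
          where
          F = Π J (efac H)
          0≤F : 0ℚ ≤ F
          0≤F = 0≤Π J (λ e → 0≤+ (0≤𝟙 (pk H e)) (0≤* 0≤c₂ 0≤Di))
          module X = At H H≤
          g g′ : A → List A → ℚ
          g x J₁ = 𝟙 (test o x J₁) * pks H J₁
          g′ x J₂ = 𝟙 (test o′ x J₂) * pks H J₂
          l : ∀ c a p b q f → c * (a * p) * (b * q) * f ≡ c * (a * b) * (p * q * f)
          l = solve-∀ ℚring
          one : ∀ x → q H x * 𝟙 (K H o x) * 𝟙 (K H o′ x) * F ≤ Σ (opts o) (λ J₁ → Σ (opts o′) (λ J₂ → nat Rn * Di * tt′ x J₁ J₂ * (pks H J₁ * pks H J₂ * F)))
          one x = *-monoʳ 0≤F (*-mono (0≤* (X.0≤q x) (0≤𝟙 (K H o x))) (*-mono (X.0≤q x) (X.q≤c x ▸ *-monoʳ 0≤Di c≤R) (0≤𝟙 (K H o x)) (K≤ H o x)) (0≤𝟙 (K H o′ x)) (K≤ H o′ x)) ▸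
            ≡≤ (trans (cong (λ z → z * Σ (opts o′) (g′ x) * F) (sym (Σ-* (nat Rn * Di) (opts o) (g x)))) (trans (cong (_* F) (sym (Σ-*ʳ (Σ (opts o′) (g′ x)) (opts o) (λ J₁ → nat Rn * Di * g x J₁))))
              (trans (sym (Σ-*ʳ F (opts o) _)) (Σ-cong (opts o) (λ J₁ → trans (cong (_* F) (sym (Σ-* (nat Rn * Di * g x J₁) (opts o′) (g′ x)))) (trans (sym (Σ-*ʳ F (opts o′) _))
                (Σ-cong (opts o′) (λ J₂ → l (nat Rn * Di) (𝟙 (test o x J₁)) (pks H J₁) (𝟙 (test o′ x J₂)) (pks H J₂) F))))))))

      Et-over : Et τ (λ H → over (q H) (K H) E o o′ * Π J (efac H)) ≤ Di ^ length J * (nat Cε * ι)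
      Et-over =
        Et-mono τ τ≤ (λ H l → ptw H (subst (ℕ._≤ I) (sym l) τ≤)) ▸
        ≡≤ (trans (Et-Σ τ E _) (Σ-cong E (λ x → trans (Et-Σ τ (opts o) _) (Σ-cong (opts o) (λ J₁ → trans (Et-Σ τ (opts o′) _) (Σ-cong (opts o′) (λ J₂ → Et-* τ (nat Rn * Di * tt′ x J₁ J₂) _))))))) ▸
        Σ-mono∈ E (λ {x} x∈ → Σ-mono∈ (opts o) (λ {J₁} m₁ → Σ-mono∈ (opts o′) (λ {J₂} m₂ → term≤ {x} {J₁} {J₂} x∈ m₁ m₂) ▸ ≡≤ (Σ-* Z (opts o′) _)) ▸ ≡≤ (Σ-* Z (opts o) _)) ▸
        ≡≤ (Σ-* Z E _) ▸ *-monoˡ (0≤* (0≤^ (length J) 0≤Di) (0≤* 0≤Rε 0≤ι)) total ▸ ≡≤ (trans (ℚₚ.*-assoc (Di ^ length J) (Rε * ι) (nat Wall)) (cong (Di ^ length J *_) Cε≡))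
        where
        Z = Di ^ length J * (Rε * ι)

    over-sym : ∀ (p : A → ℚ) (Kf : Obj → A → Bool) o o′ → over p Kf E o o′ ≡ over p Kf E o′ o
    over-sym p Kf o o′ = Σ-cong E (λ x → l (p x) (𝟙 (Kf o x)) (𝟙 (Kf o′ x)))
      where
      l : ∀ a b c → a * b * c ≡ a * c * b
      l = solve-∀ ℚring

    ⋃[_] : ∀ (x : A) → ⋃ (x ∷ []) ≡ x
    ⋃[ x ] = ∪-identityʳ x

    in-pset : ∀ {p x} → inP p x ≡ true → pset p ⊆ₛ x
    in-pset {p} {x} eq = pset⊆ {x} {p} (MP.mem-∈ eq)

    ∣pset∣≡ : ∀ {p} → p ∈ C.allP → ∣ pset p ∣ ≡ 2
    ∣pset∣≡ {a , b} m = ∣pset∣ (allP< m)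

    1≤WT : ∀ {a} x y → a ℕ.≤ x → a ℕ.≤ x ℕ.* suc y
    1≤WT x y p = ℕₚ.≤-trans p (ℕₚ.m≤m*n x (suc y))

    -- Two distinct pairs cover at least three vertices of `x`, leaving at most t - 1 new ones.
    jointPP : ∀ {J p p′} → p ∈ C.allP → p′ ∈ C.allP → p ≢ p′ → Joint J (inj₁ p) (inj₁ p′)
    jointPP {J} {p} {p′} m m′ ne = record { V = V ; cov = cov ; total = total }
      where
      V = pset p ∪ pset p′
      cov : ∀ {x J₁ J₂} → x ∈ E → J₁ ∈ [] ∷ [] → J₂ ∈ [] ∷ [] → inP p x ≡ true → inP p′ x ≡ true →
          ∣ ⋃ (x ∷ J₁ ++ J₂) ─ V ∣ ℕ.+ 1 ℕ.≤ t ℕ.* (1 ℕ.+ length (J₁ ∖ J) ℕ.+ length (J₂ ∖ (J ++ J₁)))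
      cov {x} x∈ (here refl) (here refl) a b = ℕₚ.+-cancelʳ-≤ 2 _ _ (ℕₚ.≤-trans (ℕₚ.≤-reflexive (trans (cong (λ z → ∣ z ─ V ∣ ℕ.+ 1 ℕ.+ 2) ⋃[ x ]) (ℕₚ.+-assoc ∣ x ─ V ∣ 1 2)))
        (ℕₚ.≤-trans (ℕₚ.+-monoʳ-≤ ∣ x ─ V ∣ (∣pset∪∣ m m′ ne)) (ℕₚ.≤-trans (∣─∣ x V sub) (ℕₚ.≤-reflexive (trans (rsub-card n r x∈) (l t))))))
        where
        l : ∀ t → 2 ℕ.+ t ≡ t ℕ.* 1 ℕ.+ 2
        l = ℕR.solve-∀
        sub : V ⊆ₛ x
        sub z with x∈p∪q⁻ (pset p) (pset p′) z
        ... | inj₁ w = in-pset {p} {x} a w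
        ... | inj₂ w = in-pset {p′} {x} b w
      ∣V∣ : ∣ V ∣ ℕ.≤ σ₀
      ∣V∣ = ℕₚ.≤-trans (∣∪∣≤ (pset p) (pset p′)) (ℕₚ.≤-trans (ℕₚ.≤-reflexive (cong₂ ℕ._+_ (∣pset∣≡ m) (∣pset∣≡ m′))) (ℕₚ.m≤n+m 4 (r ℕ.* (2 ℕ.+ k))))
      l : ∀ a → a + 0ℚ + 0ℚ ≡ a
      l = solve-∀ ℚring
      total : Σ E (λ x → ι ^ ∣ ⋃ (x ∷ []) ─ V ∣ + 0ℚ + 0ℚ) ≤ nat Wall
      total = ≡≤ (Σ-cong E (λ x → trans (l (ι ^ ∣ ⋃ (x ∷ []) ─ V ∣)) (cong (λ z → ι ^ ∣ z ─ V ∣) ⋃[ x ]))) ▸ sum₁ V ∣V∣ ▸ nat-mono (ℕₚ.m≤m*n (W σ₀) _)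

    jointPF : ∀ {J p e} → length J ℕ.≤ k → All (_∈ E) J → p ∈ C.allP → e ∈ E → Joint J (inj₁ p) (inj₂ e)
    jointPF {J} {p} {e} lJ J⊆ m e∈ = record { V = V ; cov = cov ; total = total }
      where
      V = ⋃ (e ∷ J) ∪ pset p
      cov : ∀ {x J₁ J₂} → x ∈ E → J₁ ∈ [] ∷ [] → J₂ ∈ tup → inP p x ≡ true → conf e x J₂ ≡ true →
          ∣ ⋃ (x ∷ J₁ ++ J₂) ─ V ∣ ℕ.+ 1 ℕ.≤ t ℕ.* (1 ℕ.+ length (J₁ ∖ J) ℕ.+ length (J₂ ∖ (J ++ J₁)))
      cov {x} {J₂ = J₂} x∈ (here refl) _ a b = ℕₚ.≤-trans (RF {e} {x} {J₂} {J} (pset p) (confL-out b) (in-pset {p} {x} a) (ℕₚ.≤-reflexive (sym (∣pset∣≡ m))))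
        (ℕₚ.≤-reflexive (cong (λ z → t ℕ.* (1 ℕ.+ length (J₂ ∖ z))) (sym (++-identityʳ J))))
        where open import Data.List.Properties using (++-identityʳ)
      ∣V∣ : ∣ V ∣ ℕ.≤ σ₀
      ∣V∣ = ℕₚ.≤-trans (∣∪∣≤ (⋃ (e ∷ J)) (pset p)) (ℕₚ.+-mono-≤ (ℕₚ.≤-trans (∣⋃∣≤ (e ∷ J) (e∈ ∷ J⊆)) (ℕₚ.*-monoʳ-≤ r (s≤s (ℕₚ.≤-trans lJ (ℕₚ.n≤1+n k))))) (ℕₚ.≤-trans (ℕₚ.≤-reflexive (∣pset∣≡ m)) (s≤s (s≤s z≤n))))
      total : Σ E (λ x → Σ tup (λ J₂ → ι ^ ∣ ⋃ (x ∷ J₂) ─ V ∣) + 0ℚ) ≤ nat Wall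
      total = ≡≤ (Σ-cong E (λ x → ℚₚ.+-identityʳ (Σ tup (λ J₂ → ι ^ ∣ ⋃ (x ∷ J₂) ─ V ∣)))) ▸ sum₂ k V ∣V∣ ▸
        nat-mono (ℕₚ.*-monoʳ-≤ (W σ₀) (1≤WT (suc (WT k (σ₀ ℕ.+ r))) (WT k (σ₀ ℕ.+ r ℕ.+ r ℕ.* k)) (ℕₚ.n≤1+n _)))

    jointFF : ∀ {J e e′} → length J ℕ.≤ k → All (_∈ E) J → e ∈ E → e′ ∈ E → e ≢ e′ → ∣ e ∩ e′ ∣ ℕ.≤ 2 → Joint J (inj₂ e) (inj₂ e′)
    jointFF {J} {e} {e′} lJ J⊆ e∈ e′∈ ne p = record { V = V ; cov = cov ; total = total }
      where
      V = ⋃ (e ∷ e′ ∷ J)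
      cov : ∀ {x J₁ J₂} → x ∈ E → J₁ ∈ tup → J₂ ∈ tup → conf e x J₁ ≡ true → conf e′ x J₂ ≡ true →
          ∣ ⋃ (x ∷ J₁ ++ J₂) ─ V ∣ ℕ.+ 1 ℕ.≤ t ℕ.* (1 ℕ.+ length (J₁ ∖ J) ℕ.+ length (J₂ ∖ (J ++ J₁)))
      cov {x} {J₁} {J₂} _ _ _ a b = FF {e} {e′} {x} {J₁} {J₂} {J} (confL-out a) (confL-out b) ne p
      ∣V∣ : ∣ V ∣ ℕ.≤ σ₀
      ∣V∣ = ℕₚ.≤-trans (∣⋃∣≤ (e ∷ e′ ∷ J) (e∈ ∷ e′∈ ∷ J⊆)) (ℕₚ.≤-trans (ℕₚ.*-monoʳ-≤ r (s≤s (s≤s lJ))) (ℕₚ.m≤m+n (r ℕ.* (2 ℕ.+ k)) 4))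
      total : Σ E (λ x → Σ tup (λ J₁ → Σ tup (λ J₂ → ι ^ ∣ ⋃ (x ∷ J₁ ++ J₂) ─ V ∣))) ≤ nat Wall
      total = sum₃ k V ∣V∣ ▸ nat-mono (ℕₚ.*-monoʳ-≤ (W σ₀) (ℕₚ.*-mono-≤ (ℕₚ.n≤1+n (WT k (σ₀ ℕ.+ r))) (ℕₚ.n≤1+n (WT k (σ₀ ℕ.+ r ℕ.+ r ℕ.* k)))))

    Valid : Obj → Set
    Valid (inj₁ p) = p ∈ C.allP
    Valid (inj₂ e) = e ∈ E

    -- What the three overlap bounds ask of two objects. Edges that share three or more vertices
    -- fall outside `FF`; where they occur they are handled as rare exceptions.
    Apart : Obj → Obj → Set
    Apart (inj₁ p) (inj₁ p′) = p ≢ p′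
    Apart (inj₁ _) (inj₂ _) = ⊤
    Apart (inj₂ _) (inj₁ _) = ⊤
    Apart (inj₂ e) (inj₂ e′) = e ≢ e′ × ∣ e ∩ e′ ∣ ℕ.≤ 2

    module _ (J : List A) (lJ : length J ℕ.≤ k) (uJ : Unique J) (J⊆ : All (_∈ E) J) (τ : ℕ) (τ≤ : τ ℕ.≤ I) where
      B₁ : ℚ
      B₁ = Di ^ length J * (nat Cε * ι)
      0≤B₁ : 0ℚ ≤ B₁
      0≤B₁ = 0≤* (0≤^ (length J) 0≤Di) (0≤* (0≤nat Cε) 0≤ι)

      Et-pair : ∀ o o′ → Valid o → Valid o′ → Apart o o′ → Et τ (λ H → over (q H) (K H) E o o′ * Π J (efac H)) ≤ B₁
      Et-pair (inj₁ p) (inj₁ p′) a b ne = Et-over (jointPP {J} a b ne) lJ uJ J⊆ τ τ≤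
      Et-pair (inj₁ p) (inj₂ e) a b _ = Et-over (jointPF {J} lJ J⊆ a b) lJ uJ J⊆ τ τ≤
      Et-pair (inj₂ e) (inj₁ p) a b _ = ≡≤ (Et-cong τ (λ H → cong (_* Π J (efac H)) (over-sym (q H) (K H) (inj₂ e) (inj₁ p)))) ▸ Et-over (jointPF {J} lJ J⊆ b a) lJ uJ J⊆ τ τ≤
      Et-pair (inj₂ e) (inj₂ e′) a b (ne , i) = Et-over (jointFF {J} lJ J⊆ a b ne i) lJ uJ J⊆ τ τ≤

      Et-row : ∀ o os → Valid o → All Valid os → All (Apart o) os → Et τ (λ H → Σ os (over (q H) (K H) E o) * Π J (efac H)) ≤ nat (length os) * B₁
      Et-row o os v vs as = ≡≤ (trans (Et-cong τ (λ H → sym (Σ-*ʳ (Π J (efac H)) os _))) (Et-Σ τ os _)) ▸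
        Σ-mono∈ os (λ {o′} mem → Et-pair o o′ v (All.lookup vs mem) (All.lookup as mem)) ▸ ≡≤ (Σ-const os B₁)

      Et-overs : ∀ os → All Valid os → AllPairs Apart os → Et τ (λ H → overs (q H) (K H) E os * Π J (efac H)) ≤ nat (length os ℕ.* length os) * B₁
      Et-overs [] _ _ = ≡≤ (trans (Et-cong τ (λ H → ℚₚ.*-zeroˡ (Π J (efac H)))) (Et-const τ 0ℚ)) ▸ ≡≤ (sym (ℚₚ.*-zeroˡ B₁))
      Et-overs (o ∷ os) (v ∷ vs) (a ∷ as) =
        ≡≤ (trans (Et-cong τ (λ H → ℚₚ.*-distribʳ-+ (Π J (efac H)) (Σ os (over (q H) (K H) E o)) (overs (q H) (K H) E os))) (Et-+ τ _ _)) ▸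
        +-mono-≤ (Et-row o os v vs a) (Et-overs os vs as) ▸
        ≡≤ (trans (sym (ℚₚ.*-distribʳ-+ B₁ (nat ℓ) (nat (ℓ ℕ.* ℓ)))) (cong (_* B₁) (sym (nat-+ ℓ (ℓ ℕ.* ℓ))))) ▸
        *-monoʳ 0≤B₁ (nat-mono (ℕₚ.≤-trans (ℕₚ.+-mono-≤ (ℕₚ.n≤1+n ℓ) (ℕₚ.*-monoʳ-≤ ℓ (ℕₚ.n≤1+n ℓ))) (ℕₚ.≤-refl)))
        where ℓ = length os

    ωC : ℕ
    ωC = ω ℕ.* ω ℕ.* Cε

    ε : ℚ
    ε = nat ωC * ι

    0≤ε : 0ℚ ≤ ε
    0≤ε = 0≤* (0≤nat ωC) 0≤ι

    Et-overs-ε : ∀ τ → τ ℕ.≤ I → ∀ J → length J ℕ.≤ k → Unique J → All (_∈ E) J → ∀ os → length os ℕ.≤ ω → All Valid os → AllPairs Apart os →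
      Et τ (λ H → overs (q H) (K H) E os * Π J (efac H)) ≤ Di ^ length J * ε
    Et-overs-ε τ τ≤ J lJ uJ J⊆ os lo vs as = Et-overs J lJ uJ J⊆ τ τ≤ os vs as ▸ *-monoʳ (0≤B₁ J lJ uJ J⊆ τ τ≤) (nat-mono (ℕₚ.*-mono-≤ lo lo)) ▸
      ≡≤ (trans (l (nat (ω ℕ.* ω)) (Di ^ length J) (nat Cε) ι) (cong (λ z → Di ^ length J * (z * ι)) (sym (nat-* (ω ℕ.* ω) Cε))))
      where
      l : ∀ w d c i → w * (d * (c * i)) ≡ d * (w * c * i)
      l = solve-∀ ℚring

    κ≡ : κ ≡ nat κn
    κ≡ = sym (trans (nat-* βn _) (cong (nat βn *_) (trans (nat-* 2 (2 ℕ.^ Mn)) (cong (nat 2 *_) (nat-^ 2 Mn)))))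

    -- The accumulated overlap error of at most ω objects.
    εI : ℚ
    εI = nat (In ℕ.* (κn ℕ.^ ω ℕ.* ωC)) * ι

    err≤ : ∀ {τ ℓ} → τ ℕ.≤ I → ℓ ℕ.≤ ω → nat τ * (κ ^ ℓ * ε) ≤ εI
    err≤ {τ} {ℓ} τ≤ ℓ≤ = *-mono (0≤nat τ) (nat-mono τ≤) (0≤* (0≤^ ℓ 0≤κ) 0≤ε) (*-monoʳ 0≤ε (^-monoʳ 1≤κ ℓ≤)) ▸
      ≡≤ (trans (cong (λ z → nat In * (z * ε)) (trans (cong (_^ ω) κ≡) (sym (nat-^ κn ω)))) (trans (l (nat In) (nat (κn ℕ.^ ω)) (nat ωC) ι)
        (cong (_* ι) (sym (trans (nat-* In _) (cong (nat In *_) (nat-* (κn ℕ.^ ω) ωC)))))))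
      where
      l : ∀ a b c i → a * (b * (c * i)) ≡ a * (b * c) * i
      l = solve-∀ ℚring

    Et-UBε : ∀ O J → length J ℕ.≤ k → Unique J → All (_∈ E) J → length (O ++ objs* J) ℕ.≤ ω → All Valid (O ++ objs* J) → AllPairs Apart (O ++ objs* J) →
      ∀ τ → τ ℕ.≤ I → Et τ (λ H → Π O (φ H) * Π J (fac 0ℚ H)) ≤ Di ^ length J * ((nat τ * θ) ^ length J + εI)
    Et-UBε O J lJ uJ J⊆ lo vs as τ τ≤ =
      Et-UB ε O J uJ J⊆ (λ τ′ τ′< → Et-overs-ε τ′ (ℕₚ.≤-trans (ℕₚ.n≤1+n τ′) τ′<) J lJ uJ J⊆ (O ++ objs* J) lo vs as) τ τ≤ 0ℚ ≤-refl
        (≡≤ (ℚₚ.+-identityˡ (nat τ * θ)) ▸ *-monoʳ 0≤θ (nat-mono τ≤)) ▸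
      *-monoˡ (0≤^ (length J) 0≤Di) (+-mono-≤ (≡≤ (cong (_^ length J) (ℚₚ.+-identityˡ (nat τ * θ)))) (err≤ {τ} {length (O ++ objs* J)} τ≤ lo))

    Et-Πφ : ∀ O → length O ℕ.≤ ω → All Valid O → AllPairs Apart O → ∀ τ → τ ℕ.≤ I → Et τ (λ H → Π O (φ H)) ≤ 1ℚ + εI
    Et-Πφ O lo vs as τ τ≤ = ≡≤ (Et-cong τ (λ H → sym (ℚₚ.*-identityʳ (Π O (φ H))))) ▸
      Et-UBε O [] z≤n [] [] (subst (λ X → length X ℕ.≤ ω) e lo) (subst (All Valid) e vs) (subst (AllPairs Apart) e as) τ τ≤ ▸ ≡≤ (ℚₚ.*-identityˡ (1ℚ + εI))
      where
      open import Data.List.Properties using (++-identityʳ)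
      e : O ≡ O ++ []
      e = sym (++-identityʳ O)

-- Moment bounds for weights, danger and degrees in the concrete system.

module Moments where
  open Rationals
  open IndependentChoice
  open NibbleProcess
  open Invariants
  open Correlations
  open Conflicts using (∣─∣+∣∩∣; ∣─∣; unique-⊂; filter-in; in-filter; filter-u)
  open UniformSets
  open ConflictSystem
  open PatternCounts
  open Parameters
  open OverlapErrors
  open import Data.Rational using (ℚ; 0ℚ; 1ℚ; _+_; _*_; _≤_)
  open import Data.Rational.Properties using (≤-refl; ≤-trans; ≤-reflexive; +-mono-≤; <⇒≤)
  open import Data.Integer using (+_)
  open import Data.Nat using (suc)
  open import Data.List using ([]; _∷_)
  open import Data.List.Relation.Unary.All using ([]; _∷_)
  open import Data.List.Relation.Unary.AllPairs using ([]; _∷_)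
  open import Tactic.RingSolver using (solve-∀)

  module Fields (t k m : ℕ) (1≤t : 1 ℕ.≤ t) (n≥ : Const.N₀ t k ℕ.≤ 2 ℕ.+ m) where
    open Errors t k m 1≤t n≥ public

    block : A → List P → List Obj
    block e ps = inj₂ e ∷ map inj₁ ps

    others : P → A → List P
    others p e = filterᵇ (λ p′ → not (does (p ≟P p′))) (pairs e)

    others-out : ∀ p e {p′} → p′ ∈ others p e → p′ ∈ pairs e × p ≢ p′
    others-out p e {p′} m = proj₁ (filter-in (λ p′ → not (does (p ≟P p′))) (pairs e) m) , ne
      where
      ne : p ≢ p′
      ne refl with p ≟P p | proj₂ (filter-in (λ p′ → not (does (p ≟P p′))) (pairs e) m)
      ... | yes _ | ()
      ... | no f | _ = f refl

    pairs⊆ : ∀ {e p} → p ∈ pairs e → p ∈ C.allP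
    pairs⊆ {e} m = proj₁ (filter-in (C.test e) C.allP m)

    ValidBlock : A → List P → Set
    ValidBlock e ps = e ∈ E × (∀ {p} → p ∈ ps → p ∈ pairs e) × Unique ps

    whole : ∀ {e} → e ∈ E → ValidBlock e (pairs e)
    whole {e} e∈ = e∈ , (λ m → m) , uPairs e

    partial : ∀ p {e} → e ∈ E → ValidBlock e (others p e)
    partial p {e} e∈ = e∈ , (λ m → proj₁ (others-out p e m)) , filter-u (λ p′ → not (does (p ≟P p′))) (uPairs e)

    block-valid : ∀ {e ps} → ValidBlock e ps → All Valid (block e ps)
    block-valid {e} {ps} (e∈ , ⊆ , u) = e∈ ∷ Allₚ.map⁺ (All.tabulate (λ m → pairs⊆ {e} (⊆ m)))

    block-apart : ∀ {e ps} → ValidBlock e ps → AllPairs Apart (block e ps)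
    block-apart {e} {ps} (e∈ , ⊆ , u) = Allₚ.map⁺ (All.tabulate (λ _ → tt)) ∷ APₚ.map⁺ u

    cross : ∀ {e ps e′ ps′} → e ≢ e′ → ∣ e ∩ e′ ∣ ℕ.≤ 2 → (∀ {p} → p ∈ ps → p ∉ ps′) → All (λ o → All (Apart o) (block e′ ps′)) (block e ps)
    cross {e} {ps} {e′} {ps′} ne i dj = ((ne , i) ∷ Allₚ.map⁺ (All.tabulate (λ _ → tt))) ∷
      Allₚ.map⁺ (All.tabulate (λ m → tt ∷ Allₚ.map⁺ (All.tabulate (λ m′ eq → dj m (subst (_∈ ps′) (sym eq) m′)))))

    cross-++ : ∀ {os os₁ os₂} → All (λ o → All (Apart o) os₁) os → All (λ o → All (Apart o) os₂) os → All (λ o → All (Apart o) (os₁ ++ os₂)) os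
    cross-++ [] [] = []
    cross-++ (a ∷ as) (b′ ∷ bs) = Allₚ.++⁺ a b′ ∷ cross-++ as bs

    block-len : ∀ {e ps} → ValidBlock e ps → length (block e ps) ℕ.≤ suc s
    block-len {e} {ps} (_ , ⊆ , u) = s≤s (ℕₚ.≤-trans (ℕₚ.≤-reflexive (length-map inj₁ ps)) (ℕₚ.≤-trans (unique-⊂ u ⊆) (|pairs| e)))

    two-common : ∀ {e e′ p} → p ∈ pairs e → p ∈ pairs e′ → 2 ℕ.≤ ∣ e ∩ e′ ∣
    two-common {e} {e′} {p} a b′ = ℕₚ.≤-trans (ℕₚ.≤-reflexive (sym (∣pset∣≡ (pairs⊆ {e} a)))) (p⊆q⇒∣p∣≤∣q∣ (λ z → x∈p∩q⁺ (pset⊆ {e} {p} a z , pset⊆ {e′} {p} b′ z)))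

    three-common : ∀ {e e′ p p′} → p ≢ p′ → p ∈ pairs e → p ∈ pairs e′ → p′ ∈ pairs e → p′ ∈ pairs e′ → 3 ℕ.≤ ∣ e ∩ e′ ∣
    three-common {e} {e′} {p} {p′} ne a b′ a′ b″ = ℕₚ.≤-trans (∣pset∪∣ (pairs⊆ {e} a) (pairs⊆ {e} a′) ne) (p⊆q⇒∣p∣≤∣q∣ (λ z → x∈p∩q⁺ (sub e a a′ z , sub e′ b′ b″ z)))
      where
      sub : ∀ e → p ∈ pairs e → p′ ∈ pairs e → pset p ∪ pset p′ ⊆ₛ e
      sub e u v z with x∈p∪q⁻ (pset p) (pset p′) z
      ... | inj₁ w = pset⊆ {e} {p} u w
      ... | inj₂ w = pset⊆ {e} {p′} v w

    3≤r : 3 ℕ.≤ r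
    3≤r = s≤s (s≤s 1≤t)

    ≢-small : ∀ {e e′} → e ∈ E → ∣ e ∩ e′ ∣ ℕ.≤ 2 → e ≢ e′
    ≢-small {e} e∈ i refl = ℕₚ.<-irrefl refl (ℕₚ.≤-trans 3≤r (ℕₚ.≤-trans (ℕₚ.≤-reflexive (trans (sym (rsub-card n r e∈)) (cong ∣_∣ (sym (∩-idem e))))) i))

    -- Edges of a minimal configuration share at most one vertex, hence no pair, so all their
    -- objects are mutually apart.
    conf-objs : ∀ {e x J} → conf e x J ≡ true → All (_∈ E) (e ∷ x ∷ J) → All Valid (objs* (e ∷ x ∷ J)) × AllPairs Apart (objs* (e ∷ x ∷ J))
    conf-objs {e} {x} {J} cf al = valid (e ∷ x ∷ J) al , apart (e ∷ x ∷ J) (λ z → z) (IsConf.uniq cf′) al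
      where
      cf′ = confL-out cf
      valid : ∀ C → All (_∈ E) C → All Valid (objs* C)
      valid [] _ = []
      valid (e ∷ C) (p ∷ ps) = Allₚ.++⁺ (block-valid (whole p)) (valid C ps)
      crosses : ∀ {e} C → e ∈ E → (∀ {x} → x ∈ C → ∣ e ∩ x ∣ ℕ.≤ 1) → All (λ o → All (Apart o) (objs* C)) (objs e)
      crosses [] _ _ = All.tabulate (λ _ → [])
      crosses {e} (x ∷ C) e∈ f = cross-++ (cross (≢-small e∈ (ℕₚ.m≤n⇒m≤1+n (f (here refl)))) (ℕₚ.m≤n⇒m≤1+n (f (here refl)))
        (λ {p} a b′ → ℕₚ.<-irrefl refl (ℕₚ.≤-trans (two-common {e} {x} {p} a b′) (f (here refl))))) (crosses C e∈ (λ z → f (there z)))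
      apart : ∀ D → (∀ {z} → z ∈ D → z ∈ e ∷ x ∷ J) → Unique D → All (_∈ E) D → AllPairs Apart (objs* D)
      apart [] _ _ _ = []
      apart (y ∷ D) ⊆ (a ∷ u) (p ∷ ps) = APₚ.++⁺ (block-apart (whole p)) (apart D (λ z → ⊆ (there z)) u ps)
        (crosses D p (λ z → C.share≤1 cf′ (⊆ (here refl)) (⊆ (there z)) (All.lookup a z)))

    objs*-len : ∀ D → All (_∈ E) D → length (objs* D) ℕ.≤ suc s ℕ.* length D
    objs*-len [] _ = z≤n
    objs*-len (e ∷ D) (p ∷ ps) = ℕₚ.≤-trans (ℕₚ.≤-reflexive (length-++ (objs e))) (ℕₚ.≤-trans (ℕₚ.+-mono-≤ (block-len (whole p)) (objs*-len D ps)) (ℕₚ.≤-reflexive (sym (ℕₚ.*-suc (suc s) (length D)))))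

    1≤ω : suc s ℕ.≤ ω
    1≤ω = ℕₚ.m≤m*n (suc s) (3 ℕ.+ k)

    εI≤ : ∀ {a} → In ℕ.* (κn ℕ.^ ω ℕ.* ωC) ℕ.≤ a → εI ≤ nat a * ι
    εI≤ p = *-monoʳ 0≤ι (nat-mono p)

    0≤εI : 0ℚ ≤ εI
    0≤εI = 0≤* (0≤nat (In ℕ.* (κn ℕ.^ ω ℕ.* ωC))) 0≤ι

    ε₁ : ℚ
    ε₁ = nat Q * ι

    εI≤ε₁ : εI ≤ ε₁
    εI≤ε₁ = εI≤ (ℕₚ.m≤m+n _ (3 ℕ.* suc cD ℕ.* W (r ℕ.+ r) ℕ.* βn ℕ.^ (3 ℕ.* suc s)))

    hov′ : ∀ τ → τ ℕ.≤ I → ∀ {e} → e ∈ E → Et τ (λ H → overs (q H) (K H) E (objs e)) ≤ ε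
    hov′ τ τ≤ {e} e∈ = ≡≤ (Et-cong τ (λ H → sym (ℚₚ.*-identityʳ (overs (q H) (K H) E (objs e))))) ▸
      Et-overs-ε τ τ≤ [] z≤n [] [] (objs e) (ℕₚ.≤-trans (block-len (whole e∈)) 1≤ω) (block-valid (whole e∈)) (block-apart (whole e∈)) ▸ ≡≤ (ℚₚ.*-identityˡ ε)

    hW′ : ∀ τ → τ ℕ.≤ I → ∀ {e} → e ∈ E → Et τ (λ H → w H e) ≤ 1ℚ + ε₁
    hW′ τ τ≤ {e} e∈ = Et-Πφ (objs e) (ℕₚ.≤-trans (block-len (whole e∈)) 1≤ω) (block-valid (whole e∈)) (block-apart (whole e∈)) τ τ≤ ▸ +-mono-≤ (≤-refl {1ℚ}) εI≤ε₁

    0<0 : ∀ {a b} → a ℕ.≤ b → a ℕ.> b → Empty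
    0<0 p q = ℕₚ.<-irrefl refl (ℕₚ.≤-trans q p)

    Kc′ : ℚ
    Kc′ = nat Kn
    0≤Kc : 0ℚ ≤ Kc′
    0≤Kc = 0≤nat Kn

    -- A configuration spans at most `t` vertices per edge plus 2, of which `e` accounts for
    -- `2 + t`; the other edges thus pay in full for the new vertices.
    conf-deg′ : ∀ {e} → e ∈ E → Σ E (λ e″ → Σ tup (λ J → 𝟙 (conf e e″ J) * (Di * Di ^ length J))) ≤ Kc′
    conf-deg′ {e} e∈ = Σ-mono E (λ x → Σ-mono∈ tup (λ {J} m → term x m) ▸ ≡≤ (Σ-* (cd ^ k) tup _)) ▸ ≡≤ (Σ-* (cd ^ k) E _) ▸
      *-monoˡ (0≤^ k 0≤cd) (sum₂ k e (ℕₚ.≤-reflexive (rsub-card n r e∈))) ▸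
      ≡≤ (sym (trans (nat-* (suc cD ℕ.^ k) _) (cong (_* nat (W r ℕ.* WT k (r ℕ.+ r))) (nat-^ (suc cD) k)))) ▸ nat-mono Kn≥
      where
      term : ∀ x {J} → J ∈ tup → 𝟙 (conf e x J) * (Di * Di ^ length J) ≤ cd ^ k * ι ^ ∣ ⋃ (x ∷ J) ─ e ∣
      term x {J} mm with bool? (conf e x J)
      ... | inj₂ eq = ≡≤ (trans (cong (λ z → 𝟙 z * (Di * Di ^ length J)) eq) (ℚₚ.*-zeroˡ (Di * Di ^ length J))) ▸ 0≤* (0≤^ k 0≤cd) (0≤^ ∣ ⋃ (x ∷ J) ─ e ∣ 0≤ι)
      ... | inj₁ eq = ≡≤ (trans (cong (λ z → 𝟙 z * (Di * Di ^ length J)) eq) (ℚₚ.*-identityˡ (Di * Di ^ length J))) ▸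
          Di^≤ (suc (length J)) ν (proj₁ (short-∈ k E mm))
        where
        cf = confL-out eq
        ν : ∣ ⋃ (x ∷ J) ─ e ∣ ℕ.≤ t ℕ.* suc (length J)
        ν = ℕₚ.+-cancelʳ-≤ (2 ℕ.+ t) _ _ (ℕₚ.≤-trans (ℕₚ.+-mono-≤ (─-mono (⋃ (x ∷ J)) (⋃ (e ∷ x ∷ J)) e e (q⊆p∪q e (⋃ (x ∷ J))) (λ z → z)) (ℕₚ.≤-reflexive (sym (rsub-card n r e∈))))
          (ℕₚ.≤-trans (∣─∣ (⋃ (e ∷ x ∷ J)) e (p⊆p∪q (⋃ (x ∷ J)))) (ℕₚ.≤-trans (IsConf.small cf) (ℕₚ.≤-reflexive (l t (length J))))))
          where
          open Conflicts using (─-mono)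
          l : ∀ t j → t ℕ.* (2 ℕ.+ j) ℕ.+ 2 ≡ t ℕ.* suc j ℕ.+ (2 ℕ.+ t)
          l = ℕR.solve-∀

    inP≡ : ∀ {p e} → p ∈ C.allP → e ∈ E → inP p e ≡ lookup e (proj₁ p) ∧ lookup e (proj₂ p)
    inP≡ {a , b′} {e} m e∈ with inP (a , b′) e in eq
    ... | true = sym (let (_ , u , v , _) = C.pairs-out {e} (MP.mem-∈ {a , b′} {pairs e} eq) in cong₂ _∧_ u v)
    ... | false with lookup e a in ea | lookup e b′ in eb
    ...   | false | _ = refl
    ...   | true | false = refl
    ...   | true | true = trans (sym eq) (MP.∈-mem (in-filter (C.test e) m (cong₂ _∧_ (cong₂ _∧_ ea eb) (yes-does (∣ e ∣ ℕₚ.≟ r) (rsub-card n r e∈)))))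

    reg : ∀ {p} → p ∈ C.allP → Di * Σ E (λ e₁ → 𝟙 (inP p e₁)) ≡ 1ℚ
    reg {a , b′} mm = trans (cong (Di *_) (trans (Σ-cong∈ E (λ e∈ → cong 𝟙 (inP≡ mm e∈))) (count₂ m r a b′ (allP< mm)))) (trans (ℚₚ.*-comm Di (nat D)) DDi)

    -- Double counting: every pair has the same degree D, and every edge has at most `s` pairs.
    allP-size′ : nat (length C.allP) ≤ nat s * (nat (length E) * Di)
    allP-size′ = ≡≤ (trans (sym (ℚₚ.*-identityʳ (nat (length C.allP)))) (trans (sym (Σ-const C.allP 1ℚ)) (trans (Σ-cong∈ C.allP (λ mm → sym (reg mm))) (trans (Σ-* Di C.allP _) (cong (Di *_) (Σ-swap C.allP E _)))))) ▸
      *-monoˡ 0≤Di (Σ-mono E row ▸ ≡≤ (Σ-const E (nat s))) ▸ ≡≤ (l Di (nat (length E)) (nat s))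
      where
      l : ∀ d e s → d * (e * s) ≡ s * (e * d)
      l = solve-∀ ℚring
      row : ∀ e → Σ C.allP (λ p → 𝟙 (inP p e)) ≤ nat s
      row e = ≡≤ (trans (Σ-cong C.allP (λ p → sym (ℚₚ.*-identityʳ (𝟙 (inP p e))))) (trans (sym (Σ-filter (λ p → inP p e) C.allP (λ _ → 1ℚ))) (trans (Σ-const (filterᵇ (λ p → inP p e) C.allP) 1ℚ) (ℚₚ.*-identityʳ _)))) ▸
        nat-mono (ℕₚ.≤-trans (unique-⊂ {ys = pairs e} (filter-u (λ p → inP p e) C.uAllP) (λ {p} mm → MP.mem-∈ {p} {pairs e} (proj₂ (filter-in (λ p → inP p e) C.allP mm)))) (|pairs| e))

    εI≤1 : εI ≤ 1ℚ
    εI≤1 = ι-small (n≥+ big)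
      where
      big : In ℕ.* (κn ℕ.^ ω ℕ.* ωC) ℕ.≤ N₀
      big = ℕₚ.≤-trans (ℕₚ.m≤m+n _ _) (ℕₚ.≤-trans (ℕₚ.≤-trans (ℕₚ.m≤n*m Q 2) (ℕₚ.m≤m*n (2 ℕ.* Q) (30 ℕ.* suc s ℕ.* 324)))
        (ℕₚ.≤-trans (ℕₚ.m≤m+n _ Q₂) (ℕₚ.≤-trans (ℕₚ.m≤m+n _ (2 ℕ.* Rn ℕ.* suc cD)) (ℕₚ.≤-trans (ℕₚ.m≤m+n _ t) (ℕₚ.m≤m+n _ 3)))))

    μ′ : ℚ
    μ′ = 2q * Kc′

    -- For each conflict the weights of `e` and `x` and the picks of `J` are nearly uncorrelated,
    -- which gives at most `Di ^ length J` times 1 + `εI` ≤ 2; this is the factor 2 in `μ′`.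
    hμ′ : ∀ τ → τ ℕ.≤ I → ∀ {e} → e ∈ E → Et τ (λ H → w H e * gh H e) ≤ θ * μ′
    hμ′ τ τ≤ {e} e∈ =
      Et-mono τ τ≤ (λ H l → ptw H (subst (ℕ._≤ I) (sym l) τ≤)) ▸
      ≡≤ (trans (Et-* τ (θ * Di) _) (cong (θ * Di *_) (trans (Et-Σ τ E _) (Σ-cong E (λ x → trans (Et-Σ τ tup _) (Σ-cong tup (λ J → Et-* τ (𝟙 (conf e x J)) _))))))) ▸
      *-monoˡ 0≤θDi (Σ-mono∈ E (λ {x} x∈ → Σ-mono∈ tup (λ {J} mm → term x∈ mm))) ▸
      ≡≤ (trans (ℚₚ.*-assoc θ Di _) (cong (θ *_) (trans (sym (Σ-* Di E _)) (trans (Σ-cong E (λ x → trans (sym (Σ-* Di tup _)) (trans (Σ-cong tup (λ J → l Di (𝟙 (conf e x J)) (Di ^ length J) 2q)) (Σ-* 2q tup _)))) (Σ-* 2q E _))))) ▸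
      *-monoˡ 0≤θ (*-monoˡ 0≤2q (conf-deg′ e∈))
      where
      l : ∀ d b j z → d * (b * (j * z)) ≡ z * (b * (d * j))
      l = solve-∀ ℚring
      val : A → List A → Hist → ℚ
      val x J H = Π (objs e ++ objs x) (φ H) * Π J (fac 0ℚ H)
      fac0 : ∀ H y → fac 0ℚ H y ≡ 𝟙 (pk H y)
      fac0 H y = l′ (𝟙 (pk H y)) Di (w H y)
        where
        l′ : ∀ a d w → a + 0ℚ * d * w ≡ a
        l′ = solve-∀ ℚring
      ptw : ∀ H → length H ℕ.≤ I → w H e * gh H e ≤ θ * Di * Σ E (λ x → Σ tup (λ J → 𝟙 (conf e x J) * val x J H))
      ptw H H≤ = ≡≤ (l1 (w H e) (θ * Di) _) ▸ *-monoˡ 0≤θDi (≡≤ (sym (Σ-* (w H e) E _)) ▸ Σ-mono E one)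
        where
        module X = At H H≤
        l1 : ∀ a b c → a * (b * c) ≡ b * (a * c)
        l1 = solve-∀ ℚring
        l2 : ∀ a b p w → a * (b * p * w) ≡ b * (a * w * p)
        l2 = solve-∀ ℚring
        one : ∀ x → w H e * (𝟙 (dang H e x) * w H x) ≤ Σ tup (λ J → 𝟙 (conf e x J) * val x J H)
        one x = *-monoˡ (X.0≤w e) (*-monoʳ (X.0≤w x) (dang≤ H e x)) ▸
          ≡≤ (trans (cong (w H e *_) (sym (Σ-*ʳ (w H x) tup _))) (trans (sym (Σ-* (w H e) tup _)) (Σ-cong tup (λ J → trans (l2 (w H e) (𝟙 (conf e x J)) (pks H J) (w H x))
            (cong (𝟙 (conf e x J) *_) (cong₂ _*_ (sym (Π-++ (objs e) (objs x) (φ H))) (sym (Π-cong J (fac0 H)))))))))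
      term : ∀ {x J} → x ∈ E → J ∈ tup → 𝟙 (conf e x J) * Et τ (val x J) ≤ 𝟙 (conf e x J) * (Di ^ length J * 2q)
      term {x} {J} x∈ mm with bool? (conf e x J)
      ... | inj₂ eq = ≡≤ (trans (cong (λ z → 𝟙 z * Et τ (val x J)) eq) (trans (ℚₚ.*-zeroˡ (Et τ (val x J))) (sym (trans (cong (λ z → 𝟙 z * (Di ^ length J * 2q)) eq) (ℚₚ.*-zeroˡ (Di ^ length J * 2q))))))
      ... | inj₁ eq = *-monoˡ (0≤𝟙 (conf e x J)) (Et-UBε (objs e ++ objs x) J lJ uJ J⊆ lenω (subst (All Valid) assoc (proj₁ ok)) (subst (AllPairs Apart) assoc (proj₂ ok)) τ τ≤ ▸
          *-monoˡ (0≤^ (length J) 0≤Di) (+-mono-≤ (^-mono (length J) (0≤* (0≤nat τ) 0≤θ) (*-monoʳ 0≤θ (nat-mono τ≤) ▸ T≤1) ▸ ≡≤ (1^ (length J))) εI≤1))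
        where
        J⊆ = proj₂ (short-∈ k E mm)
        lJ = ℕₚ.<⇒≤ (proj₁ (short-∈ k E mm))
        uJ = opt-u (inj₂ e) {x} {J} mm eq
        ok = conf-objs {e} {x} {J} eq (e∈ ∷ x∈ ∷ J⊆)
        assoc : objs* (e ∷ x ∷ J) ≡ (objs e ++ objs x) ++ objs* J
        assoc = sym (++-assoc (objs e) (objs x) (objs* J))
        lenω : length ((objs e ++ objs x) ++ objs* J) ℕ.≤ ω
        lenω = subst (λ z → length z ℕ.≤ ω) assoc (ℕₚ.≤-trans (objs*-len (e ∷ x ∷ J) (e∈ ∷ x∈ ∷ J⊆)) (ℕₚ.*-monoʳ-≤ (suc s) (s≤s (s≤s (ℕₚ.≤-trans lJ (ℕₚ.n≤1+n k))))))

    big? : A → A → Bool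
    big? e e′ = does (3 ℕₚ.≤? ∣ e ∩ e′ ∣)

    heavy : ℚ
    heavy = cd * ι * nat (W r)

    -- An edge that meets `e₀` in three vertices has at most t - 1 new ones, while `Di` supplies `t`
    -- powers of 1/n; one factor `ι` is left.
    heavy-sum : ∀ {e₀} → e₀ ∈ E → Σ E (λ x → Di * 𝟙 (big? e₀ x)) ≤ heavy
    heavy-sum {e₀} e∈ = Σ-mono∈ E term ▸ ≡≤ (Σ-* (cd * ι) E _) ▸ *-monoˡ (0≤* 0≤cd 0≤ι) (sum₁ e₀ (ℕₚ.≤-reflexive (rsub-card n r e∈)))
      where
      term : ∀ {x} → x ∈ E → Di * 𝟙 (big? e₀ x) ≤ cd * ι * ι ^ ∣ x ─ e₀ ∣
      term {x} x∈ with bool? (big? e₀ x)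
      ... | inj₂ eq = ≡≤ (trans (cong (λ z → Di * 𝟙 z) eq) (ℚₚ.*-zeroʳ Di)) ▸ 0≤* (0≤* 0≤cd 0≤ι) (0≤^ ∣ x ─ e₀ ∣ 0≤ι)
      ... | inj₁ eq = ≡≤ (trans (cong (λ z → Di * 𝟙 z) eq) (ℚₚ.*-identityʳ Di)) ▸ Di≤ ▸ *-monoˡ 0≤cd (^-antiʳ 0≤ι ι≤1 fewer) ▸ ≡≤ (sym (ℚₚ.*-assoc cd ι (ι ^ ∣ x ─ e₀ ∣)))
        where
        open import Data.Fin.Subset.Properties using (∩-comm)
        fewer : suc (∣ x ─ e₀ ∣) ℕ.≤ t
        fewer = ℕₚ.+-cancelʳ-≤ 2 _ _ (ℕₚ.≤-trans (ℕₚ.≤-reflexive (sym (ℕₚ.+-suc (∣ x ─ e₀ ∣) 2))) (ℕₚ.≤-trans (ℕₚ.+-monoʳ-≤ (∣ x ─ e₀ ∣) (ℕₚ.≤-trans (does-yes (3 ℕₚ.≤? ∣ e₀ ∩ x ∣) eq) (ℕₚ.≤-reflexive (cong ∣_∣ (∩-comm e₀ x)))))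
          (ℕₚ.≤-reflexive (trans (∣─∣+∣∩∣ x e₀) (trans (rsub-card n r x∈) (ℕₚ.+-comm 2 t))))))

    βB : ℚ
    βB = β ^ (3 ℕ.* suc s)
    0≤βB : 0ℚ ≤ βB
    0≤βB = 0≤^ (3 ℕ.* suc s) 0≤β

    triple : A → P → A → A → List Obj
    triple e p e₁ e₂ = objs e ++ (rest p e₁ ++ rest p e₂)

    module _ (τ : ℕ) (τ≤ : τ ℕ.≤ I) {e p} (e∈ : e ∈ E) (p∈ : p ∈ pairs e) where
      private
        ex : A → A → ℚ
        ex e₁ e₂ = Et τ (λ H → Π (triple e p e₁ e₂) (φ H))
        bs : A → A → ℚ
        bs e₁ e₂ = 𝟙 (big? e e₁) + 𝟙 (big? e e₂) + 𝟙 (big? e₁ e₂)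

      triple-len : ∀ {e₁ e₂} → e₁ ∈ E → e₂ ∈ E → length (triple e p e₁ e₂) ℕ.≤ 3 ℕ.* suc s
      triple-len {e₁} {e₂} a b′ = ℕₚ.≤-trans (ℕₚ.≤-reflexive (trans (length-++ (objs e)) (cong (length (objs e) ℕ.+_) (length-++ (rest p e₁)))))
        (ℕₚ.+-mono-≤ (block-len (whole e∈)) (ℕₚ.+-mono-≤ (block-len (partial p a)) (ℕₚ.≤-trans (block-len (partial p b′)) (ℕₚ.m≤m+n (suc s) 0))))

      -- The three edges have the pair `p` in common. When two of them meet in at most two vertices
      -- they share no other pair, and `rest` drops `p` itself, so the listed objects are apart.
      generic : ∀ {e₁ e₂} → e₁ ∈ E → e₂ ∈ E → p ∈ pairs e₁ → p ∈ pairs e₂ → ∣ e ∩ e₁ ∣ ℕ.≤ 2 → ∣ e ∩ e₂ ∣ ℕ.≤ 2 → ∣ e₁ ∩ e₂ ∣ ℕ.≤ 2 → ex e₁ e₂ ≤ 1ℚ + εI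
      generic {e₁} {e₂} a b′ p₁ p₂ i₁ i₂ i₁₂ = Et-Πφ (triple e p e₁ e₂)
        (ℕₚ.≤-trans (triple-len a b′) (ℕₚ.≤-trans (ℕₚ.≤-reflexive (ℕₚ.*-comm 3 (suc s))) (ℕₚ.*-monoʳ-≤ (suc s) (ℕₚ.m≤m+n 3 k))))
        (Allₚ.++⁺ (block-valid (whole e∈)) (Allₚ.++⁺ (block-valid (partial p a)) (block-valid (partial p b′))))
        (APₚ.++⁺ (block-apart (whole e∈)) (APₚ.++⁺ (block-apart (partial p a)) (block-apart (partial p b′))
            (cross (≢-small a i₁₂) i₁₂ (λ {p′} u v → dj {e₁} {e₂} {p′} i₁₂ p₁ p₂ (proj₂ (others-out p e₁ u)) (proj₁ (others-out p e₁ u)) (proj₁ (others-out p e₂ v)))))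
          (cross-++ (cross (≢-small e∈ i₁) i₁ (λ {p′} u v → dj {e} {e₁} {p′} i₁ p∈ p₁ (proj₂ (others-out p e₁ v)) u (proj₁ (others-out p e₁ v))))
                    (cross (≢-small e∈ i₂) i₂ (λ {p′} u v → dj {e} {e₂} {p′} i₂ p∈ p₂ (proj₂ (others-out p e₂ v)) u (proj₁ (others-out p e₂ v)))))) τ τ≤
        where
        dj : ∀ {x y p′} → ∣ x ∩ y ∣ ℕ.≤ 2 → p ∈ pairs x → p ∈ pairs y → p ≢ p′ → p′ ∈ pairs x → p′ ∈ pairs y → Empty
        dj {x} {y} {p′} i u v ne u′ v′ = 0<0 i (three-common {x} {y} {p} {p′} ne u v u′ v′)

      crudely : ∀ {e₁ e₂} → e₁ ∈ E → e₂ ∈ E → ex e₁ e₂ ≤ βB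
      crudely {e₁} {e₂} a b′ = Et-mono τ τ≤ (λ H l → At.Πφ≤ H (subst (ℕ._≤ I) (sym l) τ≤) (triple e p e₁ e₂) ▸ ^-monoʳ 1≤β (triple-len a b′)) ▸ ≡≤ (Et-const τ βB)

      -- Exceptional triples, which include coincidences such as `e₁` equal to `e₂`, get the crude
      -- bound `βB`; by `heavy-sum` their total weight is smaller by a factor 1/n.
      ex≤ : ∀ {e₁ e₂} → e₁ ∈ E → e₂ ∈ E → p ∈ pairs e₁ → p ∈ pairs e₂ → ex e₁ e₂ ≤ 1ℚ + εI + βB * bs e₁ e₂
      ex≤ {e₁} {e₂} a b′ p₁ p₂ with bool? (big? e e₁) | bool? (big? e e₂) | bool? (big? e₁ e₂)
      ... | inj₁ x | _ | _ = crudely a b′ ▸ one (≡≤ (cong 𝟙 (sym x)) ▸ ≤+ʳ (0≤𝟙 (big? e e₂)) ▸ ≤+ʳ (0≤𝟙 (big? e₁ e₂)))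
        where
        one : 1ℚ ≤ bs e₁ e₂ → βB ≤ 1ℚ + εI + βB * bs e₁ e₂
        one q = ≡≤ (sym (ℚₚ.*-identityʳ βB)) ▸ *-monoˡ 0≤βB q ▸ ≤+ˡ (0≤+ 0≤1 0≤εI)
      ... | inj₂ _ | inj₁ x | _ = crudely a b′ ▸ one (≡≤ (cong 𝟙 (sym x)) ▸ ≤+ˡ (0≤𝟙 (big? e e₁)) ▸ ≤+ʳ (0≤𝟙 (big? e₁ e₂)))
        where
        one : 1ℚ ≤ bs e₁ e₂ → βB ≤ 1ℚ + εI + βB * bs e₁ e₂
        one q = ≡≤ (sym (ℚₚ.*-identityʳ βB)) ▸ *-monoˡ 0≤βB q ▸ ≤+ˡ (0≤+ 0≤1 0≤εI)
      ... | inj₂ _ | inj₂ _ | inj₁ x = crudely a b′ ▸ one (≡≤ (cong 𝟙 (sym x)) ▸ ≤+ˡ (0≤+ (0≤𝟙 (big? e e₁)) (0≤𝟙 (big? e e₂))))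
        where
        one : 1ℚ ≤ bs e₁ e₂ → βB ≤ 1ℚ + εI + βB * bs e₁ e₂
        one q = ≡≤ (sym (ℚₚ.*-identityʳ βB)) ▸ *-monoˡ 0≤βB q ▸ ≤+ˡ (0≤+ 0≤1 0≤εI)
      ... | inj₂ x | inj₂ y | inj₂ z = generic a b′ p₁ p₂ (sm e e₁ x) (sm e e₂ y) (sm e₁ e₂ z) ▸ ≤+ʳ (0≤* 0≤βB (0≤+ (0≤+ (0≤𝟙 (big? e e₁)) (0≤𝟙 (big? e e₂))) (0≤𝟙 (big? e₁ e₂))))
        where
        sm : ∀ u v → big? u v ≡ false → ∣ u ∩ v ∣ ℕ.≤ 2
        sm u v eq = ℕₚ.≤-pred (ℕₚ.≰⇒> (does-no (3 ℕₚ.≤? ∣ u ∩ v ∣) eq))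

      private
        f : A → ℚ
        f x = Di * 𝟙 (inP p x)
        0≤f : ∀ x → 0ℚ ≤ f x
        0≤f x = 0≤* 0≤Di (0≤𝟙 (inP p x))
        Σf : Σ E f ≡ 1ℚ
        Σf = trans (Σ-* Di E _) (reg (pairs⊆ {e} p∈))
        f𝟙 : ∀ {x₀} → x₀ ∈ E → Σ E (λ x → f x * 𝟙 (big? x₀ x)) ≤ heavy
        f𝟙 {x₀} m′ = Σ-mono E (λ x → *-monoʳ (0≤𝟙 (big? x₀ x)) (*≤1 0≤Di (𝟙≤1 (inP p x)))) ▸ heavy-sum m′

        inner : A → ℚ
        inner e₁ = Σ E (λ e₂ → f e₁ * f e₂ * (1ℚ + εI + βB * bs e₁ e₂))

        inner≡ : ∀ e₁ → inner e₁ ≡ (1ℚ + εI) * f e₁ + βB * (f e₁ * 𝟙 (big? e e₁)) + βB * (f e₁ * Σ E (λ e₂ → f e₂ * 𝟙 (big? e e₂))) + βB * (f e₁ * Σ E (λ e₂ → f e₂ * 𝟙 (big? e₁ e₂)))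
        inner≡ e₁ = trans (Σ-cong E (λ e₂ → l (f e₁) (f e₂) (1ℚ + εI) βB (𝟙 (big? e e₁)) (𝟙 (big? e e₂)) (𝟙 (big? e₁ e₂))))
          (trans (Σ-+ E _ _) (trans (cong₂ _+_ (trans (Σ-+ E _ _) (cong₂ _+_ (trans (Σ-* u E f) (trans (cong (u *_) Σf) (ℚₚ.*-identityʳ u))) (Σ-* (βB * f e₁) E _))) (Σ-* (βB * f e₁) E _))
            (l2 (f e₁) (1ℚ + εI) βB (𝟙 (big? e e₁)) (Σ E (λ e₂ → f e₂ * 𝟙 (big? e e₂))) (Σ E (λ e₂ → f e₂ * 𝟙 (big? e₁ e₂))))))
          where
          u = (1ℚ + εI) * f e₁ + βB * (f e₁ * 𝟙 (big? e e₁))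
          l : ∀ x y o B a b c → x * y * (o + B * (a + b + c)) ≡ (o * x + B * (x * a)) * y + B * x * (y * b) + B * x * (y * c)
          l = solve-∀ ℚring
          l2 : ∀ x o B a s z → o * x + B * (x * a) + B * x * s + B * x * z ≡ o * x + B * (x * a) + B * (x * s) + B * (x * z)
          l2 = solve-∀ ℚring

        outer≤ : Σ E inner ≤ 1ℚ + εI + βB * heavy + βB * heavy + βB * heavy
        outer≤ = ≡≤ (trans (Σ-cong E inner≡) (trans (Σ-+ E _ _) (cong₂ _+_ (trans (Σ-+ E _ _) (cong₂ _+_ (trans (Σ-+ E _ _) (cong₂ _+_ (Σ-* (1ℚ + εI) E f) (Σ-* βB E _))) (Σ-* βB E _))) (Σ-* βB E _)))) ▸
          +-mono-≤ (+-mono-≤ (+-mono-≤ (≡≤ (trans (cong ((1ℚ + εI) *_) Σf) (ℚₚ.*-identityʳ (1ℚ + εI)))) (*-monoˡ 0≤βB (f𝟙 e∈)))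
              (*-monoˡ 0≤βB (≡≤ (trans (Σ-*ʳ X E f) (trans (cong (_* X) Σf) (ℚₚ.*-identityˡ X))) ▸ f𝟙 e∈)))
            (*-monoˡ 0≤βB (Σ-mono∈ E (λ {e₁} m₁ → *-monoˡ (0≤f e₁) (f𝟙 m₁)) ▸ ≡≤ (trans (Σ-*ʳ heavy E f) (trans (cong (_* heavy) Σf) (ℚₚ.*-identityˡ heavy)))))
          where X = Σ E (λ e₂ → f e₂ * 𝟙 (big? e e₂))

      wYY : ∀ H → w H e * (Y H p * Y H p) ≡ Σ E (λ e₁ → Σ E (λ e₂ → f e₁ * f e₂ * Π (triple e p e₁ e₂) (φ H)))
      wYY H = trans (cong (w H e *_) (trans (cong₂ _*_ Yf Yf) (trans (sym (Σ-*ʳ (Σ E g) E g)) (Σ-cong E (λ e₁ → sym (Σ-* (g e₁) E g))))))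
        (trans (sym (Σ-* (w H e) E _)) (Σ-cong E (λ e₁ → trans (sym (Σ-* (w H e) E _)) (Σ-cong E (λ e₂ → trans (l (w H e) (f e₁) (Π (rest p e₁) (φ H)) (f e₂) (Π (rest p e₂) (φ H)))
          (cong (f e₁ * f e₂ *_) (sym (trans (Π-++ (objs e) (rest p e₁ ++ rest p e₂) (φ H)) (cong (w H e *_) (Π-++ (rest p e₁) (rest p e₂) (φ H)))))))))))
        where
        g : A → ℚ
        g x = f x * Π (rest p x) (φ H)
        Yf : Y H p ≡ Σ E g
        Yf = trans (sym (Σ-* Di E _)) (Σ-cong E (λ x → sym (ℚₚ.*-assoc Di (𝟙 (inP p x)) (Π (rest p x) (φ H)))))
        l : ∀ w a x b y → w * (a * x * (b * y)) ≡ a * b * (w * (x * y))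
        l = solve-∀ ℚring

      hY2′ : Et τ (λ H → w H e * (Y H p * Y H p)) ≤ 1ℚ + ε₁
      hY2′ = ≡≤ (trans (Et-cong τ wYY) (trans (Et-Σ τ E _) (Σ-cong E (λ e₁ → trans (Et-Σ τ E _) (Σ-cong E (λ e₂ → Et-* τ (f e₁ * f e₂) _)))))) ▸
        Σ-mono∈ E (λ {e₁} a → Σ-mono∈ E (λ {e₂} b′ → term a b′)) ▸ outer≤ ▸
        ≡≤ (trans (l εI βB heavy) (cong (λ z → 1ℚ + (εI + z)) (l3 (nat 3) βB cd ι (nat (W r))))) ▸
        +-mono-≤ (≤-refl {1ℚ}) (+-mono-≤ (≤-refl {εI}) (*-monoʳ 0≤ι (*-monoʳ 0≤βB (*-monoˡ (0≤* (0≤nat 3) 0≤cd) (nat-mono (W-mono {r} {r ℕ.+ r} (ℕₚ.m≤m+n r r)))))) ▸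
          ≡≤ (trans (sym (ℚₚ.*-distribʳ-+ ι (nat (In ℕ.* (κn ℕ.^ ω ℕ.* ωC))) (nat 3 * cd * nat (W (r ℕ.+ r)) * βB)))
               (cong (_* ι) (trans (cong (λ z → nat (In ℕ.* (κn ℕ.^ ω ℕ.* ωC)) + z) (sym (trans (nat-* (3 ℕ.* suc cD ℕ.* W (r ℕ.+ r)) (βn ℕ.^ (3 ℕ.* suc s))) (cong₂ _*_ (trans (nat-* (3 ℕ.* suc cD) (W (r ℕ.+ r))) (cong (_* nat (W (r ℕ.+ r))) (nat-* 3 (suc cD)))) (nat-^ βn (3 ℕ.* suc s))))))
                 (sym (nat-+ (In ℕ.* (κn ℕ.^ ω ℕ.* ωC)) (3 ℕ.* suc cD ℕ.* W (r ℕ.+ r) ℕ.* βn ℕ.^ (3 ℕ.* suc s))))))))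
        where
        l : ∀ e b h → 1ℚ + e + b * h + b * h + b * h ≡ 1ℚ + (e + (1ℚ + (1ℚ + (1ℚ + 0ℚ))) * (b * h))
        l = solve-∀ ℚring
        l3 : ∀ z b d i w → z * (b * (d * i * w)) ≡ z * d * w * b * i
        l3 = solve-∀ ℚring
        term : ∀ {e₁ e₂} → e₁ ∈ E → e₂ ∈ E → f e₁ * f e₂ * ex e₁ e₂ ≤ f e₁ * f e₂ * (1ℚ + εI + βB * bs e₁ e₂)
        term {e₁} {e₂} a b′ with bool? (inP p e₁) | bool? (inP p e₂)
        ... | inj₁ x | inj₁ y = *-monoˡ (0≤* (0≤f e₁) (0≤f e₂)) (ex≤ a b′ (MP.mem-∈ {p} {pairs e₁} x) (MP.mem-∈ {p} {pairs e₂} y))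
        ... | inj₂ x | _ = ≡≤ (trans (z (ex e₁ e₂)) (sym (z (1ℚ + εI + βB * bs e₁ e₂))))
          where
          z : ∀ v → f e₁ * f e₂ * v ≡ 0ℚ
          z v = trans (cong (λ q → Di * 𝟙 q * f e₂ * v) x) (l′ Di (f e₂) v)
            where
            l′ : ∀ d f v → d * 0ℚ * f * v ≡ 0ℚ
            l′ = solve-∀ ℚring
        ... | inj₁ _ | inj₂ x = ≡≤ (trans (z (ex e₁ e₂)) (sym (z (1ℚ + εI + βB * bs e₁ e₂))))
          where
          z : ∀ v → f e₁ * f e₂ * v ≡ 0ℚ
          z v = trans (cong (λ q → f e₁ * (Di * 𝟙 q) * v) x) (l′ Di (f e₁) v)
            where
            l′ : ∀ d f v → f * (d * 0ℚ) * v ≡ 0ℚ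
            l′ = solve-∀ ℚring

-- The packing with four fifths of the Steiner bound.

module LowerBounds where
  open Rationals
  open NibbleProcess
  open Invariants
  open Correlations
  open PhaseYield
  open Survivors
  open UniformSets
  open ConflictSystem
  open Parameters
  open Moments
  open import Data.Rational using (ℚ; 0ℚ; 1ℚ; _+_; _*_; -_; _-_; _≤_; _<_; _/_)
  open import Data.Rational.Properties using (≤-refl; ≤-trans; ≤-reflexive; +-mono-≤; <⇒≤)
  open import Data.Integer using (+_)
  open import Data.Nat using (suc)
  open import Tactic.RingSolver using (solve-∀)

  nat-reflects : ∀ {a b} → nat a ≤ nat b → a ℕ.≤ b
  nat-reflects {a} {b} p with a ℕₚ.≤? b
  ... | yes q = q
  ... | no q = ⊥-elim (ℚₚ.<-irrefl refl (<-≤ (ℚₚ.≤-<-trans (≡≤ (sym (ℚₚ.+-identityˡ (nat b)))) (ℚₚ.+-monoˡ-< (nat b) 0<1)) (nat-mono (ℕₚ.≰⇒> q) ▸ p)))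

  -- Collisions within a phase are quadratic in the phase rate `ν * i`. Summing over `I` phases
  -- cancels one `i`; the other one makes the loss small through the bound by `τ`.
  budget : ∀ {I s i b R R′ K ν f x τ σ : ℚ} → I * i ≡ 1ℚ → 0ℚ ≤ s → 0ℚ ≤ i → 0ℚ ≤ R → 0ℚ ≤ R′ → 0ℚ ≤ K →
    ν * (ν * (b * b)) ≤ f → ν * ν ≤ 1ℚ → (s * f + R * (R * R′) * K) * i ≤ τ → σ ≡ τ → x + τ ≤ ν * (1ℚ - τ) →
    x + I * (s * (ν * i * b * (ν * i * b))) + I * (ν * i * R * (ν * i * R) * (R′ * K)) ≤ I * (ν * i) * (1ℚ - σ)
  budget {I} {s} {i} {b} {R} {R′} {K} {ν} {f} {x} {τ} {σ} Ii 0≤s 0≤i 0≤R 0≤R′ 0≤K h₁ h₂ h₃ refl h₄ =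
    ≡≤ (trans (l₁ I s i b R R′ K ν x) (cong (λ z → x + (z * (ν * (ν * (b * b))) * (s * i) + z * (ν * ν) * (R * (R * R′) * K * i))) Ii)) ▸
    +-mono-≤ (≤-refl {x}) (+-mono-≤ (*-monoʳ (0≤* 0≤s 0≤i) (≡≤ (ℚₚ.*-identityˡ (ν * (ν * (b * b)))) ▸ h₁))
      (*-monoʳ (0≤* (0≤* (0≤* 0≤R (0≤* 0≤R 0≤R′)) 0≤K) 0≤i) (≡≤ (ℚₚ.*-identityˡ (ν * ν)) ▸ h₂)) ▸ ≡≤ (l₂ f s i (R * (R * R′) * K)) ▸ h₃) ▸
    h₄ ▸ ≡≤ (sym (trans (l₃ I ν i τ) (trans (cong (_* (ν * (1ℚ - τ))) Ii) (ℚₚ.*-identityˡ (ν * (1ℚ - τ))))))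
    where
    l₁ : ∀ I s i b R R′ K ν x → x + I * (s * (ν * i * b * (ν * i * b))) + I * (ν * i * R * (ν * i * R) * (R′ * K)) ≡ x + (I * i * (ν * (ν * (b * b))) * (s * i) + I * i * (ν * ν) * (R * (R * R′) * K * i))
    l₁ = solve-∀ ℚring
    l₂ : ∀ f s i z → f * (s * i) + 1ℚ * (z * i) ≡ (s * f + z) * i
    l₂ = solve-∀ ℚring
    l₃ : ∀ I ν i τ → I * (ν * i) * (1ℚ - τ) ≡ I * i * (ν * (1ℚ - τ))
    l₃ = solve-∀ ℚring

  module LowerBound (t k m : ℕ) (1≤t : 1 ℕ.≤ t) (n≥ : Const.N₀ t k ℕ.≤ 2 ℕ.+ m) where
    open Fields t k m 1≤t n≥

    -- An edge must pass at most s + 1 tests; allowing each the failure weight 1/(30(s+1)) gives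
    -- 1/30 altogether.
    ρN : ℕ
    ρN = 30 ℕ.* suc s
    ρ′ : ℚ
    ρ′ = inv (nat ρN)
    0<ρN : 0ℚ < nat ρN
    0<ρN = 0<nat (s ℕ.+ 29 ℕ.* suc s)
    ρρ : nat ρN * ρ′ ≡ 1ℚ
    ρρ = inv-r 0<ρN
    0≤ρ′ : 0ℚ ≤ ρ′
    0≤ρ′ = 0≤inv (<⇒≤ 0<ρN)

    δ′ x′ : ℚ
    δ′ = + 1 / 18
    x′ = + 4 / 5

    0≤μ′ : 0ℚ ≤ μ′
    0≤μ′ = 0≤* 0≤2q 0≤Kc

    ε₂≥′ : nat I * (κ ^ suc s * ε * (nat I * (2q * nat Ln))) ≤ 1ℚ
    ε₂≥′ = ≡≤ (trans (cong (λ z → nat In * (z * ε * (nat In * (2q * nat Ln)))) (trans (cong (_^ suc s) κ≡) (sym (nat-^ κn (suc s)))))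
        (trans (l (nat In) (nat (κn ℕ.^ suc s)) (nat ωC) ι (nat In * (2q * nat Ln))) (cong (_* ι) (sym (trans (nat-* In _) (cong (nat In *_) (trans (nat-* (κn ℕ.^ suc s ℕ.* ωC) _)
           (cong₂ _*_ (nat-* (κn ℕ.^ suc s) ωC) (trans (nat-* In (2 ℕ.* Ln)) (cong (nat In *_) (nat-* 2 Ln))))))))))) ▸
      ι-small (n≥+ (ℕₚ.≤-trans (ℕₚ.m≤n+m Q₂ (2 ℕ.* Q ℕ.* (30 ℕ.* suc s ℕ.* 324))) (ℕₚ.≤-trans (ℕₚ.m≤m+n _ (2 ℕ.* Rn ℕ.* suc cD)) (ℕₚ.≤-trans (ℕₚ.m≤m+n _ t) (ℕₚ.m≤m+n _ 3)))))
      where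
      l : ∀ i k w ι z → i * (k * (w * ι) * z) ≡ i * (k * w * z) * ι
      l = solve-∀ ℚring

    loss-Y′ : ε₁ + ε₁ ≤ ρ′ * (δ′ * δ′)
    loss-Y′ = *-cancelʳ (0<* 0<ρN (0<nat 323)) (≡≤ (trans (l (nat Q) ι (nat ρN) (nat 324)) (cong (_* ι) (sym (trans (nat-* (2 ℕ.* Q) (ρN ℕ.* 324)) (cong₂ _*_ (nat-* 2 Q) (nat-* ρN 324)))))) ▸
      ι-small (n≥+ (ℕₚ.≤-trans (ℕₚ.m≤m+n _ Q₂) (ℕₚ.≤-trans (ℕₚ.m≤m+n _ (2 ℕ.* Rn ℕ.* suc cD)) (ℕₚ.≤-trans (ℕₚ.m≤m+n _ t) (ℕₚ.m≤m+n _ 3))))) ▸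
      ≡≤ (sym (trans (l2 ρ′ (δ′ * δ′) (nat ρN) (nat 324)) (trans (cong (_* (δ′ * δ′ * nat 324)) ρρ) refl))))
      where
      l : ∀ q i a b → (q * i + q * i) * (a * b) ≡ (1ℚ + (1ℚ + 0ℚ)) * q * (a * b) * i
      l = solve-∀ ℚring
      l2 : ∀ r d a b → r * d * (a * b) ≡ a * r * (d * b)
      l2 = solve-∀ ℚring

    loss-F′ : (T + θ) * μ′ + 1ℚ ≤ ρ′ * nat Ln
    loss-F′ = +-mono-≤ (*-monoʳ 0≤μ′ (+-mono-≤ T≤1 (≤1* 0≤θ (≡≤ (sym (ℚₚ.+-identityʳ 1ℚ)) ▸ nat-mono (ℕₚ.≤-trans (s≤s z≤n) In≥)) ▸ T≤1)))
        (≡≤ (sym (ℚₚ.+-identityʳ 1ℚ)) ▸ nat-mono 1≤Kn ▸ ≤+ʳ (0≤nat Kn)) ▸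
      ≡≤ (trans (l (nat Kn)) (sym (trans (cong (ρ′ *_) (trans (nat-* (3 ℕ.* (2 ℕ.* Kn)) ρN) (cong (_* nat ρN) (trans (nat-* 3 (2 ℕ.* Kn)) (cong (nat 3 *_) (nat-* 2 Kn))))))
        (trans (l2 ρ′ (nat 3 * (nat 2 * nat Kn)) (nat ρN)) (trans (cong (nat 3 * (nat 2 * nat Kn) *_) ρρ) (ℚₚ.*-identityʳ (nat 3 * (nat 2 * nat Kn)))))))) ▸
      *-monoˡ 0≤ρ′ (nat-mono Ln≥)
      where
      l : ∀ k → (1ℚ + 1ℚ) * ((1ℚ + 1ℚ) * k) + (k + k) ≡ (1ℚ + (1ℚ + (1ℚ + 0ℚ))) * ((1ℚ + (1ℚ + 0ℚ)) * k)
      l = solve-∀ ℚring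
      l2 : ∀ a b c → a * (b * c) ≡ b * (c * a)
      l2 = solve-∀ ℚring

    1≤nRn : 1ℚ ≤ nat Rn
    1≤nRn = 1≤^ (suc s) 1≤β ▸ ≡≤ (sym nat-Rn)

    Rk′ : ℚ
    Rk′ = nat Rn ^ k

    Rk≥′ : ∀ {J} → J ∈ tup → (nat I * c) ^ length J ≤ Rk′
    Rk≥′ {J} mm = ^-mono (length J) (0≤* (0≤nat I) 0≤c) Ic≤ ▸ ^-monoʳ 1≤nRn (ℕₚ.<⇒≤ (proj₁ (short-∈ k E mm)))

    thirtieth : ℚ
    thirtieth = + 1 / 30

    X₀ : ℕ
    X₀ = s ℕ.* 500 ℕ.+ Rn ℕ.^ (2 ℕ.+ k) ℕ.* Kn

    X₀≤ : nat X₀ * iI ≤ thirtieth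
    X₀≤ = *-cancelʳ (0<nat 29) (≡≤ (trans (l (nat X₀) iI (nat 30)) (cong (_* iI) (sym (nat-* 30 X₀)))) ▸
      I-small (ℕₚ.≤-trans (ℕₚ.*-monoʳ-≤ 30 (ℕₚ.m≤m+n X₀ 2)) (ℕₚ.≤-reflexive (sym In≡))) ▸ ≡≤ refl)
      where
      l : ∀ x i z → x * i * z ≡ z * x * i
      l = solve-∀ ℚring

    -- T is 9/10, and 4/5 of it survives: a fraction 1/30 is never eligible and at most 1/30 in total is spoilt by collisions within a phase.
    x≤′ : x′ + nat I * (nat s * (θ * (B * Y1) * (θ * (B * Y1)))) + nat I * (c * c * (Rk′ * Kc′)) ≤ T * (1ℚ - (nat s * ρ′ + ρ′))
    x≤′ = budget {nat In} {nat s} {iI} {B * Y1} {β ^ suc s} {Rk′} {Kc′} {ninth} {nat 500} {x′} {thirtieth} {nat s * ρ′ + ρ′} IiI (0≤nat s) 0≤iI (0≤^ (suc s) 0≤β) (0≤^ k (0≤nat Rn)) 0≤Kc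
        close₁ (≤+ {ninth * ninth} {1ℚ} {+ 19 / 100} (ℚₚ.nonNegative⁻¹ (+ 19 / 100)) refl) X₀≤′ sρ close₂
      where
      close₁ : ninth * (ninth * (nat 20 * Y1 * (nat 20 * Y1))) ≤ nat 500
      close₁ = ≤+ {ninth * (ninth * (nat 20 * Y1 * (nat 20 * Y1)))} {nat 500} {nat 139} (0≤nat 139) refl
      close₂ : x′ + thirtieth ≤ ninth * (1ℚ - thirtieth)
      close₂ = ≤+ {x′ + thirtieth} {ninth * (1ℚ - thirtieth)} {+ 11 / 300} (ℚₚ.nonNegative⁻¹ (+ 11 / 300)) refl
      X₀≤′ : (nat s * nat 500 + β ^ suc s * (β ^ suc s * Rk′) * Kc′) * iI ≤ thirtieth
      X₀≤′ = ≡≤ (cong (_* iI) (sym (trans (nat-+ (s ℕ.* 500) (Rn ℕ.^ (2 ℕ.+ k) ℕ.* Kn)) (cong₂ _+_ (nat-* s 500) (trans (nat-* (Rn ℕ.^ (2 ℕ.+ k)) Kn)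
        (cong (_* Kc′) (trans (nat-^ Rn (2 ℕ.+ k)) (cong (λ z → z * (z * Rk′)) nat-Rn)))))))) ▸ X₀≤
      l4 : ∀ a r z → (a * r + r) * z ≡ z * (1ℚ + a) * r
      l4 = solve-∀ ℚring
      sρ : nat s * ρ′ + ρ′ ≡ thirtieth
      sρ = trans (l5 (nat s * ρ′ + ρ′)) (trans (cong (_* thirtieth) (trans (l4 (nat s) ρ′ (nat 30)) (trans (cong (_* ρ′) (sym (nat-* 30 (suc s)))) ρρ))) (ℚₚ.*-identityˡ thirtieth))
        where
        l5 : ∀ a → a ≡ a * nat 30 * thirtieth
        l5 a = trans (sym (ℚₚ.*-identityʳ a)) (sym (ℚₚ.*-assoc a (nat 30) thirtieth))

    hypS : NearRegular S
    hypS = record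
      { allP = C.allP ; pairs⊆allP = λ {e} → pairs⊆ {e} ; tup⊆E = λ m → proj₂ (short-∈ k E m) ; confU = λ c → IsConf.uniq (confL-out c)
      ; Kc = Kc′ ; conf-deg = conf-deg′ ; regular = λ {e} _ m → reg (pairs⊆ {e} m) ; allP-size = allP-size′
      ; δ = δ′ ; ε₀ = ε ; ε₁ = ε₁ ; ε₂ = 1ℚ ; μ = μ′ ; ρ = ρ′ ; Rk = Rk′ ; x = x′
      ; 0<δ = ℚₚ.positive⁻¹ δ′ ; Y1≡ = refl ; 0≤ε₀ = 0≤ε ; 0≤ρ = 0≤ρ′ ; hov = hov′ ; hW = hW′ ; hY2 = λ τ τ≤ {e} {p} e∈ p∈ → hY2′ τ τ≤ {e} {p} e∈ p∈ ; hμ = λ τ τ≤ {e} e∈ → hμ′ τ τ≤ {e} e∈ ; 0≤μ = 0≤μ′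
      ; ε₂≥ = ε₂≥′ ; loss-Y = loss-Y′ ; loss-F = loss-F′ ; 0≤Rk = 0≤^ k (0≤nat Rn) ; Rk≥ = Rk≥′ ; x≤ = x≤′ }

    hypS′ : ConflictStructure S
    hypS′ = record
      { hyp = hypS ; confL = C.confL ; conf≡ = λ _ _ _ → refl ; confL-↭ = λ p c → C.confL-in (C.IsConf-↭ p (confL-out c)) ; confL-tup = C.conf-tup
      ; pairs-ne = ne ; confL-0 = C.confL-≤2 z≤n ; confL-1 = C.confL-≤2 (s≤s z≤n) }
      where
      ne : ∀ {e} → e ∈ E → ∃ λ p → p ∈ pairs e
      ne {e} e∈ = let (a , b′ , l , i , j) = C.two⇒pair {e} (ℚ2 (rsub-card n r e∈)) in (a , b′) , C.pairs-in l i j (rsub-card n r e∈)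
        where
        ℚ2 : ∣ e ∣ ≡ 2 ℕ.+ t → 2 ℕ.≤ ∣ e ∣
        ℚ2 p = ℕₚ.≤-trans (ℕₚ.m≤m+n 2 t) (ℕₚ.≤-reflexive (sym p))

    -- The last component is 4/5 of n(n-1)/(r(r-1)), cleared of denominators.
    Good : Set
    Good = ∃ λ M′ → Unique M′ × All (λ e → ∣ e ∣ ≡ 2 ℕ.+ t) M′ × C.HGood M′ × 4 ℕ.* ((2 ℕ.+ m) ℕ.* (1 ℕ.+ m)) ℕ.≤ 5 ℕ.* ((2 ℕ.+ t) ℕ.* (1 ℕ.+ t)) ℕ.* length M′

    good : Good
    good = go (Extraction.result S hypS′)
      where
      go : Extraction.Result S hypS′ → Good
      go (M′ , u , M⊆ , size , noPair , noConf) = M′ , u , All.tabulate card , C.hgood M′ card noPair noConf , nat-reflects (*-cancelʳ 0<D count)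
        where
        card : ∀ {e} → e ∈ M′ → ∣ e ∣ ≡ 2 ℕ.+ t
        card mm = rsub-card n r (All.lookup M⊆ mm)
        rr nn : ℕ
        rr = (2 ℕ.+ t) ℕ.* (1 ℕ.+ t)
        nn = (2 ℕ.+ m) ℕ.* (1 ℕ.+ m)
        -- Absorption twice: r(r-1) C(n,r) = n(n-1) C(n-2,r-2), so 1/`Di` is recognised inside the
        -- number of edges.
        sizeE : rr ℕ.* length E ≡ nn ℕ.* D
        sizeE = trans (cong (rr ℕ.*_) (rsub-length n r)) (trans (l (2 ℕ.+ t) (1 ℕ.+ t) (binom n r)) (trans (cong ((1 ℕ.+ t) ℕ.*_) (absorb (suc m) (suc t)))
          (trans (l′ (1 ℕ.+ t) (2 ℕ.+ m) (binom (suc m) (suc t))) (trans (cong ((2 ℕ.+ m) ℕ.*_) (absorb m t)) (sym (ℕₚ.*-assoc (2 ℕ.+ m) (1 ℕ.+ m) D))))))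
          where
          l : ∀ a b c → a ℕ.* b ℕ.* c ≡ b ℕ.* (a ℕ.* c)
          l = ℕR.solve-∀
          l′ : ∀ a b c → a ℕ.* (b ℕ.* c) ≡ b ℕ.* (a ℕ.* c)
          l′ = ℕR.solve-∀
        count : nat (4 ℕ.* nn) * nat D ≤ nat (5 ℕ.* rr ℕ.* length M′) * nat D
        count = ≡≤ (trans (cong (_* nat D) (nat-* 4 nn)) (trans (ℚₚ.*-assoc (nat 4) (nat nn) (nat D)) (cong (nat 4 *_) (trans (sym (nat-* nn D)) (trans (cong nat (sym sizeE)) (nat-* rr (length E))))))) ▸
          ≡≤ (trans (l5 (nat rr) (nat (length E))) (trans (sym (ℚₚ.*-identityʳ _)) (cong (nat 5 * nat rr * (nat (length E) * x′) *_) (sym DDi)))) ▸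
          ≡≤ (l6 (nat 5 * nat rr) (nat (length E)) x′ (nat D) Di) ▸
          *-monoˡ (0≤* (0≤* (0≤nat 5) (0≤nat rr)) (<⇒≤ 0<D)) size ▸
          ≡≤ (trans (l7 (nat 5 * nat rr) (nat D) (nat (length M′))) (cong (_* nat D) (sym (trans (nat-* (5 ℕ.* rr) (length M′)) (cong (_* nat (length M′)) (nat-* 5 rr))))))
          where
          l5 : ∀ a b → nat 4 * (a * b) ≡ nat 5 * a * (b * x′)
          l5 a b = sym (trans (l8 (nat 5) a b x′) (cong (_* (a * b)) (refl {x = nat 4})))
            where
            l8 : ∀ f a b x → f * a * (b * x) ≡ f * x * (a * b)
            l8 = solve-∀ ℚring
          l6 : ∀ F e x d i → F * (e * x) * (d * i) ≡ F * d * (e * i * x)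
          l6 = solve-∀ ℚring
          l7 : ∀ F d M → F * d * M ≡ F * M * d
          l7 = solve-∀ ℚring

-- Large minimum degree excludes dense configurations with fewer than k edges.

module DegreeArgument where
  open Conflicts using (∣∪∣+∣∩∣; ∣─∣+∣∩∣; ∣∪─∣; ∈─; unique-⊂; ⋃∈; ⋃-mono; filter-in; in-filter; filter-u)
  open UniformSets using (lists; ∈-lists; lists-∈)
  open ConflictSystem using (_≟S_; unique-↭)
  open PatternCounts using (⋃-++)
  open IndependentChoice using (module Bernoulli)
  open NibbleProcess using (does-yes; does-no)
  open import Data.Nat
  open import Data.Nat.Properties
  open import Data.Nat.Tactic.RingSolver using (solve-∀)
  open import Data.Fin using (zero; suc)
  open import Data.Vec using ([]; _∷_)
  open import Data.Fin.Subset using (_⊆_)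
  open import Data.List using ([]; _∷_)
  open import Data.List.Relation.Unary.All using ([]; _∷_)
  open import Data.List.Relation.Unary.AllPairs using ([]; _∷_)

  unique-++ : ∀ {X : Set} (xs : List X) {ys} → Unique (xs ++ ys) → Unique xs × Unique ys
  unique-++ [] u = [] , u
  unique-++ (x ∷ xs) (a ∷ u) = let (u₁ , u₂) = unique-++ xs u in All.tabulate (λ m → All.lookup a (∈-++⁺ˡ m)) ∷ u₁ , u₂

  degree : ∀ {n} → List (Subset n) → Fin n → ℕ
  degree H v = length (filterᵇ (λ e → lookup e v) H)

  meets : ∀ {n} → List (Subset n) → Subset n → ℕ
  meets H V = sum (map (λ e → ∣ e ∩ V ∣) H)

  tails : ∀ {n} → List (Subset (suc n)) → List (Subset n)
  tails = map Vec.tail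

  degree-suc : ∀ {n} (H : List (Subset (suc n))) v → degree (tails H) v ≡ degree H (suc v)
  degree-suc [] v = refl
  degree-suc ((x ∷ e) ∷ H) v with lookup e v
  ... | true = cong suc (degree-suc H v)
  ... | false = degree-suc H v

  meets-in : ∀ {n} (H : List (Subset (suc n))) V → meets H (true ∷ V) ≡ degree H zero + meets (tails H) V
  meets-in [] V = refl
  meets-in ((true ∷ e) ∷ H) V = cong suc (trans (cong (∣ e ∩ V ∣ +_) (meets-in H V)) (l (∣ e ∩ V ∣) (degree H zero) (meets (tails H) V)))
    where
    l : ∀ a b c → a + (b + c) ≡ b + (a + c)
    l = solve-∀
  meets-in ((false ∷ e) ∷ H) V = trans (cong (∣ e ∩ V ∣ +_) (meets-in H V)) (l (∣ e ∩ V ∣) (degree H zero) (meets (tails H) V))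
    where
    l : ∀ a b c → a + (b + c) ≡ b + (a + c)
    l = solve-∀

  meets-out : ∀ {n} (H : List (Subset (suc n))) V → meets H (false ∷ V) ≡ meets (tails H) V
  meets-out [] V = refl
  meets-out ((x ∷ e) ∷ H) V rewrite 𝔹ₚ.∧-zeroʳ x = cong (∣ e ∩ V ∣ +_) (meets-out H V)

  -- Double counting of incidences; `α` clears the denominator of the degree bound.
  degree-sum : ∀ {n} (H : List (Subset n)) V {α Δ} → (∀ v → Δ ≤ α * degree H v) → ∣ V ∣ * Δ ≤ α * meets H V
  degree-sum H [] d = z≤n
  degree-sum H (true ∷ V) {α} {Δ} d = ≤-trans (+-mono-≤ (d zero) (degree-sum (tails H) V {α} (λ v → ≤-trans (d (suc v)) (≤-reflexive (cong (α *_) (sym (degree-suc H v)))))))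
    (≤-reflexive (trans (sym (*-distribˡ-+ α (degree H zero) (meets (tails H) V))) (cong (α *_) (sym (meets-in H V)))))
  degree-sum H (false ∷ V) {α} {Δ} d = ≤-trans (degree-sum (tails H) V {α} (λ v → ≤-trans (d (suc v)) (≤-reflexive (cong (α *_) (sym (degree-suc H v))))))
    (≤-reflexive (cong (α *_) (sym (meets-out H V))))

  module SparseExtension {n : ℕ} (t k : ℕ) (H : List (Subset n)) (uH : Unique H) (card : ∀ {e} → e ∈ H → ∣ e ∣ ≡ 2 + t)
    (free : ∀ C → Unique C → All (_∈ H) C → length C ≡ k → ¬ (∣ ⋃ C ∣ ≤ t * k + 2)) where

    open Bernoulli (_≟S_ {n}) using (mem; mem-∈; ∈-mem; ∉-mem)
    open UD (_≟S_ {n}) using (unique?)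

    -- The configurations that the second half of `GFree` forbids.
    Tight : List (Subset n) → Set
    Tight S = 2 ≤ length S × length S < k × Unique S × ∣ ⋃ S ∣ ≤ t * length S + 1

    tight? : ∀ S → Dec (Tight S)
    tight? S = (2 ≤? length S) ×-dec (length S <? k) ×-dec unique? S ×-dec (∣ ⋃ S ∣ ≤? t * length S + 1)

    Maximal : List (Subset n) → Set
    Maximal S = All (_∈ H) S × Tight S × (∀ S′ → All (_∈ H) S′ → Tight S′ → length S′ ≤ length S)

    maximal : ∀ j → (∀ S → All (_∈ H) S → Tight S → length S ≤ j) → (∃ Maximal) ⊎ (∀ S → All (_∈ H) S → ¬ Tight S)
    maximal zero b = inj₂ (λ S al tg → n≮n 1 (≤-trans (proj₁ tg) (≤-trans (b S al tg) z≤n)))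
    maximal (suc j) b with any? tight? (lists (suc j) H)
    ... | yes a = let (S , m , tg) = find′ a in let (len , al) = lists-∈ (suc j) H m in
          inj₁ (S , al , tg , λ S′ al′ tg′ → ≤-trans (b S′ al′ tg′) (≤-reflexive (sym len)))
      where
      find′ : ∀ {xs : List (List (Subset n))} → Any Tight xs → ∃ λ S → S ∈ xs × Tight S
      find′ (here p) = _ , here refl , p
      find′ (there p) = let (S , m , q) = find′ p in S , there m , q
    ... | no na = maximal j (λ S al tg → ≤-pred (≤∧≢⇒< (b S al tg) (λ eq → na (Any.map (λ {refl → tg}) (subst (λ i → S ∈ lists i H) eq (∈-lists H S al))))))

    module Outside {S} (mx : Maximal S) where
      S⊆ = proj₁ mx
      tS = proj₁ (proj₂ mx)
      uS = proj₁ (proj₂ (proj₂ tS))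
      ℓ = length S
      V = ⋃ S

      module _ B (uB : Unique B) (B⊆ : All (_∈ H) B) (dj : ∀ {e} → e ∈ B → e ∉ S) (1≤B : 1 ≤ length B) where
        private
          SB = S ++ B
          uSB : Unique SB
          uSB = Uₚ.++⁺ uS uB (λ (a , b) → dj b a)
          SB⊆ : All (_∈ H) SB
          SB⊆ = All.tabulate sub
            where
            sub : ∀ {e} → e ∈ SB → e ∈ H
            sub m with ∈-++⁻ S m
            ... | inj₁ a = All.lookup S⊆ a
            ... | inj₂ b = All.lookup B⊆ b
          len : length SB ≡ ℓ + length B
          len = length-++ S
          size : ∣ ⋃ SB ∣ ≡ ∣ V ∣ + ∣ ⋃ B ─ V ∣
          size = trans (cong ∣_∣ (⋃-++ S B)) (+-cancelʳ-≡ ∣ V ∩ ⋃ B ∣ _ _ (trans (∣∪∣+∣∩∣ V (⋃ B)) (trans (cong (∣ V ∣ +_) (sym (∣─∣+∣∩∣ (⋃ B) V))) (trans (sym (+-assoc (∣ V ∣) (∣ ⋃ B ─ V ∣) (∣ ⋃ B ∩ V ∣))) (cong (λ z → ∣ V ∣ + ∣ ⋃ B ─ V ∣ + ∣ z ∣) (∩-comm (⋃ B) V))))))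
            where open import Data.Fin.Subset.Properties using (∩-comm)
          upper : ∀ {x} → ∣ ⋃ B ─ V ∣ ≤ t * length B + x → ∣ ⋃ SB ∣ ≤ t * (ℓ + length B) + 1 + x
          upper {x} p = ≤-trans (≤-reflexive size) (≤-trans (+-mono-≤ (proj₂ (proj₂ (proj₂ tS))) p) (≤-reflexive (l t ℓ (length B) x)))
            where
            l : ∀ t a b x → t * a + 1 + (t * b + x) ≡ t * (a + b) + 1 + x
            l = solve-∀

        -- Otherwise `S ++ B` would be a larger tight set.
        grows : ℓ + length B < k → t * length B + 1 ≤ ∣ ⋃ B ─ V ∣
        grows p with t * length B + 1 ≤? ∣ ⋃ B ─ V ∣
        ... | yes q = q
        ... | no q = ⊥-elim (n≮n ℓ (≤-trans (m<m+n ℓ 1≤B) (≤-trans (≤-reflexive (sym len)) (proj₂ (proj₂ mx) SB SB⊆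
                (≤-trans (proj₁ tS) (≤-trans (m≤m+n ℓ (length B)) (≤-reflexive (sym len))) , ≤-trans (≤-reflexive (cong suc len)) p , uSB ,
                  ≤-trans (upper {0} (≤-trans (≤-pred (≤-trans (≰⇒> q) (≤-reflexive (+-comm (t * length B) 1)))) (≤-reflexive (sym (+-identityʳ _))))) (≤-reflexive (trans (+-identityʳ _) (cong (λ z → t * z + 1) (sym len)))))))))

        -- Otherwise `S ++ B` would be `k` edges on at most `t * k + 2` vertices: `S` contributes
        -- excess one and `B` at most one more.
        full : ℓ + length B ≡ k → ¬ (∣ ⋃ B ─ V ∣ ≤ t * length B + 1)
        full p q = free SB uSB SB⊆ (trans len p) (≤-trans (upper {1} q) (≤-reflexive (trans (cong (λ z → t * z + 1 + 1) p) (+-assoc (t * k) 1 1))))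

      touching : Subset n → Bool
      touching e = not (mem e S) ∧ does (1 ≤? ∣ e ∩ V ∣)

      L : List (Subset n)
      L = filterᵇ touching H

      ∧-out : ∀ {a b} → a ∧ b ≡ true → a ≡ true × b ≡ true
      ∧-out {true} {true} _ = refl , refl

      L-out : ∀ {e} → e ∈ L → e ∈ H × e ∉ S × 1 ≤ ∣ e ∩ V ∣
      L-out {e} m = proj₁ fi , (λ s → contra (∈-mem s) (proj₁ (∧-out {not (mem e S)} (proj₂ fi)))) , does-yes (1 ≤? ∣ e ∩ V ∣) (proj₂ (∧-out {not (mem e S)} (proj₂ fi)))
        where
        fi = filter-in touching H m
        contra : ∀ {b} → b ≡ true → not b ≡ true → Empty
        contra refl ()

      e─V : ∀ {e} → e ∈ L → ∣ e ─ V ∣ ≤ t + 1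
      e─V {e} m = +-cancelʳ-≤ 1 _ _ (≤-trans (+-monoʳ-≤ ∣ e ─ V ∣ (proj₂ (proj₂ (L-out m)))) (≤-reflexive (trans (∣─∣+∣∩∣ e V) (trans (card (proj₁ (L-out m))) (trans (+-comm 2 t) (sym (+-assoc t 1 1)))))))

      ⋃1 : ∀ (e : Subset n) → ⋃ (e ∷ []) ≡ e
      ⋃1 e = ∪-identityʳ e

      rest : ∀ f R → length R ≤ f → Unique R → (∀ {e} → e ∈ R → e ∈ L) → t * length R ≤ ∣ ⋃ R ─ V ∣

      -- A cluster B of edges of L, each meeting the earlier ones outside V, can neither reach k − ℓ edges nor be swallowed; edges that meet no cluster contribute independently.
      spread : ∀ f B R → length R ≤ f → 1 ≤ length B → ℓ + length B ≤ k → Unique (B ++ R) → (∀ {e} → e ∈ B ++ R → e ∈ L) →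
        ∣ ⋃ B ─ V ∣ ≤ t * length B + 1 → t * length (B ++ R) ≤ ∣ ⋃ (B ++ R) ─ V ∣
      spread f B R lf 1≤B ≤k u ⊆L small with any? (λ e → 1 ≤? ∣ (e ─ V) ∩ ⋃ B ∣) R
      ... | yes a = go f lf (find′ a)
        where
        find′ : ∀ {xs} → Any (λ e → 1 ≤ ∣ (e ─ V) ∩ ⋃ B ∣) xs → ∃ λ e → e ∈ xs × 1 ≤ ∣ (e ─ V) ∩ ⋃ B ∣
        find′ (here p) = _ , here refl , p
        find′ (there p) = let (S , m , q) = find′ p in S , there m , q
        go : ∀ f → length R ≤ f → (∃ λ e → e ∈ R × 1 ≤ ∣ (e ─ V) ∩ ⋃ B ∣) → t * length (B ++ R) ≤ ∣ ⋃ (B ++ R) ─ V ∣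
        go f lf (e , m , hit) with ∈-∃++ m
        go zero lf (e , m , hit) | xs , ys , refl = ⊥-elim (n≮n 0 (≤-trans (≤-trans (≤-trans (s≤s z≤n) (m≤n+m (suc (length ys)) (length xs))) (≤-reflexive (sym (length-++ xs)))) lf))
        go (suc f) lf (e , m , hit) | xs , ys , refl =
          ≤-trans (≤-reflexive (cong (t *_) (↭-length perm))) (≤-trans (spread f (e ∷ B) (xs ++ ys) lf′ (s≤s z≤n) ≤k′ (unique-↭ perm u) (λ z → ⊆L (∈-resp-↭ (↭-sym perm) z)) small′)
            (p⊆q⇒∣p∣≤∣q∣ (λ {x} z → let (a , b) = ∈─ (⋃ (e ∷ B ++ xs ++ ys)) V z in x∈p∧x∉q⇒x∈p─q (⋃-mono (∈-resp-↭ (↭-sym perm)) a) b)))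
          where
          perm : B ++ xs ++ e ∷ ys ↭ e ∷ B ++ xs ++ ys
          perm = subst₂ _↭_ (++-assoc B xs (e ∷ ys)) (cong (e ∷_) (++-assoc B xs ys)) (shift e (B ++ xs) ys)
            where open import Data.List.Properties using (++-assoc)
          lf′ : length (xs ++ ys) ≤ f
          lf′ = ≤-pred (≤-trans (≤-reflexive (sym (↭-length (shift e xs ys)))) lf)
          eL : e ∈ L
          eL = ⊆L (∈-++⁺ʳ B m)
          uB : ∀ C → Unique (B ++ C) → Unique B
          uB C w = proj₁ (unique-++ B w)
          -- By `full`, a cluster of excess at most one cannot have exactly `k - ℓ` edges, so there
          -- is room for another edge. That edge meets both the tight set and the cluster and brings
          -- at most `t` new vertices.
          ≤k′ : ℓ + suc (length B) ≤ k
          ≤k′ = ≤-trans (≤-reflexive (+-suc ℓ (length B))) (≤∧≢⇒< ≤k (λ eq → full B (uB _ u) (All.tabulate (λ z → proj₁ (L-out (⊆L (∈-++⁺ˡ z))))) (λ z → proj₁ (proj₂ (L-out (⊆L (∈-++⁺ˡ z))))) 1≤B eq small))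
          small′ : ∣ ⋃ (e ∷ B) ─ V ∣ ≤ t * suc (length B) + 1
          small′ = ≤-trans (≤-reflexive (trans (cong (λ z → ∣ z ─ V ∣) (∪-comm e (⋃ B))) (∣∪─∣ (⋃ B) e V))) (≤-trans (+-mono-≤ small new) (≤-reflexive (l t (length B))))
            where
            open import Data.Fin.Subset.Properties using (∪-comm; ∩-comm)
            l : ∀ t b → t * b + 1 + t ≡ t * suc b + 1
            l = solve-∀
            new : ∣ e ─ (V ∪ ⋃ B) ∣ ≤ t
            new = +-cancelʳ-≤ 1 _ _ (≤-trans (+-mono-≤ (p⊆q⇒∣p∣≤∣q∣ {p = e ─ (V ∪ ⋃ B)} {q = (e ─ V) ─ ⋃ B} (λ z → let (a , b) = ∈─ e (V ∪ ⋃ B) z in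
                x∈p∧x∉q⇒x∈p─q (x∈p∧x∉q⇒x∈p─q a (λ w → b (x∈p∪q⁺ (inj₁ w)))) (λ w → b (x∈p∪q⁺ (inj₂ w))))) hit)
              (≤-trans (≤-reflexive (∣─∣+∣∩∣ (e ─ V) (⋃ B))) (e─V eL)))
      -- No remaining edge meets the cluster outside `V`, so the vertex counts add up, and the
      -- cluster itself is large enough by `grows`.
      ... | no na = ≤-trans (≤-reflexive (trans (cong (t *_) (length-++ B)) (*-distribˡ-+ t (length B) (length R))))
          (≤-trans (+-mono-≤ own (rest f R lf (proj₂ (unique-++ B u)) (λ z → ⊆L (∈-++⁺ʳ B z)))) (≤-reflexive (sym total)))
        where
        own : t * length B ≤ ∣ ⋃ B ─ V ∣
        own = ≤-trans (m≤m+n _ 1) (grows B (proj₁ (unique-++ B u)) B⊆ B∉ 1≤B (≤∧≢⇒< ≤k (λ eq → full B (proj₁ (unique-++ B u)) B⊆ B∉ 1≤B eq small)))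
          where
          B⊆ = All.tabulate (λ z → proj₁ (L-out (⊆L (∈-++⁺ˡ z))))
          B∉ = λ {e} z → proj₁ (proj₂ (L-out {e} (⊆L (∈-++⁺ˡ z))))
        total : ∣ ⋃ (B ++ R) ─ V ∣ ≡ ∣ ⋃ B ─ V ∣ + ∣ ⋃ R ─ V ∣
        total = trans (cong (λ z → ∣ z ─ V ∣) (⋃-++ B R)) (trans (∣∪─∣ (⋃ B) (⋃ R) V) (cong (λ z → ∣ ⋃ B ─ V ∣ + ∣ z ∣) (⊆-antisym
            (λ z → let (a , b) = ∈─ (⋃ R) (V ∪ ⋃ B) z in x∈p∧x∉q⇒x∈p─q a (λ w → b (x∈p∪q⁺ (inj₁ w)))) apart)))
          where
          apart : ⋃ R ─ V ⊆ ⋃ R ─ (V ∪ ⋃ B)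
          apart {x} z with ∈─ (⋃ R) V z
          ... | a , b = x∈p∧x∉q⇒x∈p─q a out
            where
            out : x ∉ₛ V ∪ ⋃ B
            out w with x∈p∪q⁻ V (⋃ B) w
            ... | inj₁ v = b v
            ... | inj₂ v with ⋃∈ R a
            ...   | e , e∈ , xe = na (Any.map (λ {refl → nonempty (x∈p∩q⁺ (x∈p∧x∉q⇒x∈p─q xe b , v))}) e∈)
              where
              nonempty : ∀ {n} {p : Subset n} {x} → x ∈ₛ p → 1 ≤ ∣ p ∣
              nonempty Vec.here = s≤s z≤n
              nonempty {p = true ∷ p} (Vec.there m) = s≤s z≤n
              nonempty {p = false ∷ p} (Vec.there m) = nonempty m

      rest f [] _ _ _ = ≤-trans (≤-reflexive (*-zeroʳ t)) z≤n
      rest (suc f) (e ∷ R) (s≤s lf) u′ ⊆L′ = spread f (e ∷ []) R lf (s≤s z≤n) (≤-trans (≤-reflexive (+-comm ℓ 1)) (proj₁ (proj₂ tS))) u′ ⊆L′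
        (≤-trans (≤-reflexive (cong (λ z → ∣ z ─ V ∣) (⋃1 e))) (≤-trans (e─V (⊆L′ (here refl))) (≤-reflexive (cong (_+ 1) (sym (*-identityʳ t))))))

      t∣L∣≤n : t * length L ≤ n
      t∣L∣≤n = ≤-trans (rest (length L) L ≤-refl (filter-u touching uH) (λ m → m)) (∣p∣≤n (⋃ L ─ V))

      -- An edge with two vertices in `V` would bring at most `t` new ones, against `grows`, or
      -- against `full` when it is the `k`-th edge.
      once : ∀ {e} → e ∈ L → ∣ e ∩ V ∣ ≤ 1
      once {e} m = +-cancelˡ-≤ (t + 1) _ _ (≤-trans (+-monoˡ-≤ ∣ e ∩ V ∣ out) (≤-reflexive (trans (∣─∣+∣∩∣ e V) (trans (card (proj₁ (L-out m))) (trans (+-comm 2 t) (sym (+-assoc t 1 1)))))))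
        where
        B = e ∷ []
        B⊆ : All (_∈ H) B
        B⊆ = proj₁ (L-out m) ∷ []
        B∉ : ∀ {x} → x ∈ B → x ∉ S
        B∉ (here refl) = proj₁ (proj₂ (L-out m))
        out : t + 1 ≤ ∣ e ─ V ∣
        out with ℓ + 1 ≟ k
        ... | no ne = ≤-trans (≤-reflexive (cong (_+ 1) (sym (*-identityʳ t)))) (≤-trans (grows B ([] ∷ []) B⊆ B∉ (s≤s z≤n) (≤∧≢⇒< (≤-trans (≤-reflexive (+-comm ℓ 1)) (proj₁ (proj₂ tS))) ne))
                  (≤-reflexive (cong (λ z → ∣ z ─ V ∣) (⋃1 e))))
        ... | yes eq = ≤-trans (n≤1+n (t + 1)) (≰⇒> (λ p → full B ([] ∷ []) B⊆ B∉ (s≤s z≤n) eq (≤-trans (≤-reflexive (cong (λ z → ∣ z ─ V ∣) (⋃1 e))) (≤-trans p (≤-reflexive (cong (_+ 1) (sym (*-identityʳ t))))))))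

      meets≤ : ∀ X → All (_∈ H) X → meets X V ≤ length (filterᵇ touching X) + (2 + t) * length (filterᵇ (λ e → mem e S) X)
      meets≤ [] [] = z≤n
      meets≤ (e ∷ X) (p ∷ ps) with mem e S in eqS
      ... | true = ≤-trans (+-mono-≤ (≤-trans (p⊆q⇒∣p∣≤∣q∣ (λ z → proj₁ (x∈p∩q⁻ e V z))) (≤-reflexive (card p))) (meets≤ X ps)) (≤-reflexive (l (2 + t) (length (filterᵇ touching X)) (length (filterᵇ (λ e → mem e S) X))))
        where
        l : ∀ r a b → r + (a + r * b) ≡ a + r * suc b
        l = solve-∀
      ... | false with does (1 ≤? ∣ e ∩ V ∣) in eqT
      ...   | true = +-mono-≤ (once (in-filter touching p (cong₂ _∧_ (cong not eqS) eqT))) (meets≤ X ps)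
      ...   | false = ≤-trans (+-monoˡ-≤ _ (≤-pred (≰⇒> (does-no (1 ≤? ∣ e ∩ V ∣) eqT)))) (meets≤ X ps)

      meets-bound : meets H V ≤ length L + (2 + t) * k
      meets-bound = ≤-trans (meets≤ H (All.tabulate (λ m → m))) (+-monoʳ-≤ (length L) (*-monoʳ-≤ (2 + t)
        (≤-trans (unique-⊂ {ys = S} (filter-u (λ e → mem e S) uH) (λ {e} m → mem-∈ {e} {S} (proj₂ (filter-in (λ e → mem e S) H m)))) (<⇒≤ (proj₁ (proj₂ tS))))))

      -- Two distinct edges of equal size have a union larger than either.
      ∣V∣≥ : 3 + t ≤ ∣ V ∣
      ∣V∣≥ = two S uS S⊆ (proj₁ tS)
        where
        full-eq : ∀ {n} (p q : Subset n) → p ⊆ q → ∣ q ∣ ≤ ∣ p ∣ → p ≡ q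
        full-eq [] [] _ _ = refl
        full-eq (true ∷ p) (true ∷ q) f (s≤s l) = cong (true ∷_) (full-eq p q (λ m → drop-there (f (Vec.there m))) l)
          where open import Data.Fin.Subset.Properties using (drop-there)
        full-eq (false ∷ p) (false ∷ q) f l = cong (false ∷_) (full-eq p q (λ m → drop-there (f (Vec.there m))) l)
          where open import Data.Fin.Subset.Properties using (drop-there)
        full-eq (true ∷ p) (false ∷ q) f l with f Vec.here
        ... | ()
        full-eq (false ∷ p) (true ∷ q) f l = ⊥-elim (n≮n ∣ q ∣ (≤-trans l (p⊆q⇒∣p∣≤∣q∣ (λ m → drop-there (f (Vec.there m))))))
          where open import Data.Fin.Subset.Properties using (drop-there)
        two : ∀ S → Unique S → All (_∈ H) S → 2 ≤ length S → 3 + t ≤ ∣ ⋃ S ∣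
        two (x ∷ []) _ _ (s≤s ())
        two (x ∷ y ∷ S) ((ne ∷ _) ∷ _) (px ∷ py ∷ _) _ with 3 + t ≤? ∣ x ∪ y ∣
        ... | yes q = ≤-trans q (p⊆q⇒∣p∣≤∣q∣ sub)
          where
          sub : x ∪ y ⊆ x ∪ (y ∪ ⋃ S)
          sub z with x∈p∪q⁻ x y z
          ... | inj₁ a = x∈p∪q⁺ (inj₁ a)
          ... | inj₂ a = x∈p∪q⁺ (inj₂ (x∈p∪q⁺ (inj₁ a)))
        ... | no q = ⊥-elim (ne (trans (full-eq x (x ∪ y) (p⊆p∪q y) (≤-trans (≤-pred (≰⇒> q)) (≤-reflexive (sym (card px)))))
                                  (sym (full-eq y (x ∪ y) (q⊆p∪q x y) (≤-trans (≤-pred (≰⇒> q)) (≤-reflexive (sym (card py))))))))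

      -- Incidences with `V`, counted by vertices, are at least (3+t)Δ/α. Counted by edges they are
      -- at most one for each touching edge, of which there are at most n/t, plus at most `2 + t`
      -- for each edge of `S`.
      bound : ∀ {α Δ} → (∀ v → Δ ≤ α * degree H v) → t * ((3 + t) * Δ) ≤ α * (n + t * ((2 + t) * k))
      bound {α} {Δ} d = ≤-trans (*-monoʳ-≤ t (≤-trans (*-monoˡ-≤ Δ ∣V∣≥) (≤-trans (degree-sum H V {α} d) (*-monoʳ-≤ α meets-bound))))
        (≤-trans (≤-reflexive (l t α (length L) ((2 + t) * k))) (*-monoʳ-≤ α (+-monoˡ-≤ (t * ((2 + t) * k)) t∣L∣≤n)))
        where
        l : ∀ t a b c → t * (a * (b + c)) ≡ a * (t * b + t * c)
        l = solve-∀

    no-tight : ∀ {α Δ} → (∀ v → Δ ≤ α * degree H v) → ¬ (t * ((3 + t) * Δ) ≤ α * (n + t * ((2 + t) * k))) → ∀ S → All (_∈ H) S → ¬ Tight S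
    no-tight {α} d np with maximal k (λ S al tg → <⇒≤ (proj₁ (proj₂ tg)))
    ... | inj₁ (S , mx) = ⊥-elim (np (Outside.bound mx {α} d))
    ... | inj₂ f = f

-- From edge counts to limits superior: vertex deletion and comparison of f with g.

module Densities where
  open import Defs
  open Rationals
  open Conflicts using (unique-⊂; filter-in; filter-u; filter-len)
  open UniformSets using (rsub-complete; rsub-length; binom)
  open Parameters using (module Const)
  open LowerBounds using (nat-reflects; module LowerBound)
  open DegreeArgument using (degree; module SparseExtension)
  open import Data.Rational using (ℚ; 0ℚ; 1ℚ; _+_; _*_; -_; _-_; _≤_; _<_; _/_; mkℚ; *<*; toℚᵘ)
  open import Data.Rational.Properties using (≤-refl; +-mono-≤; <⇒≤)
  open import Data.Rational.Unnormalised using (mkℚᵘ; *≡*; _≃_)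
  open import Data.Integer using (ℤ; +_; -[1+_]; +<+)
  open import Data.Nat using (zero; suc)
  open import Data.Fin using (zero; suc)
  open import Data.Fin.Subset using (⊥)
  open import Data.Vec using (_∷_; [])
  open import Data.List using ([]; _∷_)
  open import Data.List.Relation.Unary.All using ([]; _∷_)
  open import Data.List.Relation.Unary.AllPairs using ([]; _∷_)
  open import Tactic.RingSolver using (solve-∀)

  natᵘ : ∀ m → toℚᵘ (nat m) ≃ mkℚᵘ (+ m) 0
  natᵘ zero = ℚᵘₚ.≃-refl
  natᵘ (suc m) = ℚᵘₚ.≃-trans (ℚₚ.toℚᵘ-homo-+ 1ℚ (nat m)) (ℚᵘₚ.≃-trans (ℚᵘₚ.+-cong (ℚᵘₚ.≃-refl {mkℚᵘ (+ 1) 0}) (natᵘ m)) (*≡* (l (+ m))))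
    where
    l : ∀ m → (+ 1 ℤ.* + 1 ℤ.+ m ℤ.* + 1) ℤ.* + 1 ≡ (+ 1 ℤ.+ m) ℤ.* + 1
    l = ℤR.solve-∀

  frac : ∀ m d → (+ m / suc d) * nat (suc d) ≡ nat m
  frac m d = ℚₚ.toℚᵘ-injective (ℚᵘₚ.≃-trans (ℚₚ.toℚᵘ-homo-* (+ m / suc d) (nat (suc d))) (ℚᵘₚ.≃-trans (ℚᵘₚ.*-cong (ℚₚ.toℚᵘ-fromℚᵘ (mkℚᵘ (+ m) d)) (natᵘ (suc d)))
    (ℚᵘₚ.≃-trans (*≡* (trans (l (+ m) (+ suc d)) (cong (λ z → + m ℤ.* + z) (sym (ℕₚ.*-identityʳ (suc d)))))) (ℚᵘₚ.≃-sym (natᵘ m)))))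
    where
    l : ∀ m d → m ℤ.* d ℤ.* + 1 ≡ m ℤ.* d
    l = ℤR.solve-∀

  normSq-elim : ∀ {m n q} → normSq m (suc n) ≤ q → nat m ≤ q * nat (suc n ℕ.* suc n)
  normSq-elim {m} {n} p = ≡≤ (sym (frac m (n ℕ.+ n ℕ.* suc n))) ▸ *-monoʳ (0≤nat (suc n ℕ.* suc n)) p

  normSq-intro : ∀ {m n q} → nat m ≤ q * nat (suc n ℕ.* suc n) → normSq m (suc n) ≤ q
  normSq-intro {m} {n} p = *-cancelʳ (0<nat (n ℕ.+ n ℕ.* suc n)) (≡≤ (frac m (n ℕ.+ n ℕ.* suc n)) ▸ p)

  archimedean : ∀ {ε} → 0ℚ < ε → ∃ λ N → 1ℚ ≤ ε * nat N
  archimedean {ε@(mkℚ (+ zero) d c)} (*<* (+<+ ()))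
  archimedean {ε@(mkℚ (+ suc a) d c)} _ = suc d , (1≤nat a ▸ ≡≤ (sym (trans (cong (_* nat (suc d)) (sym (ℚₚ.↥p/↧p≡p ε))) (frac (suc a) d))))
  archimedean {mkℚ -[1+ a ] d c} (*<* ())

  binom-mono : ∀ {n m} r → n ℕ.≤ m → binom n r ℕ.≤ binom m r
  binom-mono {n} {m} r p = subst (λ z → binom n r ℕ.≤ binom z r) (ℕₚ.m+[n∸m]≡n p) (go (m ∸ n) r)
    where
    up : ∀ n r → binom n r ℕ.≤ binom (suc n) r
    up n zero = ℕₚ.≤-refl
    up n (suc r) = ℕₚ.m≤n+m (binom n (suc r)) (binom n r)
    go : ∀ j r → binom n r ℕ.≤ binom (n ℕ.+ j) r
    go zero r = ℕₚ.≤-reflexive (cong (λ z → binom z r) (sym (ℕₚ.+-identityʳ n)))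
    go (suc j) r = ℕₚ.≤-trans (go j r) (ℕₚ.≤-trans (up (n ℕ.+ j) r) (ℕₚ.≤-reflexive (cong (λ z → binom z r) (sym (ℕₚ.+-suc n j)))))

  edges≤ : ∀ {r n} (H : Hypergraph r n) → e H ℕ.≤ binom n r
  edges≤ {r} {n} H = ℕₚ.≤-trans (unique-⊂ (distinct H) (λ {x} m → rsub-complete r x (All.lookup (uniform H) m))) (ℕₚ.≤-reflexive (rsub-length n r))

  module Delete {r n} (H : Hypergraph r (suc n)) (v : Fin (suc n)) where
    avoids : Subset (suc n) → Bool
    avoids x = not (lookup x v)

    put : Subset n → Subset (suc n)
    put x = insertAt x v false

    ∣put∣ : ∀ {n} (x : Subset n) v → ∣ insertAt x v false ∣ ≡ ∣ x ∣
    ∣put∣ x zero = refl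
    ∣put∣ (true ∷ x) (suc v) = cong suc (∣put∣ x v)
    ∣put∣ (false ∷ x) (suc v) = ∣put∣ x v

    put-∪ : ∀ {n} (x y : Subset n) v → insertAt x v false ∪ insertAt y v false ≡ insertAt (x ∪ y) v false
    put-∪ x y zero = refl
    put-∪ (a ∷ x) (b ∷ y) (suc v) = cong (_ ∷_) (put-∪ x y v)

    put-⊥ : ∀ {n} v → insertAt (⊥ {n}) v false ≡ ⊥
    put-⊥ zero = refl
    put-⊥ {suc n} (suc v) = cong (false ∷_) (put-⊥ v)

    put-⋃ : ∀ C → ⋃ (map put C) ≡ put (⋃ C)
    put-⋃ [] = sym (put-⊥ v)
    put-⋃ (x ∷ C) = trans (cong (put x ∪_) (put-⋃ C)) (put-∪ x (⋃ C) v)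

    put-injective : ∀ {x y} → put x ≡ put y → x ≡ y
    put-injective {x} {y} p = trans (sym (removeAt-insertAt x v false)) (trans (cong (λ z → removeAt z v) p) (removeAt-insertAt y v false))

    kept : List (Subset (suc n))
    kept = filterᵇ avoids (edges H)

    put-remove : ∀ {x} → x ∈ kept → put (removeAt x v) ≡ x
    put-remove {x} m = trans (cong (insertAt (removeAt x v) v) (sym (off (lookup x v) (proj₂ (filter-in avoids (edges H) m))))) (insertAt-removeAt x v)
      where
      off : ∀ b → not b ≡ true → b ≡ false
      off false _ = refl

    puts : ∀ X → All (_∈ kept) X → map put (map (λ x → removeAt x v) X) ≡ X
    puts [] _ = refl
    puts (x ∷ X) (p ∷ ps) = cong₂ _∷_ (put-remove p) (puts X ps)

    all-kept : All (_∈ kept) kept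
    all-kept = All.tabulate (λ m → m)

    del : Hypergraph r n
    del = record
      { edges = map (λ x → removeAt x v) kept
      ; distinct = Uₚ.map⁻ (subst Unique (sym (puts kept all-kept)) (filter-u avoids (distinct H)))
      ; uniform = Allₚ.map⁺ (All.tabulate (λ {x} m → trans (sym (∣put∣ (removeAt x v) v)) (trans (cong ∣_∣ (put-remove m)) (All.lookup (uniform H) (proj₁ (filter-in avoids (edges H) m)))))) }

    e-del : degree (edges H) v ℕ.+ e del ≡ e H
    e-del = trans (cong (degree (edges H) v ℕ.+_) (length-map _ kept)) (filter-len (λ x → lookup x v) (edges H))

    lift : ∀ {x} → x ∈ edges del → put x ∈ edges H
    lift {x} m with ∈-map⁻ (λ x → removeAt x v) m
    ... | y , y∈ , refl = subst (_∈ edges H) (sym (put-remove y∈)) (proj₁ (filter-in avoids (edges H) y∈))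

    del-free : ∀ {s k} → Free s k H → Free s k del
    del-free f (C , len , u , al , p) = f (map put C , trans (length-map put C) len , Uₚ.map⁺ put-injective u , Allₚ.map⁺ (All.map lift al) ,
      ℕₚ.≤-trans (ℕₚ.≤-reflexive (trans (cong ∣_∣ (put-⋃ C)) (∣put∣ (⋃ C) v))) p)

  -- A function with at least (4/5) n(n−1)/ϱ edges for all large n has density at least 0.78/ϱ; for ϱ = r(r−1) this beats the threshold 1/(2(r+1)(r−2)) of the degree argument, because 1.56 (r+1)(r−2) > r(r−1).
  dense : ∀ {g : ℕ → ℕ} {ϱ q} N₀ → (∀ m → N₀ ℕ.≤ 2 ℕ.+ m → 4 ℕ.* ((2 ℕ.+ m) ℕ.* (1 ℕ.+ m)) ℕ.≤ 5 ℕ.* ϱ ℕ.* g (2 ℕ.+ m)) →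
    ∀ N → (∀ n → N ℕ.≤ n → normSq (g n) n ≤ q) → nat 78 ≤ nat (100 ℕ.* ϱ) * q
  dense {g} {ϱ} {q} N₀ lower N b = at (N₀ ℕ.+ N ℕ.+ 38) (ℕₚ.m≤n+m 38 (N₀ ℕ.+ N))
    (lower m (ℕₚ.≤-trans (ℕₚ.m≤m+n N₀ N) (ℕₚ.≤-trans (ℕₚ.m≤m+n (N₀ ℕ.+ N) 38) (ℕₚ.m≤n+m m 2))))
    (normSq-elim {g (2 ℕ.+ m)} {suc m} (b (2 ℕ.+ m) (ℕₚ.≤-trans (ℕₚ.m≤n+m N N₀) (ℕₚ.≤-trans (ℕₚ.m≤m+n (N₀ ℕ.+ N) 38) (ℕₚ.m≤n+m m 2)))))
    where
    m = N₀ ℕ.+ N ℕ.+ 38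
    at : ∀ m {x} → 38 ℕ.≤ m → 4 ℕ.* ((2 ℕ.+ m) ℕ.* (1 ℕ.+ m)) ℕ.≤ 5 ℕ.* ϱ ℕ.* x → nat x ≤ q * nat ((2 ℕ.+ m) ℕ.* (2 ℕ.+ m)) → nat 78 ≤ nat (100 ℕ.* ϱ) * q
    at m {x} 38≤ low up = *-cancelʳ (0<nat (suc m)) (*-cancelʳ (0<nat (suc m))
      (≡≤ (trans (ℚₚ.*-assoc (nat 78) (nat n) (nat n)) (trans (cong (nat 78 *_) (sym (nat-* n n))) (sym (nat-* 78 (n ℕ.* n))))) ▸ nat-mono forty ▸
       ≡≤ (nat-* 20 (5 ℕ.* ϱ ℕ.* x)) ▸ *-monoˡ (0≤nat 20) (≡≤ (nat-* (5 ℕ.* ϱ) x) ▸ *-monoˡ (0≤nat (5 ℕ.* ϱ)) (up ▸ ≡≤ (cong (q *_) (nat-* n n)))) ▸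
       ≡≤ (trans (l (nat 20) (nat (5 ℕ.* ϱ)) q (nat n)) (cong (λ z → z * q * nat n * nat n) (trans (sym (nat-* 20 (5 ℕ.* ϱ))) (cong nat (sym (ℕₚ.*-assoc 20 5 ϱ))))))))
      where
      n = 2 ℕ.+ m
      l : ∀ z a q n → z * (a * (q * (n * n))) ≡ z * a * q * n * n
      l = solve-∀ ℚring
      -- 78 n² ≤ 80 n(n-1) as soon as n ≥ 40; this is where the 38 comes from.
      forty : 78 ℕ.* (n ℕ.* n) ℕ.≤ 20 ℕ.* (5 ℕ.* ϱ ℕ.* x)
      forty = ℕₚ.≤-trans (ℕₚ.≤-reflexive (l1 m)) (ℕₚ.≤-trans (ℕₚ.*-monoʳ-≤ (2 ℕ.* n) (ℕₚ.≤-trans (ℕₚ.+-monoʳ-≤ (39 ℕ.* m ℕ.+ 40) 38≤) (ℕₚ.≤-reflexive (l2 m))))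
        (ℕₚ.≤-trans (ℕₚ.≤-reflexive (l3 m)) (ℕₚ.*-monoʳ-≤ 20 low)))
        where
        l1 : ∀ m → 78 ℕ.* ((2 ℕ.+ m) ℕ.* (2 ℕ.+ m)) ≡ 2 ℕ.* (2 ℕ.+ m) ℕ.* (39 ℕ.* m ℕ.+ 40 ℕ.+ 38)
        l1 = ℕR.solve-∀
        l2 : ∀ m → 39 ℕ.* m ℕ.+ 40 ℕ.+ m ≡ 40 ℕ.* (1 ℕ.+ m)
        l2 = ℕR.solve-∀
        l3 : ∀ m → 2 ℕ.* (2 ℕ.+ m) ℕ.* (40 ℕ.* (1 ℕ.+ m)) ≡ 20 ℕ.* (4 ℕ.* ((2 ℕ.+ m) ℕ.* (1 ℕ.+ m)))
        l3 = ℕR.solve-∀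

  module Transfer (k t : ℕ) (2≤k : 2 ℕ.≤ k) (1≤t : 1 ℕ.≤ t) (F G : ℕ → ℕ)
    (isF : IsF (2 ℕ.+ t) (t ℕ.* k ℕ.+ 2) k F) (isG : IsG (2 ℕ.+ t) k G) where

    r rr : ℕ
    r = 2 ℕ.+ t
    rr = (2 ℕ.+ t) ℕ.* (1 ℕ.+ t)

    G≤F : ∀ n → G n ℕ.≤ F n
    G≤F n with proj₁ (isG n)
    ... | H , gf , eq = subst (ℕ._≤ F n) eq (proj₂ (isF n) H (proj₁ gf))

    F⇒G : ∀ {q} → LimsupLt (λ n → normSq (F n) n) q → LimsupLt (λ n → normSq (G n) n) q
    F⇒G (q′ , q′<q , N , b) = q′ , q′<q , N , λ n N≤ → le n (b n N≤)
      where
      le : ∀ n → normSq (F n) n ≤ q′ → normSq (G n) n ≤ q′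
      le zero p = p
      le (suc n) p = normSq-intro {G (suc n)} {n} (nat-mono (G≤F (suc n)) ▸ normSq-elim {F (suc n)} {n} p)

    G-lower : ∀ m → Const.N₀ t k ℕ.≤ 2 ℕ.+ m → 4 ℕ.* ((2 ℕ.+ m) ℕ.* (1 ℕ.+ m)) ℕ.≤ 5 ℕ.* rr ℕ.* G (2 ℕ.+ m)
    G-lower m n≥ = use (LowerBound.good t k m 1≤t n≥)
      where
      use : LowerBound.Good t k m 1≤t n≥ → 4 ℕ.* ((2 ℕ.+ m) ℕ.* (1 ℕ.+ m)) ℕ.≤ 5 ℕ.* rr ℕ.* G (2 ℕ.+ m)
      use (M , uM , card , hg , size) = ℕₚ.≤-trans size (ℕₚ.*-monoʳ-≤ (5 ℕ.* rr) (proj₂ (isG (2 ℕ.+ m)) hyp (free , low)))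
        where
        hyp : Hypergraph r (2 ℕ.+ m)
        hyp = record { edges = M ; distinct = uM ; uniform = card }
        free : Free (t ℕ.* k ℕ.+ 2) k hyp
        free (C , len , u , al , p) = ℕₚ.<-irrefl refl (ℕₚ.≤-trans (ℕₚ.≤-reflexive (sym (ℕₚ.+-suc (t ℕ.* k) 2))) (ℕₚ.≤-trans (subst (λ z → t ℕ.* z ℕ.+ 3 ℕ.≤ ∣ ⋃ C ∣) len
          (hg C u (λ m → All.lookup al m) (subst (2 ℕ.≤_) (sym len) 2≤k) (ℕₚ.≤-reflexive len))) p))
        low : ∀ ℓ → 2 ℕ.≤ ℓ → ℓ ℕ.≤ k ∸ 1 → Free (t ℕ.* ℓ ℕ.+ 1) ℓ hyp
        low ℓ 2≤ ≤k (C , len , u , al , p) = ℕₚ.<-irrefl refl (ℕₚ.≤-trans (ℕₚ.≤-trans (ℕₚ.n≤1+n _) (ℕₚ.≤-reflexive (trans (cong suc (sym (ℕₚ.+-suc (t ℕ.* ℓ) 1))) (sym (ℕₚ.+-suc (t ℕ.* ℓ) 2)))))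
          (ℕₚ.≤-trans (subst (λ z → t ℕ.* z ℕ.+ 3 ℕ.≤ ∣ ⋃ C ∣) len (hg C u (λ m → All.lookup al m) (subst (2 ℕ.≤_) (sym len) 2≤) (ℕₚ.≤-trans (ℕₚ.≤-reflexive len) (ℕₚ.≤-trans ≤k (ℕₚ.m∸n≤m k 1))))) p))

    density : ∀ {q N} → (∀ n → N ℕ.≤ n → normSq (G n) n ≤ q) → nat 78 ≤ nat (100 ℕ.* rr) * q
    density {q} {N} b = dense {G} {rr} {q} (Const.N₀ t k) G-lower N b

    -- With u = (r+1)(r-2) one has r(r-1) = u + 2; `N₁` is chosen so that the constant term
    -- 100(u+2)(1+y) is at most n.
    u y N₁ : ℕ
    u = t ℕ.* (3 ℕ.+ t)
    y = t ℕ.* (r ℕ.* k)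
    N₁ = 100 ℕ.* (u ℕ.+ 2) ℕ.* (1 ℕ.+ y)

    -- Comparing coefficients of n: 156u on the left against 100(u+2) + 1 on the right, and 56u ≥
    -- 201 because u ≥ 4. The constant 78u then remains on the left alone.
    too-many : ∀ {n} → N₁ ℕ.≤ n → ¬ (t ℕ.* ((3 ℕ.+ t) ℕ.* (78 ℕ.* (2 ℕ.* n ℕ.+ 1))) ℕ.≤ 100 ℕ.* rr ℕ.* (suc n ℕ.+ t ℕ.* (r ℕ.* k)))
    too-many {n} n≥ p = ℕₚ.<-irrefl refl (ℕₚ.≤-trans 4≤u (ℕₚ.≤-trans u≤0 z≤n))
      where
      4≤u : 1 ℕ.≤ u
      4≤u = ℕₚ.*-mono-≤ 1≤t (s≤s z≤n)
      56u : 201 ℕ.≤ 56 ℕ.* u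
      56u = ℕₚ.≤-trans (ℕₚ.m≤m+n 201 23) (ℕₚ.*-monoʳ-≤ 56 {4} (ℕₚ.*-mono-≤ 1≤t (ℕₚ.+-monoʳ-≤ 3 1≤t)))
      main : 156 ℕ.* (u ℕ.* n) ℕ.+ 78 ℕ.* u ℕ.≤ 156 ℕ.* (u ℕ.* n) ℕ.+ 0
      main = ℕₚ.≤-trans (ℕₚ.≤-reflexive (l1 t n)) (ℕₚ.≤-trans p (ℕₚ.≤-trans (ℕₚ.≤-reflexive (l2 t n y)) (ℕₚ.≤-trans (ℕₚ.+-monoʳ-≤ (100 ℕ.* (u ℕ.+ 2) ℕ.* n) n≥)
        (ℕₚ.≤-trans (ℕₚ.≤-reflexive (l3 u n)) (ℕₚ.≤-trans (ℕₚ.+-monoʳ-≤ (100 ℕ.* u ℕ.* n) (ℕₚ.*-monoˡ-≤ n 56u)) (ℕₚ.≤-reflexive (l4 u n)))))))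
        where
        l1 : ∀ t n → 156 ℕ.* (t ℕ.* (3 ℕ.+ t) ℕ.* n) ℕ.+ 78 ℕ.* (t ℕ.* (3 ℕ.+ t)) ≡ t ℕ.* ((3 ℕ.+ t) ℕ.* (78 ℕ.* (2 ℕ.* n ℕ.+ 1)))
        l1 = ℕR.solve-∀
        l2 : ∀ t n y → 100 ℕ.* ((2 ℕ.+ t) ℕ.* (1 ℕ.+ t)) ℕ.* (suc n ℕ.+ y) ≡ 100 ℕ.* (t ℕ.* (3 ℕ.+ t) ℕ.+ 2) ℕ.* n ℕ.+ 100 ℕ.* (t ℕ.* (3 ℕ.+ t) ℕ.+ 2) ℕ.* (1 ℕ.+ y)
        l2 = ℕR.solve-∀
        l3 : ∀ u n → 100 ℕ.* (u ℕ.+ 2) ℕ.* n ℕ.+ n ≡ 100 ℕ.* u ℕ.* n ℕ.+ 201 ℕ.* n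
        l3 = ℕR.solve-∀
        l4 : ∀ u n → 100 ℕ.* u ℕ.* n ℕ.+ 56 ℕ.* u ℕ.* n ≡ 156 ℕ.* (u ℕ.* n) ℕ.+ 0
        l4 = ℕR.solve-∀
      u≤0 : u ℕ.≤ 0
      u≤0 = ℕₚ.≤-trans (ℕₚ.m≤n*m u 78) (ℕₚ.+-cancelˡ-≤ (156 ℕ.* (u ℕ.* n)) _ _ main)

    module Peel (q′ q″ : ℚ) (q′≤ : q′ ≤ q″) (N : ℕ) (b : ∀ n → N ℕ.≤ n → normSq (G n) n ≤ q′) where
      N* C₀ : ℕ
      N* = N ℕ.+ N₁
      C₀ = binom N* r

      0≤q″ : 0ℚ ≤ q″
      0≤q″ = *-cancelʳ (0<nat (ℕ.pred (100 ℕ.* rr))) (≡≤ (ℚₚ.*-zeroˡ (nat (100 ℕ.* rr))) ▸ 0≤nat 78 ▸ density {q′} {N} b ▸ ≡≤ (ℚₚ.*-comm (nat (100 ℕ.* rr)) q′) ▸ *-monoʳ (0≤nat (100 ℕ.* rr)) q′≤)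

      -- The threshold `q″ * nat (2 ℕ.* n ℕ.+ 1)` is the increment of q″n² from n to n + 1, so
      -- deleting a vertex of at most this degree preserves the bound. If there is no such vertex,
      -- the degree argument makes `H` a competitor for `G`.
      bound : ∀ n (H : Hypergraph r n) → Free (t ℕ.* k ℕ.+ 2) k H → nat (e H) ≤ q″ * nat (n ℕ.* n) + nat C₀
      small : ∀ {n} (H : Hypergraph r n) → n ℕ.≤ N* → nat (e H) ≤ q″ * nat (n ℕ.* n) + nat C₀
      small {n} H p = nat-mono (ℕₚ.≤-trans (edges≤ H) (binom-mono r p)) ▸ ≤+ˡ (0≤* 0≤q″ (0≤nat (n ℕ.* n)))
      bound zero H _ = small H z≤n
      bound (suc n) H free with suc n ℕₚ.≤? N*
      ... | yes p = small H p
      ... | no p with Finₚ.any? (λ v → nat (degree (edges H) v) ℚₚ.≤? q″ * nat (2 ℕ.* n ℕ.+ 1))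
      ...   | yes (v , lo) = ≡≤ (trans (cong nat (sym D.e-del)) (nat-+ (degree (edges H) v) (e D.del))) ▸ +-mono-≤ lo (bound n D.del (D.del-free free)) ▸
          ≡≤ (trans (l q″ (nat (2 ℕ.* n ℕ.+ 1)) (nat (n ℕ.* n)) (nat C₀)) (cong (λ z → q″ * z + nat C₀) (trans (sym (nat-+ (2 ℕ.* n ℕ.+ 1) (n ℕ.* n))) (cong nat (l2 n)))))
        where
        module D = Delete H v
        l : ∀ q a b c → q * a + (q * b + c) ≡ q * (a + b) + c
        l = solve-∀ ℚring
        l2 : ∀ n → 2 ℕ.* n ℕ.+ 1 ℕ.+ n ℕ.* n ≡ suc n ℕ.* suc n
        l2 = ℕR.solve-∀
      ...   | no hi = nat-mono (proj₂ (isG (suc n)) H (free , gfree)) ▸ normSq-elim {G (suc n)} {n} (b (suc n) (ℕₚ.≤-trans (ℕₚ.m≤m+n N N₁) (ℕₚ.≤-trans N*≤n (ℕₚ.n≤1+n n)))) ▸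
          *-monoʳ (0≤nat (suc n ℕ.* suc n)) q′≤ ▸ ≤+ʳ (0≤nat C₀)
        where
        N*≤n : N* ℕ.≤ n
        N*≤n = ℕₚ.≤-pred (ℕₚ.≰⇒> p)
        open SparseExtension t k (edges H) (distinct H) (All.lookup (uniform H)) (λ C uC C⊆ len q → free (C , len , uC , C⊆ , q))
        -- `density` bounds `q″` below by 78/(100 r(r-1)); this is the only place where the quality
        -- of the packing is felt.
        degrees : ∀ v → 78 ℕ.* (2 ℕ.* n ℕ.+ 1) ℕ.≤ 100 ℕ.* rr ℕ.* degree (edges H) v
        degrees v = nat-reflects (≡≤ (nat-* 78 (2 ℕ.* n ℕ.+ 1)) ▸ *-monoʳ (0≤nat (2 ℕ.* n ℕ.+ 1)) (density {q′} {N} b ▸ *-monoˡ (0≤nat (100 ℕ.* rr)) q′≤) ▸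
          ≡≤ (ℚₚ.*-assoc (nat (100 ℕ.* rr)) q″ (nat (2 ℕ.* n ℕ.+ 1))) ▸ *-monoˡ (0≤nat (100 ℕ.* rr)) (<⇒≤ (ℚₚ.≰⇒> (λ lo → hi (v , lo)))) ▸ ≡≤ (sym (nat-* (100 ℕ.* rr) (degree (edges H) v))))
        gfree : ∀ ℓ → 2 ℕ.≤ ℓ → ℓ ℕ.≤ k ∸ 1 → Free (t ℕ.* ℓ ℕ.+ 1) ℓ H
        gfree ℓ 2≤ ≤k (C , refl , uC , C⊆ , q) = no-tight {100 ℕ.* rr} degrees (too-many (ℕₚ.≤-trans (ℕₚ.m≤n+m N₁ N) N*≤n)) C C⊆
          (2≤ , ℕₚ.≤-trans (s≤s ≤k) (ℕₚ.≤-reflexive (ℕₚ.m+[n∸m]≡n (ℕₚ.≤-trans (s≤s z≤n) 2≤k))) , uC , q)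

    G⇒F : ∀ {q} → LimsupLt (λ n → normSq (G n) n) q → LimsupLt (λ n → normSq (F n) n) q
    G⇒F {q} (q′ , q′<q , N , b) = q″ + ε , lt , suc N₃ , upper
      where
      third ε q″ : ℚ
      third = + 1 / 3
      -- One third of the gap goes into `q″`, one third absorbs the constant `C₀` divided by n², and
      -- one third keeps the final inequality strict.
      ε = (q - q′) * third
      q″ = q′ + ε
      0<ε : 0ℚ < ε
      0<ε = 0<* (ℚₚ.≤-<-trans (≡≤ (sym (ℚₚ.+-inverseʳ q′))) (ℚₚ.+-monoˡ-< (- q′) q′<q)) (ℚₚ.positive⁻¹ third)
      open Peel q′ q″ (≤+ʳ (<⇒≤ 0<ε)) N b
      lt : q″ + ε < q
      lt = <-≤ (ℚₚ.≤-<-trans (≡≤ (sym (ℚₚ.+-identityʳ (q″ + ε)))) (ℚₚ.+-monoʳ-< (q″ + ε) 0<ε)) (≡≤ (trans (l q q′ third) (l2 q q′)))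
        where
        l : ∀ q p z → p + (q - p) * z + (q - p) * z + (q - p) * z ≡ p + (q - p) * (z + z + z)
        l = solve-∀ ℚring
        l2 : ∀ q p → p + (q - p) * 1ℚ ≡ q
        l2 = solve-∀ ℚring
      N₂ = proj₁ (archimedean 0<ε)
      N₃ = N₂ ℕ.* C₀
      C₀≤ : nat C₀ ≤ ε * nat N₃
      C₀≤ = ≤1* (0≤nat C₀) (proj₂ (archimedean 0<ε)) ▸ ≡≤ (trans (ℚₚ.*-assoc ε (nat N₂) (nat C₀)) (cong (ε *_) (sym (nat-* N₂ C₀))))
      upper : ∀ n → suc N₃ ℕ.≤ n → normSq (F n) n ≤ q″ + ε
      upper (suc n) (s≤s p) with proj₁ (isF (suc n))
      ... | H , free , eq = normSq-intro {F (suc n)} {n} (≡≤ (cong nat (sym eq)) ▸ bound (suc n) H free ▸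
        +-mono-≤ (≤-refl {q″ * nat (suc n ℕ.* suc n)}) (C₀≤ ▸ *-monoˡ (<⇒≤ 0<ε) (nat-mono (ℕₚ.≤-trans p (ℕₚ.≤-trans (ℕₚ.n≤1+n n) (ℕₚ.m≤m*n (suc n) (suc n)))))) ▸
        ≡≤ (sym (ℚₚ.*-distribʳ-+ (nat (suc n ℕ.* suc n)) q″ ε)))

open Densities using (module Transfer)
open import Defs
open import Data.Nat using (ℕ; suc; _≤_; _+_; _*_; _∸_)

theorem3p1 : (k r : ℕ) → 2 ≤ k → 3 ≤ r →
    (F G : ℕ → ℕ) → IsF r ((r ∸ 2) * k + 2) k F → IsG r k G →
    LimsupEq (λ n → normSq (F n) n) (λ n → normSq (G n) n)
theorem3p1 k (suc (suc t)) 2≤k (s≤s (s≤s 1≤t)) F G isF isG q = mk⇔ F⇒G G⇒F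
  where open Transfer k t 2≤k 1≤t F G isF isG
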